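{- Let $\boldsymbol{\mu}$ and $\boldsymbol{\nu}$ be $k$-tuples of partitions, each partition having infinitely many parts of which only finitely many are nonzero. Fix positive integers $n,m,p,q$ and variables $X_n=(x_1,\dots,x_n)$, $Y_m=(y_1,\dots,y_m)$, $W_p=(w_1,\dots,w_p)$, $Z_q=(z_1,\dots,z_q)$. Then, as formal power series, $$\sum_{\boldsymbol{\lambda}} t^{d(\boldsymbol{\mu},\boldsymbol{\lambda})}\,\mathcal{L}^S_{\boldsymbol{\nu}/\boldsymbol{\lambda}}(X_n;Y_m;t)\,\mathcal{L}^S_{\boldsymbol{\mu}/\boldsymbol{\lambda}}(W_p;Z_q;t)=\Omega\cdot\sum_{\boldsymbol{\lambda}} t^{d(\boldsymbol{\lambda},\boldsymbol{\nu})}\,\mathcal{L}^S_{\boldsymbol{\lambda}/\boldsymbol{\mu}}(X_n;Y_m;t)\,\mathcal{L}^S_{\boldsymbol{\lambda}/\boldsymbol{\nu}}(W_p;Z_q;t),$$ where both sums run over all $k$-tuples of partitions $\boldsymbol{\lambda}$ and $$\Omega=\prod_{l=0}^{k-1}\frac{\prod_{i=1}^n\prod_{\alpha=1}^p(1-x_iw_\alpha t^l)\;\prod_{j=1}^m\prod_{\beta=1}^q(1-y_jz_\beta t^l)}{\prod_{j=1}^m\prod_{\alpha=1}^p(1+y_jw_\alpha t^l)\;\prod_{i=1}^n\prod_{\beta=1}^q(1+x_iz_\beta t^l)}.$$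
   Context: Fix an integer $k\ge1$ (colours $1,\dots,k$) and an indeterminate $t$. For $\mathbf I=(I_1,\dots,I_k)\in\{0,1\}^k$ let $|\mathbf I|=\sum_cI_c$, and for $\mathbf I,\mathbf J\in\mathbb Z^k$ let $\varphi(\mathbf I,\mathbf J)=\sum_{1\le c<d\le k}I_cJ_d$. A vertex is a unit square whose bottom, left, top, right edges carry labels $\mathbf I,\mathbf J,\mathbf K,\mathbf L\in\{0,1\}^k$; $I_c=1$ means a path of colour $c$ uses that edge (paths move up and right). The white weight with parameter $x$ is $W_x(\mathbf I,\mathbf J,\mathbf K,\mathbf L)=\mathbf 1_{\mathbf I+\mathbf J=\mathbf K+\mathbf L}\prod_{c}\mathbf 1_{I_c+J_c\neq2}\,x^{|\mathbf L|}t^{\varphi(\mathbf L,\mathbf I+\mathbf J)}$, and the purple weight is $P_x(\mathbf I,\mathbf J,\mathbf K,\mathbf L)=\mathbf 1_{\mathbf I+\mathbf J=\mathbf K+\mathbf L}\prod_{c}\mathbf 1_{K_c\ge J_c}\,x^{|\mathbf L|}t^{\varphi(\mathbf L,\mathbf K-\mathbf J)}$. For $k$-tuples of partitions $\boldsymbol\lambda=(\lambda^{(1)},\dots,\lambda^{(k)})$, $\boldsymbol\mu=(\mu^{(1)},\dots,\mu^{(k)})$, each regarded as having exactly $\ell$ parts (padding with zeros), where $\ell$ is at least the number of nonzero parts of every partition involved, and variables $X_n,Y_m$, consider the lattice with $n+m$ rows and columns indexed by the integers $-\ell,\dots,N$ ($N$ at least every part of every partition involved): rows $1,\dots,n$ from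 the bottom are white with parameters $x_1,\dots,x_n$, rows $n+1,\dots,n+m$ are purple with parameters $y_1,\dots,y_m$. The bottom boundary edge of column $c$ carries colour $a$ iff $c=\mu^{(a)}_j-j$ for some $1\le j\le\ell$; the top boundary edge of column $c$ carries colour $a$ iff $c=\lambda^{(a)}_j-j$ for some $j$; all left and right boundary edges are empty. A configuration assigns labels in $\{0,1\}^k$ to all internal edges; its weight is the product of the vertex weights (white or purple, with the row's parameter). $\mathcal L^S_{\boldsymbol\lambda/\boldsymbol\mu}(X_n;Y_m;t)$ is the sum of the weights of all configurations (it does not depend on $\ell,N$ once they are large enough). For tuples of partitions with infinitely many parts, finitely many nonzero, use any sufficiently large $\ell$. For $k$-tuples $\boldsymbol\alpha,\boldsymbol\beta$ and $L$ at least the number of nonzero parts of all their components, let $N_L(\boldsymbol\alpha)=\sum_{1\le a<b\le k}\#\{(i,j)\in\{1,\dots,L\}^2:\alpha^{(a)}_j-j>\alpha^{(b)}_i-i\}$ and $d(\boldsymbol\alpha,\boldsymbol\beta)=N_L(\boldsymbol\beta)-N_L(\boldsymbol\alpha)$ (independent of $L$). -}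

module Defs where

open import Level using (0ℓ)
open import Algebra.Bundles using (CommutativeRing)
open import Data.Nat as ℕ using (ℕ; zero; suc; _≤_; _<ᵇ_; _⊔_)
import Data.Nat.Properties as ℕP
open import Data.Integer as ℤ using (ℤ; +_; -[1+_])
open import Data.Bool using (Bool; true; false; if_then_else_; _∧_; _∨_; not)
import Data.Bool.Properties as BoolP
open import Data.List as List using (List; []; _∷_; _++_; concatMap; map; foldr; upTo; allFin; length)
open import Data.Bool.ListAction using (and; or)
open import Data.Nat.ListAction using (sum)
import Data.List.Properties as ListP
open import Data.List.Relation.Unary.All as ListAll using ()
open import Data.List.Relation.Unary.Unique.Propositional using (Unique)
open import Data.List.Membership.Propositional using (_∉_)
open import Data.Vec as Vec using (Vec; []; _∷_; zipWith; replicate; lookup; tabulate)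
import Data.Vec.Properties as VecP
open import Data.Vec.Relation.Unary.All as VecAll using ()
open import Data.Fin as Fin using (Fin; _↑ˡ_; _↑ʳ_; toℕ)
open import Data.Product using (Σ; _×_; _,_)
open import Data.Unit using (⊤)
open import Relation.Nullary.Decidable using (⌊_⌋)

-- Partitions and k-tuples of partitions.
-- A partition (infinitely many parts, finitely many nonzero) is represented
-- canonically by the list of its nonzero parts, weakly decreasing.

IsPartition : List ℕ → Set
IsPartition [] = ⊤
IsPartition (x ∷ []) = 1 ≤ x
IsPartition (x ∷ y ∷ r) = y ≤ x × IsPartition (y ∷ r)

Tuple : ℕ → Set
Tuple k = Vec (List ℕ) k

IsPartitionTuple : ∀ {k} → Tuple k → Set
IsPartitionTuple = VecAll.All IsPartition

at : List ℕ → ℕ → ℕ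
at [] _ = 0
at (x ∷ _) zero = x
at (_ ∷ r) (suc i) = at r i

-- λ_j - j  with j = i + 1
pos : List ℕ → ℕ → ℤ
pos la i = + at la i ℤ.- + suc i

maxLen : ∀ {k} → Tuple k → ℕ
maxLen = Vec.foldr _ (λ la r → length la ⊔ r) 0

maxPart : ∀ {k} → Tuple k → ℕ
maxPart = Vec.foldr _ (λ la r → foldr _⊔_ 0 la ⊔ r) 0

b2n : Bool → ℕ
b2n true = 1
b2n false = 0

count : List Bool → ℕ
count = foldr (λ b r → b2n b ℕ.+ r) 0

NL : ∀ {k} → ℕ → Tuple k → ℕ
NL {k} L α =
  count (concatMap (λ a → concatMap (λ b →
    if toℕ a <ᵇ toℕ b
    then concatMap (λ i → map (λ j →
           ⌊ pos (lookup α b) i ℤ.<? pos (lookup α a) j ⌋) (upTo L)) (upTo L)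
    else []) (allFin k)) (allFin k))

dist : ∀ {k} → Tuple k → Tuple k → ℤ
dist α β = let L = maxLen α ⊔ maxLen β in + NL L β ℤ.- + NL L α

Label : ℕ → Set
Label k = Vec Bool k

allLabels : (k : ℕ) → List (Label k)
allLabels zero = [] ∷ []
allLabels (suc k) = concatMap (λ v → (false ∷ v) ∷ (true ∷ v) ∷ []) (allLabels k)

allRowStates : (k cols : ℕ) → List (List (Label k))
allRowStates k zero = [] ∷ []
allRowStates k (suc c) = concatMap (λ L → map (L ∷_) (allRowStates k c)) (allLabels k)

columns : (ℓ N : ℕ) → List ℤ
columns ℓ N = map (λ i → + i ℤ.- + ℓ) (upTo (ℓ ℕ.+ N ℕ.+ 1))

-- boundary edge of column c carries colour a iff c = α^(a)_j - j, 1 ≤ j ≤ ℓ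
boundary : ∀ {k} → (ℓ N : ℕ) → Tuple k → List (Label k)
boundary ℓ N α =
  map (λ c → tabulate (λ a → or (map (λ i → ⌊ c ℤ.≟ pos (lookup α a) i ⌋) (upTo ℓ))))
      (columns ℓ N)

data RowType : Set where
  white purple : RowType

-- Formal power series in V commuting variables over a commutative ring R.
-- t is the parameter, t⁻¹ an element (assumed inverse to t in the theorem).

module Lattice (R : CommutativeRing 0ℓ 0ℓ) (t t⁻¹ : CommutativeRing.Carrier R) where
  open CommutativeRing R

  Mono : ℕ → Set
  Mono V = Vec ℕ V

  FPS : ℕ → Set
  FPS V = Mono V → Carrier

  _^ᴿ_ : Carrier → ℕ → Carrier
  x ^ᴿ zero = 1#
  x ^ᴿ suc n = x * (x ^ᴿ n)

  tpow : ℤ → Carrier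
  tpow (+ n) = t ^ᴿ n
  tpow -[1+ n ] = t⁻¹ ^ᴿ suc n

  sumR : List Carrier → Carrier
  sumR = foldr _+_ 0#

  below : ∀ {V} → Mono V → List (Mono V)
  below [] = [] ∷ []
  below (x ∷ xs) = concatMap (λ a → map (a ∷_) (below xs)) (upTo (suc x))

  zeroS : ∀ {V} → FPS V
  zeroS _ = 0#

  monoS : ∀ {V} → Carrier → Mono V → FPS V
  monoS c m e = if ⌊ VecP.≡-dec ℕ._≟_ e m ⌋ then c else 0#

  oneS : ∀ {V} → FPS V
  oneS = monoS 1# (replicate _ 0)

  infixl 6 _⊕_
  infixl 7 _⊛_
  _⊕_ : ∀ {V} → FPS V → FPS V → FPS V
  (f ⊕ g) e = f e + g e

  _⊛_ : ∀ {V} → FPS V → FPS V → FPS V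
  (f ⊛ g) e = sumR (map (λ a → f a * g (zipWith ℕ._∸_ e a)) (below e))

  sumS : ∀ {V} → List (FPS V) → FPS V
  sumS = foldr _⊕_ zeroS

  prodS : ∀ {V} → List (FPS V) → FPS V
  prodS = foldr _⊛_ oneS

  _≋_ : ∀ {V} → FPS V → FPS V → Set
  f ≋ g = ∀ e → f e ≈ g e

  unitV : ∀ {V} → Fin V → ℕ → Mono V
  unitV v n = tabulate (λ u → if ⌊ u Fin.≟ v ⌋ then n else 0)

  pairMono : ∀ {V} → Fin V → Fin V → Mono V
  pairMono u v = zipWith ℕ._+_ (unitV u 1) (unitV v 1)

  oneMinus : ∀ {V} → Carrier → Fin V → Fin V → FPS V
  oneMinus c u v = oneS ⊕ monoS (- c) (pairMono u v)

  -- (1 + c·u·v)^{-1} = Σ_j (-c)^j (u v)^j   (u ≠ v)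
  geomInv : ∀ {V} → Carrier → Fin V → Fin V → FPS V
  geomInv c u v e =
    let j = lookup e u in
    if ⌊ VecP.≡-dec ℕ._≟_ e (Vec.map (j ℕ.*_) (pairMono u v)) ⌋ then (- c) ^ᴿ j else 0#

  size : ∀ {k} → Label k → ℕ
  size L = Vec.foldr _ (λ b r → b2n b ℕ.+ r) 0 L

  φ : ∀ {k} → Label k → Vec ℕ k → ℕ
  φ {k} L M = sum (concatMap (λ c → map (λ d →
      if toℕ c <ᵇ toℕ d then b2n (lookup L c) ℕ.* lookup M d else 0)
      (allFin k)) (allFin k))

  allV : ∀ {k} → (Fin k → Bool) → Bool
  allV {k} f = and (map f (allFin k))

  conserve : ∀ {k} → Label k → Label k → Label k → Label k → Bool
  conserve I J K L = allV (λ c →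
    ⌊ (b2n (lookup I c) ℕ.+ b2n (lookup J c)) ℕ.≟ (b2n (lookup K c) ℕ.+ b2n (lookup L c)) ⌋)

  plusV : ∀ {k} → Label k → Label k → Vec ℕ k
  plusV I J = zipWith (λ a b → b2n a ℕ.+ b2n b) I J

  minusV : ∀ {k} → Label k → Label k → Vec ℕ k
  minusV K J = zipWith (λ a b → b2n a ℕ.∸ b2n b) K J

  -- vertex with bottom I, left J, top K, right L, row variable v
  vertex : ∀ {k V} → RowType → Fin V → Label k → Label k → Label k → Label k → FPS V
  vertex white v I J K L =
    if conserve I J K L ∧ allV (λ c → not (lookup I c ∧ lookup J c))
    then monoS (t ^ᴿ φ L (plusV I J)) (unitV v (size L))
    else zeroS
  vertex purple v I J K L =
    if conserve I J K L ∧ allV (λ c → not (lookup J c ∧ not (lookup K c)))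
    then monoS (t ^ᴿ φ L (minusV K J)) (unitV v (size L))
    else zeroS

  Row : ℕ → Set
  Row V = RowType × Fin V

  emptyL : ∀ {k} → Label k → Bool
  emptyL L = Vec.foldr _ (λ b r → not b ∧ r) true L

  -- one row: left edge label J, bottom labels, top labels (left to right);
  -- the right boundary edge must be empty
  rowW : ∀ {k V} → Row V → Label k → List (Label k) → List (Label k) → FPS V
  rowW r J [] [] = if emptyL J then oneS else zeroS
  rowW {k} (ty , v) J (I ∷ Is) (K ∷ Ks) =
    sumS (map (λ L → vertex ty v I J K L ⊛ rowW (ty , v) L Is Ks) (allLabels k))
  rowW _ _ _ _ = zeroS

  labelsEq : ∀ {k} → List (Label k) → List (Label k) → Bool
  labelsEq B T = ⌊ ListP.≡-dec (VecP.≡-dec BoolP._≟_) B T ⌋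

  -- rows listed bottom to top
  lattice : ∀ {k V} → List (Row V) → (cols : ℕ) → List (Label k) → List (Label k) → FPS V
  lattice [] cols B T = if labelsEq B T then oneS else zeroS
  lattice {k} (r ∷ rs) cols B T =
    sumS (map (λ S → rowW r (replicate k false) B S ⊛ lattice rs cols S T) (allRowStates k cols))

  -- L^S_{λ/μ} for the given rows (top boundary λ, bottom boundary μ),
  -- with ℓ = max number of nonzero parts, N = max part
  LS : ∀ {k V} → List (Row V) → Tuple k → Tuple k → FPS V
  LS rows la mu =
    let ℓ = maxLen la ⊔ maxLen mu
        N = maxPart la ⊔ maxPart mu
    in lattice rows (ℓ ℕ.+ N ℕ.+ 1) (boundary ℓ N mu) (boundary ℓ N la)

  rowsOf : ∀ {V} → List (Fin V) → List (Fin V) → List (Row V)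
  rowsOf xs ys = map (white ,_) xs ++ map (purple ,_) ys

  scale : ∀ {V} → Carrier → FPS V → FPS V
  scale c f e = c * f e

  -- Sum of a family of series indexed by k-tuples of partitions:
  -- for each monomial, the coefficient is a finite sum over a finite
  -- duplicate-free list of tuples outside which the coefficients vanish.

  HasSum : ∀ {k V} → (Tuple k → FPS V) → FPS V → Set
  HasSum {k} F S = ∀ e → Σ (List (Tuple k)) λ Λ →
      Unique Λ
    × ListAll.All IsPartitionTuple Λ
    × (∀ la → IsPartitionTuple la → la ∉ Λ → F la e ≈ 0#)
    × (S e ≈ sumR (map (λ la → F la e) Λ))

module Vars (n m p q : ℕ) where
  xv : Fin n → Fin (n ℕ.+ m ℕ.+ p ℕ.+ q)
  xv i = ((i ↑ˡ m) ↑ˡ p) ↑ˡ q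
  yv : Fin m → Fin (n ℕ.+ m ℕ.+ p ℕ.+ q)
  yv j = ((n ↑ʳ j) ↑ˡ p) ↑ˡ q
  wv : Fin p → Fin (n ℕ.+ m ℕ.+ p ℕ.+ q)
  wv α = ((n ℕ.+ m) ↑ʳ α) ↑ˡ q
  zv : Fin q → Fin (n ℕ.+ m ℕ.+ p ℕ.+ q)
  zv β = (n ℕ.+ m ℕ.+ p) ↑ʳ β

  Xs : List (Fin (n ℕ.+ m ℕ.+ p ℕ.+ q))
  Xs = map xv (allFin n)
  Ys : List (Fin (n ℕ.+ m ℕ.+ p ℕ.+ q))
  Ys = map yv (allFin m)
  Ws : List (Fin (n ℕ.+ m ℕ.+ p ℕ.+ q))
  Ws = map wv (allFin p)
  Zs : List (Fin (n ℕ.+ m ℕ.+ p ℕ.+ q))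
  Zs = map zv (allFin q)

  module _ (R : CommutativeRing 0ℓ 0ℓ) (t t⁻¹ : CommutativeRing.Carrier R) where
    open Lattice R t t⁻¹

    pairs : ∀ {V} → List (Fin V) → List (Fin V) → List (Fin V × Fin V)
    pairs us vs = concatMap (λ u → map (u ,_) vs) us

    Ω : ℕ → FPS (n ℕ.+ m ℕ.+ p ℕ.+ q)
    Ω k = prodS (map (λ l →
            prodS (map (λ { (u , v) → oneMinus (t ^ᴿ l) u v }) (pairs Xs Ws))
         ⊛ prodS (map (λ { (u , v) → oneMinus (t ^ᴿ l) u v }) (pairs Ys Zs))
         ⊛ prodS (map (λ { (u , v) → geomInv (t ^ᴿ l) u v }) (pairs Ys Ws))
         ⊛ prodS (map (λ { (u , v) → geomInv (t ^ᴿ l) u v }) (pairs Xs Zs)))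
         (upTo k))

{-# OPTIONS --safe #-}
-- Reading the lattice row by row turns L^S into an entry of a product of row
-- operators acting on the states of a horizontal line, and k-tuples of
-- partitions are such states seen through a window of columns.
-- The second factor of each sum enters transposed. Conjugating the transpose of
-- a white row by the power of t that counts N_L gives, by summation by parts, a
-- row of local "dual" weights. A purple row with parameter y and a dual white
-- row with parameter w commute up to ∏_{l<k} (1 + y w t^l): an R-matrix, given by
-- a recursion that removes one colour at a time, is carried through the columns
-- from one end of the window to the other, where it collapses to scalars because
-- the first column is full and the last one empty. The other three pairs of rows
-- reduce to this one, since the purple row with parameter -x inverts the white
-- row with parameter x, and since purple and white trade places under duality.
-- Matrix entries are homogeneous, their degree being the gain in total size, so
-- that every single coefficient of the identity is decided in a finite window.
module Submission where

open import Defs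
open import Level using (0ℓ)
open import Algebra.Bundles using (CommutativeRing)
import Algebra.Properties.AbelianGroup
import Algebra.Properties.Ring
import Algebra.Properties.Semiring.Mult.TCOptimised
import Algebra.Solver.Ring
import Algebra.Solver.Ring.AlmostCommutativeRing as ACR
import Relation.Binary.Reasoning.Setoid
open import Data.Bool using (Bool; true; false; if_then_else_; _∧_; _∨_; not)
open import Data.Bool.ListAction using (and; or)
import Data.Bool.Properties as BoolP
open import Data.Empty using (⊥-elim)
open import Data.Fin as Fin using (Fin; zero; suc; toℕ; _↑ˡ_; _↑ʳ_)
import Data.Fin.Properties as FinP
open import Data.Integer as ℤ using (ℤ; -[1+_]) renaming (+_ to ι)
import Data.Integer.Properties as ℤP
open import Data.List as List using (List; []; _∷_; _++_; allFin; applyUpTo; concatMap; filter; foldr; length; map; upTo)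
import Data.List.Membership.DecPropositional as DecMembership
open import Data.List.Membership.Propositional using (_∈_; _∉_; lose)
import Data.List.Membership.Propositional.Properties as MemP
import Data.List.Properties as ListP
open import Data.List.Relation.Unary.All as All using (All; []; _∷_)
import Data.List.Relation.Unary.All.Properties as AllP
open import Data.List.Relation.Unary.AllPairs as AllPairs using ([]; _∷_)
import Data.List.Relation.Unary.AllPairs.Properties as AllPairsP
open import Data.List.Relation.Unary.Any using (here; there)
open import Data.List.Relation.Unary.Unique.Propositional using (Unique)
import Data.List.Relation.Unary.Unique.Propositional.Properties as UniqueP
open import Data.Maybe using (Maybe; just; nothing)
open import Data.Maybe.Properties using (just-injective)
open import Data.Nat as ℕ using (ℕ; zero; suc; _<_; _≤_; _<ᵇ_; _⊔_; z≤n; s≤s)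
open import Data.Nat.ListAction using (sum)
import Data.Nat.ListAction.Properties as SumP
import Data.Nat.Properties as ℕP
open import Data.Nat.Solver using (module +-*-Solver)
open import Data.Product using (Σ; _×_; _,_; proj₁; proj₂)
open import Data.Sum using (_⊎_; inj₁; inj₂)
open import Data.Unit using (tt)
open import Data.Vec as Vec using (Vec; []; _∷_; lookup; replicate; tabulate; zipWith)
import Data.Vec.Properties as VecP
open import Data.Vec.Relation.Unary.All using ([]; _∷_)
import Data.Vec.Relation.Unary.All.Properties as VecAllP
open import Relation.Binary.PropositionalEquality as ≡ using (_≡_; _≢_)
open import Relation.Nullary using (¬_; yes; no; Dec; Reflects; ofʸ; ofⁿ)
open import Relation.Nullary.Decidable using (⌊_⌋; _×-dec_)
open import Relation.Unary using (Decidable)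

-- Two obstacles shape the proof. The R-matrix has no product formula over the colours, and passing
-- one colour through a column trades the last letter of a word for the first letter of another. So
-- `R` is defined by a recursion at the front, its behaviour at the back is derived from it, and the
-- column relation is proved for rotated words, where `pre` stores the letters of the colours
-- already treated. One entry at the back is known only after multiplication by z; this suffices,
-- since it always occurs with that factor. The exchange of two rows holds only between states whose
-- first column is full and whose last is empty, whereas products of several rows pass through
-- arbitrary states. The relation `≃` therefore compares entries only in low degrees: raising the
-- energy costs at least as much degree, so intermediate states near the borders of the window are
-- invisible there. Rows and their duals share this one-sided bound, and it survives composition.
-- The factors 1 + y w t^l stay on the side where they arise and are divided away once, after all
-- rows have been exchanged.

private variable
  k : ℕ
  A B : Set

-- The solvers of the library either lack negation or need a decidable equality;
-- integer coefficients serve every commutative ring.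
module RingSolver (K : CommutativeRing 0ℓ 0ℓ) where
  private
    open CommutativeRing K
    open Algebra.Properties.Ring ring
    open Algebra.Properties.AbelianGroup +-abelianGroup using (⁻¹-∙-comm; ⁻¹-involutive; ε⁻¹≈ε)
    open Algebra.Properties.Semiring.Mult.TCOptimised semiring renaming (_×_ to infixl 8 _·ℕ_)
    open import Relation.Binary.Reasoning.Setoid setoid

    -- With the optimised multiple, 1 times `1#` is `1#` by definition. The constants `𝟘` and `𝟙` of
    -- a solved equation are then literally `0#` and `1#`, and match the vertex weights without
    -- conversion.
    ⟪_⟫ : ℤ → Carrier
    ⟪ ι n ⟫ = n ·ℕ 1#
    ⟪ -[1+ n ] ⟫ = - (suc n ·ℕ 1#)

    suc-× : ∀ n → suc n ·ℕ 1# ≈ 1# + n ·ℕ 1#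
    suc-× n = 1+× n 1#

    ⊖-homo : ∀ m n → ⟪ m ℤ.⊖ n ⟫ ≈ m ·ℕ 1# + - (n ·ℕ 1#)
    ⊖-homo m zero = sym (trans (+-congˡ ε⁻¹≈ε) (+-identityʳ _))
    ⊖-homo zero (suc n) = sym (+-identityˡ _)
    ⊖-homo (suc m) (suc n) = begin
      ⟪ suc m ℤ.⊖ suc n ⟫                        ≡⟨ ≡.cong ⟪_⟫ (ℤP.[1+m]⊖[1+n]≡m⊖n m n) ⟩
      ⟪ m ℤ.⊖ n ⟫                                ≈⟨ ⊖-homo m n ⟩
      m ·ℕ 1# + - (n ·ℕ 1#)                        ≈⟨ +-congʳ (+-identityˡ _) ⟨
      0# + m ·ℕ 1# + - (n ·ℕ 1#)                   ≈⟨ +-congʳ (+-congʳ (-‿inverseʳ 1#)) ⟨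
      1# + - 1# + m ·ℕ 1# + - (n ·ℕ 1#)            ≈⟨ +-congʳ (trans (+-assoc _ _ _) (trans (+-congˡ (+-comm _ _)) (sym (+-assoc _ _ _)))) ⟩
      1# + m ·ℕ 1# + - 1# + - (n ·ℕ 1#)            ≈⟨ +-assoc _ _ _ ⟩
      1# + m ·ℕ 1# + (- 1# + - (n ·ℕ 1#))          ≈⟨ +-cong (sym (suc-× m)) (trans (⁻¹-∙-comm _ _) (-‿cong (sym (suc-× n)))) ⟩
      suc m ·ℕ 1# + - (suc n ·ℕ 1#)                ∎

    neg-homo : ∀ i → ⟪ ℤ.- i ⟫ ≈ - ⟪ i ⟫
    neg-homo (ι zero) = sym ε⁻¹≈ε
    neg-homo (ι (suc n)) = refl
    neg-homo -[1+ n ] = sym (⁻¹-involutive _)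

    plus-homo : ∀ i j → ⟪ i ℤ.+ j ⟫ ≈ ⟪ i ⟫ + ⟪ j ⟫
    plus-homo (ι m) (ι n) = ×-homo-+ 1# m n
    plus-homo (ι m) -[1+ n ] = ⊖-homo m (suc n)
    plus-homo -[1+ m ] (ι n) = trans (⊖-homo n (suc m)) (+-comm _ _)
    plus-homo -[1+ m ] -[1+ n ] = begin
      - (suc (suc (m ℕ.+ n)) ·ℕ 1#)       ≡⟨ ≡.cong (λ x → - (suc x ·ℕ 1#)) (≡.sym (ℕP.+-suc m n)) ⟩
      - ((suc m ℕ.+ suc n) ·ℕ 1#)         ≈⟨ -‿cong (×-homo-+ 1# (suc m) (suc n)) ⟩
      - (suc m ·ℕ 1# + suc n ·ℕ 1#)        ≈⟨ ⁻¹-∙-comm _ _ ⟨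
      - (suc m ·ℕ 1#) + - (suc n ·ℕ 1#)    ∎

    pos-homo : ∀ m n → ⟪ ι m ℤ.* ι n ⟫ ≈ ⟪ ι m ⟫ * ⟪ ι n ⟫
    pos-homo m n = trans (reflexive (≡.cong ⟪_⟫ (≡.sym (ℤP.pos-* m n)))) (×1-homo-* m n)

    times-homo : ∀ i j → ⟪ i ℤ.* j ⟫ ≈ ⟪ i ⟫ * ⟪ j ⟫
    times-homo (ι m) (ι n) = pos-homo m n
    times-homo (ι m) -[1+ n ] = begin
      ⟪ ι m ℤ.* ℤ.- (ι (suc n)) ⟫    ≡⟨ ≡.cong ⟪_⟫ (≡.sym (ℤP.neg-distribʳ-* (ι m) (ι (suc n)))) ⟩
      ⟪ ℤ.- (ι m ℤ.* ι (suc n)) ⟫    ≈⟨ neg-homo (ι m ℤ.* ι (suc n)) ⟩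
      - ⟪ ι m ℤ.* ι (suc n) ⟫        ≈⟨ -‿cong (pos-homo m (suc n)) ⟩
      - (⟪ ι m ⟫ * ⟪ ι (suc n) ⟫)    ≈⟨ -‿distribʳ-* _ _ ⟩
      ⟪ ι m ⟫ * - ⟪ ι (suc n) ⟫      ∎
    times-homo -[1+ m ] j = begin
      ⟪ ℤ.- (ι (suc m)) ℤ.* j ⟫    ≡⟨ ≡.cong ⟪_⟫ (≡.sym (ℤP.neg-distribˡ-* (ι (suc m)) j)) ⟩
      ⟪ ℤ.- (ι (suc m) ℤ.* j) ⟫    ≈⟨ neg-homo (ι (suc m) ℤ.* j) ⟩
      - ⟪ ι (suc m) ℤ.* j ⟫        ≈⟨ -‿cong (lem j) ⟩
      - (⟪ ι (suc m) ⟫ * ⟪ j ⟫)    ≈⟨ -‿distribˡ-* _ _ ⟩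
      - ⟪ ι (suc m) ⟫ * ⟪ j ⟫      ∎
      where
      lem : ∀ j → ⟪ ι (suc m) ℤ.* j ⟫ ≈ ⟪ ι (suc m) ⟫ * ⟪ j ⟫
      lem (ι n) = pos-homo (suc m) n
      lem -[1+ n ] = begin
        ⟪ ι (suc m) ℤ.* ℤ.- (ι (suc n)) ⟫   ≡⟨ ≡.cong ⟪_⟫ (≡.sym (ℤP.neg-distribʳ-* (ι (suc m)) (ι (suc n)))) ⟩
        ⟪ ℤ.- (ι (suc m) ℤ.* ι (suc n)) ⟫   ≈⟨ neg-homo (ι (suc m) ℤ.* ι (suc n)) ⟩
        - ⟪ ι (suc m) ℤ.* ι (suc n) ⟫       ≈⟨ -‿cong (pos-homo (suc m) (suc n)) ⟩
        - (⟪ ι (suc m) ⟫ * ⟪ ι (suc n) ⟫)   ≈⟨ -‿distribʳ-* _ _ ⟩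
        ⟪ ι (suc m) ⟫ * - ⟪ ι (suc n) ⟫     ∎

    almost : ACR.AlmostCommutativeRing 0ℓ 0ℓ
    almost = ACR.fromCommutativeRing K

    morphism : CommutativeRing.rawRing ℤP.+-*-commutativeRing ACR.-Raw-AlmostCommutative⟶ almost
    morphism = record
      { ⟦_⟧ = ⟪_⟫ ; +-homo = plus-homo ; *-homo = times-homo ; -‿homo = neg-homo
      ; 0-homo = refl ; 1-homo = refl }

    dec : ∀ i j → Maybe (⟪ i ⟫ ≈ ⟪ j ⟫)
    dec i j with i ℤ.≟ j
    ... | yes p = just (reflexive (≡.cong ⟪_⟫ p))
    ... | no _ = nothing

  open Algebra.Solver.Ring (CommutativeRing.rawRing ℤP.+-*-commutativeRing) almost morphism dec public
    using (Polynomial; solve; _:=_; _:+_; _:*_; :-_; _:-_; con)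

  𝟘 𝟙 : ∀ {n} → Polynomial n
  𝟘 = con (ι 0)
  𝟙 = con (ι 1)

-- Finite sums over labels and row states

module Sums (K : CommutativeRing 0ℓ 0ℓ) where
  open CommutativeRing K
  open Relation.Binary.Reasoning.Setoid setoid
  open RingSolver K using (solve; _:=_; _:+_)
  open Algebra.Properties.AbelianGroup +-abelianGroup using (⁻¹-∙-comm; ε⁻¹≈ε)

  ∑ : List A → (A → Carrier) → Carrier
  ∑ xs f = foldr _+_ 0# (map f xs)

  syntax ∑ xs (λ x → e) = ∑[ x ∈ xs ] e

  ∑-cong : ∀ (xs : List A) {f g : A → Carrier} → (∀ x → f x ≈ g x) → ∑ xs f ≈ ∑ xs g
  ∑-cong [] h = refl
  ∑-cong (x ∷ xs) h = +-cong (h x) (∑-cong xs h)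

  ∑-cong-All : ∀ {xs : List A} {f g : A → Carrier} → All (λ x → f x ≈ g x) xs → ∑ xs f ≈ ∑ xs g
  ∑-cong-All [] = refl
  ∑-cong-All (h ∷ hs) = +-cong h (∑-cong-All hs)

  ∑-0 : ∀ (xs : List A) → ∑ xs (λ _ → 0#) ≈ 0#
  ∑-0 [] = refl
  ∑-0 (x ∷ xs) = trans (+-identityˡ _) (∑-0 xs)

  ∑-zero : ∀ (xs : List A) {f : A → Carrier} → (∀ x → f x ≈ 0#) → ∑ xs f ≈ 0#
  ∑-zero xs h = trans (∑-cong xs h) (∑-0 xs)

  ∑-zero-All : ∀ {xs : List A} {f : A → Carrier} → All (λ x → f x ≈ 0#) xs → ∑ xs f ≈ 0#
  ∑-zero-All {xs = xs} h = trans (∑-cong-All h) (∑-0 xs)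

  ∑-+ : ∀ (xs : List A) (f g : A → Carrier) → ∑ xs (λ x → f x + g x) ≈ ∑ xs f + ∑ xs g
  ∑-+ [] f g = sym (+-identityˡ _)
  ∑-+ (x ∷ xs) f g = begin
    f x + g x + ∑ xs (λ x → f x + g x)  ≈⟨ +-congˡ (∑-+ xs f g) ⟩
    f x + g x + (∑ xs f + ∑ xs g)       ≈⟨ solve 4 (λ a b c d → (a :+ b) :+ (c :+ d) := (a :+ c) :+ (b :+ d)) refl _ _ _ _ ⟩
    f x + ∑ xs f + (g x + ∑ xs g)       ∎

  ∑-neg : ∀ (xs : List A) (f : A → Carrier) → ∑ xs (λ x → - f x) ≈ - ∑ xs f
  ∑-neg [] f = sym ε⁻¹≈ε
  ∑-neg (x ∷ xs) f = trans (+-congˡ (∑-neg xs f)) (⁻¹-∙-comm _ _)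

  *-∑ : ∀ (xs : List A) c (f : A → Carrier) → c * ∑ xs f ≈ ∑ xs (λ x → c * f x)
  *-∑ [] c f = zeroʳ c
  *-∑ (x ∷ xs) c f = trans (distribˡ _ _ _) (+-congˡ (*-∑ xs c f))

  ∑-* : ∀ (xs : List A) c (f : A → Carrier) → ∑ xs f * c ≈ ∑ xs (λ x → f x * c)
  ∑-* [] c f = zeroˡ c
  ∑-* (x ∷ xs) c f = trans (distribʳ _ _ _) (+-congˡ (∑-* xs c f))

  ∑-swap : ∀ (xs : List A) (ys : List B) (f : A → B → Carrier) →
           ∑[ x ∈ xs ] ∑[ y ∈ ys ] f x y ≈ ∑[ y ∈ ys ] ∑[ x ∈ xs ] f x y
  ∑-swap [] ys f = sym (∑-0 ys)
  ∑-swap (x ∷ xs) ys f = trans (+-congˡ (∑-swap xs ys f)) (sym (∑-+ ys _ _))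

  ∑-++ : ∀ (xs ys : List A) (f : A → Carrier) → ∑ (xs ++ ys) f ≈ ∑ xs f + ∑ ys f
  ∑-++ [] ys f = sym (+-identityˡ _)
  ∑-++ (x ∷ xs) ys f = trans (+-congˡ (∑-++ xs ys f)) (sym (+-assoc _ _ _))

  ∑-map : ∀ (g : A → B) (xs : List A) (f : B → Carrier) → ∑ (map g xs) f ≈ ∑ xs (λ x → f (g x))
  ∑-map g [] f = refl
  ∑-map g (x ∷ xs) f = +-congˡ (∑-map g xs f)

  ∑-concatMap : ∀ (g : A → List B) (xs : List A) (f : B → Carrier) →
                ∑ (concatMap g xs) f ≈ ∑[ x ∈ xs ] ∑ (g x) f
  ∑-concatMap g [] f = refl
  ∑-concatMap g (x ∷ xs) f = trans (∑-++ (g x) (concatMap g xs) f) (+-congˡ (∑-concatMap g xs f))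

  ∑-labels : ∀ k (f : Label (suc k) → Carrier) →
             ∑ (allLabels (suc k)) f ≈ ∑[ v ∈ allLabels k ] (f (false ∷ v) + f (true ∷ v))
  ∑-labels k f = trans (∑-concatMap _ (allLabels k) f)
                       (∑-cong (allLabels k) λ v → +-congˡ (+-identityʳ _))

  bit : (Bool → Carrier) → Carrier
  bit f = f false + f true

  ∑-labels′ : ∀ k (f : Label (suc k) → Carrier) →
             ∑ (allLabels (suc k)) f ≈ bit λ b → ∑[ v ∈ allLabels k ] f (b ∷ v)
  ∑-labels′ k f = trans (∑-labels k f) (∑-+ (allLabels k) _ _)

  ∑-bit : ∀ (xs : List A) (f : A → Bool → Carrier) →
          ∑ xs (λ x → bit (f x)) ≈ bit λ b → ∑[ x ∈ xs ] f x b
  ∑-bit xs f = ∑-+ xs _ _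

  ∑-states : ∀ k c (f : List (Label k) → Carrier) →
             ∑ (allRowStates k (suc c)) f ≈ ∑[ L ∈ allLabels k ] ∑[ s ∈ allRowStates k c ] f (L ∷ s)
  ∑-states k c f = trans (∑-concatMap _ (allLabels k) f)
                         (∑-cong (allLabels k) λ L → ∑-map (L ∷_) (allRowStates k c) f)

  -- States are enumerated from the left column on; splitting off the last column instead is what an
  -- extension of the window to the right requires.
  ∑-states-snoc : ∀ k c (f : List (Label k) → Carrier) →
             ∑ (allRowStates k (suc c)) f ≈ ∑[ s ∈ allRowStates k c ] ∑[ L ∈ allLabels k ] f (s ++ L ∷ [])
  ∑-states-snoc k zero f = begin
    ∑ (allRowStates k 1) f                       ≈⟨ ∑-states k 0 f ⟩
    ∑[ L ∈ allLabels k ] (f (L ∷ []) + 0#)        ≈⟨ ∑-cong (allLabels k) (λ L → +-identityʳ _) ⟩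
    ∑[ L ∈ allLabels k ] f (L ∷ [])               ≈⟨ +-identityʳ _ ⟨
    ∑[ L ∈ allLabels k ] f (L ∷ []) + 0#          ∎
  ∑-states-snoc k (suc c) f = begin
    ∑ (allRowStates k (suc (suc c))) f
      ≈⟨ ∑-states k (suc c) f ⟩
    ∑[ L ∈ allLabels k ] ∑[ s ∈ allRowStates k (suc c) ] f (L ∷ s)
      ≈⟨ ∑-cong (allLabels k) (λ L → ∑-states-snoc k c (λ s → f (L ∷ s))) ⟩
    ∑[ L ∈ allLabels k ] ∑[ s ∈ allRowStates k c ] ∑[ M ∈ allLabels k ] f (L ∷ s ++ M ∷ [])
      ≈⟨ ∑-states k c (λ s → ∑[ M ∈ allLabels k ] f (s ++ M ∷ [])) ⟨
    ∑[ s ∈ allRowStates k (suc c) ] ∑[ M ∈ allLabels k ] f (s ++ M ∷ []) ∎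

-- The exchange relation for one column

okW okP : (i j k l : Bool) → Bool
okW i j k l = ⌊ (b2n i ℕ.+ b2n j) ℕ.≟ (b2n k ℕ.+ b2n l) ⌋ ∧ not (i ∧ j)
okP i j k l = ⌊ (b2n i ℕ.+ b2n j) ℕ.≟ (b2n k ℕ.+ b2n l) ⌋ ∧ not (j ∧ not k)

-- The single-colour weights are written over bare operations, so that the same
-- terms can be read both in a ring and as polynomials of the ring solver.
module SiteWeights {C : Set} (_+_ _*_ : C → C → C) (-_ : C → C) (0# 1# : C) where

  pick guard : Bool → C → C
  pick b x = if b then x else 1#
  guard b x = if b then x else 0#

  -- white, purple and dual white weights of one colour; g and h stand for the
  -- powers of t contributed by the other colours
  w1 p1 : (ξ g : C) (i j k l : Bool) → C
  w1 ξ g i j k l = guard (okW i j k l) (pick l ξ * pick (i ∨ j) g)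
  p1 ξ g i j k l = guard (okP i j k l) (pick l ξ * pick (k ∧ not j) g)

  s1 : (ω g h : C) (i j k l : Bool) → C
  s1 ω g h i j k l = guard (okW k j i l) (pick l ω * (pick j g * pick i h))

  bits : (Bool → C) → C
  bits f = f false + f true

  -- The R-matrix entries with one more letter in front of a word (`headT`) or behind it (`tailT`),
  -- including their gauge factors. `x`, `y`, `x″`, `y″` are the powers of t of the four edges over
  -- the colours in `pre`; `v`, `v″` are those of the second and fourth edge over `post`. `X` is the
  -- one entry without a closed expression.
  module Tables (x y x″ y″ v v″ Ψ Θ ω ξ X : C) where

    headT tailT : (a b c d : Bool) → C
    headT false false false false = x * (v * (y″ * (v″ * Ψ)))
    headT true  true  false false = y * (v * (y″ * (v″ * Ψ)))
    headT true  true  true  true  = - (y * (v * Ψ))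
    headT false true  false true  = y * (v * (v″ * Ψ))
    headT true  false true  false = y″ * (v * (Θ + (x * Ψ)))
    headT false false true  true  = v * Θ
    headT _ _ _ _ = 0#

    tailT false false false false = x″ * (v″ * (y″ * (v″ * Ψ)))
    tailT true  true  false false = X
    tailT true  true  true  true  = - (y″ * (v″ * Ψ))
    tailT false true  false true  = v * (y″ * (v″ * Ψ))
    tailT true  false true  false = y″ * (v″ * (Θ + (x * Ψ)))
    tailT false false true  true  = (ω * ξ) * (y″ * (v″ * Ψ))
    tailT _ _ _ _ = 0#

    siteL siteR : (i k a b c d : Bool) → C
    siteL i k a b c d = bits λ a′ → bits λ b′ →
      bits (λ m → s1 ω y v i b m b′ * p1 ξ x m a k a′) * tailT a′ b′ c d
    siteR i k a b c d = bits λ a′ → bits λ b′ →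
      headT a b a′ b′ * bits (λ m → p1 ξ x″ i a′ m c * s1 ω y″ v″ m b′ k d)

module SiteRelation (K : CommutativeRing 0ℓ 0ℓ) where
  open CommutativeRing K
  open RingSolver K
  open SiteWeights _+_ _*_ -_ 0# 1# public
  private module P n = SiteWeights {Polynomial n} _:+_ _:*_ :-_ 𝟘 𝟙

  module _ (x y x″ y″ v v″ Ψ Θ ω ξ X : Carrier)
           (eqX : ω * ξ * X ≈ y″ * (v″ * (v * Θ + x * (v * Ψ) + - (x″ * (v″ * Ψ))))) where
    open Tables x y x″ y″ v v″ Ψ Θ ω ξ X

    private
      polyL polyR : (i k a b c d : Bool) (x y x″ y″ v v″ Ψ Θ ω ξ X : Polynomial 11) → Polynomial 11
      polyL i k a b c d x y x″ y″ v v″ Ψ Θ ω ξ X = P.Tables.siteL 11 x y x″ y″ v v″ Ψ Θ ω ξ X i k a b c d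
      polyR i k a b c d x y x″ y″ v v″ Ψ Θ ω ξ X = P.Tables.siteR 11 x y x″ y″ v v″ Ψ Θ ω ξ X i k a b c d

      poly : (i k a b c d : Bool) (x y x″ y″ v v″ Ψ Θ ω ξ X : Polynomial 11) → Polynomial 11 × Polynomial 11
      poly i k a b c d x y x″ y″ v v″ Ψ Θ ω ξ X =
        polyL i k a b c d x y x″ y″ v v″ Ψ Θ ω ξ X := polyR i k a b c d x y x″ y″ v v″ Ψ Θ ω ξ X

      absorbX : ∀ {l r} → l ≈ x″ * (v″ * (y″ * (v″ * Ψ))) + ω * ξ * X →
                x″ * (v″ * (y″ * (v″ * Ψ))) + y″ * (v″ * (v * Θ + x * (v * Ψ) + - (x″ * (v″ * Ψ)))) ≈ r → l ≈ r
      absorbX p q = trans p (trans (+-congˡ eqX) q)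

    -- Sixty-four polynomial identities. `X` belongs to the letter with a′ and b′ true and c and d
    -- false; the guards of the two vertices then leave only i and b false with a = k. In these two
    -- cases `X` carries the factor ω ξ and is eliminated by `eqX`; all others hold without a
    -- hypothesis.
    site : ∀ i k a b c d → siteL i k a b c d ≈ siteR i k a b c d
    site false false false false false false = absorbX
      (solve 11 (λ x y x″ y″ v v″ Ψ Θ ω ξ X → polyL false false false false false false x y x″ y″ v v″ Ψ Θ ω ξ X
                   := x″ :* (v″ :* (y″ :* (v″ :* Ψ))) :+ ω :* ξ :* X) refl x y x″ y″ v v″ Ψ Θ ω ξ X)
      (solve 11 (λ x y x″ y″ v v″ Ψ Θ ω ξ X → x″ :* (v″ :* (y″ :* (v″ :* Ψ))) :+ y″ :* (v″ :* (v :* Θ :+ x :* (v :* Ψ) :+ :- (x″ :* (v″ :* Ψ))))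
                   := polyR false false false false false false x y x″ y″ v v″ Ψ Θ ω ξ X) refl x y x″ y″ v v″ Ψ Θ ω ξ X)
    site false false false false false true = solve 11 (poly false false false false false true) refl x y x″ y″ v v″ Ψ Θ ω ξ X
    site false false false false true false = solve 11 (poly false false false false true false) refl x y x″ y″ v v″ Ψ Θ ω ξ X
    site false false false false true true = solve 11 (poly false false false false true true) refl x y x″ y″ v v″ Ψ Θ ω ξ X
    site false false false true false false = solve 11 (poly false false false true false false) refl x y x″ y″ v v″ Ψ Θ ω ξ X
    site false false false true false true = solve 11 (poly false false false true false true) refl x y x″ y″ v v″ Ψ Θ ω ξ X
    site false false false true true false = solve 11 (poly false false false true true false) refl x y x″ y″ v v″ Ψ Θ ω ξ X
    site false false false true true true = solve 11 (poly false false false true true true) refl x y x″ y″ v v″ Ψ Θ ω ξ X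
    site false false true false false false = solve 11 (poly false false true false false false) refl x y x″ y″ v v″ Ψ Θ ω ξ X
    site false false true false false true = solve 11 (poly false false true false false true) refl x y x″ y″ v v″ Ψ Θ ω ξ X
    site false false true false true false = solve 11 (poly false false true false true false) refl x y x″ y″ v v″ Ψ Θ ω ξ X
    site false false true false true true = solve 11 (poly false false true false true true) refl x y x″ y″ v v″ Ψ Θ ω ξ X
    site false false true true false false = solve 11 (poly false false true true false false) refl x y x″ y″ v v″ Ψ Θ ω ξ X
    site false false true true false true = solve 11 (poly false false true true false true) refl x y x″ y″ v v″ Ψ Θ ω ξ X
    site false false true true true false = solve 11 (poly false false true true true false) refl x y x″ y″ v v″ Ψ Θ ω ξ X
    site false false true true true true = solve 11 (poly false false true true true true) refl x y x″ y″ v v″ Ψ Θ ω ξ X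
    site false true false false false false = solve 11 (poly false true false false false false) refl x y x″ y″ v v″ Ψ Θ ω ξ X
    site false true false false false true = solve 11 (poly false true false false false true) refl x y x″ y″ v v″ Ψ Θ ω ξ X
    site false true false false true false = solve 11 (poly false true false false true false) refl x y x″ y″ v v″ Ψ Θ ω ξ X
    site false true false false true true = solve 11 (poly false true false false true true) refl x y x″ y″ v v″ Ψ Θ ω ξ X
    site false true false true false false = solve 11 (poly false true false true false false) refl x y x″ y″ v v″ Ψ Θ ω ξ X
    site false true false true false true = solve 11 (poly false true false true false true) refl x y x″ y″ v v″ Ψ Θ ω ξ X
    site false true false true true false = solve 11 (poly false true false true true false) refl x y x″ y″ v v″ Ψ Θ ω ξ X
    site false true false true true true = solve 11 (poly false true false true true true) refl x y x″ y″ v v″ Ψ Θ ω ξ X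
    site false true true false false false = absorbX
      (solve 11 (λ x y x″ y″ v v″ Ψ Θ ω ξ X → polyL false true true false false false x y x″ y″ v v″ Ψ Θ ω ξ X
                   := x″ :* (v″ :* (y″ :* (v″ :* Ψ))) :+ ω :* ξ :* X) refl x y x″ y″ v v″ Ψ Θ ω ξ X)
      (solve 11 (λ x y x″ y″ v v″ Ψ Θ ω ξ X → x″ :* (v″ :* (y″ :* (v″ :* Ψ))) :+ y″ :* (v″ :* (v :* Θ :+ x :* (v :* Ψ) :+ :- (x″ :* (v″ :* Ψ))))
                   := polyR false true true false false false x y x″ y″ v v″ Ψ Θ ω ξ X) refl x y x″ y″ v v″ Ψ Θ ω ξ X)
    site false true true false false true = solve 11 (poly false true true false false true) refl x y x″ y″ v v″ Ψ Θ ω ξ X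
    site false true true false true false = solve 11 (poly false true true false true false) refl x y x″ y″ v v″ Ψ Θ ω ξ X
    site false true true false true true = solve 11 (poly false true true false true true) refl x y x″ y″ v v″ Ψ Θ ω ξ X
    site false true true true false false = solve 11 (poly false true true true false false) refl x y x″ y″ v v″ Ψ Θ ω ξ X
    site false true true true false true = solve 11 (poly false true true true false true) refl x y x″ y″ v v″ Ψ Θ ω ξ X
    site false true true true true false = solve 11 (poly false true true true true false) refl x y x″ y″ v v″ Ψ Θ ω ξ X
    site false true true true true true = solve 11 (poly false true true true true true) refl x y x″ y″ v v″ Ψ Θ ω ξ X
    site true false false false false false = solve 11 (poly true false false false false false) refl x y x″ y″ v v″ Ψ Θ ω ξ X
    site true false false false false true = solve 11 (poly true false false false false true) refl x y x″ y″ v v″ Ψ Θ ω ξ X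
    site true false false false true false = solve 11 (poly true false false false true false) refl x y x″ y″ v v″ Ψ Θ ω ξ X
    site true false false false true true = solve 11 (poly true false false false true true) refl x y x″ y″ v v″ Ψ Θ ω ξ X
    site true false false true false false = solve 11 (poly true false false true false false) refl x y x″ y″ v v″ Ψ Θ ω ξ X
    site true false false true false true = solve 11 (poly true false false true false true) refl x y x″ y″ v v″ Ψ Θ ω ξ X
    site true false false true true false = solve 11 (poly true false false true true false) refl x y x″ y″ v v″ Ψ Θ ω ξ X
    site true false false true true true = solve 11 (poly true false false true true true) refl x y x″ y″ v v″ Ψ Θ ω ξ X
    site true false true false false false = solve 11 (poly true false true false false false) refl x y x″ y″ v v″ Ψ Θ ω ξ X
    site true false true false false true = solve 11 (poly true false true false false true) refl x y x″ y″ v v″ Ψ Θ ω ξ X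
    site true false true false true false = solve 11 (poly true false true false true false) refl x y x″ y″ v v″ Ψ Θ ω ξ X
    site true false true false true true = solve 11 (poly true false true false true true) refl x y x″ y″ v v″ Ψ Θ ω ξ X
    site true false true true false false = solve 11 (poly true false true true false false) refl x y x″ y″ v v″ Ψ Θ ω ξ X
    site true false true true false true = solve 11 (poly true false true true false true) refl x y x″ y″ v v″ Ψ Θ ω ξ X
    site true false true true true false = solve 11 (poly true false true true true false) refl x y x″ y″ v v″ Ψ Θ ω ξ X
    site true false true true true true = solve 11 (poly true false true true true true) refl x y x″ y″ v v″ Ψ Θ ω ξ X
    site true true false false false false = solve 11 (poly true true false false false false) refl x y x″ y″ v v″ Ψ Θ ω ξ X
    site true true false false false true = solve 11 (poly true true false false false true) refl x y x″ y″ v v″ Ψ Θ ω ξ X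
    site true true false false true false = solve 11 (poly true true false false true false) refl x y x″ y″ v v″ Ψ Θ ω ξ X
    site true true false false true true = solve 11 (poly true true false false true true) refl x y x″ y″ v v″ Ψ Θ ω ξ X
    site true true false true false false = solve 11 (poly true true false true false false) refl x y x″ y″ v v″ Ψ Θ ω ξ X
    site true true false true false true = solve 11 (poly true true false true false true) refl x y x″ y″ v v″ Ψ Θ ω ξ X
    site true true false true true false = solve 11 (poly true true false true true false) refl x y x″ y″ v v″ Ψ Θ ω ξ X
    site true true false true true true = solve 11 (poly true true false true true true) refl x y x″ y″ v v″ Ψ Θ ω ξ X
    site true true true false false false = solve 11 (poly true true true false false false) refl x y x″ y″ v v″ Ψ Θ ω ξ X
    site true true true false false true = solve 11 (poly true true true false false true) refl x y x″ y″ v v″ Ψ Θ ω ξ X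
    site true true true false true false = solve 11 (poly true true true false true false) refl x y x″ y″ v v″ Ψ Θ ω ξ X
    site true true true false true true = solve 11 (poly true true true false true true) refl x y x″ y″ v v″ Ψ Θ ω ξ X
    site true true true true false false = solve 11 (poly true true true true false false) refl x y x″ y″ v v″ Ψ Θ ω ξ X
    site true true true true false true = solve 11 (poly true true true true false true) refl x y x″ y″ v v″ Ψ Θ ω ξ X
    site true true true true true false = solve 11 (poly true true true true true false) refl x y x″ y″ v v″ Ψ Θ ω ξ X
    site true true true true true true = solve 11 (poly true true true true true true) refl x y x″ y″ v v″ Ψ Θ ω ξ X

-- One colour of an entry of the R-matrix: the states (a , b) and (c , d) of the
-- two horizontal edges before and after the crossing.
data Letter : Set where
  ltr : (a b c d : Bool) → Letter

-- The legal letters are the six solutions of a + d = b + c: the dual row conserves paths with its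
-- top and bottom exchanged, so that the difference of the two horizontal edges, not their sum, is
-- preserved by the crossing.
data Kind : Set where
  flat both up rise illegal : Kind

kind : Letter → Kind
kind (ltr false false false false) = flat
kind (ltr true true false false) = flat
kind (ltr false true false true) = flat
kind (ltr true true true true) = both
kind (ltr true false true false) = up
kind (ltr false false true true) = rise
kind _ = illegal

isOk : Kind → Bool
isOk illegal = false
isOk _ = true

ok : Letter → Bool
ok c = isOk (kind c)

allOk : List Letter → Bool
allOk [] = true
allOk (c ∷ r) = ok c ∧ allOk r

-- The R-matrix and its behaviour at the last colour

module RMatrix (K : CommutativeRing 0ℓ 0ℓ) (t τ : CommutativeRing.Carrier K)
               (tτ : CommutativeRing._≈_ K (CommutativeRing._*_ K t τ) (CommutativeRing.1# K)) where
  open CommutativeRing K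
  open Relation.Binary.Reasoning.Setoid setoid
  open RingSolver K
  open SiteRelation K public

  infixl 6 _∷ʳ_
  _∷ʳ_ : ∀ {A : Set} → List A → A → List A
  r ∷ʳ c = r ++ c ∷ []

  stat : (Letter → Carrier) → List Letter → Carrier
  stat f [] = 1#
  stat f (c ∷ r) = f c * stat f r

  stat-++ : ∀ f r s → stat f (r ++ s) ≈ stat f r * stat f s
  stat-++ f [] s = sym (*-identityˡ _)
  stat-++ f (c ∷ r) s = trans (*-congˡ (stat-++ f r s)) (sym (*-assoc _ _ _))

  stat-∷ʳ : ∀ f r c → stat f (r ∷ʳ c) ≈ f c * stat f r
  stat-∷ʳ f r c = trans (stat-++ f r (c ∷ [])) (trans (*-comm _ _) (*-congʳ (*-identityʳ _)))

  stat-inverse : ∀ f g → (∀ c → f c * g c ≈ 1#) → ∀ r → stat f r * stat g r ≈ 1#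
  stat-inverse f g h [] = *-identityˡ _
  stat-inverse f g h (c ∷ r) = trans
    (solve 4 (λ a b c d → (a :* b) :* (c :* d) := (a :* c) :* (b :* d)) refl _ _ _ _)
    (trans (*-cong (h c) (stat-inverse f g h r)) (*-identityˡ _))

  fa fb fc fd : Carrier → Letter → Carrier
  fa s (ltr a b c d) = pick a s
  fb s (ltr a b c d) = pick b s
  fc s (ltr a b c d) = pick c s
  fd s (ltr a b c d) = pick d s

  pick-inverse : ∀ b → pick b t * pick b τ ≈ 1#
  pick-inverse false = *-identityˡ _
  pick-inverse true = tτ

  α β γ δ ᾱ β̄ γ̄ δ̄ len : List Letter → Carrier
  α = stat (fa t)
  β = stat (fb t)
  γ = stat (fc t)
  δ = stat (fd t)
  ᾱ = stat (fa τ)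
  β̄ = stat (fb τ)
  γ̄ = stat (fc τ)
  δ̄ = stat (fd τ)
  len = stat (λ _ → t)

  ββ̄ : ∀ r → β r * β̄ r ≈ 1#
  ββ̄ = stat-inverse _ _ λ { (ltr a b c d) → pick-inverse b }
  γγ̄ : ∀ r → γ r * γ̄ r ≈ 1#
  γγ̄ = stat-inverse _ _ λ { (ltr a b c d) → pick-inverse c }
  δδ̄ : ∀ r → δ r * δ̄ r ≈ 1#
  δδ̄ = stat-inverse _ _ λ { (ltr a b c d) → pick-inverse d }

  headK : Kind → (Φ Y b : Carrier) → Carrier
  headK flat Φ Y b = Φ
  headK both Φ Y b = - (b * Φ)
  headK up   Φ Y b = Y
  headK rise Φ Y b = Y + - (b * Φ)
  headK illegal  Φ Y b = 0#

  -- The R-matrix. Its entries do not factor over colours, but they obey this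
  -- recursion, which removes the first colour at the cost of a shift of z.
  R : Carrier → List Letter → Carrier
  R z [] = 1#
  R z (c ∷ r) = headK (kind c) (α r * (γ̄ r * R (z * t) r)) ((1# + z * len r) * (δ̄ r * R z r)) (δ̄ r)

  headK-cong : ∀ k {Φ Φ′ Y Y′ b b′} → Φ ≈ Φ′ → Y ≈ Y′ → b ≈ b′ → headK k Φ Y b ≈ headK k Φ′ Y′ b′
  headK-cong flat p q r = p
  headK-cong both p q r = -‿cong (*-cong r p)
  headK-cong up   p q r = q
  headK-cong rise p q r = +-cong q (-‿cong (*-cong r p))
  headK-cong illegal  p q r = refl

  headK-linear : ∀ k s Φ Y Φ′ Y′ b →
    headK k (s * Φ + - Φ′) (s * Y + - Y′) b ≈ s * headK k Φ Y b + - headK k Φ′ Y′ b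
  headK-linear flat s Φ Y Φ′ Y′ b = refl
  headK-linear both s Φ Y Φ′ Y′ b =
    solve 4 (λ s Φ Φ′ b → :- (b :* (s :* Φ :+ :- Φ′)) := s :* (:- (b :* Φ)) :+ :- (:- (b :* Φ′))) refl s Φ Φ′ b
  headK-linear up   s Φ Y Φ′ Y′ b = refl
  headK-linear rise s Φ Y Φ′ Y′ b =
    solve 6 (λ s Φ Φ′ Y Y′ b → (s :* Y :+ :- Y′) :+ :- (b :* (s :* Φ :+ :- Φ′))
      := s :* (Y :+ :- (b :* Φ)) :+ :- (Y′ :+ :- (b :* Φ′))) refl s Φ Φ′ Y Y′ b
  headK-linear illegal  s Φ Y Φ′ Y′ b = solve 1 (λ s → 𝟘 := s :* 𝟘 :+ :- 𝟘) refl s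

  headK-scale : ∀ k s Φ Y b → headK k (s * Φ) (s * Y) b ≈ s * headK k Φ Y b
  headK-scale flat s Φ Y b = refl
  headK-scale both s Φ Y b = solve 3 (λ s Φ b → :- (b :* (s :* Φ)) := s :* (:- (b :* Φ))) refl s Φ b
  headK-scale up   s Φ Y b = refl
  headK-scale rise s Φ Y b =
    solve 4 (λ s Φ Y b → s :* Y :+ :- (b :* (s :* Φ)) := s :* (Y :+ :- (b :* Φ))) refl s Φ Y b
  headK-scale illegal  s Φ Y b = sym (zeroʳ s)

  -- The legal letters with third edge empty are exactly the `flat` ones, whose entry is Φ alone.
  -- All other kinds are built from Y and b Φ, each of which has picked up one τ, and for them
  -- `fc τ c` is τ.
  headK-twist : ∀ c s Φ Y b → headK (kind c) (s * Φ) (τ * (s * Y)) (τ * b) ≈ s * (fc τ c * headK (kind c) Φ Y b)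
  headK-twist (ltr false false false false) s Φ Y b = *-congˡ (sym (*-identityˡ _))
  headK-twist (ltr false false false true) s Φ Y b = sym (trans (*-congˡ (zeroʳ _)) (zeroʳ _))
  headK-twist (ltr false false true false) s Φ Y b = sym (trans (*-congˡ (zeroʳ _)) (zeroʳ _))
  headK-twist (ltr false false true true) s Φ Y b = solve 5 (λ s τ Φ Y b → τ :* (s :* Y) :+ :- ((τ :* b) :* (s :* Φ)) := s :* (τ :* (Y :+ :- (b :* Φ)))) refl s τ Φ Y b
  headK-twist (ltr false true false false) s Φ Y b = sym (trans (*-congˡ (zeroʳ _)) (zeroʳ _))
  headK-twist (ltr false true false true) s Φ Y b = *-congˡ (sym (*-identityˡ _))
  headK-twist (ltr false true true false) s Φ Y b = sym (trans (*-congˡ (zeroʳ _)) (zeroʳ _))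
  headK-twist (ltr false true true true) s Φ Y b = sym (trans (*-congˡ (zeroʳ _)) (zeroʳ _))
  headK-twist (ltr true false false false) s Φ Y b = sym (trans (*-congˡ (zeroʳ _)) (zeroʳ _))
  headK-twist (ltr true false false true) s Φ Y b = sym (trans (*-congˡ (zeroʳ _)) (zeroʳ _))
  headK-twist (ltr true false true false) s Φ Y b = solve 3 (λ s τ Y → τ :* (s :* Y) := s :* (τ :* Y)) refl s τ Y
  headK-twist (ltr true false true true) s Φ Y b = sym (trans (*-congˡ (zeroʳ _)) (zeroʳ _))
  headK-twist (ltr true true false false) s Φ Y b = *-congˡ (sym (*-identityˡ _))
  headK-twist (ltr true true false true) s Φ Y b = sym (trans (*-congˡ (zeroʳ _)) (zeroʳ _))
  headK-twist (ltr true true true false) s Φ Y b = sym (trans (*-congˡ (zeroʳ _)) (zeroʳ _))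
  headK-twist (ltr true true true true) s Φ Y b = solve 4 (λ s τ Φ b → :- ((τ :* b) :* (s :* Φ)) := s :* (τ :* (:- (b :* Φ)))) refl s τ Φ b

  headK-zero : ∀ k {Φ Y b} → Φ ≈ 0# → Y ≈ 0# → headK k Φ Y b ≈ 0#
  headK-zero k {Φ} {Y} {b} p q =
    trans (headK-cong k {Φ} {0# * 0#} {Y} {0# * 0#} {b} {b} (trans p (sym (zeroˡ 0#))) (trans q (sym (zeroˡ 0#))) refl)
          (trans (headK-scale k 0# 0# 0# b) (zeroˡ _))

  R-bad : ∀ z r → allOk r ≡ false → R z r ≈ 0#
  R-bad-tail : ∀ z r → allOk r ≡ false → ∀ k →
    headK k (α r * (γ̄ r * R (z * t) r)) ((1# + z * len r) * (δ̄ r * R z r)) (δ̄ r) ≈ 0#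
  R-bad z (c ∷ r) eq with kind c
  ... | illegal = refl
  ... | flat = R-bad-tail z r eq flat
  ... | both = R-bad-tail z r eq both
  ... | up = R-bad-tail z r eq up
  ... | rise = R-bad-tail z r eq rise
  R-bad-tail z r eq k = headK-zero k
    (trans (*-congˡ (trans (*-congˡ (R-bad (z * t) r eq)) (zeroʳ _))) (zeroʳ _))
    (trans (*-congˡ (trans (*-congˡ (R-bad z r eq)) (zeroʳ _))) (zeroʳ _))

  -- An empty letter contributes nothing to α, γ and δ and multiplies `len` by t. As `len` occurs
  -- only next to z, the effect is to replace z by z t.
  R-tail-00 : ∀ z r → R z (r ∷ʳ ltr false false false false) ≈ R (z * t) r
  R-tail-00 z [] = trans (*-identityˡ _) (*-identityˡ _)
  R-tail-00 z (c ∷ r) = headK-cong (kind c)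
    (*-cong (st (fa t) ≡.refl) (*-cong (st (fc τ) ≡.refl) (R-tail-00 (z * t) r)))
    (*-cong (+-congˡ (trans (*-congˡ (stat-∷ʳ _ r _)) (sym (*-assoc z t _))))
            (*-cong (st (fd τ) ≡.refl) (R-tail-00 z r)))
    (st (fd τ) ≡.refl)
    where
    o = ltr false false false false
    st : ∀ f → f o ≡ 1# → stat f (r ∷ʳ o) ≈ stat f r
    st f eq = trans (stat-∷ʳ f r o) (trans (*-congʳ (reflexive eq)) (*-identityˡ _))

  -- Common proof for the three legal letters with d true. The extra τ in every δ̄ is absorbed by
  -- `headK-twist`; the hypothesis on `s` says that `s` compensates the powers of t which the letter
  -- adds to α and γ̄ when z becomes z t.
  R-tail-twist : ∀ a b c (s : Carrier → Carrier) →
    (∀ z → R z (ltr a b c true ∷ []) ≈ s z) → (∀ z → pick a t * (pick c τ * s (z * t)) ≈ s z) →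
    ∀ z r → R z (r ∷ʳ ltr a b c true) ≈ s z * (γ̄ r * R (z * t) r)
  R-tail-twist a b c s base step z [] = trans (base z) (solve 1 (λ s → s := s :* (𝟙 :* 𝟙)) refl _)
  R-tail-twist a b c s base step z (e ∷ r) = begin
    headK (kind e) (α (r ∷ʳ o) * (γ̄ (r ∷ʳ o) * R (z * t) (r ∷ʳ o)))
                   ((1# + z * len (r ∷ʳ o)) * (δ̄ (r ∷ʳ o) * R z (r ∷ʳ o))) (δ̄ (r ∷ʳ o))
      ≈⟨ headK-cong (kind e) eqΦ eqY (stat-∷ʳ _ r o) ⟩
    headK (kind e) (s z * γ̄ r * Φ) (τ * (s z * γ̄ r * Y)) (τ * δ̄ r)
      ≈⟨ headK-twist e (s z * γ̄ r) Φ Y (δ̄ r) ⟩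
    s z * γ̄ r * (fc τ e * headK (kind e) Φ Y (δ̄ r))
      ≈⟨ solve 4 (λ s g f h → (s :* g) :* (f :* h) := s :* ((f :* g) :* h)) refl (s z) (γ̄ r) (fc τ e) _ ⟩
    s z * (fc τ e * γ̄ r * headK (kind e) Φ Y (δ̄ r)) ∎
    where
    o = ltr a b c true
    Φ = α r * (γ̄ r * R (z * t * t) r)
    Y = (1# + z * t * len r) * (δ̄ r * R (z * t) r)
    IH = R-tail-twist a b c s base step
    eqΦ : α (r ∷ʳ o) * (γ̄ (r ∷ʳ o) * R (z * t) (r ∷ʳ o)) ≈ s z * γ̄ r * Φ
    eqΦ = begin
      α (r ∷ʳ o) * (γ̄ (r ∷ʳ o) * R (z * t) (r ∷ʳ o))
        ≈⟨ *-cong (stat-∷ʳ _ r o) (*-cong (stat-∷ʳ _ r o) (IH (z * t) r)) ⟩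
      (pick a t * α r) * ((pick c τ * γ̄ r) * (s (z * t) * (γ̄ r * R (z * t * t) r)))
        ≈⟨ solve 6 (λ p q s A g ψ → (p :* A) :* ((q :* g) :* (s :* (g :* ψ)))
                 := ((p :* (q :* s)) :* g) :* (A :* (g :* ψ))) refl (pick a t) (pick c τ) (s (z * t)) (α r) (γ̄ r) _ ⟩
      pick a t * (pick c τ * s (z * t)) * γ̄ r * Φ
        ≈⟨ *-congʳ (*-congʳ (step z)) ⟩
      s z * γ̄ r * Φ ∎
    eqY : (1# + z * len (r ∷ʳ o)) * (δ̄ (r ∷ʳ o) * R z (r ∷ʳ o)) ≈ τ * (s z * γ̄ r * Y)
    eqY = begin
      (1# + z * len (r ∷ʳ o)) * (δ̄ (r ∷ʳ o) * R z (r ∷ʳ o))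
        ≈⟨ *-cong (+-congˡ (*-congˡ (stat-∷ʳ _ r o))) (*-cong (stat-∷ʳ _ r o) (IH z r)) ⟩
      (1# + z * (t * len r)) * ((τ * δ̄ r) * (s z * (γ̄ r * R (z * t) r)))
        ≈⟨ solve 8 (λ z t τ s l d g ψ → (𝟙 :+ z :* (t :* l)) :* ((τ :* d) :* (s :* (g :* ψ)))
                 := τ :* ((s :* g) :* ((𝟙 :+ (z :* t) :* l) :* (d :* ψ)))) refl z t τ (s z) (len r) (δ̄ r) (γ̄ r) _ ⟩
      τ * (s z * γ̄ r * Y) ∎

  R-tail-01 : ∀ z r → R z (r ∷ʳ ltr false false true true) ≈ z * (γ̄ r * R (z * t) r)
  R-tail-01 = R-tail-twist false false true (λ z → z)
    (λ z → solve 1 (λ z → (𝟙 :+ z :* 𝟙) :* (𝟙 :* 𝟙) :+ :- (𝟙 :* (𝟙 :* (𝟙 :* 𝟙))) := z) refl z)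
    (λ z → trans (solve 3 (λ z t τ → 𝟙 :* (τ :* (z :* t)) := z :* (t :* τ)) refl z t τ)
                 (trans (*-congˡ tτ) (*-identityʳ z)))

  R-tail-11 : ∀ z r → R z (r ∷ʳ ltr true true true true) ≈ - 1# * (γ̄ r * R (z * t) r)
  R-tail-11 = R-tail-twist true true true (λ _ → - 1#)
    (λ z → solve 0 (:- (𝟙 :* (𝟙 :* (𝟙 :* 𝟙))) := :- 𝟙) refl)
    (λ z → trans (sym (*-assoc _ _ _)) (trans (*-congʳ tτ) (*-identityˡ _)))

  R-tail-down : ∀ z r → R z (r ∷ʳ ltr false true false true) ≈ 1# * (γ̄ r * R (z * t) r)
  R-tail-down = R-tail-twist false true false (λ _ → 1#)
    (λ z → solve 0 (𝟙 :* (𝟙 :* 𝟙) := 𝟙) refl)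
    (λ z → solve 0 (𝟙 :* (𝟙 :* 𝟙) := 𝟙) refl)

  -- The letter contributes t to α and τ to γ̄, which cancel. In Φ the factor 1 + z t `len r` comes
  -- from the induction hypothesis at z t, in Y from the prefactor of the longer word; being common
  -- to both, it comes out by `headK-scale`.
  R-tail-up : ∀ z r → R z (r ∷ʳ ltr true false true false) ≈ (1# + z * len r) * R z r
  R-tail-up z [] = solve 1 (λ z → (𝟙 :+ z :* 𝟙) :* (𝟙 :* 𝟙) := (𝟙 :+ z :* 𝟙) :* 𝟙) refl z
  R-tail-up z (c ∷ r) = trans (headK-cong (kind c) eqΦ eqY eqb) (headK-scale (kind c) s Φ Y (δ̄ r))
    where
    o = ltr true false true false
    s = 1# + z * (t * len r)
    Φ = α r * (γ̄ r * R (z * t) r)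
    Y = (1# + z * len r) * (δ̄ r * R z r)
    eqb : δ̄ (r ∷ʳ o) ≈ δ̄ r
    eqb = trans (stat-∷ʳ _ r o) (*-identityˡ _)
    eqΦ : α (r ∷ʳ o) * (γ̄ (r ∷ʳ o) * R (z * t) (r ∷ʳ o)) ≈ s * Φ
    eqΦ = begin
      α (r ∷ʳ o) * (γ̄ (r ∷ʳ o) * R (z * t) (r ∷ʳ o))
        ≈⟨ *-cong (stat-∷ʳ _ r o) (*-cong (stat-∷ʳ _ r o) (R-tail-up (z * t) r)) ⟩
      (t * α r) * ((τ * γ̄ r) * ((1# + z * t * len r) * R (z * t) r))
        ≈⟨ solve 7 (λ z t τ A g l ψ → (t :* A) :* ((τ :* g) :* ((𝟙 :+ (z :* t) :* l) :* ψ))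
                 := (t :* τ) :* ((𝟙 :+ z :* (t :* l)) :* (A :* (g :* ψ)))) refl z t τ (α r) (γ̄ r) (len r) _ ⟩
      (t * τ) * (s * Φ) ≈⟨ trans (*-congʳ tτ) (*-identityˡ _) ⟩
      s * Φ ∎
    eqY : (1# + z * len (r ∷ʳ o)) * (δ̄ (r ∷ʳ o) * R z (r ∷ʳ o)) ≈ s * Y
    eqY = trans (*-cong (+-congˡ (*-congˡ (stat-∷ʳ _ r o))) (*-cong eqb (R-tail-up z r)))
                (solve 4 (λ s l d ψ → s :* (d :* (l :* ψ)) := s :* (l :* (d :* ψ))) refl s (1# + z * len r) (δ̄ r) (R z r))

  -- The entry is a divided difference in z and is stated multiplied by z, which need not be
  -- cancellable. The induction closes because the t which this letter adds to α turns the factor z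
  -- into the z t demanded by the hypothesis for the shifted parameter.
  R-tail-10 : ∀ z r → z * R z (r ∷ʳ ltr true true false false) ≈ (1# + z * len r) * R z r + - R (z * t) r
  R-tail-10 z [] = solve 1 (λ z → z :* (𝟙 :* (𝟙 :* 𝟙)) := (𝟙 :+ z :* 𝟙) :* 𝟙 :+ :- 𝟙) refl z
  R-tail-10 z (c ∷ r) = begin
    z * R z (c ∷ r ∷ʳ o)
      ≈⟨ headK-scale (kind c) z _ _ _ ⟨
    headK (kind c) (z * (α (r ∷ʳ o) * (γ̄ (r ∷ʳ o) * R (z * t) (r ∷ʳ o))))
                   (z * ((1# + z * len (r ∷ʳ o)) * (δ̄ (r ∷ʳ o) * R z (r ∷ʳ o)))) (δ̄ (r ∷ʳ o))
      ≈⟨ headK-cong (kind c) eqΦ eqY eqb ⟩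
    headK (kind c) (s * Φ + - Φ′) (s * Y + - Y′) (δ̄ r)
      ≈⟨ headK-linear (kind c) s Φ Y Φ′ Y′ (δ̄ r) ⟩
    s * R z (c ∷ r) + - R (z * t) (c ∷ r) ∎
    where
    o = ltr true true false false
    s = 1# + z * (t * len r)
    Φ = α r * (γ̄ r * R (z * t) r)
    Y = (1# + z * len r) * (δ̄ r * R z r)
    Φ′ = α r * (γ̄ r * R (z * t * t) r)
    Y′ = (1# + z * t * len r) * (δ̄ r * R (z * t) r)
    eqb : δ̄ (r ∷ʳ o) ≈ δ̄ r
    eqb = trans (stat-∷ʳ _ r o) (*-identityˡ _)
    eqΦ : z * (α (r ∷ʳ o) * (γ̄ (r ∷ʳ o) * R (z * t) (r ∷ʳ o))) ≈ s * Φ + - Φ′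
    eqΦ = begin
      z * (α (r ∷ʳ o) * (γ̄ (r ∷ʳ o) * R (z * t) (r ∷ʳ o)))
        ≈⟨ *-congˡ (*-cong (stat-∷ʳ _ r o) (*-congʳ (trans (stat-∷ʳ _ r o) (*-identityˡ _)))) ⟩
      z * ((t * α r) * (γ̄ r * R (z * t) (r ∷ʳ o)))
        ≈⟨ solve 5 (λ z t A g ψ → z :* ((t :* A) :* (g :* ψ)) := A :* (g :* ((z :* t) :* ψ))) refl z t _ _ _ ⟩
      α r * (γ̄ r * (z * t * R (z * t) (r ∷ʳ o)))
        ≈⟨ *-congˡ (*-congˡ (R-tail-10 (z * t) r)) ⟩
      α r * (γ̄ r * ((1# + z * t * len r) * R (z * t) r + - R (z * t * t) r))
        ≈⟨ solve 7 (λ z t l A g ψ ψ′ → A :* (g :* ((𝟙 :+ (z :* t) :* l) :* ψ :+ :- ψ′))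
                 := (𝟙 :+ z :* (t :* l)) :* (A :* (g :* ψ)) :+ :- (A :* (g :* ψ′))) refl z t (len r) (α r) (γ̄ r) _ _ ⟩
      s * Φ + - Φ′ ∎
    eqY : z * ((1# + z * len (r ∷ʳ o)) * (δ̄ (r ∷ʳ o) * R z (r ∷ʳ o))) ≈ s * Y + - Y′
    eqY = begin
      z * ((1# + z * len (r ∷ʳ o)) * (δ̄ (r ∷ʳ o) * R z (r ∷ʳ o)))
        ≈⟨ *-congˡ (*-cong (+-congˡ (*-congˡ (stat-∷ʳ _ r o))) (*-congʳ eqb)) ⟩
      z * ((1# + z * (t * len r)) * (δ̄ r * R z (r ∷ʳ o)))
        ≈⟨ solve 4 (λ z s d ψ → z :* (s :* (d :* ψ)) := s :* (d :* (z :* ψ))) refl z s _ _ ⟩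
      s * (δ̄ r * (z * R z (r ∷ʳ o)))
        ≈⟨ *-congˡ (*-congˡ (R-tail-10 z r)) ⟩
      s * (δ̄ r * ((1# + z * len r) * R z r + - R (z * t) r))
        ≈⟨ solve 7 (λ z t l d q ψ ψ′ → (𝟙 :+ z :* (t :* l)) :* (d :* (q :* ψ :+ :- ψ′))
                 := (𝟙 :+ z :* (t :* l)) :* (q :* (d :* ψ)) :+ :- ((𝟙 :+ (z :* t) :* l) :* (d :* ψ′)))
                 refl z t (len r) (δ̄ r) (1# + z * len r) _ _ ⟩
      s * Y + - Y′ ∎

-- The one-colour relation for entries of the R-matrix

allOk-++ : ∀ r s → allOk (r ++ s) ≡ allOk r ∧ allOk s
allOk-++ [] s = ≡.refl
allOk-++ (c ∷ r) s = ≡.trans (≡.cong (ok c ∧_) (allOk-++ r s)) (≡.sym (BoolP.∧-assoc (ok c) _ _))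

∧-trueˡ : ∀ {a b} → a ∧ b ≡ true → a ≡ true
∧-trueˡ {true} p = ≡.refl

∧-trueʳ : ∀ {a b} → a ∧ b ≡ true → b ≡ true
∧-trueʳ {true} p = p

module SiteOnLists (K : CommutativeRing 0ℓ 0ℓ) (t τ : CommutativeRing.Carrier K)
               (tτ : CommutativeRing._≈_ K (CommutativeRing._*_ K t τ) (CommutativeRing.1# K)) where
  open CommutativeRing K
  open Relation.Binary.Reasoning.Setoid setoid
  open RingSolver K
  open RMatrix K t τ tτ public

  bits-cong : ∀ {f g : Bool → Carrier} → (∀ b → f b ≈ g b) → bits f ≈ bits g
  bits-cong h = +-cong (h false) (h true)

  balanced : ∀ c → ok c ≡ true → fa t c * fd t c ≈ fb t c * fc t c
  balanced (ltr false false false false) _ = refl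
  balanced (ltr false false false true) ()
  balanced (ltr false false true false) ()
  balanced (ltr false false true true) _ = refl
  balanced (ltr false true false false) ()
  balanced (ltr false true false true) _ = *-comm _ _
  balanced (ltr false true true false) ()
  balanced (ltr false true true true) ()
  balanced (ltr true false false false) ()
  balanced (ltr true false false true) ()
  balanced (ltr true false true false) _ = *-comm _ _
  balanced (ltr true false true true) ()
  balanced (ltr true true false false) _ = refl
  balanced (ltr true true false true) ()
  balanced (ltr true true true false) ()
  balanced (ltr true true true true) _ = refl

  allOk-balanced : ∀ r → allOk r ≡ true → α r * δ r ≈ β r * γ r
  allOk-balanced [] _ = refl
  allOk-balanced (c ∷ r) h = trans (swap _ _ _ _) (trans
    (*-cong (balanced c (∧-trueˡ h)) (allOk-balanced r (∧-trueʳ {ok c} h))) (swap _ _ _ _))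
    where
    swap : ∀ a b c d → (a * b) * (c * d) ≈ (a * c) * (b * d)
    swap = solve 4 (λ a b c d → (a :* b) :* (c :* d) := (a :* c) :* (b :* d)) refl

  cancel : ∀ {a b} → a * b ≈ 1# → ∀ e → (a * b) * e ≈ e
  cancel h e = trans (*-congʳ h) (*-identityˡ e)

  module _ (ω ξ : Carrier) (pre post : List Letter) where
    private
      z = ω * ξ
      r = post ++ pre
      x = α pre
      y = β pre
      x″ = γ pre
      y″ = δ pre
      v = β post
      v″ = δ post
      x̄ = γ̄ pre
      ȳ = δ̄ pre
      v̄ = β̄ post
      w̄ = δ̄ post
      p = α post
      q̄ = γ̄ post
      Ψ = R (z * t) r
      -- Since t is a unit, Ψ can be divided by the powers of t that the tables put back. In terms
      -- of `Ψ₁` and `Θ` all table entries except `X` are polynomials, so the case analysis meets no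
      -- inverses.
      Ψ₀ = x̄ * (w̄ * Ψ)
      Ψ₁ = ȳ * (w̄ * Ψ₀)
      Φ = α r * (γ̄ r * Ψ)
      Y = (1# + z * len r) * (δ̄ r * R z r)
      Θ = v̄ * (Y + - (δ̄ r * Φ))
      X = R z (r ∷ʳ ltr true true false false)

      bad-tail : ∀ c → ok c ≡ false → allOk (r ∷ʳ c) ≡ false
      bad-tail c h = ≡.trans (allOk-++ r _) (≡.trans (≡.cong (λ b → allOk r ∧ b ∧ true) h) (BoolP.∧-zeroʳ _))

    module Balanced (okPre : allOk pre ≡ true) (okPost : allOk post ≡ true) where
      private
        e-pq : p * q̄ ≈ v * w̄
        e-pq = begin
          p * q̄                               ≈⟨ cancel (δδ̄ post) _ ⟨
          (v″ * w̄) * (p * q̄)                 ≈⟨ solve 4 (λ a b c d → (a :* b) :* (c :* d) := (c :* a) :* (b :* d)) refl v″ w̄ p q̄ ⟩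
          (p * v″) * (w̄ * q̄)                 ≈⟨ *-congʳ (allOk-balanced post okPost) ⟩
          (v * γ post) * (w̄ * q̄)             ≈⟨ solve 4 (λ a b c d → (a :* b) :* (c :* d) := (b :* d) :* (a :* c)) refl v (γ post) w̄ q̄ ⟩
          (γ post * q̄) * (v * w̄)             ≈⟨ cancel (γγ̄ post) _ ⟩
          v * w̄                               ∎

        e-xy : x * x̄ ≈ y * ȳ
        e-xy = begin
          x * x̄                   ≈⟨ cancel (δδ̄ pre) _ ⟨
          (y″ * ȳ) * (x * x̄)     ≈⟨ solve 4 (λ a b c d → (a :* b) :* (c :* d) := (c :* a) :* (b :* d)) refl y″ ȳ x x̄ ⟩
          (x * y″) * (ȳ * x̄)     ≈⟨ *-congʳ (allOk-balanced pre okPre) ⟩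
          (y * x″) * (ȳ * x̄)     ≈⟨ solve 4 (λ a b c d → (a :* b) :* (c :* d) := (b :* d) :* (a :* c)) refl y x″ ȳ x̄ ⟩
          (x″ * x̄) * (y * ȳ)     ≈⟨ cancel (γγ̄ pre) _ ⟩
          y * ȳ                   ∎

        e-xy″ : x * (y″ * x̄) ≈ y
        e-xy″ = begin
          x * (y″ * x̄)   ≈⟨ solve 3 (λ a b c → a :* (b :* c) := (a :* c) :* b) refl x y″ x̄ ⟩
          (x * x̄) * y″   ≈⟨ *-congʳ e-xy ⟩
          (y * ȳ) * y″   ≈⟨ solve 3 (λ a b c → (a :* b) :* c := (c :* b) :* a) refl y ȳ y″ ⟩
          (y″ * ȳ) * y   ≈⟨ cancel (δδ̄ pre) y ⟩
          y               ∎

        e-vΨ₁ : v″ * Ψ₁ ≈ ȳ * Ψ₀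
        e-vΨ₁ = trans (solve 4 (λ a b c d → a :* (b :* (c :* d)) := (a :* c) :* (b :* d)) refl v″ ȳ w̄ Ψ₀) (cancel (δδ̄ post) _)

        e-Ψ₀ : y″ * (v″ * Ψ₁) ≈ Ψ₀
        e-Ψ₀ = trans (*-congˡ e-vΨ₁) (trans (sym (*-assoc _ _ _)) (cancel (δδ̄ pre) Ψ₀))

        e-Ψ : x″ * (v″ * Ψ₀) ≈ Ψ
        e-Ψ = trans (solve 5 (λ a b c d e → a :* (b :* (c :* (d :* e))) := (a :* c) :* ((b :* d) :* e)) refl x″ v″ x̄ w̄ Ψ)
                    (trans (cancel (γγ̄ pre) _) (cancel (δδ̄ post) _))

        e-Φ : Φ ≈ x * (v * Ψ₀)
        e-Φ = begin
          α r * (γ̄ r * Ψ)               ≈⟨ *-cong (stat-++ _ post pre) (*-congʳ (stat-++ _ post pre)) ⟩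
          (p * x) * ((q̄ * x̄) * Ψ)       ≈⟨ solve 5 (λ a b c d e → (a :* b) :* ((c :* d) :* e) := (a :* c) :* (b :* (d :* e))) refl p x q̄ x̄ Ψ ⟩
          (p * q̄) * (x * (x̄ * Ψ))       ≈⟨ *-congʳ e-pq ⟩
          (v * w̄) * (x * (x̄ * Ψ))       ≈⟨ solve 5 (λ a b c d e → (a :* b) :* (c :* (d :* e)) := c :* (a :* (d :* (b :* e)))) refl v w̄ x x̄ Ψ ⟩
          x * (v * Ψ₀)                   ∎

        e-δ̄ : δ̄ r ≈ w̄ * ȳ
        e-δ̄ = stat-++ _ post pre

        e-bΦ : δ̄ r * Φ ≈ x * (v * Ψ₁)
        e-bΦ = trans (*-cong e-δ̄ e-Φ)
          (solve 5 (λ a b c d e → (a :* b) :* (c :* (d :* e)) := c :* (d :* (b :* (a :* e)))) refl w̄ ȳ x v Ψ₀)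

        e-vΘ : v * Θ ≈ Y + - (δ̄ r * Φ)
        e-vΘ = trans (sym (*-assoc _ _ _)) (cancel (ββ̄ post) _)

        e-Y : v * (Θ + x * Ψ₁) ≈ Y
        e-Y = begin
          v * (Θ + x * Ψ₁)                        ≈⟨ solve 4 (λ v θ x ψ → v :* (θ :+ x :* ψ) := v :* θ :+ x :* (v :* ψ)) refl v Θ x Ψ₁ ⟩
          v * Θ + x * (v * Ψ₁)                    ≈⟨ +-cong e-vΘ (sym e-bΦ) ⟩
          Y + - (δ̄ r * Φ) + δ̄ r * Φ             ≈⟨ solve 2 (λ a b → (a :+ :- b) :+ b := a) refl Y _ ⟩
          Y                                        ∎

        e-tw : γ̄ r * Ψ * (p * v̄) ≈ Ψ₀
        e-tw = begin
          γ̄ r * Ψ * (p * v̄)                ≈⟨ *-congʳ (*-congʳ (stat-++ _ post pre)) ⟩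
          (q̄ * x̄) * Ψ * (p * v̄)            ≈⟨ solve 5 (λ a b c d e → ((a :* b) :* c) :* (d :* e) := (d :* a) :* (b :* (c :* e))) refl q̄ x̄ Ψ p v̄ ⟩
          (p * q̄) * (x̄ * (Ψ * v̄))          ≈⟨ *-congʳ e-pq ⟩
          (v * w̄) * (x̄ * (Ψ * v̄))          ≈⟨ solve 5 (λ a b c d e → (a :* b) :* (c :* (d :* e)) := (a :* e) :* (c :* (b :* d))) refl v w̄ x̄ Ψ v̄ ⟩
          (v * v̄) * Ψ₀                       ≈⟨ cancel (ββ̄ post) _ ⟩
          Ψ₀                                  ∎

        e-td : γ̄ r * Ψ * p ≈ v * Ψ₀
        e-td = begin
          γ̄ r * Ψ * p                        ≈⟨ cancel (ββ̄ post) _ ⟨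
          (v * v̄) * (γ̄ r * Ψ * p)           ≈⟨ solve 4 (λ a b c d → (a :* b) :* (c :* d) := a :* (c :* (d :* b))) refl v v̄ _ p ⟩
          v * (γ̄ r * Ψ * (p * v̄))           ≈⟨ *-congˡ e-tw ⟩
          v * Ψ₀                              ∎

      open Tables x y x″ y″ v v″ Ψ₁ Θ ω ξ X

      eqX : z * X ≈ y″ * (v″ * (v * Θ + x * (v * Ψ₁) + - (x″ * (v″ * Ψ₁))))
      eqX = begin
        z * X                                             ≈⟨ R-tail-10 z r ⟩
        (1# + z * len r) * R z r + - Ψ                    ≈⟨ +-cong e1 (-‿cong (sym e-Ψ)) ⟩
        y″ * (v″ * Y) + - (x″ * (v″ * Ψ₀))                ≈⟨ +-cong (*-congˡ (*-congˡ (sym e-Y))) (-‿cong (*-congˡ (*-congˡ (sym e-Ψ₀)))) ⟩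
        y″ * (v″ * (v * (Θ + x * Ψ₁))) + - (x″ * (v″ * (y″ * (v″ * Ψ₁))))
          ≈⟨ solve 7 (λ y w v θ x ψ u → y :* (w :* (v :* (θ :+ x :* ψ))) :+ :- (u :* (w :* (y :* (w :* ψ))))
               := y :* (w :* (v :* θ :+ x :* (v :* ψ) :+ :- (u :* (w :* ψ))))) refl y″ v″ v Θ x Ψ₁ x″ ⟩
        y″ * (v″ * (v * Θ + x * (v * Ψ₁) + - (x″ * (v″ * Ψ₁)))) ∎
        where
        e1 : (1# + z * len r) * R z r ≈ y″ * (v″ * Y)
        e1 = begin
          (1# + z * len r) * R z r                            ≈⟨ trans (cancel (δδ̄ pre) _) (cancel (δδ̄ post) _) ⟨
          (y″ * ȳ) * ((v″ * w̄) * ((1# + z * len r) * R z r)) ≈⟨ solve 6 (λ a b c d l ψ → (a :* b) :* ((c :* d) :* (l :* ψ)) := a :* (c :* (l :* ((d :* b) :* ψ)))) refl y″ ȳ v″ w̄ _ _ ⟩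
          y″ * (v″ * ((1# + z * len r) * ((w̄ * ȳ) * R z r))) ≈⟨ *-congˡ (*-congˡ (*-congˡ (*-congʳ e-δ̄))) ⟨
          y″ * (v″ * Y)                                       ∎

      -- The factor on the left is what a colour with edges a, b contributes to `gauge pre`. Balance
      -- of the legal words `pre` and `post` turns the inverse powers of t in the recursion into the
      -- monomials of the table.
      headEq : ∀ a b c d → R z (ltr a b c d ∷ r) * (pick a y″ * pick b x̄) ≈ headT a b c d
      headEq false false false false = trans (*-congˡ (*-identityˡ _)) (trans (*-identityʳ _) (trans e-Φ (*-congˡ (*-congˡ (sym e-Ψ₀)))))
      headEq false false false true = zeroˡ _
      headEq false false true false = zeroˡ _
      headEq false false true true = trans (*-congˡ (*-identityˡ _)) (trans (*-identityʳ _) (sym e-vΘ))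
      headEq false true false false = zeroˡ _
      headEq false true false true = begin
        Φ * (1# * x̄)                   ≈⟨ *-cong e-Φ (*-identityˡ _) ⟩
        x * (v * Ψ₀) * x̄               ≈⟨ solve 4 (λ x v ψ g → (x :* (v :* ψ)) :* g := (x :* g) :* (v :* ψ)) refl x v Ψ₀ x̄ ⟩
        x * x̄ * (v * Ψ₀)               ≈⟨ *-congʳ e-xy ⟩
        y * ȳ * (v * Ψ₀)               ≈⟨ solve 4 (λ y g v ψ → (y :* g) :* (v :* ψ) := y :* (v :* (g :* ψ))) refl y ȳ v Ψ₀ ⟩
        y * (v * (ȳ * Ψ₀))             ≈⟨ *-congˡ (*-congˡ e-vΨ₁) ⟨
        y * (v * (v″ * Ψ₁))             ∎
      headEq false true true false = zeroˡ _
      headEq false true true true = zeroˡ _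
      headEq true false false false = zeroˡ _
      headEq true false false true = zeroˡ _
      headEq true false true false = begin
        Y * (y″ * 1#)                   ≈⟨ solve 2 (λ a b → a :* (b :* 𝟙) := b :* a) refl Y y″ ⟩
        y″ * Y                          ≈⟨ *-congˡ e-Y ⟨
        y″ * (v * (Θ + x * Ψ₁))         ∎
      headEq true false true true = zeroˡ _
      headEq true true false false = begin
        Φ * (y″ * x̄)                   ≈⟨ *-congʳ e-Φ ⟩
        x * (v * Ψ₀) * (y″ * x̄)        ≈⟨ solve 4 (λ x v ψ g → (x :* (v :* ψ)) :* g := (x :* g) :* (v :* ψ)) refl x v Ψ₀ _ ⟩
        x * (y″ * x̄) * (v * Ψ₀)        ≈⟨ *-cong e-xy″ (*-congˡ (sym e-Ψ₀)) ⟩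
        y * (v * (y″ * (v″ * Ψ₁)))      ∎
      headEq true true false true = zeroˡ _
      headEq true true true false = zeroˡ _
      headEq true true true true = begin
        - (δ̄ r * Φ) * (y″ * x̄)         ≈⟨ *-congʳ (-‿cong e-bΦ) ⟩
        - (x * (v * Ψ₁)) * (y″ * x̄)    ≈⟨ solve 4 (λ x v ψ g → (:- (x :* (v :* ψ))) :* g := :- ((x :* g) :* (v :* ψ))) refl x v Ψ₁ _ ⟩
        - (x * (y″ * x̄) * (v * Ψ₁))    ≈⟨ -‿cong (*-congʳ e-xy″) ⟩
        - (y * (v * Ψ₁))               ∎

      -- The factor on the left is what appending the letter to `pre` adds to the gauge factor of
      -- the remaining colours, whose edges are recorded in `post`; compare `gauge-∷ʳ`.
      tailEq : ∀ a b c d → R z (r ∷ʳ ltr a b c d) * (pick d p * pick c v̄) ≈ tailT a b c d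
      tailEq false false false false = begin
        R z (r ∷ʳ ltr false false false false) * (1# * 1#)   ≈⟨ *-cong (R-tail-00 z r) (*-identityˡ _) ⟩
        Ψ * 1#                           ≈⟨ *-identityʳ _ ⟩
        Ψ                                ≈⟨ e-Ψ ⟨
        x″ * (v″ * Ψ₀)                   ≈⟨ *-congˡ (*-congˡ e-Ψ₀) ⟨
        x″ * (v″ * (y″ * (v″ * Ψ₁)))     ∎
      tailEq false false false true = trans (*-congʳ (R-bad z (r ∷ʳ (ltr false false false true)) (bad-tail (ltr false false false true) ≡.refl))) (zeroˡ _)
      tailEq false false true false = trans (*-congʳ (R-bad z (r ∷ʳ (ltr false false true false)) (bad-tail (ltr false false true false) ≡.refl))) (zeroˡ _)
      tailEq false false true true = begin
        R z (r ∷ʳ ltr false false true true) * (p * v̄)  ≈⟨ *-congʳ (R-tail-01 z r) ⟩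
        z * (γ̄ r * Ψ) * (p * v̄)        ≈⟨ *-assoc _ _ _ ⟩
        z * (γ̄ r * Ψ * (p * v̄))        ≈⟨ *-congˡ (trans e-tw (sym e-Ψ₀)) ⟩
        z * (y″ * (v″ * Ψ₁))            ∎
      tailEq false true false false = trans (*-congʳ (R-bad z (r ∷ʳ (ltr false true false false)) (bad-tail (ltr false true false false) ≡.refl))) (zeroˡ _)
      tailEq false true false true = begin
        R z (r ∷ʳ ltr false true false true) * (p * 1#)  ≈⟨ *-congʳ (R-tail-down z r) ⟩
        1# * (γ̄ r * Ψ) * (p * 1#)       ≈⟨ solve 2 (λ a b → (𝟙 :* a) :* (b :* 𝟙) := a :* b) refl _ _ ⟩
        γ̄ r * Ψ * p                     ≈⟨ e-td ⟩
        v * Ψ₀                           ≈⟨ *-congˡ e-Ψ₀ ⟨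
        v * (y″ * (v″ * Ψ₁))            ∎
      tailEq false true true false = trans (*-congʳ (R-bad z (r ∷ʳ (ltr false true true false)) (bad-tail (ltr false true true false) ≡.refl))) (zeroˡ _)
      tailEq false true true true = trans (*-congʳ (R-bad z (r ∷ʳ (ltr false true true true)) (bad-tail (ltr false true true true) ≡.refl))) (zeroˡ _)
      tailEq true false false false = trans (*-congʳ (R-bad z (r ∷ʳ (ltr true false false false)) (bad-tail (ltr true false false false) ≡.refl))) (zeroˡ _)
      tailEq true false false true = trans (*-congʳ (R-bad z (r ∷ʳ (ltr true false false true)) (bad-tail (ltr true false false true) ≡.refl))) (zeroˡ _)
      tailEq true false true false = begin
        R z (r ∷ʳ ltr true false true false) * (1# * v̄)     ≈⟨ *-cong (R-tail-up z r) (*-identityˡ _) ⟩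
        (1# + z * len r) * R z r * v̄                         ≈⟨ trans (cancel (δδ̄ pre) _) (cancel (δδ̄ post) _) ⟨
        (y″ * ȳ) * ((v″ * w̄) * ((1# + z * len r) * R z r * v̄))
          ≈⟨ solve 7 (λ a b c d l ψ e → (a :* b) :* ((c :* d) :* ((l :* ψ) :* e)) := a :* (c :* (e :* (l :* ((d :* b) :* ψ))))) refl y″ ȳ v″ w̄ _ _ v̄ ⟩
        y″ * (v″ * (v̄ * ((1# + z * len r) * ((w̄ * ȳ) * R z r))))
          ≈⟨ *-congˡ (*-congˡ (*-congˡ (trans (*-congˡ (*-congʳ (sym e-δ̄))) (sym e-Y)))) ⟩
        y″ * (v″ * (v̄ * (v * (Θ + x * Ψ₁))))
          ≈⟨ *-congˡ (*-congˡ (trans (sym (*-assoc _ _ _)) (trans (*-congʳ (*-comm _ _)) (cancel (ββ̄ post) _)))) ⟩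
        y″ * (v″ * (Θ + x * Ψ₁))        ∎
      tailEq true false true true = trans (*-congʳ (R-bad z (r ∷ʳ (ltr true false true true)) (bad-tail (ltr true false true true) ≡.refl))) (zeroˡ _)
      tailEq true true false false = trans (*-congˡ (*-identityˡ _)) (*-identityʳ _)
      tailEq true true false true = trans (*-congʳ (R-bad z (r ∷ʳ (ltr true true false true)) (bad-tail (ltr true true false true) ≡.refl))) (zeroˡ _)
      tailEq true true true false = trans (*-congʳ (R-bad z (r ∷ʳ (ltr true true true false)) (bad-tail (ltr true true true false) ≡.refl))) (zeroˡ _)
      tailEq true true true true = begin
        R z (r ∷ʳ ltr true true true true) * (p * v̄)    ≈⟨ *-congʳ (R-tail-11 z r) ⟩
        - 1# * (γ̄ r * Ψ) * (p * v̄)     ≈⟨ solve 2 (λ a b → (:- 𝟙 :* a) :* b := :- (a :* b)) refl _ _ ⟩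
        - (γ̄ r * Ψ * (p * v̄))          ≈⟨ -‿cong (trans e-tw (sym e-Ψ₀)) ⟩
        - (y″ * (v″ * Ψ₁))              ∎

    private
      wL wR eL eR : (i k a b c d a′ b′ : Bool) → Carrier
      wL i k a b c d a′ b′ = bits λ m → s1 ω y v i b m b′ * p1 ξ x m a k a′
      wR i k a b c d a′ b′ = bits λ m → p1 ξ x″ i a′ m c * s1 ω y″ v″ m b′ k d
      eL i k a b c d a′ b′ = R z (r ∷ʳ ltr a′ b′ c d) * (pick d p * pick c v̄)
      eR i k a b c d a′ b′ = R z (ltr a b a′ b′ ∷ r) * (pick a y″ * pick b x̄)

    colL colR : (i k a b c d : Bool) → Carrier
    colL i k a b c d = bits λ a′ → bits λ b′ → wL i k a b c d a′ b′ * eL i k a b c d a′ b′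
    colR i k a b c d = bits λ a′ → bits λ b′ → eR i k a b c d a′ b′ * wR i k a b c d a′ b′

    private
      bits²-cong : ∀ (f g : Bool → Bool → Carrier) → (∀ a b → f a b ≈ g a b) →
                   (bits λ a → bits λ b → f a b) ≈ (bits λ a → bits λ b → g a b)
      bits²-cong f g h = bits-cong {λ a → bits (f a)} {λ a → bits (g a)} λ a → bits-cong {f a} {g a} (h a)

      bits²-zero : ∀ (f : Bool → Bool → Carrier) → (∀ a b → f a b ≈ 0#) → (bits λ a → bits λ b → f a b) ≈ 0#
      bits²-zero f h = trans (bits²-cong f (λ _ _ → 0#) h) (solve 0 ((𝟘 :+ 𝟘) :+ (𝟘 :+ 𝟘) := 𝟘) refl)

      -- The tables rely on balance, which is available for legal words only. For every other word
      -- each term on both sides contains a vanishing entry of the R-matrix.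
      vanish : allOk r ≡ false → ∀ i k a b c d → colL i k a b c d ≈ colR i k a b c d
      vanish h i k a b c d = trans
        (bits²-zero (λ a′ b′ → wL i k a b c d a′ b′ * eL i k a b c d a′ b′) λ a′ b′ →
          trans (*-congˡ (trans (*-congʳ
          (R-bad z (r ∷ʳ ltr a′ b′ c d) (≡.trans (allOk-++ r _) (≡.cong (_∧ _) h)))) (zeroˡ _))) (zeroʳ _))
        (sym (bits²-zero (λ a′ b′ → eR i k a b c d a′ b′ * wR i k a b c d a′ b′) λ a′ b′ →
          trans (*-congʳ (trans (*-congʳ
          (R-bad z (ltr a b a′ b′ ∷ r) (≡.trans (≡.cong (ok (ltr a b a′ b′) ∧_) h) (BoolP.∧-zeroʳ _)))) (zeroˡ _))) (zeroˡ _)))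

    site-list : ∀ i k a b c d → colL i k a b c d ≈ colR i k a b c d
    site-list i k a b c d with allOk pre in okPre | allOk post in okPost
    ... | true | true = trans
      (bits²-cong (λ a′ b′ → wL i k a b c d a′ b′ * eL i k a b c d a′ b′)
                  (λ a′ b′ → wL i k a b c d a′ b′ * tailT a′ b′ c d)
                  λ a′ b′ → *-congˡ {wL i k a b c d a′ b′} (tailEq a′ b′ c d))
      (trans (site x y x″ y″ v v″ Ψ₁ Θ ω ξ X eqX i k a b c d)
             (bits²-cong (λ a′ b′ → headT a b a′ b′ * wR i k a b c d a′ b′)
                         (λ a′ b′ → eR i k a b c d a′ b′ * wR i k a b c d a′ b′)
                         λ a′ b′ → *-congʳ {wR i k a b c d a′ b′} (sym (headEq a b a′ b′))))
      where
      open Balanced okPre okPost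
      open Tables x y x″ y″ v v″ Ψ₁ Θ ω ξ X
    ... | false | _ = vanish (≡.trans (allOk-++ post pre) (≡.trans (≡.cong (allOk post ∧_) okPre) (BoolP.∧-zeroʳ _))) i k a b c d
    ... | true | false = vanish (≡.trans (allOk-++ post pre) (≡.cong (_∧ allOk pre) okPost)) i k a b c d

-- Rows of vertices

∅ full : ∀ {k} → Label k
∅ = replicate _ false
full = replicate _ true

empty? : ∀ {k} → Label k → Bool
empty? = Vec.foldr _ (λ b r → not b ∧ r) true

zipL : ∀ {n} → (A B C D : Label n) → List Letter
zipL [] [] [] [] = []
zipL (a ∷ A) (b ∷ B) (c ∷ C) (d ∷ D) = ltr a b c d ∷ zipL A B C D

module Rows (K : CommutativeRing 0ℓ 0ℓ) where
  open CommutativeRing K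
  open Relation.Binary.Reasoning.Setoid setoid
  open RingSolver K
  open Sums K public

  infixr 8 _^_
  _^_ : Carrier → ℕ → Carrier
  x ^ zero = 1#
  x ^ suc n = x * x ^ n

  ^-+ : ∀ x m n → x ^ (m ℕ.+ n) ≈ x ^ m * x ^ n
  ^-+ x zero n = sym (*-identityˡ _)
  ^-+ x (suc m) n = trans (*-congˡ (^-+ x m n)) (sym (*-assoc _ _ _))

  Vertex : ℕ → Set
  Vertex k = (I J K L : Label k) → Carrier

  row : ∀ {k} → Vertex k → Label k → List (Label k) → List (Label k) → Carrier
  row V J [] [] = if empty? J then 1# else 0#
  row {k} V J (I ∷ Is) (K ∷ Ks) = ∑[ L ∈ allLabels k ] (V I J K L * row V L Is Ks)
  row V J _ _ = 0#

  row-cong : ∀ {k} {V V′ : Vertex k} → (∀ I J K L → V I J K L ≈ V′ I J K L) →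
             ∀ J Is Ks → row V J Is Ks ≈ row V′ J Is Ks
  row-cong h J [] [] = refl
  row-cong h J [] (_ ∷ _) = refl
  row-cong h J (_ ∷ _) [] = refl
  row-cong {k} h J (I ∷ Is) (K ∷ Ks) = ∑-cong (allLabels k) λ L → *-cong (h I J K L) (row-cong h L Is Ks)

  ∑-∅ : ∀ k (f : Label k → Carrier) → ∑[ L ∈ allLabels k ] (f L * (if empty? L then 1# else 0#)) ≈ f ∅
  ∑-∅ zero f = trans (+-identityʳ _) (*-identityʳ _)
  ∑-∅ (suc k) f = begin
    ∑[ L ∈ allLabels (suc k) ] (f L * (if empty? L then 1# else 0#))
      ≈⟨ ∑-labels k _ ⟩
    ∑[ L ∈ allLabels k ] (f (false ∷ L) * (if empty? L then 1# else 0#) + f (true ∷ L) * 0#)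
      ≈⟨ ∑-cong (allLabels k) (λ L → trans (+-congˡ (zeroʳ _)) (+-identityʳ _)) ⟩
    ∑[ L ∈ allLabels k ] (f (false ∷ L) * (if empty? L then 1# else 0#))
      ≈⟨ ∑-∅ k _ ⟩
    f ∅ ∎

  -- Two consecutive rows, V₁ below V₂, with left edges J₁ and J₂.
  two : ∀ {k} → Vertex k → Vertex k → Label k → Label k → List (Label k) → List (Label k) → Carrier
  two {k} V₁ V₂ J₁ J₂ Is Ks = ∑[ s ∈ allRowStates k (length Is) ] (row V₁ J₁ Is s * row V₂ J₂ s Ks)

  column : ∀ {k} → Vertex k → Vertex k → (I K J₁ J₂ L₁ L₂ : Label k) → Carrier
  column {k} V₁ V₂ I K J₁ J₂ L₁ L₂ = ∑[ M ∈ allLabels k ] (V₁ I J₁ M L₁ * V₂ M J₂ K L₂)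

  two-[] : ∀ {k} (V₁ V₂ : Vertex k) J₁ J₂ →
           two V₁ V₂ J₁ J₂ [] [] ≈ (if empty? J₁ then 1# else 0#) * (if empty? J₂ then 1# else 0#)
  two-[] V₁ V₂ J₁ J₂ = +-identityʳ _

  two-∷ : ∀ {k} (V₁ V₂ : Vertex k) J₁ J₂ I K Is Ks → two V₁ V₂ J₁ J₂ (I ∷ Is) (K ∷ Ks)
    ≈ ∑[ L₁ ∈ allLabels k ] ∑[ L₂ ∈ allLabels k ] (column V₁ V₂ I K J₁ J₂ L₁ L₂ * two V₁ V₂ L₁ L₂ Is Ks)
  two-∷ {k} V₁ V₂ J₁ J₂ I K Is Ks = begin
    two V₁ V₂ J₁ J₂ (I ∷ Is) (K ∷ Ks)
      ≈⟨ ∑-states k (length Is) _ ⟩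
    ∑[ M ∈ ls ] ∑[ s ∈ st ] ((∑[ L₁ ∈ ls ] (V₁ I J₁ M L₁ * row V₁ L₁ Is s)) * (∑[ L₂ ∈ ls ] (V₂ M J₂ K L₂ * row V₂ L₂ s Ks)))
      ≈⟨ ∑-cong ls (λ M → ∑-cong st (λ s → expand M s)) ⟩
    ∑[ M ∈ ls ] ∑[ s ∈ st ] ∑[ L₁ ∈ ls ] ∑[ L₂ ∈ ls ] X M s L₁ L₂
      ≈⟨ ∑-cong ls (λ M → trans (∑-swap st ls _) (∑-cong ls λ L₁ → ∑-swap st ls _)) ⟩
    ∑[ M ∈ ls ] ∑[ L₁ ∈ ls ] ∑[ L₂ ∈ ls ] ∑[ s ∈ st ] X M s L₁ L₂
      ≈⟨ trans (∑-swap ls ls _) (∑-cong ls λ L₁ → ∑-swap ls ls _) ⟩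
    ∑[ L₁ ∈ ls ] ∑[ L₂ ∈ ls ] ∑[ M ∈ ls ] ∑[ s ∈ st ] X M s L₁ L₂
      ≈⟨ ∑-cong ls (λ L₁ → ∑-cong ls λ L₂ → trans
           (∑-cong ls λ M → sym (*-∑ st _ _)) (sym (∑-* ls _ _))) ⟩
    ∑[ L₁ ∈ ls ] ∑[ L₂ ∈ ls ] (column V₁ V₂ I K J₁ J₂ L₁ L₂ * two V₁ V₂ L₁ L₂ Is Ks) ∎
    where
    ls = allLabels k
    st = allRowStates k (length Is)
    X : Label k → List (Label k) → Label k → Label k → Carrier
    X M s L₁ L₂ = (V₁ I J₁ M L₁ * V₂ M J₂ K L₂) * (row V₁ L₁ Is s * row V₂ L₂ s Ks)
    expand : ∀ M s → (∑[ L₁ ∈ ls ] (V₁ I J₁ M L₁ * row V₁ L₁ Is s)) * (∑[ L₂ ∈ ls ] (V₂ M J₂ K L₂ * row V₂ L₂ s Ks))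
             ≈ ∑[ L₁ ∈ ls ] ∑[ L₂ ∈ ls ] X M s L₁ L₂
    expand M s = trans (∑-* ls _ _) (∑-cong ls λ L₁ → trans (*-∑ ls _ _) (∑-cong ls λ L₂ →
      solve 4 (λ a b c d → (a :* b) :* (c :* d) := (a :* c) :* (b :* d)) refl _ _ _ _))

  ∑² : ∀ n → (Label n → Label n → Carrier) → Carrier
  ∑² n f = ∑[ A ∈ allLabels n ] ∑[ B ∈ allLabels n ] f A B

  ∑²-cong : ∀ n {f g : Label n → Label n → Carrier} → (∀ A B → f A B ≈ g A B) → ∑² n f ≈ ∑² n g
  ∑²-cong n h = ∑-cong (allLabels n) λ A → ∑-cong (allLabels n) (h A)

  *-∑² : ∀ n c f → c * ∑² n f ≈ ∑² n (λ A B → c * f A B)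
  *-∑² n c f = trans (*-∑ (allLabels n) c _) (∑-cong (allLabels n) λ A → *-∑ (allLabels n) c _)

  ∑²-swap : ∀ n m (f : Label n → Label n → Label m → Label m → Carrier) →
            ∑² n (λ A B → ∑² m (f A B)) ≈ ∑² m (λ C D → ∑² n (λ A B → f A B C D))
  ∑²-swap n m f = begin
    (∑[ A ∈ ln ] ∑[ B ∈ ln ] ∑[ C ∈ lm ] ∑[ D ∈ lm ] f A B C D)
      ≈⟨ ∑-cong ln (λ A → trans (∑-swap ln lm _) (∑-cong lm λ C → ∑-swap ln lm _)) ⟩
    (∑[ A ∈ ln ] ∑[ C ∈ lm ] ∑[ D ∈ lm ] ∑[ B ∈ ln ] f A B C D)
      ≈⟨ trans (∑-swap ln lm _) (∑-cong lm λ C → ∑-swap ln lm _) ⟩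
    (∑[ C ∈ lm ] ∑[ D ∈ lm ] ∑[ A ∈ ln ] ∑[ B ∈ ln ] f A B C D) ∎
    where
    ln = allLabels n
    lm = allLabels m

  ∑²-+ : ∀ n f g → ∑² n (λ A B → f A B + g A B) ≈ ∑² n f + ∑² n g
  ∑²-+ n f g = trans (∑-cong (allLabels n) λ A → ∑-+ (allLabels n) _ _) (∑-+ (allLabels n) _ _)

  ∑²-flip : ∀ n f → ∑² n f ≈ ∑² n (λ A B → f B A)
  ∑²-flip n f = ∑-swap (allLabels n) (allLabels n) f

  ∑²-∷ : ∀ n (f : Label (suc n) → Label (suc n) → Carrier) →
         ∑² (suc n) f ≈ bit λ a → bit λ b → ∑² n (λ A B → f (a ∷ A) (b ∷ B))
  ∑²-∷ n f = trans (∑-labels′ n _) (+-cong (h false) (h true))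
    where
    h : ∀ a → ∑[ A ∈ allLabels n ] ∑ (allLabels (suc n)) (f (a ∷ A)) ≈ bit λ b → ∑² n (λ A B → f (a ∷ A) (b ∷ B))
    h a = trans (∑-cong (allLabels n) λ A → ∑-labels′ n (f (a ∷ A)))
                (∑-bit (allLabels n) λ A b → ∑[ B ∈ allLabels n ] f (a ∷ A) (b ∷ B))

  ∑²-bit² : ∀ n (f : Label n → Label n → Bool → Bool → Carrier) →
    ∑² n (λ A B → bit λ a → bit λ b → f A B a b) ≈ bit λ a → bit λ b → ∑² n λ A B → f A B a b
  ∑²-bit² n f = trans (∑²-+ n _ _) (+-cong (∑²-+ n _ _) (∑²-+ n _ _))

  bit²-* : ∀ (f : Bool → Bool → Carrier) c → (bit λ a → bit λ b → f a b) * c ≈ bit λ a → bit λ b → f a b * c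
  bit²-* f c = trans (distribʳ _ _ _) (+-cong (distribʳ _ _ _) (distribʳ _ _ _))

  *-bit² : ∀ (f : Bool → Bool → Carrier) c → c * (bit λ a → bit λ b → f a b) ≈ bit λ a → bit λ b → c * f a b
  *-bit² f c = trans (distribˡ _ _ _) (+-cong (distribˡ _ _ _) (distribˡ _ _ _))

  bit²-cong : ∀ (f g : Bool → Bool → Carrier) → (∀ a b → f a b ≈ g a b) →
              (bit λ a → bit λ b → f a b) ≈ (bit λ a → bit λ b → g a b)
  bit²-cong f g h = +-cong (+-cong (h _ _) (h _ _)) (+-cong (h _ _) (h _ _))

  column-split : ∀ n (f₁ f₂ : Bool → Carrier) (F₁ F₂ : Label n → Carrier) (H₁ H₂ : Label (suc n) → Carrier) →
    (∀ m M → H₁ (m ∷ M) ≈ f₁ m * F₁ M) → (∀ m M → H₂ (m ∷ M) ≈ f₂ m * F₂ M) →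
    ∑[ M ∈ allLabels (suc n) ] (H₁ M * H₂ M) ≈ bit (λ m → f₁ m * f₂ m) * (∑[ M ∈ allLabels n ] (F₁ M * F₂ M))
  column-split n f₁ f₂ F₁ F₂ H₁ H₂ h₁ h₂ = begin
    ∑[ M ∈ allLabels (suc n) ] (H₁ M * H₂ M)
      ≈⟨ ∑-labels n _ ⟩
    ∑[ M ∈ allLabels n ] (H₁ (false ∷ M) * H₂ (false ∷ M) + H₁ (true ∷ M) * H₂ (true ∷ M))
      ≈⟨ ∑-cong (allLabels n) (λ M → trans
           (+-cong (*-cong (h₁ false M) (h₂ false M)) (*-cong (h₁ true M) (h₂ true M)))
           (solve 6 (λ a b c d p q → (a :* p) :* (b :* q) :+ (c :* p) :* (d :* q) := (a :* b :+ c :* d) :* (p :* q))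
             refl _ _ _ _ _ _)) ⟩
    ∑[ M ∈ allLabels n ] (bit (λ m → f₁ m * f₂ m) * (F₁ M * F₂ M))
      ≈⟨ *-∑ (allLabels n) _ _ ⟨
    bit (λ m → f₁ m * f₂ m) * (∑[ M ∈ allLabels n ] (F₁ M * F₂ M)) ∎

module VertexWeights (K : CommutativeRing 0ℓ 0ℓ) (t : CommutativeRing.Carrier K) where
  open CommutativeRing K
  open Rows K
  open SiteWeights _+_ _*_ -_ 0# 1#

  ws : ∀ {n} → Carrier → Label n → Carrier
  ws s [] = 1#
  ws s (b ∷ B) = pick b s * ws s B

  -- White, purple and dual white weights of all colours; the power g of t
  -- collects the contribution of the colours already passed.
  whiteV purpleV dualV : ∀ {n} → (ξ g : Carrier) → Vertex n
  whiteV ξ g [] [] [] [] = 1#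
  whiteV ξ g (i ∷ I) (j ∷ J) (k ∷ K) (l ∷ L) = w1 ξ g i j k l * whiteV ξ (pick l t * g) I J K L
  purpleV ξ g [] [] [] [] = 1#
  purpleV ξ g (i ∷ I) (j ∷ J) (k ∷ K) (l ∷ L) = p1 ξ g i j k l * purpleV ξ (pick l t * g) I J K L
  dualV ω g [] [] [] [] = 1#
  dualV ω g (i ∷ I) (j ∷ J) (k ∷ K) (l ∷ L) = s1 ω g (ws t J) i j k l * dualV ω (pick l t * g) I J K L

  guard-cong : ∀ b {x y} → x ≈ y → guard b x ≈ guard b y
  guard-cong false h = refl
  guard-cong true h = h

  pick-cong : ∀ b {x y} → x ≈ y → pick b x ≈ pick b y
  pick-cong false h = refl
  pick-cong true h = h

  w1-cong : ∀ {ξ ξ′ g g′} → ξ ≈ ξ′ → g ≈ g′ → ∀ i j k l → w1 ξ g i j k l ≈ w1 ξ′ g′ i j k l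
  w1-cong p q i j k l = guard-cong (okW i j k l) (*-cong (pick-cong l p) (pick-cong (i ∨ j) q))

  p1-cong : ∀ {ξ ξ′ g g′} → ξ ≈ ξ′ → g ≈ g′ → ∀ i j k l → p1 ξ g i j k l ≈ p1 ξ′ g′ i j k l
  p1-cong p q i j k l = guard-cong (okP i j k l) (*-cong (pick-cong l p) (pick-cong (k ∧ not j) q))

  s1-cong : ∀ {ξ g g′ h h′} → g ≈ g′ → h ≈ h′ → ∀ i j k l → s1 ξ g h i j k l ≈ s1 ξ g′ h′ i j k l
  s1-cong p q i j k l = guard-cong (okW k j i l) (*-congˡ (*-cong (pick-cong j p) (pick-cong i q)))

  whiteV-cong : ∀ {n ξ ξ′ g g′} → ξ ≈ ξ′ → g ≈ g′ → ∀ (I J K L : Label n) → whiteV ξ g I J K L ≈ whiteV ξ′ g′ I J K L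
  whiteV-cong p q [] [] [] [] = refl
  whiteV-cong p q (i ∷ I) (j ∷ J) (k ∷ K) (l ∷ L) = *-cong (w1-cong p q i j k l) (whiteV-cong p (*-congˡ q) I J K L)

  purpleV-cong : ∀ {n ξ ξ′ g g′} → ξ ≈ ξ′ → g ≈ g′ → ∀ (I J K L : Label n) → purpleV ξ g I J K L ≈ purpleV ξ′ g′ I J K L
  purpleV-cong p q [] [] [] [] = refl
  purpleV-cong p q (i ∷ I) (j ∷ J) (k ∷ K) (l ∷ L) = *-cong (p1-cong p q i j k l) (purpleV-cong p (*-congˡ q) I J K L)

  dualV-cong : ∀ {n ω g g′} → g ≈ g′ → ∀ (I J K L : Label n) → dualV ω g I J K L ≈ dualV ω g′ I J K L
  dualV-cong q [] [] [] [] = refl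
  dualV-cong q (i ∷ I) (j ∷ J) (k ∷ K) (l ∷ L) = *-cong (s1-cong q refl i j k l) (dualV-cong (*-congˡ q) I J K L)

-- The column relation for all colours

module Exchange (K : CommutativeRing 0ℓ 0ℓ) (t τ : CommutativeRing.Carrier K)
               (tτ : CommutativeRing._≈_ K (CommutativeRing._*_ K t τ) (CommutativeRing.1# K)) where
  open CommutativeRing K
  open Relation.Binary.Reasoning.Setoid setoid
  open RingSolver K
  open Rows K
  open VertexWeights K t
  open SiteOnLists K t τ tτ

  private variable
    n : ℕ

  α-zip : ∀ (A B C D : Label n) → α (zipL A B C D) ≡ ws t A
  α-zip [] [] [] [] = ≡.refl
  α-zip (a ∷ A) (b ∷ B) (c ∷ C) (d ∷ D) = ≡.cong (pick a t *_) (α-zip A B C D)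

  β-zip : ∀ (A B C D : Label n) → β (zipL A B C D) ≡ ws t B
  β-zip [] [] [] [] = ≡.refl
  β-zip (a ∷ A) (b ∷ B) (c ∷ C) (d ∷ D) = ≡.cong (pick b t *_) (β-zip A B C D)

  β̄-zip : ∀ (A B C D : Label n) → β̄ (zipL A B C D) ≡ ws τ B
  β̄-zip [] [] [] [] = ≡.refl
  β̄-zip (a ∷ A) (b ∷ B) (c ∷ C) (d ∷ D) = ≡.cong (pick b τ *_) (β̄-zip A B C D)

  δ-zip : ∀ (A B C D : Label n) → δ (zipL A B C D) ≡ ws t D
  δ-zip [] [] [] [] = ≡.refl
  δ-zip (a ∷ A) (b ∷ B) (c ∷ C) (d ∷ D) = ≡.cong (pick d t *_) (δ-zip A B C D)

  -- The two orders in which a purple and a dual white row can be stacked;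
  -- (A , B) are the left edges of the purple and of the dual row.
  module _ (ω ξ : Carrier) where

    colA colB : (g h : Carrier) (I K A B A′ B′ : Label n) → Carrier
    -- `column` lists the lower row first, and here the dual row lies below the purple one; hence B
    -- comes before A.
    colA g h I K A B A′ B′ = column (dualV ω h) (purpleV ξ g) I K B A B′ A′
    colB g h I K A B A′ B′ = column (purpleV ξ g) (dualV ω h) I K A B A′ B′

    colA-cong : ∀ {g g′ h h′} → g ≈ g′ → h ≈ h′ → ∀ (I K A B A′ B′ : Label n) →
                colA g h I K A B A′ B′ ≈ colA g′ h′ I K A B A′ B′
    colA-cong {n} p q I K A B A′ B′ = ∑-cong (allLabels n) λ M →
      *-cong (dualV-cong q I B M B′) (purpleV-cong refl p M A K A′)

    colB-cong : ∀ {g g′ h h′} → g ≈ g′ → h ≈ h′ → ∀ (I K A B A′ B′ : Label n) →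
                colB g h I K A B A′ B′ ≈ colB g′ h′ I K A B A′ B′
    colB-cong {n} p q I K A B A′ B′ = ∑-cong (allLabels n) λ M →
      *-cong (purpleV-cong refl p I A M A′) (dualV-cong q M B K B′)

    siteA siteB : (g h w : Carrier) (i k a b a′ b′ : Bool) → Carrier
    siteA g h w i k a b a′ b′ = bits λ m → s1 ω h w i b m b′ * p1 ξ g m a k a′
    siteB g h w i k a b a′ b′ = bits λ m → p1 ξ g i a m a′ * s1 ω h w m b k b′

    colA-∷ : ∀ {n} g h i k a b a′ b′ (I K A B A′ B′ : Label n) →
      colA g h (i ∷ I) (k ∷ K) (a ∷ A) (b ∷ B) (a′ ∷ A′) (b′ ∷ B′)
        ≈ siteA g h (ws t B) i k a b a′ b′ * colA (pick a′ t * g) (pick b′ t * h) I K A B A′ B′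
    colA-∷ {n} g h i k a b a′ b′ I K A B A′ B′ = column-split n
      (λ m → s1 ω h (ws t B) i b m b′) (λ m → p1 ξ g m a k a′)
      (λ M → dualV ω (pick b′ t * h) I B M B′) (λ M → purpleV ξ (pick a′ t * g) M A K A′)
      (λ M → dualV ω h (i ∷ I) (b ∷ B) M (b′ ∷ B′)) (λ M → purpleV ξ g M (a ∷ A) (k ∷ K) (a′ ∷ A′))
      (λ m M → refl) (λ m M → refl)

    colB-∷ : ∀ {n} g h i k a b a′ b′ (I K A B A′ B′ : Label n) →
      colB g h (i ∷ I) (k ∷ K) (a ∷ A) (b ∷ B) (a′ ∷ A′) (b′ ∷ B′)
        ≈ siteB g h (ws t B) i k a b a′ b′ * colB (pick a′ t * g) (pick b′ t * h) I K A B A′ B′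
    colB-∷ {n} g h i k a b a′ b′ I K A B A′ B′ = column-split n
      (λ m → p1 ξ g i a m a′) (λ m → s1 ω h (ws t B) m b k b′)
      (λ M → purpleV ξ (pick a′ t * g) I A M A′) (λ M → dualV ω (pick b′ t * h) M B K B′)
      (λ M → purpleV ξ g (i ∷ I) (a ∷ A) M (a′ ∷ A′)) (λ M → dualV ω h M (b ∷ B) (k ∷ K) (b′ ∷ B′))
      (λ m M → refl) (λ m M → refl)

    private
      z = ω * ξ

    -- The colours are exchanged one at a time; this factor accounts for the
    -- interaction of the colours already exchanged with those still to come.
    gauge : List Letter → (A B : Label n) → Carrier
    gauge pre [] [] = 1#
    gauge pre (a ∷ A) (b ∷ B) = (pick a (δ pre) * pick b (γ̄ pre)) * gauge pre A B

    -- The gauge factor is t to an exponent that is additive both in the letters of `pre` and in the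
    -- colours of A and B. It can therefore be grown at the far end of `pre` as well as at the front
    -- of A and B.
    gauge-∷ʳ : ∀ pre a′ b′ c d (A B : Label n) →
      gauge (pre ∷ʳ ltr a′ b′ c d) A B ≈ (pick d (ws t A) * pick c (ws τ B)) * gauge pre A B
    gauge-∷ʳ pre a′ b′ c d [] [] = sym (trans (*-identityʳ _) (trans (*-cong (one d) (one c)) (*-identityˡ _)))
      where
      one : ∀ b → pick b 1# ≈ 1#
      one false = refl
      one true = refl
    gauge-∷ʳ pre a′ b′ c d (a ∷ A) (b ∷ B) = begin
      (pick a (δ (pre ∷ʳ l)) * pick b (γ̄ (pre ∷ʳ l))) * gauge (pre ∷ʳ l) A B
        ≈⟨ *-cong (*-cong (trans (pick-cong a (stat-∷ʳ _ pre l)) (comm a d t (δ pre)))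
                          (trans (pick-cong b (stat-∷ʳ _ pre l)) (comm b c τ (γ̄ pre))))
                  (gauge-∷ʳ pre a′ b′ c d A B) ⟩
      ((pick d (pick a t) * pick a (δ pre)) * (pick c (pick b τ) * pick b (γ̄ pre)))
        * ((pick d (ws t A) * pick c (ws τ B)) * gauge pre A B)
        ≈⟨ solve 7 (λ x y z w u v g → ((x :* y) :* (z :* w)) :* ((u :* v) :* g) := ((x :* u) :* (z :* v)) :* ((y :* w) :* g))
             refl _ _ _ _ _ _ _ ⟩
      ((pick d (pick a t) * pick d (ws t A)) * (pick c (pick b τ) * pick c (ws τ B)))
        * ((pick a (δ pre) * pick b (γ̄ pre)) * gauge pre A B)
        ≈⟨ *-congʳ (*-cong (mul d _ _) (mul c _ _)) ⟩
      (pick d (pick a t * ws t A) * pick c (pick b τ * ws τ B)) * ((pick a (δ pre) * pick b (γ̄ pre)) * gauge pre A B) ∎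
      where
      l = ltr a′ b′ c d
      mul : ∀ b x y → pick b x * pick b y ≈ pick b (x * y)
      mul false x y = *-identityˡ _
      mul true x y = refl
      comm : ∀ a d s x → pick a (pick d s * x) ≈ pick d (pick a s) * pick a x
      comm false false s x = sym (*-identityˡ _)
      comm false true s x = sym (*-identityˡ _)
      comm true false s x = refl
      comm true true s x = refl

    -- Induction on the colours. Once the letter of the current colour is appended to `pre`, the
    -- induction hypothesis brings the letters of the remaining colours in front of `pre`. The
    -- appended letter is then the last of the word, where `site-list` trades it for a first letter.
    -- Earlier colours act only through the four powers of t of `pre` and the gauge factor. For
    -- empty `pre` this is the Yang-Baxter relation of one column.
    column-relation : ∀ {n} (I K A B C D : Label n) pre →
      ∑² n (λ A′ B′ → colA (α pre) (β pre) I K A B A′ B′ * R z (pre ++ zipL A′ B′ C D))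
      ≈ gauge pre A B * ∑² n (λ U V → R z (zipL A B U V ++ pre) * colB (γ pre) (δ pre) I K U V C D)
    column-relation [] [] [] [] [] [] pre = trans
      (solve 1 (λ r → (((𝟙 :* 𝟙 :+ 𝟘) :* r) :+ 𝟘) :+ 𝟘 := 𝟙 :* (((r :* (𝟙 :* 𝟙 :+ 𝟘)) :+ 𝟘) :+ 𝟘)) refl (R z (pre ++ [])))
      (reflexive (≡.cong (λ p → 1# * (((R z p * (1# * 1# + 0#)) + 0#) + 0#)) (ListP.++-identityʳ pre)))
    column-relation {suc n} (i ∷ I) (k ∷ K) (a ∷ A) (b ∷ B) (c ∷ C) (d ∷ D) pre = begin
      ∑² (suc n) (λ A′ B′ → colA (α pre) (β pre) (i ∷ I) (k ∷ K) (a ∷ A) (b ∷ B) A′ B′ * R z (pre ++ zipL A′ B′ (c ∷ C) (d ∷ D)))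
        ≈⟨ ∑²-∷ n _ ⟩
      bit (λ a′ → bit λ b′ → ∑² n (λ A′ B′ → colA (α pre) (β pre) (i ∷ I) (k ∷ K) (a ∷ A) (b ∷ B) (a′ ∷ A′) (b′ ∷ B′)
                                              * R z (pre ++ ltr a′ b′ c d ∷ zipL A′ B′ C D)))
        -- The remaining colours are moved first, with the current letter stored in `pre`.
        ≈⟨ bit²-cong LA MA left ⟩
      bit (λ a′ → bit λ b′ → ∑² n (λ U V → TA a′ b′ * E a′ b′ U V * Q U V))
        ≈⟨ sym (∑²-bit² n (λ U V a′ b′ → TA a′ b′ * E a′ b′ U V * Q U V)) ⟩
      ∑² n (λ U V → bit λ a′ → bit λ b′ → TA a′ b′ * E a′ b′ U V * Q U V)
        -- For fixed labels U, V of the remaining colours this is the one-colour relation with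
        -- `post` = `zipL A B U V`.
        ≈⟨ ∑²-cong n (λ U V → trans (sym (bit²-* (λ a′ b′ → TA a′ b′ * E a′ b′ U V) (Q U V))) (*-congʳ (middle U V))) ⟩
      ∑² n (λ U V → (bit λ u → bit λ v → (R z (ltr a b u v ∷ zipL A B U V ++ pre) * γab) * TB U V u v) * Q U V)
        ≈⟨ ∑²-cong n (λ U V → bit²-* (λ u v → (R z (ltr a b u v ∷ zipL A B U V ++ pre) * γab) * TB U V u v) (Q U V)) ⟩
      ∑² n (λ U V → bit λ u → bit λ v → ((R z (ltr a b u v ∷ zipL A B U V ++ pre) * γab) * TB U V u v) * Q U V)
        ≈⟨ ∑²-bit² n (λ U V u v → ((R z (ltr a b u v ∷ zipL A B U V ++ pre) * γab) * TB U V u v) * Q U V) ⟩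
      bit (λ u → bit λ v → ∑² n (λ U V → ((R z (ltr a b u v ∷ zipL A B U V ++ pre) * γab) * TB U V u v) * Q U V))
        ≈⟨ bit²-cong (λ u v → (γab * gauge pre A B) * RB u v) NB right ⟨
      bit (λ u → bit λ v → (γab * gauge pre A B) * ∑² n (λ U V → R z (ltr a b u v ∷ zipL A B U V ++ pre)
                                      * colB (γ pre) (δ pre) (i ∷ I) (k ∷ K) (u ∷ U) (v ∷ V) (c ∷ C) (d ∷ D)))
        ≈⟨ trans (*-congˡ (∑²-∷ n _)) (*-bit² RB (γab * gauge pre A B)) ⟨
      gauge pre (a ∷ A) (b ∷ B) * ∑² (suc n) (λ U V → R z (zipL (a ∷ A) (b ∷ B) U V ++ pre)
                                      * colB (γ pre) (δ pre) (i ∷ I) (k ∷ K) U V (c ∷ C) (d ∷ D)) ∎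
      where
      γab = pick a (δ pre) * pick b (γ̄ pre)
      TA : Bool → Bool → Carrier
      TA a′ b′ = siteA (α pre) (β pre) (ws t B) i k a b a′ b′
      TB : Label n → Label n → Bool → Bool → Carrier
      TB U V u v = siteB (γ pre) (δ pre) (ws t V) i k u v c d
      pd = pick d (ws t A) * pick c (ws τ B)
      E : Bool → Bool → Label n → Label n → Carrier
      E a′ b′ U V = R z ((zipL A B U V ++ pre) ∷ʳ ltr a′ b′ c d) * pd
      colB′ : Label n → Label n → Carrier
      colB′ U V = colB (pick c t * γ pre) (pick d t * δ pre) I K U V C D
      Q : Label n → Label n → Carrier
      Q U V = gauge pre A B * colB′ U V
      LA MA RB NB : Bool → Bool → Carrier
      LA a′ b′ = ∑² n λ A′ B′ → colA (α pre) (β pre) (i ∷ I) (k ∷ K) (a ∷ A) (b ∷ B) (a′ ∷ A′) (b′ ∷ B′)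
                                 * R z (pre ++ ltr a′ b′ c d ∷ zipL A′ B′ C D)
      MA a′ b′ = ∑² n λ U V → TA a′ b′ * E a′ b′ U V * Q U V
      RB u v = ∑² n λ U V → R z (ltr a b u v ∷ zipL A B U V ++ pre)
                            * colB (γ pre) (δ pre) (i ∷ I) (k ∷ K) (u ∷ U) (v ∷ V) (c ∷ C) (d ∷ D)
      NB u v = ∑² n λ U V → ((R z (ltr a b u v ∷ zipL A B U V ++ pre) * γab) * TB U V u v) * Q U V
      left : ∀ a′ b′ →
        ∑² n (λ A′ B′ → colA (α pre) (β pre) (i ∷ I) (k ∷ K) (a ∷ A) (b ∷ B) (a′ ∷ A′) (b′ ∷ B′)
                        * R z (pre ++ ltr a′ b′ c d ∷ zipL A′ B′ C D))
        ≈ ∑² n (λ U V → TA a′ b′ * E a′ b′ U V * Q U V)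
      left a′ b′ = begin
        ∑² n (λ A′ B′ → colA (α pre) (β pre) (i ∷ I) (k ∷ K) (a ∷ A) (b ∷ B) (a′ ∷ A′) (b′ ∷ B′)
                        * R z (pre ++ l ∷ zipL A′ B′ C D))
          ≈⟨ ∑²-cong n (λ A′ B′ → trans (*-cong
               (trans (colA-∷ (α pre) (β pre) i k a b a′ b′ I K A B A′ B′)
                      (*-congˡ (colA-cong (sym (stat-∷ʳ _ pre l)) (sym (stat-∷ʳ _ pre l)) I K A B A′ B′)))
               (reflexive (≡.cong (R z) (≡.sym (ListP.++-assoc pre (l ∷ []) _))))) (*-assoc _ _ _)) ⟩
        ∑² n (λ A′ B′ → TA a′ b′ * (colA (α pre′) (β pre′) I K A B A′ B′ * R z (pre′ ++ zipL A′ B′ C D)))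
          ≈⟨ *-∑² n _ _ ⟨
        TA a′ b′ * ∑² n (λ A′ B′ → colA (α pre′) (β pre′) I K A B A′ B′ * R z (pre′ ++ zipL A′ B′ C D))
          ≈⟨ *-congˡ (column-relation I K A B C D pre′) ⟩
        TA a′ b′ * (gauge pre′ A B * ∑² n (λ U V → R z (zipL A B U V ++ pre′) * colB (γ pre′) (δ pre′) I K U V C D))
          ≈⟨ trans (*-congˡ (*-∑² n _ _)) (*-∑² n _ _) ⟩
        ∑² n (λ U V → TA a′ b′ * (gauge pre′ A B * (R z (zipL A B U V ++ pre′) * colB (γ pre′) (δ pre′) I K U V C D)))
          ≈⟨ ∑²-cong n (λ U V → trans (*-congˡ (*-cong (gauge-∷ʳ pre a′ b′ c d A B)
               (*-cong (reflexive (≡.cong (R z) (≡.sym (ListP.++-assoc (zipL A B U V) pre (l ∷ [])))))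
                       (colB-cong (stat-∷ʳ _ pre l) (stat-∷ʳ _ pre l) I K U V C D))))
               (solve 5 (λ T P G r B → T :* ((P :* G) :* (r :* B)) := (T :* (r :* P)) :* (G :* B)) refl _ _ _ _ _)) ⟩
        ∑² n (λ U V → TA a′ b′ * E a′ b′ U V * Q U V) ∎
        where
        l = ltr a′ b′ c d
        pre′ = pre ∷ʳ l
      middle : ∀ U V → (bit λ a′ → bit λ b′ → TA a′ b′ * E a′ b′ U V)
               ≈ (bit λ u → bit λ v → (R z (ltr a b u v ∷ zipL A B U V ++ pre) * γab) * TB U V u v)
      -- The dual weight of the current colour depends on the later colours of its left edge, which
      -- are B on one side and V on the other. Both powers are statistics of the same word
      -- `zipL A B U V`.
      middle U V = ≡.subst₂ (λ p q → (bit λ a′ → bit λ b′ → siteA (α pre) (β pre) p i k a b a′ b′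
                                 * (R z ((zipL A B U V ++ pre) ∷ʳ ltr a′ b′ c d) * q))
               ≈ (bit λ u → bit λ v → (R z (ltr a b u v ∷ zipL A B U V ++ pre) * γab) * TB U V u v))
        (β-zip A B U V) (≡.cong₂ (λ x y → pick d x * pick c y) (α-zip A B U V) (β̄-zip A B U V))
        (≡.subst (λ w → colL ω ξ pre (zipL A B U V) i k a b c d
               ≈ (bit λ u → bit λ v → (R z (ltr a b u v ∷ zipL A B U V ++ pre) * γab) * siteB (γ pre) (δ pre) w i k u v c d))
          (δ-zip A B U V) (site-list ω ξ pre (zipL A B U V) i k a b c d))
      right : ∀ u v → (γab * gauge pre A B) * ∑² n (λ U V → R z (ltr a b u v ∷ zipL A B U V ++ pre)
                                      * colB (γ pre) (δ pre) (i ∷ I) (k ∷ K) (u ∷ U) (v ∷ V) (c ∷ C) (d ∷ D))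
              ≈ ∑² n (λ U V → ((R z (ltr a b u v ∷ zipL A B U V ++ pre) * γab) * TB U V u v) * Q U V)
      right u v = trans (*-∑² n _ _) (∑²-cong n λ U V → trans
        (*-congˡ (*-congˡ (colB-∷ (γ pre) (δ pre) i k u v c d I K U V C D)))
        (solve 5 (λ x g r T B → (x :* g) :* (r :* (T :* B)) := ((r :* x) :* T) :* (g :* B)) refl _ _ _ _ _))

-- From columns to rows

data LastEmpty {k : ℕ} : (Is Ks : List (Label k)) → Set where
  last : LastEmpty (∅ ∷ []) (∅ ∷ [])
  _∷_ : ∀ {Is Ks} (IK : Label k × Label k) → LastEmpty Is Ks → LastEmpty (proj₁ IK ∷ Is) (proj₂ IK ∷ Ks)

module ExchangeRows (K : CommutativeRing 0ℓ 0ℓ) (t τ : CommutativeRing.Carrier K)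
               (tτ : CommutativeRing._≈_ K (CommutativeRing._*_ K t τ) (CommutativeRing.1# K)) where
  open CommutativeRing K
  open Relation.Binary.Reasoning.Setoid setoid
  open RingSolver K
  open Rows K
  open VertexWeights K t
  open SiteOnLists K t τ tτ
  open Exchange K t τ tτ

  len-zip : ∀ {n} (A B C D : Label n) → len (zipL A B C D) ≡ t ^ n
  len-zip [] [] [] [] = ≡.refl
  len-zip (a ∷ A) (b ∷ B) (c ∷ C) (d ∷ D) = ≡.cong (t *_) (len-zip A B C D)

  crossing : Carrier → ℕ → Carrier
  crossing z zero = 1#
  crossing z (suc n) = (1# + z * t ^ n) * crossing z n

  R-∅ : ∀ z k → R z (zipL {k} ∅ ∅ ∅ ∅) ≈ 1#
  R-∅ z zero = refl
  R-∅ z (suc k) = trans (*-cong (one (fa t) ≡.refl k) (*-cong (one (fc τ) ≡.refl k) (R-∅ (z * t) k)))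
    (trans (*-identityˡ _) (*-identityˡ _))
    where
    one : ∀ f → f (ltr false false false false) ≡ 1# → ∀ k → stat f (zipL {k} ∅ ∅ ∅ ∅) ≈ 1#
    one f h zero = refl
    one f h (suc k) = trans (*-cong (reflexive h) (one f h k)) (*-identityˡ _)

  module _ (ω ξ : Carrier) where
    private
      sA = siteA ω ξ
      sB = siteB ω ξ

    -- One factor of `crossing`, arising at a column whose outer edges other than a and b are empty.
    -- If a and b are empty, u and v are both false or both true; the second term contributes Y δ -
    -- Φ because δ δ̄ = 1, so Φ cancels and (1 + z `len r`) times the shorter entry remains. If a
    -- and b are both occupied, the two terms cancel.
    site-end : ∀ z r g h g′ h′ w → h ≈ 1# → ∀ a b →
      (bit λ u → bit λ v → R z (ltr a b u v ∷ r) * sB g h (δ r) false false u v false false)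
      ≈ sA g′ h′ w false false a b false false * ((1# + z * len r) * R z r)
    site-end z r g h g′ h′ w h≈1 false false = begin
      _ ≈⟨ solve 5 (λ Φ Y b h w →
             (Φ :* ((𝟙 :* 𝟙) :* (𝟙 :* (𝟙 :* 𝟙)) :+ 𝟘 :* 𝟘) :+ 𝟘 :* ((𝟙 :* 𝟙) :* 𝟘 :+ 𝟘 :* (𝟙 :* (h :* w))))
             :+ (𝟘 :* (𝟘 :* (𝟙 :* (𝟙 :* 𝟙)) :+ (𝟙 :* 𝟙) :* 𝟘) :+ (Y :+ :- (b :* Φ)) :* (𝟘 :* 𝟘 :+ (𝟙 :* 𝟙) :* (𝟙 :* (h :* w))))
             := Φ :+ (Y :+ :- (b :* Φ)) :* (h :* w)) refl Φ Y (δ̄ r) h (δ r) ⟩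
      Φ + (Y + - (δ̄ r * Φ)) * (h * δ r)   ≈⟨ +-congˡ (*-congˡ (trans (*-congʳ h≈1) (*-identityˡ _))) ⟩
      Φ + (Y + - (δ̄ r * Φ)) * δ r         ≈⟨ solve 4 (λ Φ Y b w → Φ :+ (Y :+ :- (b :* Φ)) :* w := Φ :+ (Y :* w :+ :- ((w :* b) :* Φ))) refl Φ Y (δ̄ r) (δ r) ⟩
      Φ + (Y * δ r + - (δ r * δ̄ r * Φ))   ≈⟨ +-congˡ (+-congˡ (-‿cong (cancel (δδ̄ r) Φ))) ⟩
      Φ + (Y * δ r + - Φ)                  ≈⟨ solve 5 (λ Φ l b ψ w → Φ :+ ((l :* (b :* ψ)) :* w :+ :- Φ) := (w :* b) :* (l :* ψ)) refl Φ (1# + z * len r) (δ̄ r) (R z r) (δ r) ⟩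
      (δ r * δ̄ r) * ((1# + z * len r) * R z r)   ≈⟨ cancel (δδ̄ r) _ ⟩
      (1# + z * len r) * R z r                    ≈⟨ solve 1 (λ x → x := ((𝟙 :* (𝟙 :* 𝟙)) :* (𝟙 :* 𝟙) :+ 𝟘 :* 𝟘) :* x) refl _ ⟩
      _ ∎
      where
      Φ = α r * (γ̄ r * R (z * t) r)
      Y = (1# + z * len r) * (δ̄ r * R z r)
    site-end z r g h g′ h′ w h≈1 true true = begin
      _ ≈⟨ solve 4 (λ Φ b h w →
             (Φ :* ((𝟙 :* 𝟙) :* (𝟙 :* (𝟙 :* 𝟙)) :+ 𝟘 :* 𝟘) :+ 𝟘 :* ((𝟙 :* 𝟙) :* 𝟘 :+ 𝟘 :* (𝟙 :* (h :* w))))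
             :+ (𝟘 :* (𝟘 :* (𝟙 :* (𝟙 :* 𝟙)) :+ (𝟙 :* 𝟙) :* 𝟘) :+ (:- (b :* Φ)) :* (𝟘 :* 𝟘 :+ (𝟙 :* 𝟙) :* (𝟙 :* (h :* w))))
             := Φ :+ :- (h :* ((w :* b) :* Φ))) refl Φ (δ̄ r) h (δ r) ⟩
      Φ + - (h * (δ r * δ̄ r * Φ))          ≈⟨ +-congˡ (-‿cong (trans (*-cong h≈1 (cancel (δδ̄ r) Φ)) (*-identityˡ _))) ⟩
      Φ + - Φ                               ≈⟨ -‿inverseʳ Φ ⟩
      0#                                    ≈⟨ solve 2 (λ x h → 𝟘 := (𝟘 :* 𝟘 :+ 𝟘 :* 𝟘) :* x) refl _ h′ ⟩
      (0# * 0# + 0# * 0#) * ((1# + z * len r) * R z r) ≈⟨ *-congʳ (+-cong (zeroˡ 0#) (zeroˡ 0#)) ⟩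
      (0# + 0#) * ((1# + z * len r) * R z r) ≈⟨ *-congʳ (+-cong (sym (zeroˡ _)) (sym (zeroʳ _))) ⟩
      _ ∎
      where
      Φ = α r * (γ̄ r * R (z * t) r)
    site-end z r g h g′ h′ w h≈1 true false = begin
      _ ≈⟨ solve 4 (λ Y b h w →
             (𝟘 :* ((𝟙 :* 𝟙) :* (𝟙 :* (𝟙 :* 𝟙)) :+ 𝟘 :* 𝟘) :+ 𝟘 :* ((𝟙 :* 𝟙) :* 𝟘 :+ 𝟘 :* (𝟙 :* (h :* w))))
             :+ (Y :* (𝟘 :* (𝟙 :* (𝟙 :* 𝟙)) :+ (𝟙 :* 𝟙) :* 𝟘) :+ 𝟘 :* (𝟘 :* 𝟘 :+ (𝟙 :* 𝟙) :* (𝟙 :* (h :* w))))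
             := 𝟘) refl _ (δ̄ r) h (δ r) ⟩
      0#   ≈⟨ zeroˡ _ ⟨
      0# * ((1# + z * len r) * R z r) ≈⟨ *-congʳ (trans (+-cong (zeroʳ _) (zeroˡ _)) (+-identityˡ _)) ⟨
      _ ∎
    site-end z r g h g′ h′ w h≈1 false true = begin
      _ ≈⟨ solve 4 (λ Φ b h w →
             (𝟘 :* ((𝟙 :* 𝟙) :* (𝟙 :* (𝟙 :* 𝟙)) :+ 𝟘 :* 𝟘) :+ Φ :* ((𝟙 :* 𝟙) :* 𝟘 :+ 𝟘 :* (𝟙 :* (h :* w))))
             :+ (𝟘 :* (𝟘 :* (𝟙 :* (𝟙 :* 𝟙)) :+ (𝟙 :* 𝟙) :* 𝟘) :+ 𝟘 :* (𝟘 :* 𝟘 :+ (𝟙 :* 𝟙) :* (𝟙 :* (h :* w))))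
             := 𝟘) refl _ (δ̄ r) h (δ r) ⟩
      0#   ≈⟨ zeroˡ _ ⟨
      0# * ((1# + z * len r) * R z r) ≈⟨ *-congʳ (trans (+-cong (zeroˡ _) (zeroʳ _)) (+-identityˡ _)) ⟨
      _ ∎

    last-column : ∀ {n} (A B : Label n) z g h g′ h′ → h ≈ 1# →
      ∑² n (λ U V → R z (zipL A B U V) * colB ω ξ g h ∅ ∅ U V ∅ ∅) ≈ crossing z n * colA ω ξ g′ h′ ∅ ∅ A B ∅ ∅
    last-column [] [] z g h g′ h′ h≈1 =
      solve 0 (((𝟙 :* (𝟙 :* 𝟙 :+ 𝟘)) :+ 𝟘) :+ 𝟘 := 𝟙 :* (𝟙 :* 𝟙 :+ 𝟘)) refl
    last-column {suc n} (a ∷ A) (b ∷ B) z g h g′ h′ h≈1 = begin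
      ∑² (suc n) (λ U V → R z (zipL (a ∷ A) (b ∷ B) U V) * colB ω ξ g h ∅ ∅ U V ∅ ∅)
        ≈⟨ ∑²-∷ n _ ⟩
      (bit λ u → bit λ v → F u v)
        ≈⟨ bit²-cong F G (λ u v → ∑²-cong n λ U V → step u v U V) ⟩
      (bit λ u → bit λ v → G u v)
        ≈⟨ ∑²-bit² n (λ U V u v → (R z (ltr a b u v ∷ zipL A B U V) * sB g h (δ (zipL A B U V)) false false u v false false) * Q U V) ⟨
      ∑² n (λ U V → bit λ u → bit λ v → (R z (ltr a b u v ∷ zipL A B U V) * sB g h (δ (zipL A B U V)) false false u v false false) * Q U V)
        ≈⟨ ∑²-cong n (λ U V → trans
             (sym (bit²-* (λ u v → R z (ltr a b u v ∷ zipL A B U V) * sB g h (δ (zipL A B U V)) false false u v false false) (Q U V)))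
             (*-congʳ (site-end z (zipL A B U V) g h g′ h′ (ws t B) h≈1 a b))) ⟩
      ∑² n (λ U V → sA g′ h′ (ws t B) false false a b false false * ((1# + z * len (zipL A B U V)) * R z (zipL A B U V)) * Q U V)
        ≈⟨ ∑²-cong n (λ U V → trans (*-congʳ (*-congˡ (*-congʳ (+-congˡ (*-congˡ (reflexive (len-zip A B U V)))))))
             (solve 4 (λ e l r q → (e :* (l :* r)) :* q := (e :* l) :* (r :* q)) refl _ _ _ _)) ⟩
      ∑² n (λ U V → (sA g′ h′ (ws t B) false false a b false false * (1# + z * t ^ n)) * (R z (zipL A B U V) * Q U V))
        ≈⟨ *-∑² n _ _ ⟨
      (sA g′ h′ (ws t B) false false a b false false * (1# + z * t ^ n)) * ∑² n (λ U V → R z (zipL A B U V) * Q U V)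
        ≈⟨ *-congˡ (last-column A B z (1# * g) (1# * h) (1# * g′) (1# * h′) (trans (*-identityˡ _) h≈1)) ⟩
      (sA g′ h′ (ws t B) false false a b false false * (1# + z * t ^ n)) * (crossing z n * colA ω ξ (1# * g′) (1# * h′) ∅ ∅ A B ∅ ∅)
        ≈⟨ solve 4 (λ e l c q → (e :* l) :* (c :* q) := (l :* c) :* (e :* q)) refl _ _ _ _ ⟩
      crossing z (suc n) * (sA g′ h′ (ws t B) false false a b false false * colA ω ξ (1# * g′) (1# * h′) ∅ ∅ A B ∅ ∅)
        ≈⟨ *-congˡ (colA-∷ ω ξ g′ h′ false false a b false false ∅ ∅ A B ∅ ∅) ⟨
      crossing z (suc n) * colA ω ξ g′ h′ ∅ ∅ (a ∷ A) (b ∷ B) ∅ ∅ ∎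
      where
      Q : Label n → Label n → Carrier
      Q U V = colB ω ξ (1# * g) (1# * h) ∅ ∅ U V ∅ ∅
      F G : Bool → Bool → Carrier
      F u v = ∑² n λ U V → R z (ltr a b u v ∷ zipL A B U V) * colB ω ξ g h (false ∷ ∅) (false ∷ ∅) (u ∷ U) (v ∷ V) (false ∷ ∅) (false ∷ ∅)
      G u v = ∑² n λ U V → (R z (ltr a b u v ∷ zipL A B U V) * sB g h (δ (zipL A B U V)) false false u v false false) * Q U V
      step : ∀ u v U V → R z (ltr a b u v ∷ zipL A B U V) * colB ω ξ g h (false ∷ ∅) (false ∷ ∅) (u ∷ U) (v ∷ V) (false ∷ ∅) (false ∷ ∅)
             ≈ (R z (ltr a b u v ∷ zipL A B U V) * sB g h (δ (zipL A B U V)) false false u v false false) * Q U V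
      step u v U V = trans (*-congˡ (colB-∷ ω ξ g h false false u v false false ∅ ∅ U V ∅ ∅))
        (trans (sym (*-assoc _ _ _)) (*-congʳ (*-congˡ (reflexive
          (≡.cong (λ w → sB g h w false false u v false false) (≡.sym (δ-zip A B U V)))))))

    private
      z = ω * ξ
      V* V∘ : ∀ {k} → Vertex k
      V* = dualV ω 1#
      V∘ = purpleV ξ 1#

    rowsA rowsB : ∀ {k} → (A B : Label k) (Is Ks : List (Label k)) → Carrier
    rowsA A B Is Ks = two V* V∘ B A Is Ks
    rowsB A B Is Ks = two V∘ V* A B Is Ks

    rowsA-∷ : ∀ {k} (A B I K : Label k) Is Ks →
      rowsA A B (I ∷ Is) (K ∷ Ks) ≈ ∑² k λ A′ B′ → colA ω ξ 1# 1# I K A B A′ B′ * rowsA A′ B′ Is Ks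
    rowsA-∷ {k} A B I K Is Ks = trans (two-∷ V* V∘ B A I K Is Ks) (∑²-flip k _)

    rowsB-∷ : ∀ {k} (A B I K : Label k) Is Ks →
      rowsB A B (I ∷ Is) (K ∷ Ks) ≈ ∑² k λ A′ B′ → colB ω ξ 1# 1# I K A B A′ B′ * rowsB A′ B′ Is Ks
    rowsB-∷ A B I K Is Ks = two-∷ V∘ V* A B I K Is Ks

    ∑²-∅ : ∀ k (f : Label k → Label k → Carrier) →
      ∑² k (λ A B → f A B * ((if empty? A then 1# else 0#) * (if empty? B then 1# else 0#))) ≈ f ∅ ∅
    ∑²-∅ k f = trans
      (∑-cong (allLabels k) λ A → trans
        (∑-cong (allLabels k) λ B → sym (*-assoc _ _ _))
        (trans (∑-∅ k (λ B → f A B * (if empty? A then 1# else 0#))) refl))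
      (∑-∅ k (λ A → f A ∅))

    rowsA-[] : ∀ {k} (A B I K : Label k) → rowsA A B (I ∷ []) (K ∷ []) ≈ colA ω ξ 1# 1# I K A B ∅ ∅
    rowsA-[] {k} A B I K = trans (rowsA-∷ A B I K [] [])
      (trans (∑²-cong k λ A′ B′ → *-congˡ (trans (two-[] V* V∘ B′ A′) (*-comm _ _))) (∑²-∅ k _))

    rowsB-[] : ∀ {k} (A B I K : Label k) → rowsB A B (I ∷ []) (K ∷ []) ≈ colB ω ξ 1# 1# I K A B ∅ ∅
    rowsB-[] {k} A B I K = trans (rowsB-∷ A B I K [] [])
      (trans (∑²-cong k λ A′ B′ → *-congˡ (two-[] V∘ V* A′ B′)) (∑²-∅ k _))

    gauge-[] : ∀ {n} (A B : Label n) → gauge ω ξ [] A B ≈ 1#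
    gauge-[] [] [] = refl
    gauge-[] (a ∷ A) (b ∷ B) = trans (*-cong (*-cong (one a) (one b)) (gauge-[] A B)) (trans (*-identityʳ _) (*-identityˡ _))
      where
      one : ∀ b → pick b 1# ≈ 1#
      one false = refl
      one true = refl

    -- The empty last column creates the R-matrix together with the factor `crossing`; every further
    -- column on the left passes it on by `column-relation`.
    rows-relation : ∀ {k} {Is Ks : List (Label k)} → LastEmpty Is Ks → ∀ A B →
      crossing z k * rowsA A B Is Ks ≈ ∑² k λ U V → R z (zipL A B U V) * rowsB U V Is Ks
    rows-relation {k} last A B = begin
      crossing z k * rowsA A B (∅ ∷ []) (∅ ∷ [])             ≈⟨ *-congˡ (rowsA-[] A B ∅ ∅) ⟩
      crossing z k * colA ω ξ 1# 1# ∅ ∅ A B ∅ ∅             ≈⟨ last-column A B z 1# 1# 1# 1# refl ⟨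
      ∑² k (λ U V → R z (zipL A B U V) * colB ω ξ 1# 1# ∅ ∅ U V ∅ ∅)   ≈⟨ ∑²-cong k (λ U V → *-congˡ (rowsB-[] U V ∅ ∅)) ⟨
      ∑² k (λ U V → R z (zipL A B U V) * rowsB U V (∅ ∷ []) (∅ ∷ [])) ∎
    rows-relation {k} (_∷_ {Is} {Ks} (I , K) le) A B = begin
      crossing z k * rowsA A B (I ∷ Is) (K ∷ Ks)
        ≈⟨ trans (*-congˡ (rowsA-∷ A B I K Is Ks)) (*-∑² k _ _) ⟩
      ∑² k (λ A′ B′ → crossing z k * (cA A′ B′ * rowsA A′ B′ Is Ks))
        ≈⟨ ∑²-cong k (λ A′ B′ → trans (solve 3 (λ c a r → c :* (a :* r) := a :* (c :* r)) refl _ _ _)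
             (trans (*-congˡ (rows-relation le A′ B′)) (trans (*-∑² k _ _) (∑²-cong k λ C D → sym (*-assoc _ _ _))))) ⟩
      ∑² k (λ A′ B′ → ∑² k λ C D → (cA A′ B′ * R z (zipL A′ B′ C D)) * rowsB C D Is Ks)
        ≈⟨ ∑²-swap k k _ ⟩
      ∑² k (λ C D → ∑² k λ A′ B′ → (cA A′ B′ * R z (zipL A′ B′ C D)) * rowsB C D Is Ks)
        ≈⟨ ∑²-cong k (λ C D → trans (sym (∑²-* _ _)) (trans (*-congʳ (trans (column-relation ω ξ I K A B C D [])
             (trans (*-congʳ (gauge-[] A B)) (*-identityˡ _)))) (∑²-* _ _))) ⟩
      ∑² k (λ C D → ∑² k λ U V → (R z (zipL A B U V ++ []) * cB U V C D) * rowsB C D Is Ks)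
        ≈⟨ ∑²-swap k k _ ⟩
      ∑² k (λ U V → ∑² k λ C D → (R z (zipL A B U V ++ []) * cB U V C D) * rowsB C D Is Ks)
        ≈⟨ ∑²-cong k (λ U V → trans (∑²-cong k λ C D → *-assoc _ _ _) (trans (sym (*-∑² k _ _))
             (*-cong (reflexive (≡.cong (R z) (ListP.++-identityʳ (zipL A B U V)))) (sym (rowsB-∷ U V I K Is Ks))))) ⟩
      ∑² k (λ U V → R z (zipL A B U V) * rowsB U V (I ∷ Is) (K ∷ Ks)) ∎
      where
      cA : Label k → Label k → Carrier
      cA A′ B′ = colA ω ξ 1# 1# I K A B A′ B′
      cB : (U V C D : Label k) → Carrier
      cB U V C D = colB ω ξ 1# 1# I K U V C D
      ∑²-* : ∀ (f : Label k → Label k → Carrier) c → ∑² k f * c ≈ ∑² k (λ A B → f A B * c)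
      ∑²-* f c = trans (*-comm _ _) (trans (*-∑² k c f) (∑²-cong k λ A B → *-comm _ _))

    -- A legal letter with a and b empty has c = d, so once V is known to be empty, the R-matrix
    -- forces U to be empty as well.
    ∑²-R-∅ : ∀ z k (f : Label k → Label k → Carrier) → (∀ U V → empty? V ≡ false → f U V ≈ 0#) →
      ∑² k (λ U V → R z (zipL ∅ ∅ U V) * f U V) ≈ f ∅ ∅
    ∑²-R-∅ z k f h = begin
      ∑² k (λ U V → R z (zipL ∅ ∅ U V) * f U V)
        ≈⟨ ∑²-cong k (λ U V → term U V) ⟩
      ∑² k (λ U V → f U V * ((if empty? U then 1# else 0#) * (if empty? V then 1# else 0#)))
        ≈⟨ ∑²-∅ k f ⟩
      f ∅ ∅ ∎
      where
      empty⇒∅ : ∀ {k} (V : Label k) → empty? V ≡ true → V ≡ ∅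
      empty⇒∅ [] p = ≡.refl
      empty⇒∅ (false ∷ V) p = ≡.cong (false ∷_) (empty⇒∅ V p)
      bad-zip : ∀ {k} (U : Label k) → empty? U ≡ false → allOk (zipL ∅ ∅ U ∅) ≡ false
      bad-zip (true ∷ U) p = ≡.refl
      bad-zip (false ∷ U) p = bad-zip U p
      term : ∀ U V → R z (zipL ∅ ∅ U V) * f U V ≈ f U V * ((if empty? U then 1# else 0#) * (if empty? V then 1# else 0#))
      term U V with empty? V in eV | empty? U in eU
      ... | false | _ = trans (*-congˡ (h U V eV)) (trans (zeroʳ _) (sym (trans (*-congʳ (h U V eV)) (zeroˡ _))))
      ... | true | true rewrite empty⇒∅ V eV | empty⇒∅ U eU = trans (*-congʳ (R-∅ z k))
        (trans (*-identityˡ _) (sym (trans (*-congˡ (*-identityˡ _)) (*-identityʳ _))))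
      ... | true | false rewrite empty⇒∅ V eV = trans (*-congʳ (R-bad z (zipL ∅ ∅ U ∅) (bad-zip U eU)))
        (trans (zeroˡ _) (sym (trans (*-congˡ (zeroˡ _)) (zeroʳ _))))

    -- The dual vertex is a white vertex upside down: a colour present on its top edge may not also
    -- enter from the left.
    dualV-full : ∀ {k} h (I V L : Label k) → empty? V ≡ false → dualV ω h I V full L ≈ 0#
    dualV-full h (i ∷ I) (true ∷ V) (l ∷ L) p = trans (*-congʳ (reflexive (≡.cong (λ b → guard b
      (pick l ω * (pick true h * pick i (ws t V)))) (BoolP.∧-zeroʳ _)))) (zeroˡ _)
    dualV-full h (i ∷ I) (false ∷ V) (l ∷ L) p = trans (*-congˡ (dualV-full _ I V L p)) (zeroʳ _)

    -- Summation over the states of the two horizontal edges at the left end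
    -- collapses because a full top edge admits no dual path from the left.
    exchange : ∀ {k} (I : Label k) {Is Ks} → LastEmpty (I ∷ Is) (full ∷ Ks) →
      crossing z k * two V* V∘ ∅ ∅ (I ∷ Is) (full ∷ Ks) ≈ two V∘ V* ∅ ∅ (I ∷ Is) (full ∷ Ks)
    exchange {k} I {Is} {Ks} le = trans (rows-relation le ∅ ∅) (∑²-R-∅ z k (λ U V → rowsB U V (I ∷ Is) (full ∷ Ks)) λ U V p →
      trans (rowsB-∷ U V I full Is Ks) (trans (∑²-cong k λ A B → trans (*-congʳ
        (trans (∑-cong (allLabels k) λ M → trans (*-congˡ (dualV-full 1# M V B p)) (zeroʳ _)) (∑-0 (allLabels k)))) (zeroˡ _))
        (trans (∑-cong (allLabels k) λ A → ∑-0 (allLabels k)) (∑-0 (allLabels k)))))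

-- White rows and purple rows are inverse to each other

eqB : Bool → Bool → Bool
eqB true b = b
eqB false b = not b

eqL : ∀ {k} → Label k → Label k → Bool
eqL [] [] = true
eqL (i ∷ I) (k ∷ K) = eqB i k ∧ eqL I K

eqS : ∀ {k} → List (Label k) → List (Label k) → Bool
eqS [] [] = true
eqS (I ∷ Is) (K ∷ Ks) = eqL I K ∧ eqS Is Ks
eqS _ _ = false

-- (A , B) and (A′ , B′) differ by moving one path from the upper to the lower row.
data Swap : ∀ {n} → (A B A′ B′ : Label n) → Set where
  here : ∀ {n} {A B : Label n} → Swap (true ∷ A) (false ∷ B) (false ∷ A) (true ∷ B)
  there : ∀ {n} {A B A′ B′ : Label n} a b → Swap A B A′ B′ → Swap (a ∷ A) (b ∷ B) (a ∷ A′) (b ∷ B′)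

module Inverse (K : CommutativeRing 0ℓ 0ℓ) (t : CommutativeRing.Carrier K) (ξ : CommutativeRing.Carrier K) where
  open CommutativeRing K
  open Relation.Binary.Reasoning.Setoid setoid
  open RingSolver K
  open Rows K
  open VertexWeights K t
  open SiteWeights _+_ _*_ -_ 0# 1#
  private module P n = SiteWeights {Polynomial n} _:+_ _:*_ :-_ 𝟘 𝟙

  siteC : (g h : Carrier) (i k a b a′ b′ : Bool) → Carrier
  siteC g h i k a b a′ b′ = bits λ m → p1 (- ξ) h i b m b′ * w1 ξ g m a k a′

  private
    polyC : ∀ {n} → (i k a b a′ b′ : Bool) → (g h x : Polynomial n) → Polynomial n
    polyC {n} i k a b a′ b′ g h x = P.bits n λ m → P.p1 n (:- x) h i b m b′ :* P.w1 n x g m a k a′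

  private
    swapped : (i k a′ b′ : Bool) → (g h x : Polynomial 3) → Polynomial 3 × Polynomial 3
    swapped i k a′ b′ g h x = polyC i k true false a′ b′ g h x := polyC i k false true a′ b′ g h x

  siteC-swap : ∀ g h i k a′ b′ → siteC g h i k true false a′ b′ ≈ siteC g h i k false true a′ b′
  siteC-swap g h false false false false = solve 3 (swapped false false false false) refl g h ξ
  siteC-swap g h false false false true = solve 3 (swapped false false false true) refl g h ξ
  siteC-swap g h false false true false = solve 3 (swapped false false true false) refl g h ξ
  siteC-swap g h false false true true = solve 3 (swapped false false true true) refl g h ξ
  siteC-swap g h false true false false = solve 3 (swapped false true false false) refl g h ξ
  siteC-swap g h false true false true = solve 3 (swapped false true false true) refl g h ξ
  siteC-swap g h false true true false = solve 3 (swapped false true true false) refl g h ξ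
  siteC-swap g h false true true true = solve 3 (swapped false true true true) refl g h ξ
  siteC-swap g h true false false false = solve 3 (swapped true false false false) refl g h ξ
  siteC-swap g h true false false true = solve 3 (swapped true false false true) refl g h ξ
  siteC-swap g h true false true false = solve 3 (swapped true false true false) refl g h ξ
  siteC-swap g h true false true true = solve 3 (swapped true false true true) refl g h ξ
  siteC-swap g h true true false false = solve 3 (swapped true true false false) refl g h ξ
  siteC-swap g h true true false true = solve 3 (swapped true true false true) refl g h ξ
  siteC-swap g h true true true false = solve 3 (swapped true true true false) refl g h ξ
  siteC-swap g h true true true true = solve 3 (swapped true true true true) refl g h ξ

  colC : ∀ {n} (g h : Carrier) (I K A B A′ B′ : Label n) → Carrier
  colC g h I K A B A′ B′ = column (purpleV (- ξ) h) (whiteV ξ g) I K B A B′ A′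

  colC-∷ : ∀ {n} g h i k a b a′ b′ (I K A B A′ B′ : Label n) →
    colC g h (i ∷ I) (k ∷ K) (a ∷ A) (b ∷ B) (a′ ∷ A′) (b′ ∷ B′)
      ≈ siteC g h i k a b a′ b′ * colC (pick a′ t * g) (pick b′ t * h) I K A B A′ B′
  colC-∷ {n} g h i k a b a′ b′ I K A B A′ B′ = column-split n
    (λ m → p1 (- ξ) h i b m b′) (λ m → w1 ξ g m a k a′)
    (λ M → purpleV (- ξ) (pick b′ t * h) I B M B′) (λ M → whiteV ξ (pick a′ t * g) M A K A′)
    (λ M → purpleV (- ξ) h (i ∷ I) (b ∷ B) M (b′ ∷ B′)) (λ M → whiteV ξ g M (a ∷ A) (k ∷ K) (a′ ∷ A′))
    (λ m M → refl) (λ m M → refl)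

  -- The weights of the other colours see the moved one only through its right edges, by way of `g`
  -- and `h`, and these edges are the same on both sides. So everything reduces to `siteC-swap`.
  colC-swap : ∀ {n} g h (I K : Label n) {A B A′ B′} U V → Swap A B A′ B′ →
              colC g h I K A B U V ≈ colC g h I K A′ B′ U V
  colC-swap g h (i ∷ I) (k ∷ K) {true ∷ A} {false ∷ B} (u ∷ U) (v ∷ V) here =
    trans (colC-∷ g h i k true false u v I K A B U V)
    (trans (*-congʳ (siteC-swap g h i k u v)) (sym (colC-∷ g h i k false true u v I K A B U V)))
  colC-swap g h (i ∷ I) (k ∷ K) {a ∷ A} {b ∷ B} {_ ∷ A′} {_ ∷ B′} (u ∷ U) (v ∷ V) (there a b s) =
    trans (colC-∷ g h i k a b u v I K A B U V)
    (trans (*-congˡ (colC-swap _ _ I K U V s)) (sym (colC-∷ g h i k a b u v I K A′ B′ U V)))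

  private
    guard-* : ∀ c x g → guard c (x * g) ≈ guard c x * g
    guard-* false x g = sym (zeroˡ g)
    guard-* true x g = refl

  siteC-balance : ∀ {g h g′ h′} → g * h ≈ g′ * h′ → ∀ i k u v →
                  siteC g h i k false false u v ≈ siteC g′ h′ i k false false u v
  siteC-balance {g} {h} {g′} {h′} e i k u v = +-congˡ (trans (move g h) (trans (*-congˡ e) (sym (move g′ h′))))
    where
    x = guard (okP i false true v) (pick v (- ξ))
    y = guard (okW true false k u) (pick u ξ)
    move : ∀ g h → guard (okP i false true v) (pick v (- ξ) * h) * guard (okW true false k u) (pick u ξ * g)
           ≈ (x * y) * (g * h)
    move g h = trans (*-cong (guard-* (okP i false true v) _ h) (guard-* (okW true false k u) _ g))
      (solve 4 (λ x h y g → (x :* h) :* (y :* g) := (x :* y) :* (g :* h)) refl x h y g)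

  -- With empty left edges both rows charge for the same occupied middle edges, so `g` and `h` enter
  -- only through their product. A path leaving through the upper row multiplies `g` by t, one
  -- leaving through the lower row multiplies `h` by t; the later colours cannot tell the two apart.
  colC-balance : ∀ {n g h g′ h′} → g * h ≈ g′ * h′ → ∀ (I K U V : Label n) →
                 colC g h I K ∅ ∅ U V ≈ colC g′ h′ I K ∅ ∅ U V
  colC-balance e [] [] [] [] = refl
  colC-balance {suc n} {g} {h} {g′} {h′} e (i ∷ I) (k ∷ K) (u ∷ U) (v ∷ V) = begin
    colC g h (i ∷ I) (k ∷ K) ∅ ∅ (u ∷ U) (v ∷ V)
      ≈⟨ colC-∷ g h i k false false u v I K ∅ ∅ U V ⟩
    siteC g h i k false false u v * colC (pick u t * g) (pick v t * h) I K ∅ ∅ U V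
      ≈⟨ *-cong (siteC-balance e i k u v) (colC-balance (trans (sw _ _ _ _) (trans (*-congˡ e) (sym (sw _ _ _ _)))) I K U V) ⟩
    siteC g′ h′ i k false false u v * colC (pick u t * g′) (pick v t * h′) I K ∅ ∅ U V
      ≈⟨ colC-∷ g′ h′ i k false false u v I K ∅ ∅ U V ⟨
    colC g′ h′ (i ∷ I) (k ∷ K) ∅ ∅ (u ∷ U) (v ∷ V) ∎
    where
    sw : ∀ a b c d → (a * b) * (c * d) ≈ (a * c) * (b * d)
    sw = solve 4 (λ a b c d → (a :* b) :* (c :* d) := (a :* c) :* (b :* d)) refl

  -- The two ways for a particle of the first moving colour to leave the column
  -- carry opposite signs, and cancel when F does not distinguish them.
  column-cancel : ∀ {n} (I K : Label n) (F : Label n → Label n → Carrier) →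
    (∀ {A B A′ B′} → Swap A B A′ B′ → F A B ≈ F A′ B′) → ∀ {g h} → g ≈ 1# → h ≈ 1# →
    ∑² n (λ U V → colC g h I K ∅ ∅ U V * F U V) ≈ guard (eqL I K) (F ∅ ∅)
  column-cancel [] [] F sw p q = solve 1 (λ f → ((((𝟙 :* 𝟙) :+ 𝟘) :* f) :+ 𝟘) :+ 𝟘 := f) refl (F [] [])
  column-cancel {suc n} (i ∷ I) (k ∷ K) F sw {g} {h} p q = begin
    ∑² (suc n) (λ U V → colC g h (i ∷ I) (k ∷ K) ∅ ∅ U V * F U V)
      ≈⟨ ∑²-∷ n _ ⟩
    (bit λ u → bit λ v → ∑² n λ U V → colC g h (i ∷ I) (k ∷ K) ∅ ∅ (u ∷ U) (v ∷ V) * F (u ∷ U) (v ∷ V))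
      ≈⟨ bit²-cong _ X (λ u v → trans (∑²-cong n λ U V → trans (*-congʳ (colC-∷ g h i k false false u v I K ∅ ∅ U V)) (*-assoc _ _ _))
           (sym (*-∑² n _ _))) ⟩
    (bit λ u → bit λ v → X u v)
      ≈⟨ cases i k ⟩
    guard (eqB i k ∧ eqL I K) (F ∅ ∅) ∎
    where
    Y : Bool → Bool → Carrier
    Y u v = ∑² n λ U V → colC (pick u t * g) (pick v t * h) I K ∅ ∅ U V * F (u ∷ U) (v ∷ V)
    X : Bool → Bool → Carrier
    X u v = siteC g h i k false false u v * Y u v
    Y₀₀ : Y false false ≈ guard (eqL I K) (F ∅ ∅)
    Y₀₀ = column-cancel I K (λ A B → F (false ∷ A) (false ∷ B)) (λ s → sw (there false false s))
      (trans (*-identityˡ _) p) (trans (*-identityˡ _) q)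
    Y₁₀ : Y true false ≈ Y false true
    Y₁₀ = ∑²-cong n λ U V → *-cong (colC-balance (solve 3 (λ t g h → (t :* g) :* (𝟙 :* h) := (𝟙 :* g) :* (t :* h)) refl t g h) I K U V)
      (sw here)
    cases : ∀ i k → (bit λ u → bit λ v → siteC g h i k false false u v * Y u v) ≈ guard (eqB i k ∧ eqL I K) (F ∅ ∅)
    cases false false = trans (solve 7 (λ a b c d g h x → (polyC false false false false false false g h x :* a
        :+ polyC false false false false false true g h x :* b)
        :+ (polyC false false false false true false g h x :* c :+ polyC false false false false true true g h x :* d) := a)
      refl (Y false false) _ _ _ g h ξ) Y₀₀
    cases true true = trans (solve 7 (λ a b c d g h x → (polyC true true false false false false g h x :* a
        :+ polyC true true false false false true g h x :* b)
        :+ (polyC true true false false true false g h x :* c :+ polyC true true false false true true g h x :* d) := (g :* h) :* a)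
      refl (Y false false) _ _ _ g h ξ) (trans (*-congʳ (trans (*-cong p q) (*-identityˡ _))) (trans (*-identityˡ _) Y₀₀))
    cases false true = solve 7 (λ a b c d g h x → (polyC false true false false false false g h x :* a
        :+ polyC false true false false false true g h x :* b)
        :+ (polyC false true false false true false g h x :* c :+ polyC false true false false true true g h x :* d) := 𝟘)
      refl (Y false false) _ _ _ g h ξ
    cases true false = trans (solve 7 (λ a b c d g h x → (polyC true false false false false false g h x :* a
        :+ polyC true false false false false true g h x :* b)
        :+ (polyC true false false false true false g h x :* c :+ polyC true false false false true true g h x :* d)
        := x :* ((g :* h) :* c :+ :- b))
      refl (Y false false) _ _ _ g h ξ)
      (trans (*-congˡ (trans (+-congʳ (trans (*-cong (trans (*-cong p q) (*-identityˡ _)) Y₁₀) (*-identityˡ _))) (-‿inverseʳ _))) (zeroʳ ξ))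

  private
    Vp Vw : ∀ {k} → Vertex k
    Vp = purpleV (- ξ) 1#
    Vw = whiteV ξ 1#

  two-swap : ∀ {k} (Is Ks : List (Label k)) → length Is ≡ length Ks → ∀ {A B A′ B′} → Swap A B A′ B′ →
             two Vp Vw B A Is Ks ≈ two Vp Vw B′ A′ Is Ks
  two-swap [] [] eq {A} {B} {A′} {B′} s = trans (two-[] Vp Vw B A) (trans (vanish s) (sym (trans (two-[] Vp Vw B′ A′) (vanish′ s))))
    where
    ind : ∀ {k} → Label k → Carrier
    ind A = if empty? A then 1# else 0#
    vanish : ∀ {k} {A B A′ B′ : Label k} → Swap A B A′ B′ → ind B * ind A ≈ 0#
    vanish here = zeroʳ _
    vanish (there true b s) = zeroʳ _
    vanish (there false true s) = zeroˡ _
    vanish (there false false s) = vanish s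
    vanish′ : ∀ {k} {A B A′ B′ : Label k} → Swap A B A′ B′ → ind B′ * ind A′ ≈ 0#
    vanish′ here = zeroˡ _
    vanish′ (there true b s) = zeroʳ _
    vanish′ (there false true s) = zeroˡ _
    vanish′ (there false false s) = vanish′ s
  two-swap {k} (I ∷ Is) (K ∷ Ks) eq s = trans (two-∷ Vp Vw _ _ I K Is Ks) (trans
    (∑-cong (allLabels k) λ V → ∑-cong (allLabels k) λ U → *-congʳ (colC-swap 1# 1# I K U V s))
    (sym (two-∷ Vp Vw _ _ I K Is Ks)))

  -- Each column cancels by itself: `two-swap` shows that the columns to the right do not
  -- distinguish the two ways out, which is the hypothesis of `column-cancel`. Hence, unlike the
  -- exchange relation, this puts no condition on the first and the last column.
  white-purple : ∀ {k} (Is Ks : List (Label k)) → length Is ≡ length Ks →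
                 two Vp Vw ∅ ∅ Is Ks ≈ (if eqS Is Ks then 1# else 0#)
  white-purple {k} [] [] eq = trans (two-[] {k} Vp Vw ∅ ∅) (trans (*-cong (e k) (e k)) (*-identityˡ _))
    where
    e : ∀ k → (if empty? (∅ {k}) then 1# else 0#) ≈ 1#
    e zero = refl
    e (suc k) = e k
  white-purple {k} (I ∷ Is) (K ∷ Ks) eq = begin
    two Vp Vw ∅ ∅ (I ∷ Is) (K ∷ Ks)
      ≈⟨ trans (two-∷ Vp Vw ∅ ∅ I K Is Ks) (∑²-flip k _) ⟩
    ∑² k (λ U V → colC 1# 1# I K ∅ ∅ U V * two Vp Vw V U Is Ks)
      ≈⟨ column-cancel I K (λ U V → two Vp Vw V U Is Ks) (λ s → two-swap Is Ks (ℕP.suc-injective eq) s) refl refl ⟩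
    guard (eqL I K) (two Vp Vw ∅ ∅ Is Ks)
      ≈⟨ guard-cong (eqL I K) (white-purple Is Ks (ℕP.suc-injective eq)) ⟩
    guard (eqL I K) (if eqS Is Ks then 1# else 0#)
      ≈⟨ nest (eqL I K) (eqS Is Ks) ⟩
    (if eqL I K ∧ eqS Is Ks then 1# else 0#) ∎
    where
    nest : ∀ a b → guard a (if b then 1# else 0#) ≈ (if a ∧ b then 1# else 0#)
    nest false b = refl
    nest true b = refl

-- Formal power series

module Series (R : CommutativeRing 0ℓ 0ℓ) (t t⁻¹ : CommutativeRing.Carrier R) where
  open CommutativeRing R
  open Lattice R t t⁻¹
  open Relation.Binary.Reasoning.Setoid setoid
  open RingSolver R
  open Sums R

  private variable
    V : ℕ

  -- The sum over all pairs (a , b) with a + b = n, written without truncated subtraction. The ring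
  -- laws of series are proved in this form, one variable at a time.
  conv : ℕ → (ℕ → ℕ → Carrier) → Carrier
  conv zero h = h 0 0
  conv (suc n) h = h 0 (suc n) + conv n (λ a b → h (suc a) b)

  conv-cong : ∀ n {h h′ : ℕ → ℕ → Carrier} → (∀ a b → h a b ≈ h′ a b) → conv n h ≈ conv n h′
  conv-cong zero p = p 0 0
  conv-cong (suc n) p = +-cong (p 0 (suc n)) (conv-cong n λ a b → p (suc a) b)

  conv-+ : ∀ n (h h′ : ℕ → ℕ → Carrier) → conv n (λ a b → h a b + h′ a b) ≈ conv n h + conv n h′
  conv-+ zero h h′ = refl
  conv-+ (suc n) h h′ = trans (+-congˡ (conv-+ n _ _))
    (solve 4 (λ a b c d → (a :+ b) :+ (c :+ d) := (a :+ c) :+ (b :+ d)) refl _ _ _ _)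

  conv-right : ∀ n (h : ℕ → ℕ → Carrier) → conv (suc n) h ≈ conv n (λ a b → h a (suc b)) + h (suc n) 0
  conv-right zero h = refl
  conv-right (suc n) h = trans (+-congˡ (conv-right n (λ a b → h (suc a) b))) (sym (+-assoc _ _ _))

  conv-comm : ∀ n (h : ℕ → ℕ → Carrier) → conv n h ≈ conv n (λ a b → h b a)
  conv-comm zero h = refl
  conv-comm (suc n) h = begin
    h 0 (suc n) + conv n (λ a b → h (suc a) b)   ≈⟨ +-congˡ (conv-comm n _) ⟩
    h 0 (suc n) + conv n (λ a b → h (suc b) a)   ≈⟨ +-comm _ _ ⟩
    conv n (λ a b → h (suc b) a) + h 0 (suc n)   ≈⟨ conv-right n (λ a b → h b a) ⟨
    conv (suc n) (λ a b → h b a)                 ∎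

  conv-assoc : ∀ n (F : ℕ → ℕ → ℕ → Carrier) →
    conv n (λ a b → conv a (λ c d → F c d b)) ≈ conv n (λ a b → conv b (λ c d → F a c d))
  conv-assoc zero F = refl
  conv-assoc (suc n) F = begin
    F 0 0 (suc n) + conv n (λ a b → F 0 (suc a) b + conv a (λ c d → F (suc c) d b))
      ≈⟨ +-congˡ (conv-+ n _ _) ⟩
    F 0 0 (suc n) + (conv n (λ a b → F 0 (suc a) b) + conv n (λ a b → conv a (λ c d → F (suc c) d b)))
      ≈⟨ trans (+-congˡ (+-congˡ (conv-assoc n (λ c → F (suc c))))) (sym (+-assoc _ _ _)) ⟩
    conv (suc n) (λ c d → F 0 c d) + conv n (λ a b → conv b (λ c d → F (suc a) c d)) ∎

  conv-upTo : ∀ x (h : ℕ → ℕ → Carrier) → ∑[ a ∈ upTo (suc x) ] h a (x ℕ.∸ a) ≈ conv x h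
  conv-upTo zero h = +-identityʳ _
  conv-upTo (suc x) h = +-congˡ (begin
    ∑[ a ∈ applyUpTo suc (suc x) ] h a (suc x ℕ.∸ a)
      ≡⟨ ≡.cong (λ l → ∑[ a ∈ l ] h a (suc x ℕ.∸ a)) (≡.sym (ListP.map-upTo suc (suc x))) ⟩
    ∑[ a ∈ map suc (upTo (suc x)) ] h a (suc x ℕ.∸ a)
      ≈⟨ ∑-map suc (upTo (suc x)) _ ⟩
    ∑[ a ∈ upTo (suc x) ] h (suc a) (x ℕ.∸ a)
      ≈⟨ conv-upTo x (λ a b → h (suc a) b) ⟩
    conv x (λ a b → h (suc a) b) ∎)

  infix 30 _⟨_⟩
  _⟨_⟩ : FPS (suc V) → ℕ → FPS V
  (f ⟨ a ⟩) e = f (a ∷ e)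

  ⊛-∷ : ∀ (f g : FPS (suc V)) x xs → (f ⊛ g) (x ∷ xs) ≈ conv x (λ a b → (f ⟨ a ⟩ ⊛ g ⟨ b ⟩) xs)
  ⊛-∷ f g x xs = begin
    ∑[ a ∈ below (x ∷ xs) ] (f a * g (zipWith ℕ._∸_ (x ∷ xs) a))
      ≈⟨ ∑-concatMap (λ a → map (a ∷_) (below xs)) (upTo (suc x)) _ ⟩
    ∑[ a ∈ upTo (suc x) ] (∑[ e ∈ map (a ∷_) (below xs) ] (f e * g (zipWith ℕ._∸_ (x ∷ xs) e)))
      ≈⟨ ∑-cong (upTo (suc x)) (λ a → ∑-map (a ∷_) (below xs) _) ⟩
    ∑[ a ∈ upTo (suc x) ] (f ⟨ a ⟩ ⊛ g ⟨ x ℕ.∸ a ⟩) xs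
      ≈⟨ conv-upTo x (λ a b → (f ⟨ a ⟩ ⊛ g ⟨ b ⟩) xs) ⟩
    conv x (λ a b → (f ⟨ a ⟩ ⊛ g ⟨ b ⟩) xs) ∎

  ⊛-cong : ∀ {f f′ g g′ : FPS V} → f ≋ f′ → g ≋ g′ → (f ⊛ g) ≋ (f′ ⊛ g′)
  ⊛-cong p q e = ∑-cong (below e) λ a → *-cong (p a) (q _)

  ⊛-congʳ : ∀ {f f′ : FPS V} → f ≋ f′ → ∀ g → (f ⊛ g) ≋ (f′ ⊛ g)
  ⊛-congʳ p g e = ∑-cong (below e) λ a → *-congʳ (p a)

  ⊛-distribʳ : ∀ (h f g : FPS V) → ((f ⊕ g) ⊛ h) ≋ ((f ⊛ h) ⊕ (g ⊛ h))
  ⊛-distribʳ h f g e = trans (∑-cong (below e) λ a → distribʳ _ _ _) (∑-+ (below e) _ _)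

  ⊛-comm : ∀ (f g : FPS V) → (f ⊛ g) ≋ (g ⊛ f)
  ⊛-comm f g [] = +-congʳ (*-comm _ _)
  ⊛-comm f g (x ∷ xs) = begin
    (f ⊛ g) (x ∷ xs)                            ≈⟨ ⊛-∷ f g x xs ⟩
    conv x (λ a b → (f ⟨ a ⟩ ⊛ g ⟨ b ⟩) xs)    ≈⟨ conv-cong x (λ a b → ⊛-comm (f ⟨ a ⟩) (g ⟨ b ⟩) xs) ⟩
    conv x (λ a b → (g ⟨ b ⟩ ⊛ f ⟨ a ⟩) xs)    ≈⟨ conv-comm x _ ⟩
    conv x (λ a b → (g ⟨ a ⟩ ⊛ f ⟨ b ⟩) xs)    ≈⟨ ⊛-∷ g f x xs ⟨
    (g ⊛ f) (x ∷ xs)                            ∎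

  conv-⊛ : ∀ n (F : ℕ → ℕ → FPS V) (h : FPS V) →
           ((λ e → conv n (λ a b → F a b e)) ⊛ h) ≋ (λ e → conv n (λ a b → (F a b ⊛ h) e))
  conv-⊛ zero F h e = refl
  conv-⊛ (suc n) F h e = trans (⊛-distribʳ h (F 0 (suc n)) _ e) (+-congˡ (conv-⊛ n (λ a b → F (suc a) b) h e))

  ⊛-assoc : ∀ (f g h : FPS V) → ((f ⊛ g) ⊛ h) ≋ (f ⊛ (g ⊛ h))
  ⊛-assoc f g h [] = solve 3 (λ a b c → (a :* b :+ 𝟘) :* c :+ 𝟘 := a :* (b :* c :+ 𝟘) :+ 𝟘) refl _ _ _
  ⊛-assoc f g h (x ∷ xs) = begin
    ((f ⊛ g) ⊛ h) (x ∷ xs)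
      ≈⟨ ⊛-∷ (f ⊛ g) h x xs ⟩
    conv x (λ a b → ((f ⊛ g) ⟨ a ⟩ ⊛ h ⟨ b ⟩) xs)
      ≈⟨ conv-cong x (λ a b → trans (⊛-congʳ (⊛-∷ f g a) (h ⟨ b ⟩) xs) (conv-⊛ a _ (h ⟨ b ⟩) xs)) ⟩
    conv x (λ a b → conv a (λ c d → ((f ⟨ c ⟩ ⊛ g ⟨ d ⟩) ⊛ h ⟨ b ⟩) xs))
      ≈⟨ conv-assoc x _ ⟩
    conv x (λ a b → conv b (λ c d → ((f ⟨ a ⟩ ⊛ g ⟨ c ⟩) ⊛ h ⟨ d ⟩) xs))
      ≈⟨ conv-cong x (λ a b → conv-cong b λ c d → trans (⊛-assoc (f ⟨ a ⟩) (g ⟨ c ⟩) (h ⟨ d ⟩) xs)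
           (⊛-comm (f ⟨ a ⟩) (g ⟨ c ⟩ ⊛ h ⟨ d ⟩) xs)) ⟩
    conv x (λ a b → conv b (λ c d → ((g ⟨ c ⟩ ⊛ h ⟨ d ⟩) ⊛ f ⟨ a ⟩) xs))
      ≈⟨ conv-cong x (λ a b → trans (⊛-comm (f ⟨ a ⟩) _ xs) (trans (⊛-congʳ (⊛-∷ g h b) (f ⟨ a ⟩) xs) (conv-⊛ b _ (f ⟨ a ⟩) xs))) ⟨
    conv x (λ a b → (f ⟨ a ⟩ ⊛ (g ⊛ h) ⟨ b ⟩) xs)
      ≈⟨ ⊛-∷ f (g ⊛ h) x xs ⟨
    (f ⊛ (g ⊛ h)) (x ∷ xs) ∎

  _≟ᵐ_ : (e m : Mono V) → Dec (e ≡ m)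
  _≟ᵐ_ = VecP.≡-dec ℕ._≟_

  monoS-≡ : ∀ c (m : Mono V) → monoS c m m ≈ c
  monoS-≡ c m with m ≟ᵐ m
  ... | yes _ = refl
  ... | no ne = ⊥-elim (ne ≡.refl)

  monoS-≢ : ∀ c {m e : Mono V} → e ≢ m → monoS c m e ≈ 0#
  monoS-≢ c {m} {e} ne with e ≟ᵐ m
  ... | yes p = ⊥-elim (ne p)
  ... | no _ = refl

  minus : ℕ → ℕ → Maybe ℕ
  minus zero x = just x
  minus (suc m) zero = nothing
  minus (suc m) (suc x) = minus m x

  shift : ∀ {A : Set} → Maybe A → (A → Carrier) → Carrier
  shift (just x) f = f x
  shift nothing f = 0#

  quotient : Mono V → Mono V → Maybe (Mono V)
  quotient [] [] = just []
  quotient (m ∷ ms) (x ∷ xs) with minus m x | quotient ms xs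
  ... | just y | just ys = just (y ∷ ys)
  ... | _ | _ = nothing

  conv-single : ∀ x m (h : ℕ → ℕ → Carrier) → (∀ a b → a ≢ m → h a b ≈ 0#) → conv x h ≈ shift (minus m x) (h m)
  conv-single zero zero h p = refl
  conv-single zero (suc m) h p = p 0 0 (λ ())
  conv-single (suc x) zero h p = trans (+-congˡ (vanish x _ λ a b → p (suc a) b λ ())) (+-identityʳ _)
    where
    vanish : ∀ n (h : ℕ → ℕ → Carrier) → (∀ a b → h a b ≈ 0#) → conv n h ≈ 0#
    vanish zero h p = p 0 0
    vanish (suc n) h p = trans (+-cong (p _ _) (vanish n _ λ a b → p _ _)) (+-identityˡ _)
  conv-single (suc x) (suc m) h p = trans (+-congʳ (p 0 _ λ ())) (trans (+-identityˡ _)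
    (conv-single x m (λ a b → h (suc a) b) λ a b ne → p (suc a) b λ eq → ne (ℕP.suc-injective eq)))

  monoS-⟨⟩ : ∀ c m (ms : Mono V) → (monoS c (m ∷ ms)) ⟨ m ⟩ ≋ monoS c ms
  monoS-⟨⟩ c m ms e = by (e ≟ᵐ ms)
    where
    by : Dec (e ≡ ms) → (monoS c (m ∷ ms)) (m ∷ e) ≈ monoS c ms e
    by (yes ≡.refl) = trans (monoS-≡ c (m ∷ e)) (sym (monoS-≡ c e))
    by (no ne) = trans (monoS-≢ c (λ eq → ne (VecP.∷-injectiveʳ eq))) (sym (monoS-≢ c ne))

  zero-⊛ : ∀ {f : FPS V} g → (∀ e → f e ≈ 0#) → ∀ e → (f ⊛ g) e ≈ 0#
  zero-⊛ g p e = ∑-zero (below e) λ a → trans (*-congʳ (p a)) (zeroˡ _)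

  monoS-⊛ : ∀ c (m : Mono V) f e → (monoS c m ⊛ f) e ≈ shift (quotient m e) (λ e′ → c * f e′)
  monoS-⊛ c [] f [] = trans (+-identityʳ _) (*-congʳ (monoS-≡ c []))
  monoS-⊛ c (m ∷ ms) f (x ∷ xs) = begin
    (monoS c (m ∷ ms) ⊛ f) (x ∷ xs)
      ≈⟨ ⊛-∷ _ f x xs ⟩
    conv x (λ a b → (monoS c (m ∷ ms) ⟨ a ⟩ ⊛ f ⟨ b ⟩) xs)
      ≈⟨ conv-single x m _ (λ a b ne → zero-⊛ (f ⟨ b ⟩) (λ e → monoS-≢ c λ eq → ne (VecP.∷-injectiveˡ eq)) xs) ⟩
    shift (minus m x) (λ b → (monoS c (m ∷ ms) ⟨ m ⟩ ⊛ f ⟨ b ⟩) xs)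
      ≈⟨ inner (minus m x) ⟩
    shift (minus m x) (λ y → shift (quotient ms xs) (λ e′ → c * f (y ∷ e′)))
      ≈⟨ merge ⟩
    shift (quotient (m ∷ ms) (x ∷ xs)) (λ e′ → c * f e′) ∎
    where
    inner : ∀ r → shift r (λ b → (monoS c (m ∷ ms) ⟨ m ⟩ ⊛ f ⟨ b ⟩) xs)
                ≈ shift r (λ y → shift (quotient ms xs) (λ e′ → c * f (y ∷ e′)))
    inner nothing = refl
    inner (just b) = trans (⊛-congʳ (monoS-⟨⟩ c m ms) (f ⟨ b ⟩) xs) (monoS-⊛ c ms (f ⟨ b ⟩) xs)
    merge : shift (minus m x) (λ y → shift (quotient ms xs) (λ e′ → c * f (y ∷ e′)))
            ≈ shift (quotient (m ∷ ms) (x ∷ xs)) (λ e′ → c * f e′)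
    merge with minus m x | quotient ms xs
    ... | just y | just ys = refl
    ... | just y | nothing = refl
    ... | nothing | _ = refl

  minus-+ : ∀ m x {y} → minus m x ≡ just y → x ≡ m ℕ.+ y
  minus-+ zero x ≡.refl = ≡.refl
  minus-+ (suc m) (suc x) p = ≡.cong suc (minus-+ m x p)

  quotient-+ : ∀ (m e : Mono V) {e′} → quotient m e ≡ just e′ → e ≡ zipWith ℕ._+_ m e′
  quotient-+ [] [] ≡.refl = ≡.refl
  quotient-+ (m ∷ ms) (x ∷ xs) p with minus m x in eq | quotient ms xs in eqs
  quotient-+ (m ∷ ms) (x ∷ xs) ≡.refl | just y | just ys = ≡.cong₂ _∷_ (minus-+ m x eq) (quotient-+ ms xs eqs)

  minus-of-+ : ∀ m y → minus m (m ℕ.+ y) ≡ just y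
  minus-of-+ zero y = ≡.refl
  minus-of-+ (suc m) y = minus-of-+ m y

  quotient-of-+ : ∀ (m e : Mono V) → quotient m (zipWith ℕ._+_ m e) ≡ just e
  quotient-of-+ [] [] = ≡.refl
  quotient-of-+ (m ∷ ms) (x ∷ xs) rewrite minus-of-+ m x | quotient-of-+ ms xs = ≡.refl

  zipWith-+-injective : ∀ (m : Mono V) {e e′} → zipWith ℕ._+_ m e ≡ zipWith ℕ._+_ m e′ → e ≡ e′
  zipWith-+-injective m {e} {e′} p = just-injective (≡.trans (≡.sym (quotient-of-+ m e))
      (≡.trans (≡.cong (quotient m) p) (quotient-of-+ m e′)))

  monoS-* : ∀ c d (m m′ : Mono V) → (monoS c m ⊛ monoS d m′) ≋ monoS (c * d) (zipWith ℕ._+_ m m′)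
  monoS-* c d m m′ e = trans (monoS-⊛ c m _ e) cases
    where
    cases : shift (quotient m e) (λ e′ → c * monoS d m′ e′) ≈ monoS (c * d) (zipWith ℕ._+_ m m′) e
    cases with quotient m e in eq
    ... | nothing = sym (monoS-≢ (c * d) {zipWith ℕ._+_ m m′} {e} λ p → bad (≡.trans (≡.sym eq) (≡.trans (≡.cong (quotient m) p) (quotient-of-+ m m′))))
      where
      bad : ∀ {x : Mono _} → nothing ≢ just x
      bad ()
    ... | just e′ with e′ ≟ᵐ m′
    ...   | yes ≡.refl rewrite quotient-+ m e eq = sym (monoS-≡ (c * d) (zipWith ℕ._+_ m m′))
    ...   | no ne rewrite quotient-+ m e eq = trans (zeroʳ c) (sym (monoS-≢ _ λ p → ne (zipWith-+-injective m p)))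

  monoS-cong : ∀ {c d} (m : Mono V) → c ≈ d → monoS c m ≋ monoS d m
  monoS-cong m p e with e ≟ᵐ m
  ... | yes _ = p
  ... | no _ = refl

  zeros : Mono V
  zeros = replicate _ 0

  quotient-zeros : ∀ (e : Mono V) → quotient zeros e ≡ just e
  quotient-zeros [] = ≡.refl
  quotient-zeros (x ∷ xs) rewrite quotient-zeros xs = ≡.refl

  const-⊛ : ∀ c (f : FPS V) e → (monoS c zeros ⊛ f) e ≈ c * f e
  const-⊛ c f e = trans (monoS-⊛ c zeros f e) (reflexive (≡.cong (λ r → shift r (λ e′ → c * f e′)) (quotient-zeros e)))

  ⊛-identityˡ : ∀ (f : FPS V) → (oneS ⊛ f) ≋ f
  ⊛-identityˡ f e = trans (const-⊛ 1# f e) (*-identityˡ _)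

  seriesRing : ℕ → CommutativeRing 0ℓ 0ℓ
  seriesRing V = record
    { Carrier = FPS V ; _≈_ = _≋_ ; _+_ = _⊕_ ; _*_ = _⊛_ ; -_ = λ f e → - f e ; 0# = zeroS ; 1# = oneS
    ; isCommutativeRing = record
      { isRing = record
        { +-isAbelianGroup = record
          { isGroup = record
            { isMonoid = record
              { isSemigroup = record
                { isMagma = record
                  { isEquivalence = record
                    { refl = λ _ → refl ; sym = λ p e → sym (p e) ; trans = λ p q e → trans (p e) (q e) }
                  ; ∙-cong = λ p q e → +-cong (p e) (q e) }
                ; assoc = λ f g h e → +-assoc _ _ _ }
              ; identity = (λ f e → +-identityˡ _) , λ f e → +-identityʳ _ }
            ; inverse = (λ f e → -‿inverseˡ _) , λ f e → -‿inverseʳ _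
            ; ⁻¹-cong = λ p e → -‿cong (p e) }
          ; comm = λ f g e → +-comm _ _ }
        ; *-cong = ⊛-cong
        ; *-assoc = ⊛-assoc
        ; *-identity = ⊛-identityˡ , λ f e → trans (⊛-comm f oneS e) (⊛-identityˡ f e)
        ; distrib = (λ f g h e → trans (⊛-comm f (g ⊕ h) e) (trans (⊛-distribʳ f g h e) (+-cong (⊛-comm g f e) (⊛-comm h f e))))
                  , ⊛-distribʳ }
      ; *-comm = ⊛-comm } }

  Ord : ℕ → FPS V → Set
  Ord d f = ∀ e → Vec.sum e < d → f e ≈ 0#

  -- f is homogeneous of degree n - m; the two numbers are kept apart so that
  -- nothing is truncated when n < m.
  Hom : ℕ → ℕ → FPS V → Set
  Hom m n f = ∀ e → Vec.sum e ℕ.+ m ≢ n → f e ≈ 0#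

  below-sum : ∀ (e : Mono V) → All (λ a → Vec.sum a ℕ.+ Vec.sum (zipWith ℕ._∸_ e a) ≡ Vec.sum e) (below e)
  below-sum [] = ≡.refl ∷ []
  below-sum (x ∷ xs) = AllP.concat⁺ (AllP.map⁺ (AllP.applyUpTo⁺₁ (λ a → a) (suc x) λ {a} a≤x →
    AllP.map⁺ (All.map (λ {as} eq → lem a (ℕP.≤-pred a≤x) as eq) (below-sum xs))))
    where
    lem : ∀ a → a ≤ x → ∀ as → Vec.sum as ℕ.+ Vec.sum (zipWith ℕ._∸_ xs as) ≡ Vec.sum xs →
          (a ℕ.+ Vec.sum as) ℕ.+ ((x ℕ.∸ a) ℕ.+ Vec.sum (zipWith ℕ._∸_ xs as)) ≡ x ℕ.+ Vec.sum xs
    lem a a≤x as eq = ≡.trans (sw a (Vec.sum as) (x ℕ.∸ a) _)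
      (≡.cong₂ ℕ._+_ (ℕP.m+[n∸m]≡n a≤x) eq)
      where
      sw : ∀ a b c d → (a ℕ.+ b) ℕ.+ (c ℕ.+ d) ≡ (a ℕ.+ c) ℕ.+ (b ℕ.+ d)
      sw a b c d = ≡.trans (ℕP.+-assoc a b _) (≡.trans (≡.cong (a ℕ.+_) (≡.trans (≡.sym (ℕP.+-assoc b c d))
        (≡.trans (≡.cong (ℕ._+ d) (ℕP.+-comm b c)) (ℕP.+-assoc c b d)))) (≡.sym (ℕP.+-assoc a c _)))

  ⊛-zero : ∀ (f g : FPS V) e → (∀ a → Vec.sum a ℕ.+ Vec.sum (zipWith ℕ._∸_ e a) ≡ Vec.sum e →
           f a ≈ 0# ⊎ g (zipWith ℕ._∸_ e a) ≈ 0#) → (f ⊛ g) e ≈ 0#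
  ⊛-zero f g e p = ∑-zero-All (All.map (λ {a} eq → by (p a eq)) (below-sum e))
    where
    by : ∀ {x y} → x ≈ 0# ⊎ y ≈ 0# → x * y ≈ 0#
    by (inj₁ q) = trans (*-congʳ q) (zeroˡ _)
    by (inj₂ q) = trans (*-congˡ q) (zeroʳ _)

  ⊛-cong-below : ∀ {f f′ g g′ : FPS V} e → (∀ a → Vec.sum a ≤ Vec.sum e → f a ≈ f′ a) →
    (∀ a → Vec.sum a ≤ Vec.sum e → g a ≈ g′ a) → (f ⊛ g) e ≈ (f′ ⊛ g′) e
  ⊛-cong-below e p q = ∑-cong-All (All.map (λ {a} eq → *-cong
    (p a (ℕP.≤-trans (ℕP.m≤m+n _ _) (ℕP.≤-reflexive eq)))
    (q _ (ℕP.≤-trans (ℕP.m≤n+m _ _) (ℕP.≤-reflexive eq)))) (below-sum e))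

  Hom-* : ∀ {l m n} {f g : FPS V} → Hom l m f → Hom m n g → Hom l n (f ⊛ g)
  Hom-* {l = l} {m} {n} {f} {g} p q e ne = ⊛-zero f g e λ a eq → split a eq
    where
    split : ∀ a → Vec.sum a ℕ.+ Vec.sum (zipWith ℕ._∸_ e a) ≡ Vec.sum e → f a ≈ 0# ⊎ g (zipWith ℕ._∸_ e a) ≈ 0#
    split a eq with Vec.sum a ℕ.+ l ℕ.≟ m
    ... | no ne′ = inj₁ (p a ne′)
    ... | yes ≡.refl = inj₂ (q _ λ eq′ → ne (≡.trans (≡.cong (ℕ._+ l) (≡.trans (≡.sym eq) (ℕP.+-comm (Vec.sum a) _)))
            (≡.trans (ℕP.+-assoc _ (Vec.sum a) l) eq′)))

-- Conserved quantities and the duals of rows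

open +-*-Solver using () renaming (solve to nsolve; _:=_ to _≔_; _:+_ to _⊹_; _:*_ to _⊗_)

bv : Label k → Vec ℕ k
bv = Vec.map b2n

infixl 6 _+ᵛ_
_+ᵛ_ : Vec ℕ k → Vec ℕ k → Vec ℕ k
_+ᵛ_ = zipWith ℕ._+_

-- The form φ of the paper, on arbitrary vectors of naturals.
φᵛ : Vec ℕ k → Vec ℕ k → ℕ
φᵛ [] [] = 0
φᵛ (x ∷ xs) (y ∷ ys) = x ℕ.* Vec.sum ys ℕ.+ φᵛ xs ys

sum-+ᵛ : ∀ (x y : Vec ℕ k) → Vec.sum (x +ᵛ y) ≡ Vec.sum x ℕ.+ Vec.sum y
sum-+ᵛ [] [] = ≡.refl
sum-+ᵛ (x ∷ xs) (y ∷ ys) = ≡.trans (≡.cong (x ℕ.+ y ℕ.+_) (sum-+ᵛ xs ys))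
  (nsolve 4 (λ x y a b → (x ⊹ y) ⊹ (a ⊹ b) ≔ (x ⊹ a) ⊹ (y ⊹ b)) ≡.refl x y _ _)

φᵛ-+ˡ : ∀ (x y z : Vec ℕ k) → φᵛ (x +ᵛ y) z ≡ φᵛ x z ℕ.+ φᵛ y z
φᵛ-+ˡ [] [] [] = ≡.refl
φᵛ-+ˡ (x ∷ xs) (y ∷ ys) (z ∷ zs) = ≡.trans (≡.cong ((x ℕ.+ y) ℕ.* Vec.sum zs ℕ.+_) (φᵛ-+ˡ xs ys zs))
  (nsolve 5 (λ x y s a b → (x ⊹ y) ⊗ s ⊹ (a ⊹ b) ≔ (x ⊗ s ⊹ a) ⊹ (y ⊗ s ⊹ b)) ≡.refl x y (Vec.sum zs) _ _)

φᵛ-+ʳ : ∀ (x y z : Vec ℕ k) → φᵛ x (y +ᵛ z) ≡ φᵛ x y ℕ.+ φᵛ x z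
φᵛ-+ʳ [] [] [] = ≡.refl
φᵛ-+ʳ (x ∷ xs) (y ∷ ys) (z ∷ zs) = ≡.trans (≡.cong₂ (λ s r → x ℕ.* s ℕ.+ r) (sum-+ᵛ ys zs) (φᵛ-+ʳ xs ys zs))
  (nsolve 5 (λ x s s′ a b → x ⊗ (s ⊹ s′) ⊹ (a ⊹ b) ≔ (x ⊗ s ⊹ a) ⊹ (x ⊗ s′ ⊹ b)) ≡.refl x (Vec.sum ys) (Vec.sum zs) _ _)

zeroᵛ : Vec ℕ k
zeroᵛ = replicate _ 0

φᵛ-0ˡ : ∀ (x : Vec ℕ k) → φᵛ zeroᵛ x ≡ 0
φᵛ-0ˡ [] = ≡.refl
φᵛ-0ˡ (x ∷ xs) = φᵛ-0ˡ xs

sum-0ᵛ : ∀ k → Vec.sum (zeroᵛ {k}) ≡ 0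
sum-0ᵛ zero = ≡.refl
sum-0ᵛ (suc k) = sum-0ᵛ k

φᵛ-0ʳ : ∀ (x : Vec ℕ k) → φᵛ x zeroᵛ ≡ 0
φᵛ-0ʳ [] = ≡.refl
φᵛ-0ʳ {suc k} (x ∷ xs) rewrite sum-0ᵛ k | ℕP.*-zeroʳ x = φᵛ-0ʳ xs

bv-∅ : ∀ k → bv (∅ {k}) ≡ zeroᵛ
bv-∅ zero = ≡.refl
bv-∅ (suc k) = ≡.cong (0 ∷_) (bv-∅ k)

+ᵛ-identityʳ : ∀ (x : Vec ℕ k) → x +ᵛ zeroᵛ ≡ x
+ᵛ-identityʳ = VecP.zipWith-identityʳ ℕP.+-identityʳ

+ᵛ-comm : ∀ (x y : Vec ℕ k) → x +ᵛ y ≡ y +ᵛ x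
+ᵛ-comm = VecP.zipWith-comm ℕP.+-comm

+ᵛ-assoc : ∀ (x y z : Vec ℕ k) → (x +ᵛ y) +ᵛ z ≡ x +ᵛ (y +ᵛ z)
+ᵛ-assoc = VecP.zipWith-assoc ℕP.+-assoc

-- Particle counts, the sum of all particle positions, and the statistic N
-- counting pairs of colours a < b with the particle of colour a to the right.
counts : List (Label k) → Vec ℕ k
counts [] = zeroᵛ
counts (I ∷ Is) = bv I +ᵛ counts Is

energy : List (Label k) → ℕ
energy [] = 0
energy (I ∷ Is) = Vec.sum (counts Is) ℕ.+ energy Is

crossings : List (Label k) → ℕ
crossings [] = 0
crossings (I ∷ Is) = φᵛ (counts Is) (bv I) ℕ.+ crossings Is

module _ where
  open ≡.≡-Reasoning

  counts-step : ∀ (I J K L : Vec ℕ k) {cI cK} → I +ᵛ J ≡ K +ᵛ L → cK ≡ cI +ᵛ L → K +ᵛ cK ≡ (I +ᵛ cI) +ᵛ J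
  counts-step I J K L {cI} {cK} p q = begin
    K +ᵛ cK            ≡⟨ ≡.cong (K +ᵛ_) (≡.trans q (+ᵛ-comm _ _)) ⟩
    K +ᵛ (L +ᵛ cI)    ≡⟨ +ᵛ-assoc K L _ ⟨
    (K +ᵛ L) +ᵛ cI    ≡⟨ ≡.cong (_+ᵛ cI) p ⟨
    (I +ᵛ J) +ᵛ cI    ≡⟨ ≡.trans (+ᵛ-assoc I _ _) (≡.trans (≡.cong (I +ᵛ_) (+ᵛ-comm _ _)) (≡.sym (+ᵛ-assoc I _ _))) ⟩
    (I +ᵛ cI) +ᵛ J    ∎

  -- The exponents of t in one column of the summation by parts. Conservation at the vertex rewrites
  -- φ(cI, I + L) as φ(cI, K + J), conservation in the rest of the row splits cI into cK + L, and
  -- then both sides consist of the same values of φ.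
  adjoint-exponent : ∀ (I J K L cI cK : Vec ℕ k) c → K +ᵛ J ≡ I +ᵛ L → cI ≡ cK +ᵛ L →
    φᵛ (I +ᵛ L) J ℕ.+ (c ℕ.+ φᵛ cI L ℕ.+ φᵛ cI I) ≡ φᵛ L (K +ᵛ J) ℕ.+ (φᵛ cK K ℕ.+ c ℕ.+ φᵛ (I +ᵛ cI) J)
  adjoint-exponent I J K L cI cK c p q = begin
    φᵛ (I +ᵛ L) J ℕ.+ (c ℕ.+ φᵛ cI L ℕ.+ φᵛ cI I)
      ≡⟨ ≡.cong₂ (λ a b → a ℕ.+ b) (φᵛ-+ˡ I L J) (≡.trans (ℕP.+-assoc c _ _) (≡.cong (c ℕ.+_)
           (≡.trans (ℕP.+-comm (φᵛ cI L) _) (≡.trans (≡.sym (φᵛ-+ʳ cI I L)) (≡.trans (≡.cong (φᵛ cI) (≡.sym p)) (φᵛ-+ʳ cI K J)))))) ⟩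
    (φᵛ I J ℕ.+ φᵛ L J) ℕ.+ (c ℕ.+ (φᵛ cI K ℕ.+ φᵛ cI J))
      ≡⟨ ≡.cong (λ d → (φᵛ I J ℕ.+ φᵛ L J) ℕ.+ (c ℕ.+ (d ℕ.+ φᵛ cI J))) (≡.trans (≡.cong (λ d → φᵛ d K) q) (φᵛ-+ˡ cK L K)) ⟩
    (φᵛ I J ℕ.+ φᵛ L J) ℕ.+ (c ℕ.+ ((φᵛ cK K ℕ.+ φᵛ L K) ℕ.+ φᵛ cI J))
      ≡⟨ nsolve 6 (λ ij lj c kk lk cj → (ij ⊹ lj) ⊹ (c ⊹ ((kk ⊹ lk) ⊹ cj)) ≔ (lk ⊹ lj) ⊹ ((kk ⊹ c) ⊹ (ij ⊹ cj))) ≡.refl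
           (φᵛ I J) (φᵛ L J) c (φᵛ cK K) (φᵛ L K) (φᵛ cI J) ⟩
    (φᵛ L K ℕ.+ φᵛ L J) ℕ.+ ((φᵛ cK K ℕ.+ c) ℕ.+ (φᵛ I J ℕ.+ φᵛ cI J))
      ≡⟨ ≡.cong₂ (λ a b → a ℕ.+ ((φᵛ cK K ℕ.+ c) ℕ.+ b)) (≡.sym (φᵛ-+ʳ L K J)) (≡.sym (φᵛ-+ˡ I cI J)) ⟩
    φᵛ L (K +ᵛ J) ℕ.+ (φᵛ cK K ℕ.+ c ℕ.+ φᵛ (I +ᵛ cI) J) ∎

okAllW okAllP : (I J K L : Label k) → Bool
okAllW [] [] [] [] = true
okAllW (i ∷ I) (j ∷ J) (k ∷ K) (l ∷ L) = okW i j k l ∧ okAllW I J K L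
okAllP [] [] [] [] = true
okAllP (i ∷ I) (j ∷ J) (k ∷ K) (l ∷ L) = okP i j k l ∧ okAllP I J K L

private
  ⌊⌋-true : ∀ {A : Set} (d : Dec A) → ⌊ d ⌋ ≡ true → A
  ⌊⌋-true (yes a) _ = a

  ∧-split : ∀ {a b} → a ∧ b ≡ true → a ≡ true × b ≡ true
  ∧-split {true} p = ≡.refl , p

okW-balanced : ∀ i j k l → okW i j k l ≡ true → b2n i ℕ.+ b2n j ≡ b2n k ℕ.+ b2n l
okW-balanced i j k l p = ⌊⌋-true (b2n i ℕ.+ b2n j ℕ.≟ b2n k ℕ.+ b2n l) (proj₁ (∧-split p))

okP-balanced : ∀ i j k l → okP i j k l ≡ true → b2n i ℕ.+ b2n j ≡ b2n k ℕ.+ b2n l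
okP-balanced i j k l p = ⌊⌋-true (b2n i ℕ.+ b2n j ℕ.≟ b2n k ℕ.+ b2n l) (proj₁ (∧-split p))

okAllW-balanced : ∀ (I J K L : Label k) → okAllW I J K L ≡ true → bv I +ᵛ bv J ≡ bv K +ᵛ bv L
okAllW-balanced [] [] [] [] p = ≡.refl
okAllW-balanced (i ∷ I) (j ∷ J) (k ∷ K) (l ∷ L) p =
  ≡.cong₂ _∷_ (okW-balanced i j k l (proj₁ (∧-split p))) (okAllW-balanced I J K L (proj₂ (∧-split {okW i j k l} p)))

okAllP-balanced : ∀ (I J K L : Label k) → okAllP I J K L ≡ true → bv I +ᵛ bv J ≡ bv K +ᵛ bv L
okAllP-balanced [] [] [] [] p = ≡.refl
okAllP-balanced (i ∷ I) (j ∷ J) (k ∷ K) (l ∷ L) p =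
  ≡.cong₂ _∷_ (okP-balanced i j k l (proj₁ (∧-split p))) (okAllP-balanced I J K L (proj₂ (∧-split {okP i j k l} p)))

-- Closed forms of the vertex weights and adjoint rows

module ClosedForms (K : CommutativeRing 0ℓ 0ℓ) (t : CommutativeRing.Carrier K) where
  open CommutativeRing K
  open Relation.Binary.Reasoning.Setoid setoid
  open RingSolver K
  open Rows K
  open VertexWeights K t
  open SiteWeights _+_ _*_ -_ 0# 1#

  guard-** : ∀ a b {x y z} → (a ≡ true → x * y ≈ z) → guard a x * guard b y ≈ guard (a ∧ b) z
  guard-** false b h = zeroˡ _
  guard-** true false h = zeroʳ _
  guard-** true true h = h ≡.refl

  pick-^ : ∀ b x → pick b x ≈ x ^ b2n b
  pick-^ false x = refl
  pick-^ true x = sym (*-identityʳ x)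

  ^-* : ∀ x m n → (x ^ m) ^ n ≈ x ^ (n ℕ.* m)
  ^-* x m zero = refl
  ^-* x m (suc n) = trans (*-congˡ (^-* x m n)) (sym (^-+ x m (n ℕ.* m)))

  ^-cong : ∀ {x y} n → x ≈ y → x ^ n ≈ y ^ n
  ^-cong zero p = refl
  ^-cong (suc n) p = *-cong p (^-cong n p)

  pick-pow : ∀ b a → pick b (t ^ a) ≈ t ^ (b2n b ℕ.* a)
  pick-pow b a = trans (pick-^ b _) (^-* t a (b2n b))

  ws-^ : ∀ {k} (J : Label k) → ws t J ≈ t ^ Vec.sum (bv J)
  ws-^ [] = refl
  ws-^ (j ∷ J) = trans (*-cong (pick-^ j t) (ws-^ J)) (sym (^-+ t (b2n j) _))

  acc-^ : ∀ l a → pick l t * t ^ a ≈ t ^ (b2n l ℕ.+ a)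
  acc-^ l a = trans (*-congʳ (pick-^ l t)) (sym (^-+ t (b2n l) a))

  step-^ : ∀ ξ l a e f {s} → s ≡ a ℕ.+ e → (pick l ξ * t ^ a) * (ξ ^ f * t ^ e) ≈ ξ ^ (b2n l ℕ.+ f) * t ^ s
  step-^ ξ l a e f {s} ≡.refl = begin
    (pick l ξ * t ^ a) * (ξ ^ f * t ^ e)       ≈⟨ solve 4 (λ x a y e → (x :* a) :* (y :* e) := (x :* y) :* (a :* e)) refl _ _ _ _ ⟩
    (pick l ξ * ξ ^ f) * (t ^ a * t ^ e)       ≈⟨ *-cong (trans (*-congʳ (pick-^ l ξ)) (sym (^-+ ξ (b2n l) f))) (sym (^-+ t a e)) ⟩
    ξ ^ (b2n l ℕ.+ f) * t ^ (a ℕ.+ e)          ∎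

  -- The exponent `a` must be general for the induction: a path of the first colour on the right
  -- edge raises it by one for all later colours, which produces the terms L_c (I_d + J_d) with c <
  -- d of φ.
  whiteV-closed : ∀ {k} ξ a (I J K L : Label k) → whiteV ξ (t ^ a) I J K L
    ≈ guard (okAllW I J K L) (ξ ^ Vec.sum (bv L) * t ^ (a ℕ.* Vec.sum (bv I +ᵛ bv J) ℕ.+ φᵛ (bv L) (bv I +ᵛ bv J)))
  whiteV-closed ξ a [] [] [] [] = sym (trans (*-identityˡ _) (reflexive (≡.cong (λ e → t ^ (e ℕ.+ 0)) (ℕP.*-zeroʳ a))))
  whiteV-closed ξ a (i ∷ I) (j ∷ J) (k ∷ K) (l ∷ L) =
    trans (*-congˡ (trans (whiteV-cong refl (acc-^ l a) I J K L) (whiteV-closed ξ (b2n l ℕ.+ a) I J K L)))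
          (guard-** (okW i j k l) (okAllW I J K L) λ okV → trans
            (*-congʳ (*-congˡ (pick-pow (i ∨ j) a)))
            (step-^ ξ l (b2n (i ∨ j) ℕ.* a) _ (Vec.sum (bv L)) (exponent i j okV)))
    where
    s = Vec.sum (bv I +ᵛ bv J)
    p = φᵛ (bv L) (bv I +ᵛ bv J)
    ∨-+ : ∀ i j k l → okW i j k l ≡ true → b2n i ℕ.+ b2n j ≡ b2n (i ∨ j)
    ∨-+ false j k l okV = ≡.refl
    ∨-+ true false k l okV = ≡.refl
    ∨-+ true true true true ()
    ∨-+ true true true false ()
    ∨-+ true true false true ()
    ∨-+ true true false false ()
    exponent : ∀ i j → okW i j k l ≡ true →
      a ℕ.* (b2n i ℕ.+ b2n j ℕ.+ s) ℕ.+ (b2n l ℕ.* s ℕ.+ p) ≡ b2n (i ∨ j) ℕ.* a ℕ.+ ((b2n l ℕ.+ a) ℕ.* s ℕ.+ p)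
    exponent i j okV = ≡.trans (≡.cong (λ m → a ℕ.* (m ℕ.+ s) ℕ.+ (b2n l ℕ.* s ℕ.+ p)) (∨-+ i j k l okV))
      (nsolve 5 (λ a m s l p → a ⊗ (m ⊹ s) ⊹ (l ⊗ s ⊹ p) ≔ m ⊗ a ⊹ ((l ⊹ a) ⊗ s ⊹ p)) ≡.refl a (b2n (i ∨ j)) s (b2n l) p)

  monus : Label k → Label k → Vec ℕ k
  monus K J = zipWith (λ a b → b2n a ℕ.∸ b2n b) K J

  purpleV-closed : ∀ {k} ξ a (I J K L : Label k) → purpleV ξ (t ^ a) I J K L
    ≈ guard (okAllP I J K L) (ξ ^ Vec.sum (bv L) * t ^ (a ℕ.* Vec.sum (monus K J) ℕ.+ φᵛ (bv L) (monus K J)))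
  purpleV-closed ξ a [] [] [] [] = sym (trans (*-identityˡ _) (reflexive (≡.cong (λ e → t ^ (e ℕ.+ 0)) (ℕP.*-zeroʳ a))))
  purpleV-closed ξ a (i ∷ I) (j ∷ J) (k ∷ K) (l ∷ L) =
    trans (*-congˡ (trans (purpleV-cong refl (acc-^ l a) I J K L) (purpleV-closed ξ (b2n l ℕ.+ a) I J K L)))
          (guard-** (okP i j k l) (okAllP I J K L) λ okV → trans
            (*-congʳ (*-congˡ (pick-pow (k ∧ not j) a)))
            (step-^ ξ l (b2n (k ∧ not j) ℕ.* a) _ (Vec.sum (bv L)) (exponent k j)))
    where
    s = Vec.sum (monus K J)
    p = φᵛ (bv L) (monus K J)
    ∸-∧ : ∀ k j → b2n k ℕ.∸ b2n j ≡ b2n (k ∧ not j)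
    ∸-∧ false false = ≡.refl
    ∸-∧ false true = ≡.refl
    ∸-∧ true false = ≡.refl
    ∸-∧ true true = ≡.refl
    exponent : ∀ k j → a ℕ.* (b2n k ℕ.∸ b2n j ℕ.+ s) ℕ.+ (b2n l ℕ.* s ℕ.+ p)
               ≡ b2n (k ∧ not j) ℕ.* a ℕ.+ ((b2n l ℕ.+ a) ℕ.* s ℕ.+ p)
    exponent k j = ≡.trans (≡.cong (λ m → a ℕ.* (m ℕ.+ s) ℕ.+ (b2n l ℕ.* s ℕ.+ p)) (∸-∧ k j))
      (nsolve 5 (λ a m s l p → a ⊗ (m ⊹ s) ⊹ (l ⊗ s ⊹ p) ≔ m ⊗ a ⊹ ((l ⊹ a) ⊗ s ⊹ p)) ≡.refl a (b2n (k ∧ not j)) s (b2n l) p)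

  -- The two halves of φ(I + L, J) are collected in opposite directions: L acts on the later colours
  -- of J through the accumulated exponent, while I is charged at once for all later colours of J
  -- through `ws t J`.
  dualV-closed : ∀ {k} ω a (I J K L : Label k) → dualV ω (t ^ a) I J K L
    ≈ guard (okAllW K J I L) (ω ^ Vec.sum (bv L) * t ^ (a ℕ.* Vec.sum (bv J) ℕ.+ φᵛ (bv I +ᵛ bv L) (bv J)))
  dualV-closed ω a [] [] [] [] = sym (trans (*-identityˡ _) (reflexive (≡.cong (λ e → t ^ (e ℕ.+ 0)) (ℕP.*-zeroʳ a))))
  dualV-closed ω a (i ∷ I) (j ∷ J) (k ∷ K) (l ∷ L) =
    trans (*-congˡ (trans (dualV-cong (acc-^ l a) I J K L) (dualV-closed ω (b2n l ℕ.+ a) I J K L)))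
          (guard-** (okW k j i l) (okAllW K J I L) λ okV → trans
            (*-congʳ (*-congˡ (trans (*-cong (pick-pow j a) (trans (pick-cong i (ws-^ J)) (pick-pow i s))) (sym (^-+ t (b2n j ℕ.* a) _)))))
            (step-^ ω l (b2n j ℕ.* a ℕ.+ b2n i ℕ.* s) _ (Vec.sum (bv L))
              (nsolve 6 (λ a j s i l p → a ⊗ (j ⊹ s) ⊹ ((i ⊹ l) ⊗ s ⊹ p) ≔ (j ⊗ a ⊹ i ⊗ s) ⊹ ((l ⊹ a) ⊗ s ⊹ p)) ≡.refl a (b2n j) s (b2n i) (b2n l) p)))
    where
    s = Vec.sum (bv J)
    p = φᵛ (bv I +ᵛ bv L) (bv J)

  Conservative : Vertex k → Set
  Conservative V = ∀ I J K L → bv I +ᵛ bv J ≢ bv K +ᵛ bv L → V I J K L ≈ 0#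

  guard-conservative : ∀ {b x} {A : Set} → (b ≡ true → A) → ¬ A → guard b x ≈ 0#
  guard-conservative {false} h ne = refl
  guard-conservative {true} h ne = ⊥-elim (ne (h ≡.refl))

  whiteV-conservative : ∀ {k} ξ → Conservative {k} (whiteV ξ 1#)
  whiteV-conservative ξ I J K L ne = trans (whiteV-closed ξ 0 I J K L) (guard-conservative (okAllW-balanced I J K L) ne)

  purpleV-conservative : ∀ {k} ξ → Conservative {k} (purpleV ξ 1#)
  purpleV-conservative ξ I J K L ne = trans (purpleV-closed ξ 0 I J K L) (guard-conservative (okAllP-balanced I J K L) ne)

  empty⇒∅ : ∀ {k} (J : Label k) → empty? J ≡ true → J ≡ ∅
  empty⇒∅ [] p = ≡.refl
  empty⇒∅ (false ∷ J) p = ≡.cong (false ∷_) (empty⇒∅ J p)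

  row-counts : ∀ {k} {V : Vertex k} → Conservative V → ∀ J Is Ks →
    counts Ks ≢ counts Is +ᵛ bv J → row V J Is Ks ≈ 0#
  row-counts {k} cons J [] [] ne with empty? J in eJ
  ... | false = refl
  ... | true rewrite empty⇒∅ J eJ = ⊥-elim (ne (≡.sym (≡.trans (≡.cong (zeroᵛ +ᵛ_) (bv-∅ k)) (+ᵛ-identityʳ zeroᵛ))))
  row-counts cons J [] (_ ∷ _) ne = refl
  row-counts cons J (_ ∷ _) [] ne = refl
  row-counts {k} {V} cons J (I ∷ Is) (K ∷ Ks) ne = ∑-zero (allLabels k) λ L → by L
    where
    by : ∀ L → V I J K L * row V L Is Ks ≈ 0#
    by L with VecP.≡-dec ℕ._≟_ (bv I +ᵛ bv J) (bv K +ᵛ bv L) | VecP.≡-dec ℕ._≟_ (counts Ks) (counts Is +ᵛ bv L)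
    ... | no ne₁ | _ = trans (*-congʳ (cons I J K L ne₁)) (zeroˡ _)
    ... | yes _ | no ne₂ = trans (*-congˡ (row-counts cons L Is Ks ne₂)) (zeroʳ _)
    ... | yes p | yes q = ⊥-elim (ne (counts-step (bv I) (bv J) (bv K) (bv L) p q))

  -- Summation by parts: conjugating the transposed white row by t ^ crossings
  -- turns it into the row with local weights dualV.
  row-adjoint : ∀ {k} ω J (Is Ks : List (Label k)) →
    row (dualV ω 1#) J Is Ks * t ^ crossings Is ≈ row (whiteV ω 1#) J Ks Is * t ^ (crossings Ks ℕ.+ φᵛ (counts Is) (bv J))
  row-adjoint {k} ω J [] [] = *-congˡ (reflexive (≡.cong (t ^_) (≡.sym (φᵛ-0ˡ (bv J)))))
  row-adjoint ω J [] (_ ∷ _) = trans (zeroˡ _) (sym (zeroˡ _))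
  row-adjoint ω J (_ ∷ _) [] = trans (zeroˡ _) (sym (zeroˡ _))
  row-adjoint {k} ω J (I ∷ Is) (K ∷ Ks) =
    trans (∑-* (allLabels k) _ _) (trans (∑-cong (allLabels k) term) (sym (∑-* (allLabels k) _ _)))
    where
    cI = counts Is
    cK = counts Ks
    x : Label k → Carrier
    x L = ω ^ Vec.sum (bv L)
    e₁ = λ (L : Label k) → φᵛ (bv I +ᵛ bv L) (bv J)
    e₂ = λ (L : Label k) → φᵛ (bv L) (bv K +ᵛ bv J)
    term : ∀ L → dualV ω 1# I J K L * row (dualV ω 1#) L Is Ks * t ^ (φᵛ cI (bv I) ℕ.+ crossings Is)
           ≈ whiteV ω 1# K J I L * row (whiteV ω 1#) L Ks Is * t ^ (φᵛ cK (bv K) ℕ.+ crossings Ks ℕ.+ φᵛ (bv I +ᵛ cI) (bv J))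
    term L = begin
      dualV ω 1# I J K L * row (dualV ω 1#) L Is Ks * t ^ (φᵛ cI (bv I) ℕ.+ crossings Is)
        ≈⟨ *-cong (*-congʳ (dualV-closed ω 0 I J K L)) (trans (reflexive (≡.cong (t ^_) (ℕP.+-comm (φᵛ cI (bv I)) (crossings Is)))) (^-+ t (crossings Is) _)) ⟩
      guard okV (x L * t ^ e₁ L) * row (dualV ω 1#) L Is Ks * (t ^ crossings Is * t ^ φᵛ cI (bv I))
        ≈⟨ solve 4 (λ a b c d → (a :* b) :* (c :* d) := a :* ((b :* c) :* d)) refl _ _ _ _ ⟩
      guard okV (x L * t ^ e₁ L) * (row (dualV ω 1#) L Is Ks * t ^ crossings Is * t ^ φᵛ cI (bv I))
        ≈⟨ *-congˡ (trans (*-congʳ (row-adjoint ω L Is Ks)) (trans (*-assoc _ _ _) (*-congˡ (sym (^-+ t (crossings Ks ℕ.+ φᵛ cI (bv L)) (φᵛ cI (bv I))))))) ⟩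
      guard okV (x L * t ^ e₁ L) * (row (whiteV ω 1#) L Ks Is * t ^ (crossings Ks ℕ.+ φᵛ cI (bv L) ℕ.+ φᵛ cI (bv I)))
        ≈⟨ swap (okAllW-balanced K J I L) ⟩
      guard okV (x L * t ^ e₂ L) * row (whiteV ω 1#) L Ks Is * t ^ (φᵛ cK (bv K) ℕ.+ crossings Ks ℕ.+ φᵛ (bv I +ᵛ cI) (bv J))
        ≈⟨ *-congʳ (*-congʳ (whiteV-closed ω 0 K J I L)) ⟨
      whiteV ω 1# K J I L * row (whiteV ω 1#) L Ks Is * t ^ (φᵛ cK (bv K) ℕ.+ crossings Ks ℕ.+ φᵛ (bv I +ᵛ cI) (bv J)) ∎
      where
      okV = okAllW K J I L
      E₁ = crossings Ks ℕ.+ φᵛ cI (bv L) ℕ.+ φᵛ cI (bv I)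
      E₂ = φᵛ cK (bv K) ℕ.+ crossings Ks ℕ.+ φᵛ (bv I +ᵛ cI) (bv J)
      swap : ∀ {b} → (b ≡ true → bv K +ᵛ bv J ≡ bv I +ᵛ bv L) →
        guard b (x L * t ^ e₁ L) * (row (whiteV ω 1#) L Ks Is * t ^ E₁) ≈ guard b (x L * t ^ e₂ L) * row (whiteV ω 1#) L Ks Is * t ^ E₂
      swap {false} h = trans (zeroˡ _) (sym (trans (*-congʳ (zeroˡ _)) (zeroˡ _)))
      -- If the particle numbers in the rest of the row do not match, both sides vanish; otherwise
      -- cI = cK + L is at hand for the comparison of exponents.
      swap {true} h with VecP.≡-dec ℕ._≟_ cI (cK +ᵛ bv L)
      ... | no ne = trans (*-congˡ (trans (*-congʳ r0) (zeroˡ _))) (trans (zeroʳ _) (sym (trans (*-congʳ (trans (*-congˡ r0) (zeroʳ _))) (zeroˡ _))))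
        where r0 = row-counts (whiteV-conservative ω) L Ks Is ne
      ... | yes q = begin
        (x L * t ^ e₁ L) * (row (whiteV ω 1#) L Ks Is * t ^ E₁)
          ≈⟨ solve 4 (λ x a r b → (x :* a) :* (r :* b) := (x :* r) :* (a :* b)) refl _ _ _ _ ⟩
        (x L * row (whiteV ω 1#) L Ks Is) * (t ^ e₁ L * t ^ E₁)
          ≈⟨ *-congˡ (trans (sym (^-+ t (e₁ L) E₁)) (trans (reflexive (≡.cong (t ^_) (adjoint-exponent (bv I) (bv J) (bv K) (bv L) cI cK (crossings Ks) (h ≡.refl) q))) (^-+ t (e₂ L) E₂))) ⟩
        (x L * row (whiteV ω 1#) L Ks Is) * (t ^ e₂ L * t ^ E₂)
          ≈⟨ solve 4 (λ x a r b → (x :* r) :* (a :* b) := ((x :* a) :* r) :* b) refl _ _ _ _ ⟩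
        (x L * t ^ e₂ L) * row (whiteV ω 1#) L Ks Is * t ^ E₂ ∎

-- Row operators on the states of a window

states-length : ∀ k c → All (λ s → length s ≡ c) (allRowStates k c)
states-length k zero = ≡.refl ∷ []
states-length k (suc c) = AllP.concat⁺ (AllP.map⁺ (All.universal (λ L → AllP.map⁺ (All.map (≡.cong suc) (states-length k c))) (allLabels k)))

module Operators (K : CommutativeRing 0ℓ 0ℓ) (t τ : CommutativeRing.Carrier K)
               (tτ : CommutativeRing._≈_ K (CommutativeRing._*_ K t τ) (CommutativeRing.1# K))
               (k c : ℕ) where
  open CommutativeRing K
  open Relation.Binary.Reasoning.Setoid setoid
  open RingSolver K
  open Rows K
  open VertexWeights K t
  open ClosedForms K t
  open ExchangeRows K t τ tτ
  open Inverse K t using (white-purple)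

  State : Set
  State = List (Label k)

  -- Matrix entries are indexed by the target state first.
  Op : Set
  Op = State → State → Carrier

  states : List State
  states = allRowStates k c

  record IsState (s : State) : Set where
    constructor isState
    field len≡ : length s ≡ c
  open IsState public

  infix 4 _≐_
  -- Operators are functions on lists of any length, but only states with `c` columns count. The
  -- record keeps M and N recoverable from a proof.
  record _≐_ (M N : Op) : Set where
    constructor pointwise
    field entry : ∀ {s′ s} → IsState s′ → IsState s → M s′ s ≈ N s′ s
  open _≐_ public

  infixr 9 _∘_
  _∘_ : Op → Op → Op
  (M ∘ N) s′ s = ∑[ m ∈ states ] (M s′ m * N m s)

  infixr 8 _·_
  _·_ : Carrier → Op → Op
  (a · M) s′ s = a * M s′ s

  Id : Op
  Id s′ s = if eqS s s′ then 1# else 0#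

  ∑-states-cong : ∀ {f g : State → Carrier} → (∀ {s} → IsState s → f s ≈ g s) → ∑ states f ≈ ∑ states g
  ∑-states-cong h = ∑-cong-All (All.map (λ p → h (isState p)) (states-length k c))

  ≐-trans : ∀ {L M N} → L ≐ M → M ≐ N → L ≐ N
  ≐-trans p q = pointwise λ i j → trans (entry p i j) (entry q i j)

  ≐-sym : ∀ {M N} → M ≐ N → N ≐ M
  ≐-sym p = pointwise λ i j → sym (entry p i j)

  ≐-refl : ∀ {M} → M ≐ M
  ≐-refl = pointwise λ i j → refl

  ∘-cong : ∀ {M M′ N N′} → M ≐ M′ → N ≐ N′ → M ∘ N ≐ M′ ∘ N′
  ∘-cong p q = pointwise λ i j → ∑-states-cong λ m → *-cong (entry p i m) (entry q m j)

  ∘-assoc : ∀ L M N → (L ∘ M) ∘ N ≐ L ∘ (M ∘ N)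
  ∘-assoc L M N = pointwise λ {s′} {s} i j → begin
    ∑[ m ∈ states ] ((∑[ n ∈ states ] (L s′ n * M n m)) * N m s)
      ≈⟨ ∑-cong states (λ m → trans (∑-* states _ _) (∑-cong states λ n → *-assoc _ _ _)) ⟩
    ∑[ m ∈ states ] ∑[ n ∈ states ] (L s′ n * (M n m * N m s))
      ≈⟨ ∑-swap states states _ ⟩
    ∑[ n ∈ states ] ∑[ m ∈ states ] (L s′ n * (M n m * N m s))
      ≈⟨ ∑-cong states (λ n → *-∑ states _ _) ⟨
    ∑[ n ∈ states ] (L s′ n * (∑[ m ∈ states ] (M n m * N m s))) ∎

  ·-cong : ∀ a {M N} → M ≐ N → a · M ≐ a · N
  ·-cong a p = pointwise λ i j → *-congˡ (entry p i j)

  ·-∘ : ∀ a M N → a · (M ∘ N) ≐ (a · M) ∘ N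
  ·-∘ a M N = pointwise λ i j → trans (*-∑ states _ _) (∑-cong states λ m → sym (*-assoc _ _ _))

  ∘-· : ∀ a M N → a · (M ∘ N) ≐ M ∘ (a · N)
  ∘-· a M N = pointwise λ i j → trans (*-∑ states _ _) (∑-cong states λ m → solve 3 (λ a x y → a :* (x :* y) := x :* (a :* y)) refl _ _ _)

  eqL-sym : ∀ {n} (I K : Label n) → eqL I K ≡ eqL K I
  eqL-sym [] [] = ≡.refl
  eqL-sym (false ∷ I) (false ∷ K) = eqL-sym I K
  eqL-sym (false ∷ I) (true ∷ K) = ≡.refl
  eqL-sym (true ∷ I) (false ∷ K) = ≡.refl
  eqL-sym (true ∷ I) (true ∷ K) = eqL-sym I K

  ∑-eqL : ∀ n (K : Label n) (f : Label n → Carrier) → ∑[ I ∈ allLabels n ] (f I * (if eqL K I then 1# else 0#)) ≈ f K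
  ∑-eqL zero [] f = trans (+-identityʳ _) (*-identityʳ _)
  ∑-eqL (suc n) (false ∷ K) f = trans (∑-labels n _) (trans
    (∑-cong (allLabels n) λ I → trans (+-congˡ (zeroʳ _)) (+-identityʳ _)) (∑-eqL n K (λ I → f (false ∷ I))))
  ∑-eqL (suc n) (true ∷ K) f = trans (∑-labels n _) (trans
    (∑-cong (allLabels n) λ I → trans (+-congʳ (zeroʳ _)) (+-identityˡ _)) (∑-eqL n K (λ I → f (true ∷ I))))

  ∑-eqS : ∀ n (s : State) → length s ≡ n → (f : State → Carrier) →
          ∑[ m ∈ allRowStates k n ] (f m * (if eqS s m then 1# else 0#)) ≈ f s
  ∑-eqS zero [] p f = trans (+-identityʳ _) (*-identityʳ _)
  ∑-eqS (suc n) (I ∷ s) p f = begin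
    ∑[ m ∈ allRowStates k (suc n) ] (f m * (if eqS (I ∷ s) m then 1# else 0#))
      ≈⟨ ∑-states k n _ ⟩
    ∑[ L ∈ allLabels k ] ∑[ m ∈ allRowStates k n ] (f (L ∷ m) * (if eqL I L ∧ eqS s m then 1# else 0#))
      ≈⟨ ∑-cong (allLabels k) (λ L → trans (∑-cong (allRowStates k n) λ m → split (eqL I L) (eqS s m) _)
           (sym (∑-* (allRowStates k n) _ _))) ⟩
    ∑[ L ∈ allLabels k ] ((∑[ m ∈ allRowStates k n ] (f (L ∷ m) * (if eqS s m then 1# else 0#))) * (if eqL I L then 1# else 0#))
      ≈⟨ ∑-cong (allLabels k) (λ L → *-congʳ (∑-eqS n s (ℕP.suc-injective p) (λ m → f (L ∷ m)))) ⟩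
    ∑[ L ∈ allLabels k ] (f (L ∷ s) * (if eqL I L then 1# else 0#))
      ≈⟨ ∑-eqL k I (λ L → f (L ∷ s)) ⟩
    f (I ∷ s) ∎
    where
    split : ∀ a b x → x * (if a ∧ b then 1# else 0#) ≈ (x * (if b then 1# else 0#)) * (if a then 1# else 0#)
    split false b x = trans (zeroʳ _) (sym (zeroʳ _))
    split true b x = sym (*-identityʳ _)

  eqS-sym : ∀ (s s′ : State) → eqS s s′ ≡ eqS s′ s
  eqS-sym [] [] = ≡.refl
  eqS-sym [] (_ ∷ _) = ≡.refl
  eqS-sym (_ ∷ _) [] = ≡.refl
  eqS-sym (I ∷ s) (J ∷ s′) = ≡.cong₂ _∧_ (eqL-sym I J) (eqS-sym s s′)

  ∘-Id : ∀ M → M ∘ Id ≐ M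
  ∘-Id M = pointwise λ {s′} {s} i j → ∑-eqS c s (len≡ j) (M s′)

  Id-∘ : ∀ M → Id ∘ M ≐ M
  Id-∘ M = pointwise λ {s′} {s} i j → trans (∑-cong states λ m → trans (*-comm _ _)
    (*-congˡ (reflexive (≡.cong (λ b → if b then 1# else 0#) (eqS-sym m s′))))) (∑-eqS c s′ (len≡ i) (λ m → M m s))

  whiteᵒ purpleᵒ dualᵒ : Carrier → Op
  whiteᵒ ξ s′ s = row (whiteV ξ 1#) ∅ s s′
  purpleᵒ ξ s′ s = row (purpleV ξ 1#) ∅ s s′
  dualᵒ ω s′ s = row (dualV ω 1#) ∅ s s′

  -- For the states of two tuples the prefactor is t to the power d(source, target). Both sums of
  -- the theorem thus become entries of a product of one operator with the `star` of another.
  star : Op → Op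
  star M s′ s = (t ^ crossings s′ * τ ^ crossings s) * M s s′

  ^-inverse : ∀ n → t ^ n * τ ^ n ≈ 1#
  ^-inverse zero = *-identityˡ _
  ^-inverse (suc n) = trans (solve 4 (λ a b c d → (a :* b) :* (c :* d) := (a :* c) :* (b :* d)) refl _ _ _ _)
    (trans (*-cong tτ (^-inverse n)) (*-identityˡ _))

  star-cong : ∀ {M N} → M ≐ N → star M ≐ star N
  star-cong p = pointwise λ i j → *-congˡ (entry p j i)

  star-· : ∀ a M → star (a · M) ≐ a · star M
  star-· a M = pointwise λ i j → solve 3 (λ x a m → x :* (a :* m) := a :* (x :* m)) refl _ _ _

  star-∘ : ∀ M N → star (M ∘ N) ≐ star N ∘ star M
  star-∘ M N = pointwise λ {s′} {s} i j → trans (*-∑ states _ _) (∑-cong states λ m → begin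
    (t ^ crossings s′ * τ ^ crossings s) * (M s m * N m s′)
      ≈⟨ *-identityˡ _ ⟨
    1# * ((t ^ crossings s′ * τ ^ crossings s) * (M s m * N m s′))
      ≈⟨ *-congʳ (^-inverse (crossings m)) ⟨
    (t ^ crossings m * τ ^ crossings m) * ((t ^ crossings s′ * τ ^ crossings s) * (M s m * N m s′))
      ≈⟨ solve 6 (λ a b c d m n → (a :* b) :* ((c :* d) :* (m :* n)) := ((c :* b) :* n) :* ((a :* d) :* m)) refl _ _ _ _ _ _ ⟩
    ((t ^ crossings s′ * τ ^ crossings m) * N m s′) * ((t ^ crossings m * τ ^ crossings s) * M s m) ∎)

  star-involutive : ∀ M → star (star M) ≐ M
  star-involutive M = pointwise λ {s′} {s} i j → begin
    (t ^ crossings s′ * τ ^ crossings s) * ((t ^ crossings s * τ ^ crossings s′) * M s′ s)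
      ≈⟨ solve 5 (λ a b c d m → (a :* b) :* ((c :* d) :* m) := (a :* d) :* ((c :* b) :* m)) refl _ _ _ _ _ ⟩
    (t ^ crossings s′ * τ ^ crossings s′) * ((t ^ crossings s * τ ^ crossings s) * M s′ s)
      ≈⟨ trans (*-congʳ (^-inverse (crossings s′))) (trans (*-identityˡ _) (trans (*-congʳ (^-inverse (crossings s))) (*-identityˡ _))) ⟩
    M s′ s ∎

  eqL⇒≡ : ∀ {n} (I K : Label n) → eqL I K ≡ true → I ≡ K
  eqL⇒≡ [] [] p = ≡.refl
  eqL⇒≡ (false ∷ I) (false ∷ K) p = ≡.cong (false ∷_) (eqL⇒≡ I K p)
  eqL⇒≡ (true ∷ I) (true ∷ K) p = ≡.cong (true ∷_) (eqL⇒≡ I K p)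

  eqS⇒≡ : ∀ (s s′ : State) → eqS s s′ ≡ true → s ≡ s′
  eqS⇒≡ [] [] p = ≡.refl
  eqS⇒≡ (I ∷ s) (J ∷ s′) p with eqL I J in e
  ... | true = ≡.cong₂ _∷_ (eqL⇒≡ I J e) (eqS⇒≡ s s′ p)

  star-Id : star Id ≐ Id
  star-Id = pointwise λ {s′} {s} i j → trans (*-congˡ (reflexive (≡.cong (λ b → if b then 1# else 0#) (eqS-sym s′ s)))) (diagonal s s′)
    where
    diagonal : ∀ s s′ → (t ^ crossings s′ * τ ^ crossings s) * (if eqS s s′ then 1# else 0#) ≈ (if eqS s s′ then 1# else 0#)
    diagonal s s′ with eqS s s′ in e
    ... | true rewrite eqS⇒≡ s s′ e = trans (*-identityʳ _) (^-inverse (crossings s′))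
    ... | false = zeroʳ _

  star-white : ∀ ω → star (whiteᵒ ω) ≐ dualᵒ ω
  star-white ω = pointwise λ {s′} {s} i j → begin
    (t ^ crossings s′ * τ ^ crossings s) * row (whiteV ω 1#) ∅ s′ s
      ≈⟨ solve 3 (λ a b r → (a :* b) :* r := (r :* a) :* b) refl _ _ _ ⟩
    (row (whiteV ω 1#) ∅ s′ s * t ^ crossings s′) * τ ^ crossings s
      ≈⟨ *-congʳ (*-congˡ (reflexive (≡.cong (t ^_) (≡.sym (≡.trans (≡.cong (crossings s′ ℕ.+_)
           (≡.trans (≡.cong (φᵛ (counts s)) (bv-∅ k)) (φᵛ-0ʳ (counts s)))) (ℕP.+-identityʳ _)))))) ⟩
    (row (whiteV ω 1#) ∅ s′ s * t ^ (crossings s′ ℕ.+ φᵛ (counts s) (bv ∅))) * τ ^ crossings s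
      ≈⟨ *-congʳ (row-adjoint ω ∅ s s′) ⟨
    (row (dualV ω 1#) ∅ s s′ * t ^ crossings s) * τ ^ crossings s
      ≈⟨ trans (*-assoc _ _ _) (trans (*-congˡ (^-inverse (crossings s))) (*-identityʳ _)) ⟩
    row (dualV ω 1#) ∅ s s′ ∎

  two-∘ : ∀ (V₁ V₂ : Vertex k) {s′ s} → IsState s →
          two V₁ V₂ ∅ ∅ s s′ ≈ ∑[ m ∈ states ] (row V₂ ∅ m s′ * row V₁ ∅ s m)
  two-∘ V₁ V₂ (isState ≡.refl) = ∑-cong states λ m → *-comm _ _

  white∘purple : ∀ ξ → whiteᵒ ξ ∘ purpleᵒ (- ξ) ≐ Id
  white∘purple ξ = pointwise λ {s′} {s} i j → trans (sym (two-∘ (purpleV (- ξ) 1#) (whiteV ξ 1#) j))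
    (white-purple ξ s s′ (≡.trans (len≡ j) (≡.sym (len≡ i))))

  data Inner : State → Set where
    inner : ∀ mid → Inner (full ∷ mid ++ ∅ ∷ [])

  private
    lastEmpty : ∀ (m m′ : State) → length (m ++ ∅ ∷ []) ≡ length (m′ ++ ∅ ∷ []) → LastEmpty (m ++ ∅ ∷ []) (m′ ++ ∅ ∷ [])
    lastEmpty [] [] p = last
    lastEmpty [] (_ ∷ []) ()
    lastEmpty [] (_ ∷ _ ∷ _) ()
    lastEmpty (_ ∷ []) [] ()
    lastEmpty (_ ∷ _ ∷ _) [] ()
    lastEmpty (I ∷ m) (J ∷ m′) p = (I , J) ∷ lastEmpty m m′ (ℕP.suc-injective p)

  exchange-inner : ∀ ω ξ {s′ s} → IsState s′ → IsState s → Inner s′ → Inner s →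
    (crossing (ω * ξ) k · (purpleᵒ ξ ∘ star (whiteᵒ ω))) s′ s ≈ (star (whiteᵒ ω) ∘ purpleᵒ ξ) s′ s
  exchange-inner ω ξ {s′} {s} i j (inner mid′) (inner mid) = begin
    crossing (ω * ξ) k * (purpleᵒ ξ ∘ star (whiteᵒ ω)) s′ s
      ≈⟨ *-congˡ (entry (∘-cong {purpleᵒ ξ} ≐-refl (star-white ω)) i j) ⟩
    crossing (ω * ξ) k * (purpleᵒ ξ ∘ dualᵒ ω) s′ s
      ≈⟨ *-congˡ (two-∘ (dualV ω 1#) (purpleV ξ 1#) j) ⟨
    crossing (ω * ξ) k * two (dualV ω 1#) (purpleV ξ 1#) ∅ ∅ s s′
      ≈⟨ exchange ω ξ full ((full , full) ∷ lastEmpty mid mid′ (ℕP.suc-injective (≡.trans (len≡ j) (≡.sym (len≡ i))))) ⟩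
    two (purpleV ξ 1#) (dualV ω 1#) ∅ ∅ s s′
      ≈⟨ two-∘ (purpleV ξ 1#) (dualV ω 1#) j ⟩
    (dualᵒ ω ∘ purpleᵒ ξ) s′ s
      ≈⟨ entry (∘-cong {dualᵒ ω} {_} {purpleᵒ ξ} (≐-sym (star-white ω)) ≐-refl) i j ⟩
    (star (whiteᵒ ω) ∘ purpleᵒ ξ) s′ s ∎

  -- `star` is an involution that reverses products, so applying it to `exchange-inner` moves the
  -- dual from the white row to the purple one, with source and target interchanged.
  exchange-inner* : ∀ ω ξ {s′ s} → IsState s′ → IsState s → Inner s′ → Inner s →
    (crossing (ω * ξ) k · (whiteᵒ ω ∘ star (purpleᵒ ξ))) s′ s ≈ (star (purpleᵒ ξ) ∘ whiteᵒ ω) s′ s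
  exchange-inner* ω ξ {s′} {s} i j in′ in″ = begin
    crossing (ω * ξ) k * (whiteᵒ ω ∘ star (purpleᵒ ξ)) s′ s
      ≈⟨ *-congˡ (entry (≐-trans (∘-cong (≐-sym (star-involutive (whiteᵒ ω))) ≐-refl) (≐-sym (star-∘ (purpleᵒ ξ) (star (whiteᵒ ω))))) i j) ⟩
    crossing (ω * ξ) k * star (purpleᵒ ξ ∘ star (whiteᵒ ω)) s′ s
      ≈⟨ entry (star-· (crossing (ω * ξ) k) (purpleᵒ ξ ∘ star (whiteᵒ ω))) i j ⟨
    star (crossing (ω * ξ) k · (purpleᵒ ξ ∘ star (whiteᵒ ω))) s′ s
      ≈⟨ *-congˡ (exchange-inner ω ξ j i in″ in′) ⟩
    star (star (whiteᵒ ω) ∘ purpleᵒ ξ) s′ s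
      ≈⟨ entry (≐-trans (star-∘ (star (whiteᵒ ω)) (purpleᵒ ξ)) (∘-cong {star (purpleᵒ ξ)} ≐-refl (star-involutive (whiteᵒ ω)))) i j ⟩
    (star (purpleᵒ ξ) ∘ whiteᵒ ω) s′ s ∎

-- Variables, homogeneity and the grading of operators

module Variables (R : CommutativeRing 0ℓ 0ℓ) (t t⁻¹ : CommutativeRing.Carrier R)
                 (tt⁻¹ : CommutativeRing._≈_ R (CommutativeRing._*_ R t t⁻¹) (CommutativeRing.1# R)) where
  private module R = CommutativeRing R
  open Lattice R t t⁻¹ hiding (vertex)
  open Series R t t⁻¹

  private variable
    V : ℕ

  unitV-zero : ∀ n → unitV {suc V} zero n ≡ n ∷ zeros
  unitV-zero {V} n = ≡.cong (n ∷_) (tabulate-0 V)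
    where
    tabulate-0 : ∀ V → tabulate {n = V} (λ _ → 0) ≡ replicate V 0
    tabulate-0 zero = ≡.refl
    tabulate-0 (suc V) = ≡.cong (0 ∷_) (tabulate-0 V)

  unitV-suc : ∀ (v : Fin V) n → unitV (suc v) n ≡ 0 ∷ unitV v n
  unitV-suc v n = ≡.cong (0 ∷_) (VecP.tabulate-cong λ u → ≡.cong (λ b → if b then n else 0) (by u))
    where
    by : ∀ u → ⌊ suc u Fin.≟ suc v ⌋ ≡ ⌊ u Fin.≟ v ⌋
    by u with u Fin.≟ v
    ... | yes p = ≡.refl
    ... | no p = ≡.refl

  unitV-sum : ∀ (v : Fin V) n → Vec.sum (unitV v n) ≡ n
  unitV-sum {suc V} zero n = ≡.trans (≡.cong Vec.sum (unitV-zero {V} n)) (≡.trans (≡.cong (n ℕ.+_) (sum-0ᵛ V)) (ℕP.+-identityʳ n))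
  unitV-sum (suc v) n = ≡.trans (≡.cong Vec.sum (unitV-suc v n)) (unitV-sum v n)

  unitV-+ : ∀ (v : Fin V) m n → unitV v m +ᵛ unitV v n ≡ unitV v (m ℕ.+ n)
  unitV-+ {suc V} zero m n = ≡.trans (≡.cong₂ _+ᵛ_ (unitV-zero {V} m) (unitV-zero {V} n))
    (≡.trans (≡.cong (m ℕ.+ n ∷_) (+ᵛ-identityʳ zeros)) (≡.sym (unitV-zero (m ℕ.+ n))))
  unitV-+ (suc v) m n = ≡.trans (≡.cong₂ _+ᵛ_ (unitV-suc v m) (unitV-suc v n))
    (≡.trans (≡.cong (0 ∷_) (unitV-+ v m n)) (≡.sym (unitV-suc v (m ℕ.+ n))))

  unitV-0 : ∀ (v : Fin V) → unitV v 0 ≡ zeros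
  unitV-0 {suc V} zero = unitV-zero 0
  unitV-0 (suc v) = ≡.trans (unitV-suc v 0) (≡.cong (0 ∷_) (unitV-0 v))

  monoS-Hom : ∀ c (m : Mono V) → Hom 0 (Vec.sum m) (monoS c m)
  monoS-Hom c m e ne = monoS-≢ c λ p → ne (≡.trans (ℕP.+-identityʳ _) (≡.cong Vec.sum p))

  var : Fin V → FPS V
  var v = monoS R.1# (unitV v 1)

  const : R.Carrier → FPS V
  const c = monoS c zeros

  var-Hom : ∀ (v : Fin V) → Hom 0 1 (var v)
  var-Hom v = ≡.subst (λ n → Hom 0 n (var v)) (unitV-sum v 1) (monoS-Hom R.1# (unitV v 1))

  const-Hom : ∀ c → Hom 0 0 (const {V} c)
  const-Hom {V} c = ≡.subst (λ n → Hom 0 n (const {V} c)) (sum-0ᵛ V) (monoS-Hom c zeros)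

  const-* : ∀ c d → (const {V} c ⊛ const d) ≋ const (c R.* d)
  const-* {V} c d e = R.trans (monoS-* c d zeros zeros e) (R.reflexive (≡.cong (λ m → monoS (c R.* d) m e) (+ᵛ-identityʳ zeros)))

  const-inverse : (const {V} t ⊛ const t⁻¹) ≋ oneS
  const-inverse e = R.trans (const-* t t⁻¹ e) (monoS-cong zeros tt⁻¹ e)

  Hom-shift : ∀ c {m n} {f : FPS V} → Hom m n f → Hom (c ℕ.+ m) (c ℕ.+ n) f
  Hom-shift c {m} {n} h e ne = h e λ p → ne (≡.trans (≡.sym (ℕP.+-assoc (Vec.sum e) c m))
    (≡.trans (≡.cong (ℕ._+ m) (ℕP.+-comm (Vec.sum e) c)) (≡.trans (ℕP.+-assoc c _ m) (≡.cong (c ℕ.+_) p))))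

  Hom-cong : ∀ {m n} {f g : FPS V} → f ≋ g → Hom m n f → Hom m n g
  Hom-cong p h e ne = R.trans (R.sym (p e)) (h e ne)

  at-zeros : ∀ (f g : FPS V) → (f ⊛ g) zeros R.≈ f zeros R.* g zeros
  at-zeros {zero} f g = R.+-identityʳ _
  at-zeros {suc V} f g = R.trans (⊛-∷ f g 0 zeros) (at-zeros (f ⟨ 0 ⟩) (g ⟨ 0 ⟩))

  sum≡0 : ∀ (e : Mono V) → Vec.sum e ≡ 0 → e ≡ zeros
  sum≡0 [] p = ≡.refl
  sum≡0 (zero ∷ e) p = ≡.cong (0 ∷_) (sum≡0 e p)

module GradedOperators (R : CommutativeRing 0ℓ 0ℓ) (t t⁻¹ : CommutativeRing.Carrier R)
                 (tt⁻¹ : CommutativeRing._≈_ R (CommutativeRing._*_ R t t⁻¹) (CommutativeRing.1# R))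
                 (V k c : ℕ) where
  private module R = CommutativeRing R
  open Lattice R t t⁻¹ hiding (vertex)
  open Series R t t⁻¹
  open Variables R t t⁻¹ tt⁻¹

  K : CommutativeRing 0ℓ 0ℓ
  K = seriesRing V
  open CommutativeRing K
  open RingSolver K
  open Rows K
  open VertexWeights K (const t)
  open ClosedForms K (const t)
  open Operators K (const t) (const t⁻¹) const-inverse k c public
  open SiteWeights _+_ _*_ -_ 0# 1#

  ∑-coeff : ∀ {A : Set} (xs : List A) (f : A → FPS V) e → (∑ xs f) e R.≈ Sums.∑ R xs (λ x → f x e)
  ∑-coeff [] f e = R.refl
  ∑-coeff (x ∷ xs) f e = R.+-congˡ (∑-coeff xs f e)

  ∑-coeff-cong : ∀ {A : Set} {xs : List A} {f g : A → FPS V} e → All (λ x → f x e R.≈ g x e) xs → (∑ xs f) e R.≈ (∑ xs g) e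
  ∑-coeff-cong e [] = R.refl
  ∑-coeff-cong e (h ∷ hs) = R.+-cong h (∑-coeff-cong e hs)

  ∑-states-coeff : ∀ {f g : State → FPS V} e → (∀ {s} → IsState s → f s e R.≈ g s e) → (∑ states f) e R.≈ (∑ states g) e
  ∑-states-coeff e h = ∑-coeff-cong e (All.map (λ p → h (isState p)) (states-length k c))

  ∑-Hom : ∀ {A : Set} {m n} (xs : List A) {f : A → FPS V} → (∀ x → Hom m n (f x)) → Hom m n (∑ xs f)
  ∑-Hom [] h e ne = R.refl
  ∑-Hom (x ∷ xs) h e ne = R.trans (R.+-cong (h x e ne) (∑-Hom xs h e ne)) (R.+-identityˡ _)

  Homogeneous : Vertex k → Set
  Homogeneous U = ∀ I J K L → Hom 0 (Vec.sum (bv L)) (U I J K L)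

  ^-Hom : ∀ {m} {ξ : FPS V} n → Hom 0 m ξ → Hom 0 (n ℕ.* m) (ξ ^ n)
  ^-Hom zero h = const-Hom R.1#
  ^-Hom {m} (suc n) h = Hom-* {l = 0} {m} {m ℕ.+ n ℕ.* m} h
    (≡.subst (λ a → Hom a (m ℕ.+ n ℕ.* m) _) (ℕP.+-identityʳ m) (Hom-shift m (^-Hom n h)))

  guard-Hom : ∀ b {m n} {f : FPS V} → Hom m n f → Hom m n (guard b f)
  guard-Hom false h e ne = R.refl
  guard-Hom true h = h

  monomial-Hom : ∀ {ξ : FPS V} n a → Hom 0 1 ξ → Hom 0 n (ξ ^ n * const t ^ a)
  monomial-Hom {ξ} n a h = Hom-* {l = 0} {n} {n} (≡.subst (λ x → Hom 0 x (ξ ^ n)) (ℕP.*-identityʳ n) (^-Hom n h))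
    (≡.subst₂ (λ x y → Hom x y (const t ^ a)) (ℕP.+-identityʳ n) (≡.trans (≡.cong (n ℕ.+_) (ℕP.*-zeroʳ a)) (ℕP.+-identityʳ n))
      (Hom-shift n (^-Hom a (const-Hom t))))

  whiteV-Hom : ∀ {ξ} → Hom 0 1 ξ → Homogeneous (whiteV ξ 1#)
  whiteV-Hom {ξ} h I J K L = Hom-cong (sym (whiteV-closed ξ 0 I J K L)) (guard-Hom (okAllW I J K L) (monomial-Hom (Vec.sum (bv L)) (φᵛ (bv L) (bv I +ᵛ bv J)) h))

  purpleV-Hom : ∀ {ξ} → Hom 0 1 ξ → Homogeneous (purpleV ξ 1#)
  purpleV-Hom {ξ} h I J K L = Hom-cong (sym (purpleV-closed ξ 0 I J K L)) (guard-Hom (okAllP I J K L) (monomial-Hom (Vec.sum (bv L)) (φᵛ (bv L) (monus K J)) h))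

  zero-Hom : ∀ {m n} {f : FPS V} → f ≈ 0# → Hom m n f
  zero-Hom p e ne = p e

  -- The energy adds up, over all columns, the number of particles strictly to the right. At each
  -- column this number grows by the number of paths using the right edge, which is the degree of
  -- the vertex.
  row-Hom : ∀ {U} → Conservative U → Homogeneous U → ∀ J Is Ks → Hom (energy Is) (energy Ks) (row U J Is Ks)
  row-Hom cons hom J [] [] with empty? J
  ... | true = const-Hom R.1#
  ... | false = zero-Hom refl
  row-Hom cons hom J [] (_ ∷ _) = zero-Hom refl
  row-Hom cons hom J (_ ∷ _) [] = zero-Hom refl
  row-Hom {U} cons hom J (I ∷ Is) (K ∷ Ks) = ∑-Hom (allLabels k) term
    where
    sI = Vec.sum (counts Is)
    term : ∀ L → Hom (sI ℕ.+ energy Is) (Vec.sum (counts Ks) ℕ.+ energy Ks) (U I J K L * row U L Is Ks)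
    term L with VecP.≡-dec ℕ._≟_ (counts Ks) (counts Is +ᵛ bv L)
    ... | no ne = zero-Hom (trans (*-congˡ (row-counts cons L Is Ks ne)) (zeroʳ (U I J K L)))
    ... | yes q = Hom-* {l = sI ℕ.+ energy Is} {sI ℕ.+ energy Is ℕ.+ Vec.sum (bv L)}
          (≡.subst₂ (λ a b → Hom a b (U I J K L)) (ℕP.+-identityʳ _) ≡.refl (Hom-shift (sI ℕ.+ energy Is) (hom I J K L)))
          (≡.subst₂ (λ a b → Hom a b (row U L Is Ks)) e₁ (≡.cong (ℕ._+ energy Ks) (≡.sym e₂))
            (Hom-shift (sI ℕ.+ Vec.sum (bv L)) (row-Hom cons hom L Is Ks)))
      where
      e₂ : Vec.sum (counts Ks) ≡ sI ℕ.+ Vec.sum (bv L)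
      e₂ = ≡.trans (≡.cong Vec.sum q) (sum-+ᵛ (counts Is) (bv L))
      e₁ : sI ℕ.+ Vec.sum (bv L) ℕ.+ energy Is ≡ sI ℕ.+ energy Is ℕ.+ Vec.sum (bv L)
      e₁ = ≡.trans (ℕP.+-assoc sI _ _) (≡.trans (≡.cong (sI ℕ.+_) (ℕP.+-comm (Vec.sum (bv L)) _)) (≡.sym (ℕP.+-assoc sI _ _)))

  -- Up: particle numbers are conserved and the degree of an entry is the gain
  -- of energy. Good: the weaker property also shared by the duals of such operators.
  record Up (M : Op) : Set where
    field
      up-counts : ∀ s′ s → counts s′ ≢ counts s → M s′ s ≈ 0#
      up-hom : ∀ s′ s → Hom (energy s) (energy s′) (M s′ s)
  open Up

  record Good (M : Op) : Set where
    field
      good-counts : ∀ s′ s → counts s′ ≢ counts s → M s′ s ≈ 0#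
      good-ord : ∀ s′ s e → Vec.sum e ℕ.+ energy s < energy s′ → M s′ s e R.≈ R.0#
  open Good

  counts∅ : ∀ s → counts s +ᵛ bv ∅ ≡ counts s
  counts∅ s = ≡.trans (≡.cong (counts s +ᵛ_) (bv-∅ k)) (+ᵛ-identityʳ (counts s))

  row-Up : ∀ {U} → Conservative U → Homogeneous U → Up (λ s′ s → row U ∅ s s′)
  row-Up cons hom = record
    { up-counts = λ s′ s ne → row-counts cons ∅ s s′ λ p → ne (≡.trans p (counts∅ s))
    ; up-hom = λ s′ s → row-Hom cons hom ∅ s s′ }

  white-Up : ∀ {ξ} → Hom 0 1 ξ → Up (whiteᵒ ξ)
  white-Up {ξ} h = row-Up (whiteV-conservative ξ) (whiteV-Hom h)

  purple-Up : ∀ {ξ} → Hom 0 1 ξ → Up (purpleᵒ ξ)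
  purple-Up {ξ} h = row-Up (purpleV-conservative ξ) (purpleV-Hom h)

  Up⇒Good : ∀ {M} → Up M → Good M
  Up⇒Good u = record
    { good-counts = up-counts u
    ; good-ord = λ s′ s e lt → up-hom u s′ s e (ℕP.<⇒≢ lt) }

  -- The transpose of an operator that raises the energy can only keep or lower it. An entry whose
  -- target energy exceeds the source energy is therefore zero in every degree.
  star-Good : ∀ {M} → Up M → Good (star M)
  star-Good {M} u = record
    { good-counts = λ s′ s ne → trans (*-congˡ (up-counts u s s′ λ p → ne (≡.sym p))) (zeroʳ _)
    ; good-ord = λ s′ s e lt → ⊛-zero _ (M s s′) e λ a eq → inj₂ (up-hom u s s′ _ λ p →
        ℕP.<-irrefl ≡.refl (ℕP.<-≤-trans (ℕP.≤-<-trans (ℕP.m≤n+m (energy s) (Vec.sum e)) lt)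
          (ℕP.≤-trans (ℕP.m≤n+m (energy s′) _) (ℕP.≤-reflexive p)))) }

  ∘-counts : ∀ {M N} → (∀ s′ s → counts s′ ≢ counts s → M s′ s ≈ 0#) → (∀ s′ s → counts s′ ≢ counts s → N s′ s ≈ 0#) →
             ∀ s′ s → counts s′ ≢ counts s → (M ∘ N) s′ s ≈ 0#
  ∘-counts {M} {N} p q s′ s ne = ∑-zero states λ m → by m
    where
    by : ∀ m → M s′ m * N m s ≈ 0#
    by m with VecP.≡-dec ℕ._≟_ (counts s′) (counts m)
    ... | no ne′ = trans (*-congʳ {N m s} (p s′ m ne′)) (zeroˡ (N m s))
    ... | yes eq = trans (*-congˡ (q m s λ eq′ → ne (≡.trans eq eq′))) (zeroʳ (M s′ m))

  ∘-Up : ∀ {M N} → Up M → Up N → Up (M ∘ N)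
  ∘-Up u v = record
    { up-counts = ∘-counts (up-counts u) (up-counts v)
    ; up-hom = λ s′ s → ∑-Hom states λ m → Hom-cong (*-comm _ _) (Hom-* (up-hom v m s) (up-hom u s′ m)) }

  private
    add-< : ∀ a b {s m s′} → (a ℕ.+ b) ℕ.+ s < s′ → m ≤ b ℕ.+ s → a ℕ.+ m < s′
    add-< a b {s} lt le = ℕP.≤-<-trans (ℕP.≤-trans (ℕP.+-monoʳ-≤ a le) (ℕP.≤-reflexive (≡.sym (ℕP.+-assoc a b s)))) lt

  ∘-Good : ∀ {M N} → Good M → Good N → Good (M ∘ N)
  ∘-Good {M} {N} u v = record
    { good-counts = ∘-counts (good-counts u) (good-counts v)
    ; good-ord = λ s′ s e lt → R.trans (∑-states-coeff {g = λ _ → 0#} e λ {m} _ → ⊛-zero (M s′ m) (N m s) e λ a eq → split s′ s e lt m a eq)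
        (∑-0 states e) }
    where
    split : ∀ s′ s e → Vec.sum e ℕ.+ energy s < energy s′ → ∀ m a → Vec.sum a ℕ.+ Vec.sum (zipWith ℕ._∸_ e a) ≡ Vec.sum e →
            M s′ m a R.≈ R.0# ⊎ N m s (zipWith ℕ._∸_ e a) R.≈ R.0#
    split s′ s e lt m a eq with Vec.sum (zipWith ℕ._∸_ e a) ℕ.+ energy s ℕ.<? energy m
    ... | yes l = inj₂ (good-ord v m s _ l)
    ... | no nl = inj₁ (good-ord u s′ m a (add-< (Vec.sum a) _ (≡.subst (λ x → x ℕ.+ energy s < energy s′) (≡.sym eq) lt) (ℕP.≮⇒≥ nl)))

  ·-Good : ∀ a {M} → Good M → Good (a · M)
  ·-Good a {M} u = record
    { good-counts = λ s′ s ne → trans (*-congˡ (good-counts u s′ s ne)) (zeroʳ a)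
    ; good-ord = λ s′ s e lt → ⊛-zero a (M s′ s) e λ b eq → inj₂ (good-ord u s′ s _
        (ℕP.≤-<-trans (ℕP.+-monoˡ-≤ (energy s) (ℕP.≤-trans (ℕP.m≤n+m _ (Vec.sum b)) (ℕP.≤-reflexive eq))) lt)) }

  Id-Up : Up Id
  Id-Up = record { up-counts = cnt ; up-hom = hom }
    where
    cnt : ∀ s′ s → counts s′ ≢ counts s → Id s′ s ≈ 0#
    cnt s′ s ne with eqS s s′ in eq
    ... | false = refl
    ... | true = ⊥-elim (ne (≡.cong counts (≡.sym (eqS⇒≡ s s′ eq))))
    hom : ∀ s′ s → Hom (energy s) (energy s′) (Id s′ s)
    hom s′ s with eqS s s′ in eq
    ... | false = zero-Hom refl
    ... | true rewrite eqS⇒≡ s s′ eq = ≡.subst₂ (λ a b → Hom a b oneS) (ℕP.+-identityʳ _) (ℕP.+-identityʳ _) (Hom-shift (energy s′) (const-Hom R.1#))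

  -- Write P = Id + N, where N has no constant coefficients. Then X ∘ P = X + X ∘ N, and a
  -- coefficient of X ∘ N involves X only in smaller degrees, so equality of X and Y follows by
  -- induction on the degree.
  cancelʳ : ∀ {X Y P} → (∀ {s′ s} → IsState s′ → IsState s → P s′ s zeros R.≈ Id s′ s zeros) → X ∘ P ≐ Y ∘ P → X ≐ Y
  cancelʳ {X} {Y} {P} unit eq = pointwise λ i j e → bounded (suc (Vec.sum e)) i j e (ℕP.≤-refl)
    where
    N : Op
    N s′ s = P s′ s + - Id s′ s
    N-Ord : ∀ {s′ s} → IsState s′ → IsState s → Ord 1 (N s′ s)
    N-Ord {s′} {s} i j e lt with sum≡0 e (ℕP.n<1⇒n≡0 lt)
    ... | ≡.refl = R.trans (R.+-congʳ (unit i j)) (R.-‿inverseʳ _)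
    decompose : ∀ Z → Z ∘ P ≐ λ s′ s → Z s′ s + (Z ∘ N) s′ s
    decompose Z = pointwise λ {s′} {s} i j → trans
      (∑-cong states λ m → solve 3 (λ z p d → z :* p := z :* d :+ z :* (p :+ :- d)) refl (Z s′ m) (P m s) (Id m s))
      (trans (∑-+ states _ _) (+-congʳ (entry (∘-Id Z) i j)))
    bounded : ∀ n {s′ s} → IsState s′ → IsState s → ∀ e → Vec.sum e < n → X s′ s e R.≈ Y s′ s e
    bounded (suc n) {s′} {s} i j e lt = RP.∙-cancelʳ ((X ∘ N) s′ s e) _ _
      (R.trans (R.sym (entry (decompose X) i j e)) (R.trans (entry eq i j e) (R.trans (entry (decompose Y) i j e)
        (R.+-congˡ (R.sym same)))))
      where
      module RP = Algebra.Properties.AbelianGroup R.+-abelianGroup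
      same : (X ∘ N) s′ s e R.≈ (Y ∘ N) s′ s e
      same = ∑-states-coeff e λ {m} mi → by m mi
        where
        by : ∀ m → IsState m → (X s′ m ⊛ N m s) e R.≈ (Y s′ m ⊛ N m s) e
        by m mi = Sums.∑-cong-All R (All.map (λ {a} eq′ → step a eq′) (below-sum e))
          where
          step : ∀ a → Vec.sum a ℕ.+ Vec.sum (zipWith ℕ._∸_ e a) ≡ Vec.sum e →
                 X s′ m a R.* N m s (zipWith ℕ._∸_ e a) R.≈ Y s′ m a R.* N m s (zipWith ℕ._∸_ e a)
          -- Either no degree is left for N, and its coefficient vanishes, or the coefficient of X
          -- has smaller degree.
          step a eq′ with Vec.sum (zipWith ℕ._∸_ e a) in eq″
          ... | zero = let z = N-Ord mi j _ (≡.subst (_< 1) (≡.sym eq″) (s≤s z≤n)) in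
                R.trans (R.*-congˡ z) (R.trans (R.zeroʳ _) (R.sym (R.trans (R.*-congˡ z) (R.zeroʳ _))))
          ... | suc r = R.*-congʳ (bounded n i mi a (ℕP.≤-pred (ℕP.≤-trans (s≤s (ℕP.≤-trans
                (ℕP.≤-trans (s≤s (ℕP.m≤m+n _ r)) (ℕP.≤-reflexive (≡.sym (ℕP.+-suc _ r)))) (ℕP.≤-reflexive eq′))) lt)))

  -- In degree zero no path uses a horizontal edge, and the weight of a vertex with empty sides is 1
  -- exactly when its bottom and top agree.
  purple-unit : ∀ {ξ} → Hom 0 1 ξ → ∀ s′ s → purpleᵒ ξ s′ s zeros R.≈ Id s′ s zeros
  purple-unit {ξ} h s′ s = by s s′
    where
    okAllP-∅ : ∀ {n} (I K : Label n) → okAllP I ∅ K ∅ ≡ eqL I K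
    okAllP-∅ [] [] = ≡.refl
    okAllP-∅ (false ∷ I) (false ∷ K) = okAllP-∅ I K
    okAllP-∅ (false ∷ I) (true ∷ K) = ≡.refl
    okAllP-∅ (true ∷ I) (false ∷ K) = ≡.refl
    okAllP-∅ (true ∷ I) (true ∷ K) = okAllP-∅ I K
    purpleV-∅ : ∀ (I K : Label k) → purpleV ξ 1# I ∅ K ∅ ≈ (if eqL I K then 1# else 0#)
    purpleV-∅ I K = trans (purpleV-closed ξ 0 I ∅ K ∅) (trans (reflexive (≡.cong (λ b → guard b _) (okAllP-∅ I K)))
      (guard-cong (eqL I K) (trans (*-cong (reflexive (≡.cong (ξ ^_) (≡.trans (≡.cong Vec.sum (bv-∅ k)) (sum-0ᵛ k))))
        (reflexive (≡.cong (const t ^_) (≡.trans (≡.cong (λ b → φᵛ b (monus K ∅)) (bv-∅ k)) (φᵛ-0ˡ (monus K ∅)))))) (*-identityˡ _))))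
    nonempty-sum : ∀ {n} (L : Label n) → empty? L ≡ false → Vec.sum (bv L) ≢ 0
    nonempty-sum (true ∷ L) p ()
    nonempty-sum (false ∷ L) p q = nonempty-sum L p q
    by : ∀ Is Ks → row (purpleV ξ 1#) ∅ Is Ks zeros R.≈ (if eqS Is Ks then 1# else 0#) zeros
    by [] [] = R.trans (∑-∅-end zeros) R.refl
      where
      ∑-∅-end : (if empty? (∅ {k}) then 1# else 0#) ≈ 1#
      ∑-∅-end = reflexive (≡.cong (λ b → if b then 1# else 0#) (empty-∅ k))
        where
        empty-∅ : ∀ n → empty? (∅ {n}) ≡ true
        empty-∅ zero = ≡.refl
        empty-∅ (suc n) = empty-∅ n
    by [] (_ ∷ _) = R.refl
    by (_ ∷ _) [] = R.refl
    by (I ∷ Is) (K ∷ Ks) = R.trans (∑-coeff (allLabels k) _ zeros) (R.trans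
      (Sums.∑-cong R (allLabels k) {g = λ L → ((if eqL I K then 1# else 0#) * row (purpleV ξ 1#) L Is Ks) zeros R.* (if empty? L then R.1# else R.0#)} term)
      (R.trans (Rows.∑-∅ R k _) (R.trans (at-zeros (if eqL I K then 1# else 0#) (row (purpleV ξ 1#) ∅ Is Ks)) (R.trans (R.*-congˡ (by Is Ks)) (nest (eqL I K) (eqS Is Ks))))))
      where
      term : ∀ L → (purpleV ξ 1# I ∅ K L * row (purpleV ξ 1#) L Is Ks) zeros
             R.≈ ((if eqL I K then 1# else 0#) * row (purpleV ξ 1#) L Is Ks) zeros R.* (if empty? L then R.1# else R.0#)
      term L with empty? L in eL
      ... | false = R.trans (at-zeros (purpleV ξ 1# I ∅ K L) (row (purpleV ξ 1#) L Is Ks)) (R.trans (R.*-congʳ (purpleV-Hom h I ∅ K L zeros λ p → nonempty-sum L eL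
            (≡.trans (≡.sym p) (≡.trans (ℕP.+-identityʳ _) (sum-0ᵛ V))))) (R.trans (R.zeroˡ _) (R.sym (R.zeroʳ _))))
      ... | true rewrite empty⇒∅ L eL = R.trans (*-congʳ {row (purpleV ξ 1#) ∅ Is Ks} (purpleV-∅ I K) zeros) (R.sym (R.*-identityʳ _))
      oneS-zeros : oneS {V} zeros R.≈ R.1#
      oneS-zeros = monoS-≡ R.1# zeros
      nest : ∀ a b → (if a then 1# else 0#) zeros R.* (if b then 1# else 0#) zeros R.≈ (if a ∧ b then 1# else 0#) zeros
      nest true b = R.trans (R.*-congʳ oneS-zeros) (R.*-identityˡ _)
      nest false b = R.zeroˡ _

  neg-Hom : ∀ {m n} {f : FPS V} → Hom m n f → Hom m n (- f)
  neg-Hom {f = f} h e ne = R.trans (R.-‿cong (h e ne)) (Algebra.Properties.Ring.-0#≈0# R.ring)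

  purple-cong : ∀ {ξ ξ′} → ξ ≈ ξ′ → purpleᵒ ξ ≐ purpleᵒ ξ′
  purple-cong p = pointwise λ {s′} {s} i j → row-cong (purpleV-cong p refl) ∅ s s′

  -- The local cancellation gives an inverse on one side only. Composing with the purple row on the
  -- right reduces the other side to it, and that row can be cancelled since its constant part is
  -- the identity.
  purple∘white : ∀ {ξ} → Hom 0 1 ξ → purpleᵒ (- ξ) ∘ whiteᵒ ξ ≐ Id
  purple∘white {ξ} h = cancelʳ {P = purpleᵒ (- ξ)} (λ {s′} {s} i j → purple-unit (neg-Hom h) s′ s)
    (≐-trans (∘-assoc (purpleᵒ (- ξ)) (whiteᵒ ξ) (purpleᵒ (- ξ)))
      (≐-trans (∘-cong ≐-refl (white∘purple ξ)) (≐-trans (∘-Id (purpleᵒ (- ξ))) (≐-sym (Id-∘ (purpleᵒ (- ξ)))))))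

-- Exchange of several rows

module RowOperators (R : CommutativeRing 0ℓ 0ℓ) (t t⁻¹ : CommutativeRing.Carrier R)
                 (tt⁻¹ : CommutativeRing._≈_ R (CommutativeRing._*_ R t t⁻¹) (CommutativeRing.1# R))
                 (V k c : ℕ) where
  open Lattice R t t⁻¹ using (Row)
  open Variables R t t⁻¹ tt⁻¹
  open GradedOperators R t t⁻¹ tt⁻¹ V k c

  operator : Row V → Op
  operator (white , v) = whiteᵒ (var v)
  operator (purple , v) = purpleᵒ (var v)

  operator-Up : ∀ r → Up (operator r)
  operator-Up (white , v) = white-Up (var-Hom v)
  operator-Up (purple , v) = purple-Up (var-Hom v)

  operators : List (Row V) → Op
  operators [] = Id
  operators (r ∷ rs) = operators rs ∘ operator r

  operators-Up : ∀ rs → Up (operators rs)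
  operators-Up [] = Id-Up
  operators-Up (r ∷ rs) = ∘-Up (operators-Up rs) (operator-Up r)

module RowFactors (R : CommutativeRing 0ℓ 0ℓ) (t t⁻¹ : CommutativeRing.Carrier R)
                 (tt⁻¹ : CommutativeRing._≈_ R (CommutativeRing._*_ R t t⁻¹) (CommutativeRing.1# R))
                 (V k : ℕ) where
  open Lattice R t t⁻¹ using (Row; FPS; prodS)
  open Series R t t⁻¹ using (seriesRing)
  open Variables R t t⁻¹ tt⁻¹
  open CommutativeRing (seriesRing V) using (1#; _*_; -_)
  open ExchangeRows (seriesRing V) (const t) (const t⁻¹) const-inverse using (crossing)

  -- Pairs of different colour give the commutation factor on one side, pairs of equal colour on the
  -- other. Keeping two factors postpones every division.
  denominator numerator : Row V → Row V → FPS V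
  denominator (white , x) (white , w) = 1#
  denominator (purple , y) (white , w) = crossing (var w * var y) k
  denominator (white , x) (purple , z) = crossing (var x * var z) k
  denominator (purple , y) (purple , z) = 1#
  numerator (white , x) (white , w) = crossing (var w * - var x) k
  numerator (purple , y) (white , w) = 1#
  numerator (white , x) (purple , z) = 1#
  numerator (purple , y) (purple , z) = crossing (- var z * var y) k

  product₁ : (Row V → Row V → FPS V) → Row V → List (Row V) → FPS V
  product₁ f r rs = prodS (map (f r) rs)

  product₂ : (Row V → Row V → FPS V) → List (Row V) → List (Row V) → FPS V
  product₂ f rs rs′ = prodS (map (λ r → product₁ f r rs′) rs)

module RowExchange (R : CommutativeRing 0ℓ 0ℓ) (t t⁻¹ : CommutativeRing.Carrier R)
                 (tt⁻¹ : CommutativeRing._≈_ R (CommutativeRing._*_ R t t⁻¹) (CommutativeRing.1# R))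
                 (V k c : ℕ) (particles : Vec ℕ k) (β : ℕ) where
  private module R = CommutativeRing R
  open Series R t t⁻¹
  open Variables R t t⁻¹ tt⁻¹
  open GradedOperators R t t⁻¹ tt⁻¹ V k c
  open RowOperators R t t⁻¹ tt⁻¹ V k c
  open RowFactors R t t⁻¹ tt⁻¹ V k
  open CommutativeRing K
  open ExchangeRows K (const t) (const t⁻¹) const-inverse using (crossing)
  open Good
  open Algebra.Properties.AbelianGroup +-abelianGroup using (⁻¹-involutive)

  record Valid (s : State) : Set where
    constructor valid
    field
      state : IsState s
      filled : counts s ≡ particles
  open Valid

  -- Equality of the entries between valid states, in the degrees that the
  -- window of columns is wide enough to resolve.
  infix 4 _≃_
  record _≃_ (M N : Op) : Set where
    constructor agree
    field within : ∀ {s′ s} → Valid s′ → Valid s → ∀ e → Vec.sum e ℕ.+ energy s < β → M s′ s e R.≈ N s′ s e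
  open _≃_ public

  ≐⇒≃ : ∀ {M N} → M ≐ N → M ≃ N
  ≐⇒≃ p = agree λ i j e lt → entry p (state i) (state j) e

  ≃-trans : ∀ {L M N} → L ≃ M → M ≃ N → L ≃ N
  ≃-trans p q = agree λ i j e lt → R.trans (within p i j e lt) (within q i j e lt)

  ≃-sym : ∀ {M N} → M ≃ N → N ≃ M
  ≃-sym p = agree λ i j e lt → R.sym (within p i j e lt)

  private
    ≤-part : ∀ {a b e} s → a ℕ.+ b ≡ e → e ℕ.+ s < β → b ℕ.+ s < β
    ≤-part {a} {b} s eq lt = ℕP.≤-<-trans (ℕP.+-monoˡ-≤ s (ℕP.≤-trans (ℕP.m≤n+m b a) (ℕP.≤-reflexive eq))) lt

    ≤-step : ∀ a b {e} s m → a ℕ.+ b ≡ e → e ℕ.+ s < β → m ≤ b ℕ.+ s → a ℕ.+ m < β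
    ≤-step a b s m ≡.refl lt le = ℕP.≤-<-trans (ℕP.≤-trans (ℕP.+-monoʳ-≤ a le) (ℕP.≤-reflexive (≡.sym (ℕP.+-assoc a b s)))) lt

  ·-≃ : ∀ a {M N} → M ≃ N → a · M ≃ a · N
  ·-≃ a p = agree λ {s′} {s} i j e lt → Sums.∑-cong-All R (All.map (λ eq →
    R.*-congˡ (within p i j _ (≤-part (energy s) eq lt))) (below-sum e))

  -- `G` conserves particle numbers, so only valid intermediate states contribute. They are targets
  -- of M and N, whose source `s` is unchanged, and the degree left for M and N is not larger than
  -- before.
  ∘-≃ˡ : ∀ {G M N} → Good G → M ≃ N → G ∘ M ≃ G ∘ N
  ∘-≃ˡ {G} {M} {N} g p = agree λ {s′} {s} i j e lt → ∑-states-coeff e λ {m} im → by i j e lt m im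
    where
    by : ∀ {s′ s} → Valid s′ → Valid s → ∀ e → Vec.sum e ℕ.+ energy s < β → ∀ m → IsState m → (G s′ m * M m s) e R.≈ (G s′ m * N m s) e
    by {s′} {s} i j e lt m im with VecP.≡-dec ℕ._≟_ (counts s′) (counts m)
    ... | no ne = trans {G s′ m * M m s} {0#} {G s′ m * N m s}
            (trans (*-congʳ {M m s} (good-counts g s′ m ne)) (zeroˡ (M m s)))
            (sym (trans (*-congʳ {N m s} (good-counts g s′ m ne)) (zeroˡ (N m s)))) e
    ... | yes eq = Sums.∑-cong-All R (All.map (λ eq′ →
            R.*-congˡ (within p (valid im (≡.trans (≡.sym eq) (filled i))) j _ (≤-part (energy s) eq′ lt))) (below-sum e))

  -- Here the intermediate state is the source of M and N, and its energy may exceed that of `s`. By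
  -- `good-ord` the gain is at most the degree spent on `G`, so the remaining degree plus the new
  -- energy is still below β.
  ∘-≃ʳ : ∀ {G M N} → Good G → M ≃ N → M ∘ G ≃ N ∘ G
  ∘-≃ʳ {G} {M} {N} g p = agree λ {s′} {s} i j e lt → ∑-states-coeff e λ {m} im → by i j e lt m im
    where
    by : ∀ {s′ s} → Valid s′ → Valid s → ∀ e → Vec.sum e ℕ.+ energy s < β → ∀ m → IsState m → (M s′ m * G m s) e R.≈ (N s′ m * G m s) e
    by {s′} {s} i j e lt m im with VecP.≡-dec ℕ._≟_ (counts m) (counts s)
    ... | no ne = trans {M s′ m * G m s} {0#} {N s′ m * G m s}
            (trans (*-congˡ {M s′ m} (good-counts g m s ne)) (zeroʳ (M s′ m)))
            (sym (trans (*-congˡ {N s′ m} (good-counts g m s ne)) (zeroʳ (N s′ m)))) e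
    ... | yes eq = Sums.∑-cong-All R (All.map (λ {a} eq′ → step a eq′) (below-sum e))
      where
      step : ∀ a → Vec.sum a ℕ.+ Vec.sum (zipWith ℕ._∸_ e a) ≡ Vec.sum e →
             M s′ m a R.* G m s (zipWith ℕ._∸_ e a) R.≈ N s′ m a R.* G m s (zipWith ℕ._∸_ e a)
      step a eq′ with Vec.sum (zipWith ℕ._∸_ e a) ℕ.+ energy s ℕ.<? energy m
      ... | yes l = let z = good-ord g m s _ l in
            R.trans (R.*-congˡ z) (R.trans (R.zeroʳ _) (R.sym (R.trans (R.*-congˡ z) (R.zeroʳ _))))
      ... | no nl = R.*-congʳ (within p i (valid im (≡.trans eq (filled j))) a
            (≤-step (Vec.sum a) (Vec.sum (zipWith ℕ._∸_ e a)) (energy s) (energy m) eq′ lt (ℕP.≮⇒≥ nl)))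

  module _ (packed : ∀ {s} → Valid s → energy s < β → Inner s) where

    -- A target of energy at least β cannot be reached in the degrees compared, so both entries are
    -- zero. A target below β is packed, and so is the source, whose energy is below β by the degree
    -- bound.
    inner-≃ : ∀ {M N} → Good M → Good N →
      (∀ {s′ s} → IsState s′ → IsState s → Inner s′ → Inner s → M s′ s ≈ N s′ s) → M ≃ N
    inner-≃ {M} {N} gM gN h = agree λ {s′} {s} i j e lt → by i j e lt
      where
      by : ∀ {s′ s} → Valid s′ → Valid s → ∀ e → Vec.sum e ℕ.+ energy s < β → M s′ s e R.≈ N s′ s e
      by {s′} {s} i j e lt with energy s′ ℕ.<? β
      ... | yes l = h (state i) (state j) (packed i l) (packed j (ℕP.≤-<-trans (ℕP.m≤n+m (energy s) (Vec.sum e)) lt)) e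
      ... | no nl = R.trans (good-ord gM s′ s e (ℕP.<-≤-trans lt (ℕP.≮⇒≥ nl))) (R.sym (good-ord gN s′ s e (ℕP.<-≤-trans lt (ℕP.≮⇒≥ nl))))

    purple-white : ∀ {ω ξ} → Hom 0 1 ω → Hom 0 1 ξ →
      crossing (ω * ξ) k · (purpleᵒ ξ ∘ star (whiteᵒ ω)) ≃ star (whiteᵒ ω) ∘ purpleᵒ ξ
    purple-white {ω} {ξ} hω hξ = inner-≃
      (·-Good _ (∘-Good (Up⇒Good (purple-Up hξ)) (star-Good (white-Up hω))))
      (∘-Good (star-Good (white-Up hω)) (Up⇒Good (purple-Up hξ)))
      (exchange-inner ω ξ)

    white-purple* : ∀ {ω ξ} → Hom 0 1 ω → Hom 0 1 ξ →
      crossing (ω * ξ) k · (whiteᵒ ω ∘ star (purpleᵒ ξ)) ≃ star (purpleᵒ ξ) ∘ whiteᵒ ω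
    white-purple* {ω} {ξ} hω hξ = inner-≃
      (·-Good _ (∘-Good (Up⇒Good (white-Up hω)) (star-Good (purple-Up hξ))))
      (∘-Good (star-Good (purple-Up hξ)) (Up⇒Good (white-Up hω)))
      (exchange-inner* ω ξ)

    private
      onLeft : ∀ N {M M′} → M ≐ M′ → M ∘ N ≐ M′ ∘ N
      onLeft N p = ∘-cong {N = N} p ≐-refl

      onRight : ∀ M {N N′} → N ≐ N′ → M ∘ N ≐ M ∘ N′
      onRight M p = ∘-cong {M = M} ≐-refl p

      assoc₄ : ∀ A B C D → (A ∘ (B ∘ C)) ∘ D ≐ (A ∘ B) ∘ (C ∘ D)
      assoc₄ A B C D = ≐-trans (onLeft D (≐-sym (∘-assoc A B C))) (∘-assoc (A ∘ B) C D)

      assoc₄· : ∀ a A B C D → (A ∘ (a · (B ∘ C))) ∘ D ≐ a · ((A ∘ B) ∘ (C ∘ D))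
      assoc₄· a A B C D = ≐-trans (onLeft D (≐-sym (∘-· a A (B ∘ C))))
        (≐-trans (≐-sym (·-∘ a (A ∘ (B ∘ C)) D)) (·-cong a (assoc₄ A B C D)))

      -- Conjugation by the inverse Q of B turns one exchange relation into another.
      invert : ∀ {a A B Q} → Good Q → a · (B ∘ A) ≃ A ∘ B → Q ∘ B ≐ Id → B ∘ Q ≐ Id → Q ∘ A ≃ a · (A ∘ Q)
      invert {a} {A} {B} {Q} g rel qb bq = ≃-sym (≃-trans
        (≐⇒≃ (≐-sym (≐-trans (assoc₄· a Q B A Q) (·-cong a (≐-trans (onLeft (A ∘ Q) qb) (Id-∘ (A ∘ Q)))))))
        (≃-trans (∘-≃ʳ g (∘-≃ˡ g rel))
          (≐⇒≃ (≐-trans (assoc₄ Q A B Q) (≐-trans (onRight (Q ∘ A) bq) (∘-Id (Q ∘ A)))))))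

      invert′ : ∀ {a A B Q} → Good Q → a · (A ∘ B) ≃ B ∘ A → B ∘ Q ≐ Id → Q ∘ B ≐ Id → A ∘ Q ≃ a · (Q ∘ A)
      invert′ {a} {A} {B} {Q} g rel bq qb = ≃-sym (≃-trans
        (≐⇒≃ (≐-sym (≐-trans (assoc₄· a Q A B Q) (·-cong a (≐-trans (onRight (Q ∘ A) bq) (∘-Id (Q ∘ A)))))))
        (≃-trans (∘-≃ʳ g (∘-≃ˡ g rel))
          (≐⇒≃ (≐-trans (assoc₄ Q B A Q) (≐-trans (onLeft (A ∘ Q) qb) (Id-∘ (A ∘ Q)))))))

      1·_ : ∀ M → 1# · M ≐ M
      1· M = pointwise λ {s′} {s} i j → *-identityˡ (M s′ s)

    exchange-single : ∀ r₁ r₂ → denominator r₁ r₂ · (operator r₁ ∘ star (operator r₂))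
                                 ≃ numerator r₁ r₂ · (star (operator r₂) ∘ operator r₁)
    exchange-single (purple , y) (white , w) = ≃-trans (purple-white (var-Hom w) (var-Hom y)) (≐⇒≃ (≐-sym (1· _)))
    exchange-single (white , x) (purple , z) = ≃-trans (white-purple* (var-Hom x) (var-Hom z)) (≐⇒≃ (≐-sym (1· _)))
    exchange-single (white , x) (white , w) = ≃-trans (≐⇒≃ (1· _))
      (invert (Up⇒Good (white-Up (var-Hom x))) (purple-white (var-Hom w) (neg-Hom (var-Hom x)))
        (white∘purple (var x)) (purple∘white (var-Hom x)))
    -- Here the dual row is the one to be inverted: `star` of the purple row z is inverse to `star`
    -- of the white row with parameter - z. The inverse relations at - z produce the purple row with
    -- a doubly negated parameter.
    exchange-single (purple , y) (purple , z) = ≃-trans (≐⇒≃ (1· _))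
      (invert′ (star-Good (purple-Up (var-Hom z))) (purple-white (neg-Hom (var-Hom z)) (var-Hom y))
        (≐-trans (≐-sym (star-∘ (purpleᵒ (var z)) (whiteᵒ (- var z)))) (≐-trans (star-cong
          (≐-trans (onLeft (whiteᵒ (- var z)) (purple-cong (sym (⁻¹-involutive (var z))))) (purple∘white (neg-Hom (var-Hom z))))) star-Id))
        (≐-trans (≐-sym (star-∘ (whiteᵒ (- var z)) (purpleᵒ (var z)))) (≐-trans (star-cong
          (≐-trans (onRight (whiteᵒ (- var z)) (purple-cong (sym (⁻¹-involutive (var z))))) (white∘purple (- var z)))) star-Id)))

    private
      assoc-· : ∀ a b M → a · (b · M) ≐ (a * b) · M
      assoc-· a b M = pointwise λ {s′} {s} i j → sym (*-assoc a b (M s′ s))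

      comm-· : ∀ a b M → (a * b) · M ≐ b · (a · M)
      comm-· a b M = pointwise λ {s′} {s} i j → trans (*-congʳ {M s′ s} (*-comm a b)) (*-assoc b a (M s′ s))

      exchange-right : ∀ {d n D N X S T} → Good X → Good S → Good T → d · (X ∘ S) ≃ n · (S ∘ X) → D · (X ∘ T) ≃ N · (T ∘ X) →
        (d * D) · (X ∘ (S ∘ T)) ≃ (n * N) · ((S ∘ T) ∘ X)
      exchange-right {d} {n} {D} {N} {X} {S} {T} gX gS gT p q =
        ≃-trans (≐⇒≃ (≐-trans (comm-· d D (X ∘ (S ∘ T))) (·-cong D {d · (X ∘ (S ∘ T))} {(d · (X ∘ S)) ∘ T}
          (≐-trans (·-cong d {X ∘ (S ∘ T)} {(X ∘ S) ∘ T} (≐-sym (∘-assoc X S T))) (·-∘ d (X ∘ S) T)))))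
        (≃-trans (·-≃ D {(d · (X ∘ S)) ∘ T} {(n · (S ∘ X)) ∘ T} (∘-≃ʳ gT p))
        (≃-trans (≐⇒≃ (≐-trans (·-cong D {(n · (S ∘ X)) ∘ T} {n · (S ∘ (X ∘ T))}
                   (≐-trans (≐-sym (·-∘ n (S ∘ X) T)) (·-cong n {(S ∘ X) ∘ T} {S ∘ (X ∘ T)} (∘-assoc S X T))))
                 (≐-trans (≐-trans (assoc-· D n (S ∘ (X ∘ T))) (comm-· D n (S ∘ (X ∘ T))))
                   (·-cong n {D · (S ∘ (X ∘ T))} {S ∘ (D · (X ∘ T))} (∘-· D S (X ∘ T))))))
        (≃-trans (·-≃ n {S ∘ (D · (X ∘ T))} {S ∘ (N · (T ∘ X))} (∘-≃ˡ gS q))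
        (≐⇒≃ (≐-trans (·-cong n {S ∘ (N · (T ∘ X))} {N · ((S ∘ T) ∘ X)}
               (≐-trans (≐-sym (∘-· N S (T ∘ X))) (·-cong N {S ∘ (T ∘ X)} {(S ∘ T) ∘ X} (≐-sym (∘-assoc S T X)))))
               (assoc-· n N ((S ∘ T) ∘ X)))))))

      exchange-left : ∀ {d n D N X Y S} → Good X → Good Y → d · (X ∘ S) ≃ n · (S ∘ X) → D · (Y ∘ S) ≃ N · (S ∘ Y) →
        (d * D) · ((Y ∘ X) ∘ S) ≃ (n * N) · (S ∘ (Y ∘ X))
      exchange-left {d} {n} {D} {N} {X} {Y} {S} gX gY p q =
        ≃-trans (≐⇒≃ (≐-trans (comm-· d D ((Y ∘ X) ∘ S)) (·-cong D {d · ((Y ∘ X) ∘ S)} {Y ∘ (d · (X ∘ S))}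
          (≐-trans (·-cong d {(Y ∘ X) ∘ S} {Y ∘ (X ∘ S)} (∘-assoc Y X S)) (∘-· d Y (X ∘ S))))))
        (≃-trans (·-≃ D {Y ∘ (d · (X ∘ S))} {Y ∘ (n · (S ∘ X))} (∘-≃ˡ gY p))
        (≃-trans (≐⇒≃ (≐-trans (·-cong D {Y ∘ (n · (S ∘ X))} {n · ((Y ∘ S) ∘ X)}
                   (≐-trans (≐-sym (∘-· n Y (S ∘ X))) (·-cong n {Y ∘ (S ∘ X)} {(Y ∘ S) ∘ X} (≐-sym (∘-assoc Y S X)))))
                 (≐-trans (≐-trans (assoc-· D n ((Y ∘ S) ∘ X)) (comm-· D n ((Y ∘ S) ∘ X)))
                   (·-cong n {D · ((Y ∘ S) ∘ X)} {(D · (Y ∘ S)) ∘ X} (·-∘ D (Y ∘ S) X)))))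
        (≃-trans (·-≃ n {(D · (Y ∘ S)) ∘ X} {(N · (S ∘ Y)) ∘ X} (∘-≃ʳ gX q))
        (≐⇒≃ (≐-trans (·-cong n {(N · (S ∘ Y)) ∘ X} {N · (S ∘ (Y ∘ X))}
               (≐-trans (≐-sym (·-∘ N (S ∘ Y) X)) (·-cong N {(S ∘ Y) ∘ X} {S ∘ (Y ∘ X)} (∘-assoc S Y X))))
               (assoc-· n N (S ∘ (Y ∘ X))))))))

    exchange-one : ∀ r rs → product₁ denominator r rs · (operator r ∘ star (operators rs))
                            ≃ product₁ numerator r rs · (star (operators rs) ∘ operator r)
    exchange-one r [] = ≐⇒≃ (·-cong 1# (≐-trans (onRight (operator r) star-Id) (≐-trans (∘-Id (operator r))
      (≐-sym (≐-trans (onLeft (operator r) star-Id) (Id-∘ (operator r)))))))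
    exchange-one r (r′ ∷ rs) = ≃-trans
      (≐⇒≃ (·-cong _ (onRight (operator r) (star-∘ (operators rs) (operator r′)))))
      (≃-trans (exchange-right (Up⇒Good (operator-Up r)) (star-Good (operator-Up r′)) (star-Good (operators-Up rs))
                 (exchange-single r r′) (exchange-one r rs))
        (≐⇒≃ (·-cong _ (onLeft (operator r) (≐-sym (star-∘ (operators rs) (operator r′)))))))

    exchange-all : ∀ rs rs′ → product₂ denominator rs rs′ · (operators rs ∘ star (operators rs′))
                              ≃ product₂ numerator rs rs′ · (star (operators rs′) ∘ operators rs)
    exchange-all [] rs′ = ≐⇒≃ (·-cong 1# (≐-trans (Id-∘ (star (operators rs′))) (≐-sym (∘-Id (star (operators rs′))))))
    exchange-all (r ∷ rs) rs′ = exchange-left (Up⇒Good (operator-Up r)) (Up⇒Good (operators-Up rs))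
      (exchange-one r rs′) (exchange-all rs rs′)

-- Lattices as products of row operators

allFin-suc : ∀ {A : Set} (f : Fin (suc k) → A) → map f (allFin (suc k)) ≡ f zero ∷ map (λ i → f (suc i)) (allFin k)
allFin-suc {k} f = ≡.cong (f zero ∷_) (≡.trans (ListP.map-tabulate suc f) (≡.sym (ListP.map-tabulate (λ i → i) (λ i → f (suc i)))))

sum-concatMap : ∀ {A : Set} (f : A → List ℕ) xs → sum (concatMap f xs) ≡ sum (map (λ x → sum (f x)) xs)
sum-concatMap f [] = ≡.refl
sum-concatMap f (x ∷ xs) = ≡.trans (SumP.sum-++ (f x) (concatMap f xs)) (≡.cong (sum (f x) ℕ.+_) (sum-concatMap f xs))

sum-lookup : ∀ m (M : Vec ℕ k) → sum (map (λ d → m ℕ.* lookup M d) (allFin k)) ≡ m ℕ.* Vec.sum M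
sum-lookup m [] = ≡.sym (ℕP.*-zeroʳ m)
sum-lookup m (x ∷ M) = ≡.trans (≡.cong sum (allFin-suc (λ d → m ℕ.* lookup (x ∷ M) d)))
  (≡.trans (≡.cong (m ℕ.* x ℕ.+_) (sum-lookup m M)) (≡.sym (ℕP.*-distribˡ-+ m x (Vec.sum M))))

module LatticeLink (R : CommutativeRing 0ℓ 0ℓ) (t t⁻¹ : CommutativeRing.Carrier R)
                 (tt⁻¹ : CommutativeRing._≈_ R (CommutativeRing._*_ R t t⁻¹) (CommutativeRing.1# R))
                 (V k : ℕ) where
  private module R = CommutativeRing R
  open Lattice R t t⁻¹
  open Series R t t⁻¹
  open Variables R t t⁻¹ tt⁻¹

  φ-φᵛ : ∀ {k} (L : Label k) M → φ L M ≡ φᵛ (bv L) M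
  φ-φᵛ [] [] = ≡.refl
  φ-φᵛ {suc k} (l ∷ L) (m ∷ M) = begin
    φ (l ∷ L) (m ∷ M)
      ≡⟨ sum-concatMap (λ c → map (g c) (allFin (suc k))) (allFin (suc k)) ⟩
    sum (map (λ c → sum (map (g c) (allFin (suc k)))) (allFin (suc k)))
      ≡⟨ ≡.cong sum (allFin-suc (λ c → sum (map (g c) (allFin (suc k))))) ⟩
    sum (map (g zero) (allFin (suc k))) ℕ.+ sum (map (λ c → sum (map (g (suc c)) (allFin (suc k)))) (allFin k))
      ≡⟨ ≡.cong₂ ℕ._+_ (≡.trans (≡.cong sum (allFin-suc (g zero))) (sum-lookup (b2n l) M))
           (≡.cong sum (ListP.map-cong (λ c → ≡.cong sum (allFin-suc (g (suc c)))) (allFin k))) ⟩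
    b2n l ℕ.* Vec.sum M ℕ.+ sum (map (λ c → sum (map (λ d → g (suc c) (suc d)) (allFin k))) (allFin k))
      ≡⟨ ≡.cong (b2n l ℕ.* Vec.sum M ℕ.+_) (≡.trans (≡.sym (sum-concatMap (λ c → map (λ d → g (suc c) (suc d)) (allFin k)) (allFin k))) (φ-φᵛ L M)) ⟩
    φᵛ (bv (l ∷ L)) (m ∷ M) ∎
    where
    open ≡.≡-Reasoning
    g : Fin (suc k) → Fin (suc k) → ℕ
    g c d = if toℕ c <ᵇ toℕ d then b2n (lookup (l ∷ L) c) ℕ.* lookup (m ∷ M) d else 0

  size-sum : ∀ {k} (L : Label k) → size L ≡ Vec.sum (bv L)
  size-sum [] = ≡.refl
  size-sum (l ∷ L) = ≡.cong (b2n l ℕ.+_) (size-sum L)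

  private
    ∧-shuffle : ∀ a b c d → (a ∧ b) ∧ (c ∧ d) ≡ (a ∧ c) ∧ (b ∧ d)
    ∧-shuffle true b true d = ≡.refl
    ∧-shuffle true b false d = BoolP.∧-zeroʳ b
    ∧-shuffle false b c d = ≡.refl

    allV-suc : ∀ {k} (f : Fin (suc k) → Bool) → allV f ≡ f zero ∧ allV (λ c → f (suc c))
    allV-suc f = ≡.cong and (allFin-suc f)

  private
    flow : (i j k l : Bool) → Bool
    flow i j k l = ⌊ (b2n i ℕ.+ b2n j) ℕ.≟ (b2n k ℕ.+ b2n l) ⌋

    conserve-∷ : ∀ {n} i j k l (I J K L : Label n) →
      conserve (i ∷ I) (j ∷ J) (k ∷ K) (l ∷ L) ≡ flow i j k l ∧ conserve I J K L
    conserve-∷ i j k l I J K L = allV-suc λ c →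
      flow (lookup (i ∷ I) c) (lookup (j ∷ J) c) (lookup (k ∷ K) c) (lookup (l ∷ L) c)

  okW-link : ∀ {k} (I J K L : Label k) → conserve I J K L ∧ allV (λ c → not (lookup I c ∧ lookup J c)) ≡ okAllW I J K L
  okW-link [] [] [] [] = ≡.refl
  okW-link (i ∷ I) (j ∷ J) (k ∷ K) (l ∷ L) = ≡.trans
    (≡.cong₂ _∧_ (conserve-∷ i j k l I J K L) (allV-suc λ c → not (lookup (i ∷ I) c ∧ lookup (j ∷ J) c)))
    (≡.trans (∧-shuffle (flow i j k l) (conserve I J K L) (not (i ∧ j)) (allV λ c → not (lookup I c ∧ lookup J c)))
      (≡.cong (okW i j k l ∧_) (okW-link I J K L)))

  okP-link : ∀ {k} (I J K L : Label k) → conserve I J K L ∧ allV (λ c → not (lookup J c ∧ not (lookup K c))) ≡ okAllP I J K L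
  okP-link [] [] [] [] = ≡.refl
  okP-link (i ∷ I) (j ∷ J) (k ∷ K) (l ∷ L) = ≡.trans
    (≡.cong₂ _∧_ (conserve-∷ i j k l I J K L) (allV-suc λ c → not (lookup (j ∷ J) c ∧ not (lookup (k ∷ K) c))))
    (≡.trans (∧-shuffle (flow i j k l) (conserve I J K L) (not (j ∧ not k)) (allV λ c → not (lookup J c ∧ not (lookup K c))))
      (≡.cong (okP i j k l ∧_) (okP-link I J K L)))

  K : CommutativeRing 0ℓ 0ℓ
  K = seriesRing V
  open CommutativeRing K
  open RingSolver K
  open Rows K
  open VertexWeights K (const t)
  open ClosedForms K (const t)

  const-^ : ∀ n → const t ^ n ≈ const (t ^ᴿ n)
  const-^ zero = refl
  const-^ (suc n) = trans (*-congˡ {const t} (const-^ n)) (const-* t (t ^ᴿ n))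

  var-^ : ∀ (v : Fin V) n → var v ^ n ≈ monoS R.1# (unitV v n)
  var-^ v zero = reflexive (≡.cong (monoS R.1#) (≡.sym (unitV-0 v)))
  var-^ v (suc n) = trans (*-congˡ {var v} (var-^ v n)) (trans (monoS-* R.1# R.1# (unitV v 1) (unitV v n))
    (trans (monoS-cong (unitV v 1 +ᵛ unitV v n) (R.*-identityˡ R.1#)) (reflexive (≡.cong (monoS R.1#) (unitV-+ v 1 n)))))

  monomial-link : ∀ (v : Fin V) n a → monoS (t ^ᴿ a) (unitV v n) ≈ var v ^ n * const t ^ a
  monomial-link v n a = sym (trans (*-cong (var-^ v n) (const-^ a)) (trans (monoS-* R.1# (t ^ᴿ a) (unitV v n) zeros)
    (trans (monoS-cong (unitV v n +ᵛ zeros) (R.*-identityˡ _)) (reflexive (≡.cong (monoS (t ^ᴿ a)) (+ᵛ-identityʳ (unitV v n)))))))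

  vertexV : Row V → Vertex k
  vertexV (white , v) = whiteV (var v) 1#
  vertexV (purple , v) = purpleV (var v) 1#

  vertex-link : ∀ ty v (I J K L : Label k) → vertex ty v I J K L ≈ vertexV (ty , v) I J K L
  vertex-link white v I J K L = trans (reflexive (≡.cong₂ (λ b m → if b then m else zeroS) (okW-link I J K L)
      (≡.cong₂ (λ a n → monoS (t ^ᴿ a) (unitV v n)) (φ-φᵛ L (plusV I J)) (size-sum L))))
    (trans (guard-cong (okAllW I J K L) (trans (monomial-link v (Vec.sum (bv L)) (φᵛ (bv L) (plusV I J)))
        (reflexive (≡.cong (λ p → var v ^ Vec.sum (bv L) * const t ^ φᵛ (bv L) p) (plusV-bv I J)))))
      (sym (whiteV-closed (var v) 0 I J K L)))
    where
    plusV-bv : ∀ {k} (I J : Label k) → plusV I J ≡ bv I +ᵛ bv J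
    plusV-bv [] [] = ≡.refl
    plusV-bv (i ∷ I) (j ∷ J) = ≡.cong (_ ∷_) (plusV-bv I J)
  vertex-link purple v I J K L = trans (reflexive (≡.cong₂ (λ b m → if b then m else zeroS) (okP-link I J K L)
      (≡.cong₂ (λ a n → monoS (t ^ᴿ a) (unitV v n)) (φ-φᵛ L (minusV K J)) (size-sum L))))
    (trans (guard-cong (okAllP I J K L) (monomial-link v (Vec.sum (bv L)) (φᵛ (bv L) (minusV K J))))
      (sym (purpleV-closed (var v) 0 I J K L)))

  rowW-link : ∀ r (J : Label k) Is Ks → rowW r J Is Ks ≈ row (vertexV r) J Is Ks
  rowW-link r J [] [] = refl
  rowW-link r J [] (_ ∷ _) = refl
  rowW-link r J (_ ∷ _) [] = refl
  rowW-link (ty , v) J (I ∷ Is) (K ∷ Ks) = ∑-cong (allLabels k) λ L →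
    *-cong (vertex-link ty v I J K L) (rowW-link (ty , v) L Is Ks)

  eqL-refl : ∀ {n} (I : Label n) → eqL I I ≡ true
  eqL-refl [] = ≡.refl
  eqL-refl (false ∷ I) = eqL-refl I
  eqL-refl (true ∷ I) = eqL-refl I

  eqS-refl : ∀ (s : List (Label k)) → eqS s s ≡ true
  eqS-refl [] = ≡.refl
  eqS-refl (I ∷ s) = ≡.cong₂ _∧_ (eqL-refl I) (eqS-refl s)

  module Window (c : ℕ) where
    open RowOperators R t t⁻¹ tt⁻¹ V k c public using (operator; operators)
    open GradedOperators R t t⁻¹ tt⁻¹ V k c public using (State; states; eqS⇒≡; eqL⇒≡; eqL-sym; ∑-eqL; IsState; isState)

    labelsEq-eqS : ∀ (B T : State) → labelsEq B T ≡ eqS B T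
    labelsEq-eqS B T with ListP.≡-dec (VecP.≡-dec BoolP._≟_) B T | eqS B T in eq
    ... | yes p | true = ≡.refl
    ... | no p | false = ≡.refl
    ... | yes ≡.refl | false = ≡.trans (≡.sym (eqS-refl B)) eq
    ... | no ne | true = ⊥-elim (ne (eqS⇒≡ B T eq))

    operator-row : ∀ r T B → operator r T B ≈ row (vertexV r) ∅ B T
    operator-row (white , v) T B = refl
    operator-row (purple , v) T B = refl

    lattice-link : ∀ rs (B T : State) → lattice rs c B T ≈ operators rs T B
    lattice-link [] B T = reflexive (≡.cong (λ b → if b then oneS else zeroS) (labelsEq-eqS B T))
    lattice-link (r ∷ rs) B T = ∑-cong states λ S → trans
      (*-cong (trans (rowW-link r ∅ B S) (sym (operator-row r S B))) (lattice-link rs S T)) (*-comm (operator r S B) (operators rs T S))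

  vertexV-conservative : ∀ r → Conservative (vertexV r)
  vertexV-conservative (white , v) = whiteV-conservative (var v)
  vertexV-conservative (purple , v) = purpleV-conservative (var v)

  private
    one² : ∀ {x y} → x ≈ 1# → y ≈ 1# → x * y ≈ 1#
    one² p q = trans (*-cong p q) (*-identityˡ 1#)

  vertexV-∅ : ∀ r → vertexV r ∅ ∅ ∅ ∅ ≈ 1#
  vertexV-∅ (white , v) = by k 1#
    where
    by : ∀ n g → whiteV {n} (var v) g ∅ ∅ ∅ ∅ ≈ 1#
    by zero g = refl
    by (suc n) g = one² (*-identityˡ 1#) (by n _)
  vertexV-∅ (purple , v) = by k 1#
    where
    by : ∀ n g → purpleV {n} (var v) g ∅ ∅ ∅ ∅ ≈ 1#
    by zero g = refl
    by (suc n) g = one² (*-identityˡ 1#) (by n _)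

  vertexV-full : ∀ r → vertexV r full ∅ full ∅ ≈ 1#
  vertexV-full (white , v) = by k 1# refl
    where
    by : ∀ n g → g ≈ 1# → whiteV {n} (var v) g full ∅ full ∅ ≈ 1#
    by zero g h = refl
    by (suc n) g h = one² (one² refl h) (by n _ (one² refl h))
  vertexV-full (purple , v) = by k 1# refl
    where
    by : ∀ n g → g ≈ 1# → purpleV {n} (var v) g full ∅ full ∅ ≈ 1#
    by zero g h = refl
    by (suc n) g h = one² (one² refl h) (by n _ (one² refl h))

  ind : Label k → Label k → FPS V
  ind K I = if eqL K I then 1# else 0#

  -- A conserved column equation with K = 0 resp. K = 1 at an end of the window
  -- forces the remaining labels.
  forced-∅ : ∀ {n} (I J : Label n) → bv I +ᵛ bv J ≡ bv (∅ {n}) +ᵛ bv ∅ → I ≡ ∅ × J ≡ ∅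
  forced-∅ [] [] p = ≡.refl , ≡.refl
  forced-∅ (false ∷ I) (false ∷ J) p with forced-∅ I J (VecP.∷-injectiveʳ p)
  ... | q , r = ≡.cong (false ∷_) q , ≡.cong (false ∷_) r
  forced-∅ (true ∷ I) (j ∷ J) p with VecP.∷-injectiveˡ p
  ... | ()
  forced-∅ (false ∷ I) (true ∷ J) p with VecP.∷-injectiveˡ p
  ... | ()

  forced-full : ∀ {n} (I L : Label n) → bv I +ᵛ bv ∅ ≡ bv full +ᵛ bv L → I ≡ full × L ≡ ∅
  forced-full [] [] p = ≡.refl , ≡.refl
  forced-full (true ∷ I) (false ∷ L) p with forced-full I L (VecP.∷-injectiveʳ p)
  ... | q , r = ≡.cong (true ∷_) q , ≡.cong (false ∷_) r
  forced-full (false ∷ I) (l ∷ L) p with VecP.∷-injectiveˡ p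
  ... | ()
  forced-full (true ∷ I) (true ∷ L) p with VecP.∷-injectiveˡ p
  ... | ()

  eqL-∅ : ∀ {n} (J : Label n) → eqL ∅ J ≡ empty? J
  eqL-∅ [] = ≡.refl
  eqL-∅ (false ∷ J) = eqL-∅ J
  eqL-∅ (true ∷ J) = ≡.refl

  row-∷ʳ : ∀ r (J I : Label k) Is Ks → length Is ≡ length Ks →
           row (vertexV r) J (Is ++ I ∷ []) (Ks ++ ∅ ∷ []) ≈ row (vertexV r) J Is Ks * ind ∅ I
  row-∷ʳ r J I [] [] eq = trans (∑-∅ k (λ L → vertexV r I J ∅ L)) by
    where
    by : vertexV r I J ∅ ∅ ≈ (if empty? J then 1# else 0#) * ind ∅ I
    by with VecP.≡-dec ℕ._≟_ (bv I +ᵛ bv J) (bv ∅ +ᵛ bv ∅)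
    ... | yes p with forced-∅ I J p
    ...   | ≡.refl , ≡.refl = trans (vertexV-∅ r) (sym (trans (*-cong
              (reflexive (≡.cong (λ b → if b then 1# else 0#) (≡.trans (≡.sym (eqL-∅ (∅ {k}))) (eqL-refl (∅ {k})))))
              (reflexive (≡.cong (λ b → if b then 1# else 0#) (eqL-refl (∅ {k}))))) (*-identityˡ 1#)))
    by | no ne = trans (vertexV-conservative r I J ∅ ∅ ne) (sym cases)
      where
      cases : (if empty? J then 1# else 0#) * ind ∅ I ≈ 0#
      cases with empty? J in eJ | eqL ∅ I in eI
      ... | false | b = zeroˡ (if b then 1# else 0#)
      ... | true | false = zeroʳ 1#
      ... | true | true = ⊥-elim (ne (≡.cong₂ (λ a b → bv a +ᵛ bv b) (empty⇒∅ I (≡.trans (≡.sym (eqL-∅ I)) eI)) (empty⇒∅ J eJ)))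
  row-∷ʳ r J I (I′ ∷ Is) (K′ ∷ Ks) eq = trans (∑-cong (allLabels k) λ L → trans
    (*-congˡ {vertexV r I′ J K′ L} (row-∷ʳ r L I Is Ks (ℕP.suc-injective eq))) (sym (*-assoc (vertexV r I′ J K′ L) (row (vertexV r) L Is Ks) (ind ∅ I))))
    (sym (∑-* (allLabels k) (ind ∅ I) (λ L → vertexV r I′ J K′ L * row (vertexV r) L Is Ks)))

  row-full : ∀ r (I : Label k) Is Ks → row (vertexV r) ∅ (I ∷ Is) (full ∷ Ks) ≈ row (vertexV r) ∅ Is Ks * ind full I
  row-full r I Is Ks = trans (∑-cong (allLabels k) term) (∑-∅ k (λ L → row (vertexV r) L Is Ks * ind full I))
    where
    term : ∀ L → vertexV r I ∅ full L * row (vertexV r) L Is Ks ≈ (row (vertexV r) L Is Ks * ind full I) * (if empty? L then 1# else 0#)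
    term L with VecP.≡-dec ℕ._≟_ (bv I +ᵛ bv ∅) (bv full +ᵛ bv L)
    ... | yes p with forced-full I L p
    ...   | ≡.refl , ≡.refl = trans (*-congʳ {row (vertexV r) ∅ Is Ks} (vertexV-full r)) (trans (*-comm 1# (row (vertexV r) ∅ Is Ks)) (sym (trans
              (*-cong (*-congˡ {row (vertexV r) ∅ Is Ks} (reflexive (≡.cong (λ b → if b then 1# else 0#) (eqL-refl (full {k})))))
                (reflexive (≡.cong (λ b → if b then 1# else 0#) (≡.trans (≡.sym (eqL-∅ (∅ {k}))) (eqL-refl (∅ {k}))))))
              (*-identityʳ (row (vertexV r) ∅ Is Ks * 1#)))))
    term L | no ne = trans (*-congʳ {row (vertexV r) L Is Ks} (vertexV-conservative r I ∅ full L ne))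
        (trans (zeroˡ (row (vertexV r) L Is Ks)) (sym cases))
      where
      cases : (row (vertexV r) L Is Ks * ind full I) * (if empty? L then 1# else 0#) ≈ 0#
      cases with eqL full I in eI | empty? L in eL
      ... | false | b = trans (*-congʳ {if b then 1# else 0#} (zeroʳ (row (vertexV r) L Is Ks))) (zeroˡ (if b then 1# else 0#))
      ... | true | false = zeroʳ (row (vertexV r) L Is Ks * 1#)
      ... | true | true = ⊥-elim (ne (≡.cong₂ (λ a b → bv a +ᵛ bv b) (≡.sym (Window.eqL⇒≡ 0 full I eI)) (≡.sym (empty⇒∅ L eL))))

  module _ (c : ℕ) where
    private
      module W = Window c
      module W⁺ = Window (suc c)

    -- Only the top label of the added column is prescribed. The bottom label stays free because in
    -- the induction it is the label between two rows, and the indicator then collapses the sum over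
    -- it.
    operators-∷ʳ : ∀ rs (T B : List (Label k)) L → length T ≡ c → length B ≡ c →
      W⁺.operators rs (T ++ ∅ ∷ []) (B ++ L ∷ []) ≈ W.operators rs T B * ind ∅ L
    operators-∷ʳ [] T B L p q = trans (reflexive (≡.cong (λ b → if b then 1# else 0#) (eqS-∷ʳ B T (≡.trans q (≡.sym p)))))
      (split (eqS B T) (eqL ∅ L))
      where
      eqS-∷ʳ : ∀ (B T : List (Label k)) → length B ≡ length T → eqS (B ++ L ∷ []) (T ++ ∅ ∷ []) ≡ eqS B T ∧ eqL ∅ L
      eqS-∷ʳ [] [] r = ≡.trans (BoolP.∧-identityʳ _) (W.eqL-sym L ∅)
      eqS-∷ʳ (b ∷ B) (t ∷ T) r = ≡.trans (≡.cong (eqL b t ∧_) (eqS-∷ʳ B T (ℕP.suc-injective r))) (≡.sym (BoolP.∧-assoc (eqL b t) _ _))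
      split : ∀ a b → (if a ∧ b then 1# else 0#) ≈ (if a then 1# else 0#) * (if b then 1# else 0#)
      split true b = sym (*-identityˡ (if b then 1# else 0#))
      split false b = sym (zeroˡ (if b then 1# else 0#))
    operators-∷ʳ (r ∷ rs) T B L p q = begin
      ∑[ m ∈ allRowStates k (suc c) ] (W⁺.operators rs (T ++ ∅ ∷ []) m * W⁺.operator r m (B ++ L ∷ []))
        ≈⟨ ∑-states-snoc k c (λ m → W⁺.operators rs (T ++ ∅ ∷ []) m * W⁺.operator r m (B ++ L ∷ [])) ⟩
      ∑[ m ∈ st ] ∑[ M ∈ ls ] (W⁺.operators rs (T ++ ∅ ∷ []) (m ++ M ∷ []) * W⁺.operator r (m ++ M ∷ []) (B ++ L ∷ []))
        ≈⟨ ∑-cong-All (All.map (λ {m} pm → trans (∑-cong ls λ M → trans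
             (*-congʳ {W⁺.operator r (m ++ M ∷ []) (B ++ L ∷ [])} (operators-∷ʳ rs T m M p pm))
             (solve 3 (λ x i u → (x :* i) :* u := (x :* u) :* i) refl (W.operators rs T m) (ind ∅ M) (W⁺.operator r (m ++ M ∷ []) (B ++ L ∷ []))))
             (trans (W.∑-eqL k ∅ (λ M → W.operators rs T m * W⁺.operator r (m ++ M ∷ []) (B ++ L ∷ [])))
             (trans (*-congˡ {W.operators rs T m} (trans (W⁺.operator-row r (m ++ ∅ ∷ []) (B ++ L ∷ []))
                (trans (row-∷ʳ r ∅ L B m (≡.trans q (≡.sym pm))) (*-congʳ {ind ∅ L} (sym (W.operator-row r m B))))))
             (sym (*-assoc (W.operators rs T m) (W.operator r m B) (ind ∅ L)))))) (states-length k c)) ⟩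
      ∑[ m ∈ st ] ((W.operators rs T m * W.operator r m B) * ind ∅ L)
        ≈⟨ ∑-* st (ind ∅ L) (λ m → W.operators rs T m * W.operator r m B) ⟨
      W.operators (r ∷ rs) T B * ind ∅ L ∎
      where
      open Relation.Binary.Reasoning.Setoid setoid
      st = allRowStates k c
      ls = allLabels k

    operators-full : ∀ rs (T B : List (Label k)) L → length T ≡ c → length B ≡ c →
      W⁺.operators rs (full ∷ T) (L ∷ B) ≈ W.operators rs T B * ind full L
    operators-full [] T B L p q = trans (reflexive (≡.cong (λ b → if b then 1# else 0#) (≡.trans (BoolP.∧-comm (eqL L full) (eqS B T))
      (≡.cong (eqS B T ∧_) (W.eqL-sym L full))))) (split (eqS B T) (eqL full L))
      where
      split : ∀ a b → (if a ∧ b then 1# else 0#) ≈ (if a then 1# else 0#) * (if b then 1# else 0#)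
      split true b = sym (*-identityˡ (if b then 1# else 0#))
      split false b = sym (zeroˡ (if b then 1# else 0#))
    operators-full (r ∷ rs) T B L p q = begin
      ∑[ m ∈ allRowStates k (suc c) ] (W⁺.operators rs (full ∷ T) m * W⁺.operator r m (L ∷ B))
        ≈⟨ ∑-states k c (λ m → W⁺.operators rs (full ∷ T) m * W⁺.operator r m (L ∷ B)) ⟩
      ∑[ M ∈ ls ] ∑[ m ∈ st ] (W⁺.operators rs (full ∷ T) (M ∷ m) * W⁺.operator r (M ∷ m) (L ∷ B))
        ≈⟨ ∑-swap ls st (λ M m → W⁺.operators rs (full ∷ T) (M ∷ m) * W⁺.operator r (M ∷ m) (L ∷ B)) ⟩
      ∑[ m ∈ st ] ∑[ M ∈ ls ] (W⁺.operators rs (full ∷ T) (M ∷ m) * W⁺.operator r (M ∷ m) (L ∷ B))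
        ≈⟨ ∑-cong-All (All.map (λ {m} pm → trans (∑-cong ls λ M → trans
             (*-congʳ {W⁺.operator r (M ∷ m) (L ∷ B)} (operators-full rs T m M p pm))
             (solve 3 (λ x i u → (x :* i) :* u := (x :* u) :* i) refl (W.operators rs T m) (ind full M) (W⁺.operator r (M ∷ m) (L ∷ B))))
             (trans (W.∑-eqL k full (λ M → W.operators rs T m * W⁺.operator r (M ∷ m) (L ∷ B)))
             (trans (*-congˡ {W.operators rs T m} (trans (W⁺.operator-row r (full ∷ m) (L ∷ B))
                (trans (row-full r L B m) (*-congʳ {ind full L} (sym (W.operator-row r m B))))))
             (sym (*-assoc (W.operators rs T m) (W.operator r m B) (ind full L)))))) (states-length k c)) ⟩
      ∑[ m ∈ st ] ((W.operators rs T m * W.operator r m B) * ind full L)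
        ≈⟨ ∑-* st (ind full L) (λ m → W.operators rs T m * W.operator r m B) ⟨
      W.operators (r ∷ rs) T B * ind full L ∎
      where
      open Relation.Binary.Reasoning.Setoid setoid
      st = allRowStates k c
      ls = allLabels k

-- Tuples of partitions as states of a window

module _ where
  open import Data.Nat using (_+_; _*_; _∸_)
  open ≡ using (refl; cong; cong₂; sym; trans)
  open import Function using (_∘_)

  Σᴺ : List A → (A → ℕ) → ℕ
  Σᴺ xs f = sum (map f xs)

  Σᴺ-cong : ∀ (xs : List A) {f g : A → ℕ} → (∀ x → f x ≡ g x) → Σᴺ xs f ≡ Σᴺ xs g
  Σᴺ-cong xs h = cong sum (ListP.map-cong h xs)

  Σᴺ-cong-All : ∀ {xs : List A} {f g : A → ℕ} → All (λ x → f x ≡ g x) xs → Σᴺ xs f ≡ Σᴺ xs g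
  Σᴺ-cong-All [] = refl
  Σᴺ-cong-All (h ∷ hs) = cong₂ _+_ h (Σᴺ-cong-All hs)

  +-swap : ∀ a b c d → (a + b) + (c + d) ≡ (a + c) + (b + d)
  +-swap = let open +-*-Solver in solve 4 (λ a b c d → (a :+ b) :+ (c :+ d) := (a :+ c) :+ (b :+ d)) refl

  Σᴺ-+ : ∀ (xs : List A) (f g : A → ℕ) → Σᴺ xs (λ x → f x + g x) ≡ Σᴺ xs f + Σᴺ xs g
  Σᴺ-+ [] f g = refl
  Σᴺ-+ (x ∷ xs) f g = trans (cong (f x + g x +_) (Σᴺ-+ xs f g)) (+-swap (f x) (g x) _ _)

  Σᴺ-0 : ∀ (xs : List A) → Σᴺ xs (λ _ → 0) ≡ 0
  Σᴺ-0 [] = refl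
  Σᴺ-0 (x ∷ xs) = Σᴺ-0 xs

  Σᴺ-swap : ∀ (xs : List A) (ys : List B) (f : A → B → ℕ) → Σᴺ xs (λ x → Σᴺ ys (f x)) ≡ Σᴺ ys (λ y → Σᴺ xs (λ x → f x y))
  Σᴺ-swap [] ys f = sym (Σᴺ-0 ys)
  Σᴺ-swap (x ∷ xs) ys f = trans (cong (Σᴺ ys (f x) +_) (Σᴺ-swap xs ys f)) (sym (Σᴺ-+ ys (f x) _))

  *-Σᴺ : ∀ (xs : List A) c (f : A → ℕ) → c * Σᴺ xs f ≡ Σᴺ xs (λ x → c * f x)
  *-Σᴺ [] c f = ℕP.*-zeroʳ c
  *-Σᴺ (x ∷ xs) c f = trans (ℕP.*-distribˡ-+ c (f x) _) (cong (c * f x +_) (*-Σᴺ xs c f))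

  upTo-suc : ∀ (f : ℕ → A) n → map f (upTo (suc n)) ≡ f 0 ∷ map (f ∘ suc) (upTo n)
  upTo-suc f n = cong (f 0 ∷_) (trans (ListP.map-applyUpTo suc f n) (sym (ListP.map-upTo (f ∘ suc) n)))

  Σᴺ-upTo-suc : ∀ (f : ℕ → ℕ) n → Σᴺ (upTo (suc n)) f ≡ f 0 + Σᴺ (upTo n) (f ∘ suc)
  Σᴺ-upTo-suc f n = cong sum (upTo-suc f n)

  upTo-<  : ∀ n → All (_< n) (upTo n)
  upTo-< n = AllP.applyUpTo⁺₁ (λ i → i) n λ p → p

  head₀ : List ℕ → ℕ
  head₀ la = at la 0

  tail₀ : List ℕ → List ℕ
  tail₀ [] = []
  tail₀ (x ∷ r) = r

  at-tail : ∀ la i → at la (suc i) ≡ at (tail₀ la) i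
  at-tail [] i = refl
  at-tail (x ∷ r) i = refl

  partition-tail : ∀ la → IsPartition la → IsPartition (tail₀ la)
  partition-tail [] p = tt
  partition-tail (x ∷ []) p = tt
  partition-tail (x ∷ y ∷ r) (_ , p) = p

  head-tail : ∀ la → IsPartition la → head₀ (tail₀ la) ≤ head₀ la
  head-tail [] p = z≤n
  head-tail (x ∷ []) p = z≤n
  head-tail (x ∷ y ∷ r) (q , _) = q

  -- The condition c = λ_j - j with j = i + 1, where `u` = c + ℓ numbers the columns of the window
  -- from zero; all terms are moved so that nothing is subtracted.
  isPart : List ℕ → ℕ → ℕ → ℕ → Bool
  isPart la ℓ u i = ⌊ u + suc i ℕ.≟ at la i + ℓ ⌋

  hit : List ℕ → ℕ → ℕ → Bool
  hit la ℓ u = or (map (isPart la ℓ u) (upTo ℓ))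

  ⌊⌋-cong : ∀ {P Q : Set} (p : Dec P) (q : Dec Q) → (P → Q) → (Q → P) → ⌊ p ⌋ ≡ ⌊ q ⌋
  ⌊⌋-cong (yes p) (yes q) f g = refl
  ⌊⌋-cong (no p) (no q) f g = refl
  ⌊⌋-cong (yes p) (no q) f g = ⊥-elim (q (f p))
  ⌊⌋-cong (no p) (yes q) f g = ⊥-elim (p (g q))

  ⌊⌋-no : ∀ {P : Set} (p : Dec P) → ¬ P → ⌊ p ⌋ ≡ false
  ⌊⌋-no (yes p) n = ⊥-elim (n p)
  ⌊⌋-no (no p) n = refl

  ⌊⌋-yes : ∀ {P : Set} (p : Dec P) → P → ⌊ p ⌋ ≡ true
  ⌊⌋-yes (yes p) n = refl
  ⌊⌋-yes (no p) n = ⊥-elim (p n)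

  -- Deleting the first part raises every other part by one place in the list, and lowering ℓ by one
  -- compensates this: the remaining positions do not move. The inductions over the parts rest on
  -- this.
  hit-suc : ∀ la ℓ u → hit la (suc ℓ) u ≡ ⌊ u ℕ.≟ head₀ la + ℓ ⌋ ∨ hit (tail₀ la) ℓ u
  hit-suc la ℓ u = trans (cong or (upTo-suc (isPart la (suc ℓ) u) ℓ)) (cong₂ _∨_
    (⌊⌋-cong _ _ (λ p → ℕP.suc-injective (trans (ℕP.+-comm 1 u) (trans p (ℕP.+-suc _ ℓ))))
                 (λ p → trans (ℕP.+-comm u 1) (trans (cong suc p) (sym (ℕP.+-suc _ ℓ)))))
    (cong or (ListP.map-cong (λ i → ⌊⌋-cong _ _
        (λ p → ℕP.suc-injective (trans (sym (ℕP.+-suc u (suc i))) (trans p (trans (cong (_+ suc ℓ) (at-tail la i)) (ℕP.+-suc _ ℓ)))))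
        (λ p → trans (ℕP.+-suc u (suc i)) (trans (cong suc p) (trans (sym (ℕP.+-suc _ ℓ)) (cong (_+ suc ℓ) (sym (at-tail la i)))))))
      (upTo ℓ))))

  hit-bound : ∀ la ℓ u → IsPartition la → hit la ℓ u ≡ true → u < head₀ la + ℓ
  hit-bound la (suc ℓ) u p h with u ℕ.≟ head₀ la + ℓ | hit-suc la ℓ u
  ... | yes refl | _ = ℕP.≤-reflexive (sym (ℕP.+-suc _ ℓ))
  ... | no _ | eq = ℕP.<-≤-trans (hit-bound (tail₀ la) ℓ u (partition-tail la p) (trans (sym eq) h))
    (ℕP.≤-trans (ℕP.+-monoˡ-≤ ℓ (head-tail la p)) (ℕP.≤-trans (ℕP.n≤1+n _) (ℕP.≤-reflexive (sym (ℕP.+-suc _ ℓ)))))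

  hit-beyond : ∀ la ℓ u → IsPartition la → head₀ la + ℓ ≤ u → hit la ℓ u ≡ false
  hit-beyond la ℓ u p le with hit la ℓ u in eq
  ... | false = refl
  ... | true = ⊥-elim (ℕP.<⇒≱ (hit-bound la ℓ u p eq) le)

  -- The position of the first part lies beyond those of all the others, so the disjunction in
  -- `hit-suc` is exclusive and the sum over sites splits into a sum over parts.
  Σ-hit : ∀ la ℓ c → IsPartition la → head₀ la + ℓ ≤ c → ∀ (f : ℕ → ℕ) →
    Σᴺ (upTo c) (λ u → b2n (hit la ℓ u) * f u) ≡ Σᴺ (upTo ℓ) (λ i → f (at la i + (ℓ ∸ suc i)))
  Σ-hit la zero c p le f = Σᴺ-0 (upTo c)
  Σ-hit la (suc ℓ) c p le f = begin
    Σᴺ (upTo c) (λ u → b2n (hit la (suc ℓ) u) * f u)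
      ≡⟨ Σᴺ-cong (upTo c) (λ u → trans (cong (λ b → b2n b * f u) (hit-suc la ℓ u)) (disjoint u)) ⟩
    Σᴺ (upTo c) (λ u → b2n ⌊ u ℕ.≟ x ⌋ * f u + b2n (hit (tail₀ la) ℓ u) * f u)
      ≡⟨ Σᴺ-+ (upTo c) _ _ ⟩
    Σᴺ (upTo c) (λ u → b2n ⌊ u ℕ.≟ x ⌋ * f u) + Σᴺ (upTo c) (λ u → b2n (hit (tail₀ la) ℓ u) * f u)
      ≡⟨ cong₂ _+_ (select c x (ℕP.≤-trans (ℕP.≤-reflexive (sym (ℕP.+-suc _ ℓ))) le) f)
           (Σ-hit (tail₀ la) ℓ c (partition-tail la p)
             (ℕP.≤-trans (ℕP.+-monoˡ-≤ ℓ (head-tail la p)) (ℕP.≤-trans (ℕP.+-monoʳ-≤ _ (ℕP.n≤1+n ℓ)) le)) f) ⟩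
    f x + Σᴺ (upTo ℓ) (λ i → f (at (tail₀ la) i + (ℓ ∸ suc i)))
      ≡⟨ cong (f x +_) (Σᴺ-cong (upTo ℓ) (λ i → cong (λ a → f (a + (ℓ ∸ suc i))) (sym (at-tail la i)))) ⟩
    f x + Σᴺ (upTo ℓ) (λ i → f (at la (suc i) + (suc ℓ ∸ suc (suc i))))
      ≡⟨ Σᴺ-upTo-suc (λ i → f (at la i + (suc ℓ ∸ suc i))) ℓ ⟨
    Σᴺ (upTo (suc ℓ)) (λ i → f (at la i + (suc ℓ ∸ suc i))) ∎
    where
    open ≡.≡-Reasoning
    x = head₀ la + ℓ
    disjoint : ∀ u → b2n (⌊ u ℕ.≟ x ⌋ ∨ hit (tail₀ la) ℓ u) * f u ≡ b2n ⌊ u ℕ.≟ x ⌋ * f u + b2n (hit (tail₀ la) ℓ u) * f u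
    disjoint u with u ℕ.≟ x
    ... | no _ = refl
    ... | yes refl rewrite hit-beyond (tail₀ la) ℓ (head₀ la + ℓ) (partition-tail la p) (ℕP.+-monoˡ-≤ ℓ (head-tail la p)) = sym (ℕP.+-identityʳ _)
    select : ∀ c x → x < c → ∀ (f : ℕ → ℕ) → Σᴺ (upTo c) (λ u → b2n ⌊ u ℕ.≟ x ⌋ * f u) ≡ f x
    select (suc c) zero lt f = trans (Σᴺ-upTo-suc (λ u → b2n ⌊ u ℕ.≟ 0 ⌋ * f u) c) (trans (cong₂ _+_ (ℕP.+-identityʳ (f 0))
      (trans (Σᴺ-cong (upTo c) (λ u → refl)) (Σᴺ-0 (upTo c)))) (ℕP.+-identityʳ (f 0)))
    select (suc c) (suc x) (s≤s lt) f = trans (Σᴺ-upTo-suc (λ u → b2n ⌊ u ℕ.≟ suc x ⌋ * f u) c)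
      (trans (Σᴺ-cong (upTo c) (λ u → cong (λ b → b2n b * f (suc u)) (⌊⌋-cong (suc u ℕ.≟ suc x) (u ℕ.≟ x) ℕP.suc-injective (cong suc))))
        (select c x lt (f ∘ suc)))

  column-of : Tuple k → ℕ → ℕ → Label k
  column-of α ℓ u = tabulate λ a → hit (lookup α a) ℓ u

  stateOf : Tuple k → ℕ → ℕ → List (Label k)
  stateOf α ℓ c = map (column-of α ℓ) (upTo c)

  pos-hit : ∀ la ℓ u i → ⌊ (ι u ℤ.- ι ℓ) ℤ.≟ pos la i ⌋ ≡ isPart la ℓ u i
  pos-hit la ℓ u i = ⌊⌋-cong _ _ to from
    where
    open ≡.≡-Reasoning
    drop : ∀ x y → (x ℤ.+ y) ℤ.- y ≡ x
    drop x y = trans (ℤP.+-assoc x y (ℤ.- y)) (trans (cong (ℤ._+_ x) (ℤP.+-inverseʳ y)) (ℤP.+-identityʳ x))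
    drop′ : ∀ x y → (x ℤ.- y) ℤ.+ y ≡ x
    drop′ x y = trans (ℤP.+-assoc x (ℤ.- y) y) (trans (cong (ℤ._+_ x) (ℤP.+-inverseˡ y)) (ℤP.+-identityʳ x))
    to : ι u ℤ.- ι ℓ ≡ pos la i → u + suc i ≡ at la i + ℓ
    to p = ℤP.+-injective (begin
      ι u ℤ.+ ι (suc i)                                 ≡⟨ cong (ℤ._+ ι (suc i)) (drop′ (ι u) (ι ℓ)) ⟨
      ((ι u ℤ.- ι ℓ) ℤ.+ ι ℓ) ℤ.+ ι (suc i)             ≡⟨ cong (λ z → (z ℤ.+ ι ℓ) ℤ.+ ι (suc i)) p ⟩
      (pos la i ℤ.+ ι ℓ) ℤ.+ ι (suc i)                  ≡⟨ ℤP.+-assoc (pos la i) (ι ℓ) (ι (suc i)) ⟩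
      pos la i ℤ.+ (ι ℓ ℤ.+ ι (suc i))                  ≡⟨ cong (ℤ._+_ (pos la i)) (ℤP.+-comm (ι ℓ) (ι (suc i))) ⟩
      pos la i ℤ.+ (ι (suc i) ℤ.+ ι ℓ)                  ≡⟨ ℤP.+-assoc (pos la i) (ι (suc i)) (ι ℓ) ⟨
      (pos la i ℤ.+ ι (suc i)) ℤ.+ ι ℓ                  ≡⟨ cong (ℤ._+ ι ℓ) (drop′ (ι (at la i)) (ι (suc i))) ⟩
      ι (at la i) ℤ.+ ι ℓ                               ∎)
    from : u + suc i ≡ at la i + ℓ → ι u ℤ.- ι ℓ ≡ pos la i
    from p = begin
      ι u ℤ.- ι ℓ                                        ≡⟨ cong (ℤ._- ι ℓ) (drop (ι u) (ι (suc i))) ⟨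
      (ι (u + suc i) ℤ.- ι (suc i)) ℤ.- ι ℓ              ≡⟨ cong (λ z → (ι z ℤ.- ι (suc i)) ℤ.- ι ℓ) p ⟩
      (ι (at la i + ℓ) ℤ.- ι (suc i)) ℤ.- ι ℓ            ≡⟨ ℤP.+-assoc (ι (at la i + ℓ)) (ℤ.- ι (suc i)) (ℤ.- ι ℓ) ⟩
      ι (at la i + ℓ) ℤ.+ (ℤ.- ι (suc i) ℤ.- ι ℓ)        ≡⟨ cong (ℤ._+_ (ι (at la i + ℓ))) (ℤP.+-comm (ℤ.- ι (suc i)) (ℤ.- ι ℓ)) ⟩
      ι (at la i + ℓ) ℤ.+ (ℤ.- ι ℓ ℤ.- ι (suc i))        ≡⟨ ℤP.+-assoc (ι (at la i + ℓ)) (ℤ.- ι ℓ) (ℤ.- ι (suc i)) ⟨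
      (ι (at la i + ℓ) ℤ.- ι ℓ) ℤ.- ι (suc i)            ≡⟨ cong (ℤ._- ι (suc i)) (drop (ι (at la i)) (ι ℓ)) ⟩
      pos la i ∎

  boundary-stateOf : ∀ ℓ N (α : Tuple k) → boundary ℓ N α ≡ stateOf α ℓ (ℓ + N + 1)
  boundary-stateOf ℓ N α = trans (sym (ListP.map-∘ (upTo (ℓ + N + 1)))) (ListP.map-cong (λ u →
    VecP.tabulate-cong λ a → cong or (ListP.map-cong (pos-hit (lookup α a) ℓ u) (upTo ℓ))) (upTo (ℓ + N + 1)))

  tupleSize : Tuple k → ℕ
  tupleSize [] = 0
  tupleSize (la ∷ α) = sum la + tupleSize α

  triangle : ℕ → ℕ
  triangle ℓ = Σᴺ (upTo ℓ) (λ i → ℓ ∸ suc i)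

  -- The energy of the tuple of empty partitions, whose particles fill the first ℓ columns.
  groundEnergy : ℕ → ℕ → ℕ
  groundEnergy k ℓ = Σᴺ (allFin k) (λ _ → triangle ℓ)

  Fits : ℕ → ℕ → Tuple k → Set
  Fits ℓ c α = ∀ a → length (lookup α a) ≤ ℓ × head₀ (lookup α a) + ℓ ≤ c

  partition-lookup : ∀ {α : Tuple k} → IsPartitionTuple α → ∀ a → IsPartition (lookup α a)
  partition-lookup {α = la ∷ α} (p ∷ ps) zero = p
  partition-lookup {α = la ∷ α} (p ∷ ps) (suc a) = partition-lookup ps a

  Σᴺ-allFin : ∀ (α : Tuple k) → Σᴺ (allFin k) (λ a → sum (lookup α a)) ≡ tupleSize α
  Σᴺ-allFin [] = refl
  Σᴺ-allFin (la ∷ α) = trans (cong sum (allFin-suc (λ a → sum (lookup (la ∷ α) a)))) (cong (sum la +_) (Σᴺ-allFin α))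

  sum-lookup≤ : ∀ (α : Tuple k) a → sum (lookup α a) ≤ tupleSize α
  sum-lookup≤ (la ∷ α) zero = ℕP.m≤m+n _ _
  sum-lookup≤ (la ∷ α) (suc a) = ℕP.≤-trans (sum-lookup≤ α a) (ℕP.m≤n+m _ (sum la))

  at-beyond : ∀ la i → length la ≤ i → at la i ≡ 0
  at-beyond [] i p = refl
  at-beyond (x ∷ r) (suc i) (s≤s p) = at-beyond r i p

  Σ-at : ∀ la ℓ → length la ≤ ℓ → Σᴺ (upTo ℓ) (at la) ≡ sum la
  Σ-at [] ℓ p = Σᴺ-0 (upTo ℓ)
  Σ-at (x ∷ r) (suc ℓ) (s≤s p) = trans (Σᴺ-upTo-suc (at (x ∷ r)) ℓ) (cong (x +_) (Σ-at r ℓ p))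

  head-positive : ∀ x r → IsPartition (x ∷ r) → 1 ≤ x
  head-positive x [] p = p
  head-positive x (y ∷ r) (q , p) = ℕP.≤-trans (head-positive y r p) q

  length≤sum : ∀ la → IsPartition la → length la ≤ sum la
  length≤sum [] p = z≤n
  length≤sum (x ∷ r) p = ℕP.+-mono-≤ (head-positive x r p) (length≤sum r (partition-tail (x ∷ r) p))

  foldr-⊔≤sum : ∀ la → foldr _⊔_ 0 la ≤ sum la
  foldr-⊔≤sum [] = z≤n
  foldr-⊔≤sum (x ∷ r) = ℕP.⊔-lub (ℕP.m≤m+n x _) (ℕP.≤-trans (foldr-⊔≤sum r) (ℕP.m≤n+m _ x))

  maxLen≤ : ∀ (α : Tuple k) → IsPartitionTuple α → maxLen α ≤ tupleSize α
  maxLen≤ [] p = z≤n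
  maxLen≤ (la ∷ α) (q ∷ p) = ℕP.⊔-lub (ℕP.≤-trans (length≤sum la q) (ℕP.m≤m+n _ _)) (ℕP.≤-trans (maxLen≤ α p) (ℕP.m≤n+m _ (sum la)))

  maxPart≤ : ∀ (α : Tuple k) → maxPart α ≤ tupleSize α
  maxPart≤ [] = z≤n
  maxPart≤ (la ∷ α) = ℕP.⊔-lub (ℕP.≤-trans (foldr-⊔≤sum la) (ℕP.m≤m+n _ _)) (ℕP.≤-trans (maxPart≤ α) (ℕP.m≤n+m _ (sum la)))

  length≤maxLen : ∀ (α : Tuple k) a → length (lookup α a) ≤ maxLen α
  length≤maxLen (la ∷ α) zero = ℕP.m≤m⊔n _ _
  length≤maxLen (la ∷ α) (suc a) = ℕP.≤-trans (length≤maxLen α a) (ℕP.m≤n⊔m (length la) _)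

  head≤maxPart : ∀ (α : Tuple k) a → head₀ (lookup α a) ≤ maxPart α
  head≤maxPart ([] ∷ α) zero = z≤n
  head≤maxPart ((x ∷ r) ∷ α) zero = ℕP.≤-trans (ℕP.m≤m⊔n x _) (ℕP.m≤m⊔n _ _)
  head≤maxPart (la ∷ α) (suc a) = ℕP.≤-trans (head≤maxPart α a) (ℕP.m≤n⊔m (foldr _⊔_ 0 la) _)

  tabulate-const : ∀ k (x : ℕ) → tabulate {n = k} (λ _ → x) ≡ replicate k x
  tabulate-const zero x = refl
  tabulate-const (suc k) x = cong (x ∷_) (tabulate-const k x)

  counts-tabulate : ∀ (s : List (Label k)) → counts s ≡ tabulate (λ a → Σᴺ s (λ I → b2n (lookup I a)))
  counts-tabulate {k} [] = sym (tabulate-const k 0)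
  counts-tabulate (I ∷ s) = trans (cong (bv I +ᵛ_) (counts-tabulate s)) (add I (λ a → Σᴺ s (λ J → b2n (lookup J a))))
    where
    add : ∀ {k} (I : Label k) (f : Fin k → ℕ) → bv I +ᵛ tabulate f ≡ tabulate (λ a → b2n (lookup I a) + f a)
    add [] f = refl
    add (i ∷ I) f = cong (_ ∷_) (add I (f ∘ suc))

  Σᴺ-map : ∀ (g : A → B) xs (f : B → ℕ) → Σᴺ (map g xs) f ≡ Σᴺ xs (f ∘ g)
  Σᴺ-map g xs f = cong sum (sym (ListP.map-∘ xs))

  module StateOf (α : Tuple k) (ℓ c : ℕ) (part : IsPartitionTuple α) (fits : Fits ℓ c α) where
    private
      h : ℕ → Label k
      h = column-of α ℓ
      bitOf : Fin k → ℕ → Bool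
      bitOf a = hit (lookup α a) ℓ
      lookup-h : ∀ a u → lookup (h u) a ≡ bitOf a u
      lookup-h a u = VecP.lookup∘tabulate (λ a → bitOf a u) a
      place : Fin k → ℕ → ℕ
      place a i = at (lookup α a) i + (ℓ ∸ suc i)

    Σ-column : ∀ a (f : ℕ → ℕ) → Σᴺ (upTo c) (λ u → b2n (lookup (h u) a) * f u) ≡ Σᴺ (upTo ℓ) (λ i → f (place a i))
    Σ-column a f = trans (Σᴺ-cong (upTo c) λ u → cong (λ b → b2n b * f u) (lookup-h a u))
      (Σ-hit (lookup α a) ℓ c (partition-lookup part a) (proj₂ (fits a)) f)

    counts-stateOf : counts (stateOf α ℓ c) ≡ replicate k ℓ
    counts-stateOf = trans (counts-tabulate (stateOf α ℓ c)) (trans (VecP.tabulate-cong λ a → begin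
      Σᴺ (map h (upTo c)) (λ I → b2n (lookup I a))      ≡⟨ Σᴺ-map h (upTo c) _ ⟩
      Σᴺ (upTo c) (λ u → b2n (lookup (h u) a))          ≡⟨ Σᴺ-cong (upTo c) (λ u → sym (ℕP.*-identityʳ _)) ⟩
      Σᴺ (upTo c) (λ u → b2n (lookup (h u) a) * 1)      ≡⟨ Σ-column a (λ _ → 1) ⟩
      Σᴺ (upTo ℓ) (λ _ → 1)                             ≡⟨ ones ℓ ⟩
      ℓ                                                 ∎) (tabulate-const k ℓ))
      where
      open ≡.≡-Reasoning
      ones : ∀ n → Σᴺ (upTo n) (λ _ → 1) ≡ n
      ones zero = refl
      ones (suc n) = trans (Σᴺ-upTo-suc (λ _ → 1) n) (cong suc (ones n))

    energy-upTo : ∀ (g : ℕ → Label k) c → energy (map g (upTo c)) ≡ Σᴺ (upTo c) (λ u → u * Vec.sum (bv (g u)))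
    energy-upTo g zero = refl
    energy-upTo g (suc c) = begin
      energy (map g (upTo (suc c)))
        ≡⟨ cong energy (upTo-suc g c) ⟩
      Vec.sum (counts (map (g ∘ suc) (upTo c))) + energy (map (g ∘ suc) (upTo c))
        ≡⟨ cong₂ _+_ (trans (sum-counts (map (g ∘ suc) (upTo c))) (Σᴺ-map (g ∘ suc) (upTo c) _)) (energy-upTo (g ∘ suc) c) ⟩
      Σᴺ (upTo c) (λ u → Vec.sum (bv (g (suc u)))) + Σᴺ (upTo c) (λ u → u * Vec.sum (bv (g (suc u))))
        ≡⟨ Σᴺ-+ (upTo c) _ _ ⟨
      Σᴺ (upTo c) (λ u → suc u * Vec.sum (bv (g (suc u))))
        ≡⟨ Σᴺ-upTo-suc (λ u → u * Vec.sum (bv (g u))) c ⟨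
      Σᴺ (upTo (suc c)) (λ u → u * Vec.sum (bv (g u))) ∎
      where
      open ≡.≡-Reasoning
      sum-counts : ∀ (s : List (Label k)) → Vec.sum (counts s) ≡ Σᴺ s (λ I → Vec.sum (bv I))
      sum-counts [] = sum-0ᵛ k
      sum-counts (I ∷ s) = trans (sum-+ᵛ (bv I) (counts s)) (cong (_ +_) (sum-counts s))

    sum-bv : ∀ {k} (I : Label k) → Vec.sum (bv I) ≡ Σᴺ (allFin k) (λ a → b2n (lookup I a))
    sum-bv [] = refl
    sum-bv (i ∷ I) = trans (cong (b2n i +_) (sum-bv I)) (cong sum (sym (allFin-suc (λ a → b2n (lookup (i ∷ I) a)))))

    energy-stateOf : energy (stateOf α ℓ c) ≡ groundEnergy k ℓ + tupleSize α
    energy-stateOf = begin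
      energy (map h (upTo c))
        ≡⟨ energy-upTo h c ⟩
      Σᴺ (upTo c) (λ u → u * Vec.sum (bv (h u)))
        ≡⟨ Σᴺ-cong (upTo c) (λ u → trans (cong (u *_) (sum-bv (h u))) (trans (*-Σᴺ (allFin k) u _) (Σᴺ-cong (allFin k) λ a → ℕP.*-comm u _))) ⟩
      Σᴺ (upTo c) (λ u → Σᴺ (allFin k) (λ a → b2n (lookup (h u) a) * u))
        ≡⟨ Σᴺ-swap (upTo c) (allFin k) _ ⟩
      Σᴺ (allFin k) (λ a → Σᴺ (upTo c) (λ u → b2n (lookup (h u) a) * u))
        ≡⟨ Σᴺ-cong (allFin k) (λ a → trans (Σ-column a (λ u → u)) (trans (Σᴺ-+ (upTo ℓ) (at (lookup α a)) _)
             (trans (cong (_+ triangle ℓ) (Σ-at (lookup α a) ℓ (proj₁ (fits a)))) (ℕP.+-comm _ (triangle ℓ))))) ⟩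
      Σᴺ (allFin k) (λ a → triangle ℓ + sum (lookup α a))
        ≡⟨ trans (Σᴺ-+ (allFin k) _ _) (cong (groundEnergy k ℓ +_) (Σᴺ-allFin α)) ⟩
      groundEnergy k ℓ + tupleSize α ∎
      where open ≡.≡-Reasoning

    φᵛ-Σ : ∀ {k} (X Y : Vec ℕ k) → φᵛ X Y ≡ Σᴺ (allFin k) (λ a → Σᴺ (allFin k) (λ b → b2n (toℕ a <ᵇ toℕ b) * (lookup X a * lookup Y b)))
    φᵛ-Σ [] [] = refl
    φᵛ-Σ {suc k} (x ∷ X) (y ∷ Y) = sym (begin
      Σᴺ (allFin (suc k)) (λ a → Σᴺ (allFin (suc k)) (g a))
        ≡⟨ cong sum (allFin-suc (λ a → Σᴺ (allFin (suc k)) (g a))) ⟩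
      Σᴺ (allFin (suc k)) (g zero) + Σᴺ (allFin k) (λ a → Σᴺ (allFin (suc k)) (g (suc a)))
        ≡⟨ cong₂ _+_ (trans (cong sum (allFin-suc (g zero))) (trans (Σᴺ-cong (allFin k) (λ b → ℕP.+-identityʳ _)) (sum-lookup x Y)))
             (Σᴺ-cong (allFin k) λ a → cong sum (allFin-suc (g (suc a)))) ⟩
      x * Vec.sum Y + Σᴺ (allFin k) (λ a → Σᴺ (allFin k) (λ b → g (suc a) (suc b)))
        ≡⟨ cong (x * Vec.sum Y +_) (sym (φᵛ-Σ X Y)) ⟩
      φᵛ (x ∷ X) (y ∷ Y) ∎)
      where
      open ≡.≡-Reasoning
      g : Fin (suc k) → Fin (suc k) → ℕ
      g a b = b2n (toℕ a <ᵇ toℕ b) * (lookup (x ∷ X) a * lookup (y ∷ Y) b)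

    crossings-upTo : ∀ (g : ℕ → Label k) c → crossings (map g (upTo c))
      ≡ Σᴺ (upTo c) (λ v → Σᴺ (upTo c) (λ u → b2n (v <ᵇ u) * φᵛ (bv (g u)) (bv (g v))))
    crossings-upTo g zero = refl
    crossings-upTo g (suc c) = begin
      crossings (map g (upTo (suc c)))
        ≡⟨ cong crossings (upTo-suc g c) ⟩
      φᵛ (counts (map (g ∘ suc) (upTo c))) (bv (g 0)) + crossings (map (g ∘ suc) (upTo c))
        ≡⟨ cong₂ _+_ (trans (φᵛ-counts (map (g ∘ suc) (upTo c)) (bv (g 0))) (Σᴺ-map (g ∘ suc) (upTo c) _)) (crossings-upTo (g ∘ suc) c) ⟩
      Σᴺ (upTo c) (λ u → φᵛ (bv (g (suc u))) (bv (g 0))) + Σᴺ (upTo c) (λ v → Σᴺ (upTo c) (λ u → G (suc v) (suc u)))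
        ≡⟨ cong₂ _+_ (trans (Σᴺ-cong (upTo c) (λ u → sym (ℕP.+-identityʳ _))) (sym (Σᴺ-upTo-suc (G 0) c)))
             (Σᴺ-cong (upTo c) λ v → sym (Σᴺ-upTo-suc (G (suc v)) c)) ⟩
      Σᴺ (upTo (suc c)) (G 0) + Σᴺ (upTo c) (λ v → Σᴺ (upTo (suc c)) (G (suc v)))
        ≡⟨ Σᴺ-upTo-suc (λ v → Σᴺ (upTo (suc c)) (G v)) c ⟨
      Σᴺ (upTo (suc c)) (λ v → Σᴺ (upTo (suc c)) (G v)) ∎
      where
      open ≡.≡-Reasoning
      G : ℕ → ℕ → ℕ
      G v u = b2n (v <ᵇ u) * φᵛ (bv (g u)) (bv (g v))
      φᵛ-counts : ∀ (s : List (Label k)) z → φᵛ (counts s) z ≡ Σᴺ s (λ I → φᵛ (bv I) z)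
      φᵛ-counts [] z = φᵛ-0ˡ z
      φᵛ-counts (I ∷ s) z = trans (φᵛ-+ˡ (bv I) (counts s) z) (cong (_ +_) (φᵛ-counts s z))

    NL-Σ : NL ℓ α ≡ Σᴺ (allFin k) (λ a → Σᴺ (allFin k) (λ b → b2n (toℕ a <ᵇ toℕ b) *
             Σᴺ (upTo ℓ) (λ i → Σᴺ (upTo ℓ) (λ j → b2n ⌊ pos (lookup α b) i ℤ.<? pos (lookup α a) j ⌋))))
    NL-Σ = trans (count-concatMap _ (allFin k)) (Σᴺ-cong (allFin k) λ a → trans (count-concatMap _ (allFin k)) (Σᴺ-cong (allFin k) λ b →
      trans (count-if (toℕ a <ᵇ toℕ b) _) (cong (b2n (toℕ a <ᵇ toℕ b) *_)
        (trans (count-concatMap _ (upTo ℓ)) (Σᴺ-cong (upTo ℓ) λ i → count-map _ (upTo ℓ))))))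
      where
      count-++ : ∀ xs ys → count (xs ++ ys) ≡ count xs + count ys
      count-++ [] ys = refl
      count-++ (x ∷ xs) ys = trans (cong (b2n x +_) (count-++ xs ys)) (sym (ℕP.+-assoc (b2n x) _ _))
      count-concatMap : ∀ {A : Set} (f : A → List Bool) xs → count (concatMap f xs) ≡ Σᴺ xs (λ x → count (f x))
      count-concatMap f [] = refl
      count-concatMap f (x ∷ xs) = trans (count-++ (f x) (concatMap f xs)) (cong (count (f x) +_) (count-concatMap f xs))
      count-map : ∀ {A : Set} (g : A → Bool) xs → count (map g xs) ≡ Σᴺ xs (λ x → b2n (g x))
      count-map g [] = refl
      count-map g (x ∷ xs) = cong (b2n (g x) +_) (count-map g xs)
      count-if : ∀ b xs → count (if b then xs else []) ≡ b2n b * count xs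
      count-if false xs = refl
      count-if true xs = sym (ℕP.+-identityʳ _)

    place-< : ∀ a b i j → i < ℓ → j < ℓ → ⌊ pos (lookup α b) i ℤ.<? pos (lookup α a) j ⌋ ≡ (place b i <ᵇ place a j)
    place-< a b i j i<ℓ j<ℓ = decide (pos (lookup α b) i ℤ.<? pos (lookup α a) j) (ℕP.<ᵇ-reflects-< (place b i) (place a j))
      where
      shifted : ∀ a i → i < ℓ → ι (place a i) ≡ pos (lookup α a) i ℤ.+ ι ℓ
      shifted a i i<ℓ = trans (cong (ℤ._+_ (ι (at (lookup α a) i))) (trans (sym (ℤP.⊖-≥ i<ℓ)) (trans (sym (ℤP.m-n≡m⊖n ℓ (suc i))) (ℤP.+-comm (ι ℓ) (ℤ.- ι (suc i))))))
        (sym (ℤP.+-assoc (ι (at (lookup α a) i)) (ℤ.- ι (suc i)) (ι ℓ)))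
      fwd : pos (lookup α b) i ℤ.< pos (lookup α a) j → place b i < place a j
      fwd lt = ℤP.drop‿+<+ (≡.subst₂ ℤ._<_ (sym (shifted b i i<ℓ)) (sym (shifted a j j<ℓ)) (ℤP.+-monoˡ-< (ι ℓ) lt))
      bwd : place b i < place a j → pos (lookup α b) i ℤ.< pos (lookup α a) j
      bwd lt = ≡.subst₂ ℤ._<_ (unshift b i i<ℓ) (unshift a j j<ℓ) (ℤP.+-monoˡ-< (ℤ.- ι ℓ) (ℤ.+<+ lt))
        where
        unshift : ∀ a i → i < ℓ → ι (place a i) ℤ.+ ℤ.- ι ℓ ≡ pos (lookup α a) i
        unshift a i i<ℓ = trans (cong (ℤ._+ ℤ.- ι ℓ) (shifted a i i<ℓ)) (trans (ℤP.+-assoc (pos (lookup α a) i) (ι ℓ) (ℤ.- ι ℓ))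
          (trans (cong (ℤ._+_ (pos (lookup α a) i)) (ℤP.+-inverseʳ (ι ℓ))) (ℤP.+-identityʳ (pos (lookup α a) i))))
      decide : ∀ {x} (d : Dec (pos (lookup α b) i ℤ.< pos (lookup α a) j)) → Reflects (place b i < place a j) x → ⌊ d ⌋ ≡ x
      decide (yes p) (ofʸ q) = refl
      decide (no p) (ofⁿ q) = refl
      decide (yes p) (ofⁿ q) = ⊥-elim (q (fwd p))
      decide (no p) (ofʸ q) = ⊥-elim (p (bwd q))

    -- Both sides count pairs of particles, once by columns and once by parts. After the sums are
    -- regrouped by colours, `Σ-column` passes from columns to parts, once for each colour of the
    -- pair.
    crossings-stateOf : crossings (stateOf α ℓ c) ≡ NL ℓ α
    crossings-stateOf = begin
      crossings (map h (upTo c))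
        ≡⟨ crossings-upTo h c ⟩
      Σᴺ U (λ v → Σᴺ U (λ u → b2n (v <ᵇ u) * φᵛ (bv (h u)) (bv (h v))))
        ≡⟨ Σᴺ-cong U (λ v → Σᴺ-cong U λ u → expand u v) ⟩
      Σᴺ U (λ v → Σᴺ U (λ u → Σᴺ F (λ a → Σᴺ F (λ b → X a b u v))))
        ≡⟨ Σᴺ-cong U (λ v → trans (Σᴺ-swap U F _) (Σᴺ-cong F λ a → Σᴺ-swap U F _)) ⟩
      Σᴺ U (λ v → Σᴺ F (λ a → Σᴺ F (λ b → Σᴺ U (λ u → X a b u v))))
        ≡⟨ trans (Σᴺ-swap U F _) (Σᴺ-cong F λ a → Σᴺ-swap U F _) ⟩
      Σᴺ F (λ a → Σᴺ F (λ b → Σᴺ U (λ v → Σᴺ U (λ u → X a b u v))))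
        ≡⟨ Σᴺ-cong F (λ a → Σᴺ-cong F λ b → pair a b) ⟩
      Σᴺ F (λ a → Σᴺ F (λ b → b2n (toℕ a <ᵇ toℕ b) * Σᴺ (upTo ℓ) (λ i → Σᴺ (upTo ℓ) (λ j → b2n ⌊ pos (lookup α b) i ℤ.<? pos (lookup α a) j ⌋))))
        ≡⟨ NL-Σ ⟨
      NL ℓ α ∎
      where
      open ≡.≡-Reasoning
      U = upTo c
      F = allFin k
      x : Fin k → ℕ → ℕ
      x a u = b2n (lookup (h u) a)
      X : Fin k → Fin k → ℕ → ℕ → ℕ
      X a b u v = b2n (toℕ a <ᵇ toℕ b) * (x b v * (x a u * b2n (v <ᵇ u)))
      shuffle : ∀ l w p q → w * (l * (p * q)) ≡ l * (q * (p * w))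
      shuffle = let open +-*-Solver in solve 4 (λ l w p q → w :* (l :* (p :* q)) := l :* (q :* (p :* w))) refl
      expand : ∀ u v → b2n (v <ᵇ u) * φᵛ (bv (h u)) (bv (h v)) ≡ Σᴺ F (λ a → Σᴺ F (λ b → X a b u v))
      expand u v = trans (cong (b2n (v <ᵇ u) *_) (φᵛ-Σ (bv (h u)) (bv (h v)))) (trans (*-Σᴺ F (b2n (v <ᵇ u)) _) (Σᴺ-cong F λ a →
        trans (*-Σᴺ F (b2n (v <ᵇ u)) (λ b → b2n (toℕ a <ᵇ toℕ b) * (lookup (bv (h u)) a * lookup (bv (h v)) b))) (Σᴺ-cong F λ b → trans
          (cong₂ (λ p q → b2n (v <ᵇ u) * (b2n (toℕ a <ᵇ toℕ b) * (p * q))) (VecP.lookup-map a b2n (h u)) (VecP.lookup-map b b2n (h v)))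
          (shuffle (b2n (toℕ a <ᵇ toℕ b)) (b2n (v <ᵇ u)) (x a u) (x b v)))))
      pair : ∀ a b → Σᴺ U (λ v → Σᴺ U (λ u → X a b u v))
        ≡ b2n (toℕ a <ᵇ toℕ b) * Σᴺ (upTo ℓ) (λ i → Σᴺ (upTo ℓ) (λ j → b2n ⌊ pos (lookup α b) i ℤ.<? pos (lookup α a) j ⌋))
      pair a b = begin
        Σᴺ U (λ v → Σᴺ U (λ u → X a b u v))
          ≡⟨ Σᴺ-cong U (λ v → trans (sym (*-Σᴺ U l (λ u → x b v * (x a u * b2n (v <ᵇ u))))) (cong (l *_) (sym (*-Σᴺ U (x b v) (λ u → x a u * b2n (v <ᵇ u)))))) ⟩
        Σᴺ U (λ v → l * (x b v * Σᴺ U (λ u → x a u * b2n (v <ᵇ u))))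
          ≡⟨ *-Σᴺ U l _ ⟨
        l * Σᴺ U (λ v → x b v * Σᴺ U (λ u → x a u * b2n (v <ᵇ u)))
          ≡⟨ cong (l *_) (trans (Σᴺ-cong U λ v → cong (x b v *_) (Σ-column a (λ u → b2n (v <ᵇ u))))
               (Σ-column b (λ v → Σᴺ (upTo ℓ) (λ j → b2n (v <ᵇ place a j))))) ⟩
        l * Σᴺ (upTo ℓ) (λ i → Σᴺ (upTo ℓ) (λ j → b2n (place b i <ᵇ place a j)))
          ≡⟨ cong (l *_) (Σᴺ-cong-All (All.map (λ {i} pi → Σᴺ-cong-All (All.map (λ {j} pj → cong b2n (sym (place-< a b i j pi pj))) (upTo-< ℓ))) (upTo-< ℓ))) ⟩
        l * Σᴺ (upTo ℓ) (λ i → Σᴺ (upTo ℓ) (λ j → b2n ⌊ pos (lookup α b) i ℤ.<? pos (lookup α a) j ⌋)) ∎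
        where
        l = b2n (toℕ a <ᵇ toℕ b)

  length-tail : ∀ la ℓ → length la ≤ suc ℓ → length (tail₀ la) ≤ ℓ
  length-tail [] ℓ p = z≤n
  length-tail (x ∷ r) ℓ (s≤s p) = p

  head-empty : ∀ la → length la ≤ 0 → head₀ la ≡ 0
  head-empty [] p = refl

  -- Enlarging the window on the left adds a particle of every colour in front.
  hit-first : ∀ la ℓ → length la ≤ ℓ → hit la (suc ℓ) 0 ≡ true
  hit-first la zero p rewrite head-empty la p = refl
  hit-first la (suc ℓ) p = trans (hit-suc la (suc ℓ) 0) (trans (cong (⌊ 0 ℕ.≟ head₀ la + suc ℓ ⌋ ∨_) (hit-first (tail₀ la) ℓ (length-tail la ℓ p)))
    (∨-true _))
    where
    ∨-true : ∀ b → b ∨ true ≡ true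
    ∨-true true = refl
    ∨-true false = refl

  hit-shift : ∀ la ℓ u → length la ≤ ℓ → hit la (suc ℓ) (suc u) ≡ hit la ℓ u
  hit-shift la zero u p = trans (hit-suc la 0 (suc u)) (cong (λ h → ⌊ suc u ℕ.≟ h + 0 ⌋ ∨ false) (head-empty la p))
  hit-shift la (suc ℓ) u p = trans (hit-suc la (suc ℓ) (suc u)) (trans (cong₂ _∨_
    (⌊⌋-cong (suc u ℕ.≟ head₀ la + suc ℓ) (u ℕ.≟ head₀ la + ℓ) (λ q → ℕP.suc-injective (trans q (ℕP.+-suc _ ℓ))) (λ q → trans (cong suc q) (sym (ℕP.+-suc _ ℓ))))
    (hit-shift (tail₀ la) ℓ u (length-tail la ℓ p))) (sym (hit-suc la ℓ u)))

  tabulate-replicate : ∀ {k} {A : Set} {f : Fin k → A} {x} → (∀ a → f a ≡ x) → tabulate f ≡ replicate k x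
  tabulate-replicate {zero} h = refl
  tabulate-replicate {suc k} h = cong₂ _∷_ (h zero) (tabulate-replicate (h ∘ suc))

  stateOf-full : ∀ (α : Tuple k) ℓ c → (∀ a → length (lookup α a) ≤ ℓ) → stateOf α (suc ℓ) (suc c) ≡ full ∷ stateOf α ℓ c
  stateOf-full α ℓ c short = trans (upTo-suc (column-of α (suc ℓ)) c) (cong₂ _∷_
    (tabulate-replicate λ a → hit-first (lookup α a) ℓ (short a))
    (ListP.map-cong (λ u → VecP.tabulate-cong λ a → hit-shift (lookup α a) ℓ u (short a)) (upTo c)))

  stateOf-∅ : ∀ (α : Tuple k) ℓ c → IsPartitionTuple α → (∀ a → head₀ (lookup α a) + ℓ ≤ c) → stateOf α ℓ (suc c) ≡ stateOf α ℓ c ++ ∅ ∷ []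
  stateOf-∅ α ℓ c part small = trans (cong (map (column-of α ℓ)) (sym (ListP.upTo-∷ʳ c))) (trans (ListP.map-++ _ (upTo c) (c ∷ []))
    (cong (λ L → stateOf α ℓ c ++ L ∷ []) (tabulate-replicate λ a → hit-beyond (lookup α a) ℓ c (partition-lookup part a) (small a))))

  -- The partition read off from the occupied positions of one colour:
  -- an empty site increases all parts above it by one.
  grow : ℕ → List ℕ → List ℕ
  grow zero la = []
  grow (suc n) la = suc (head₀ la) ∷ grow n (tail₀ la)

  parts : List Bool → List ℕ
  parts [] = []
  parts (true ∷ bs) = parts bs
  parts (false ∷ bs) = grow (count bs) (parts bs)

  grow-partition : ∀ n la → IsPartition la → IsPartition (grow n la)
  grow-partition zero la p = tt
  grow-partition (suc zero) la p = s≤s z≤n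
  grow-partition (suc (suc n)) la p = s≤s (head-tail la p) , grow-partition (suc n) (tail₀ la) (partition-tail la p)

  grow-length : ∀ n la → length (grow n la) ≡ n
  grow-length zero la = refl
  grow-length (suc n) la = cong suc (grow-length n (tail₀ la))

  grow-head : ∀ n la → head₀ (grow n la) ≤ suc (head₀ la)
  grow-head zero la = z≤n
  grow-head (suc n) la = ℕP.≤-refl

  hit-grow-first : ∀ n la → hit (grow n la) n 0 ≡ false
  hit-grow-first zero la = refl
  hit-grow-first (suc n) la = trans (hit-suc (grow (suc n) la) n 0) (hit-grow-first n (tail₀ la))

  hit-grow : ∀ n la u → hit (grow n la) n (suc u) ≡ hit la n u
  hit-grow zero la u = refl
  hit-grow (suc n) la u = trans (hit-suc (grow (suc n) la) n (suc u)) (trans (cong₂ _∨_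
    (⌊⌋-cong (suc u ℕ.≟ suc (head₀ la) + n) (u ℕ.≟ head₀ la + n) ℕP.suc-injective (cong suc)) (hit-grow n (tail₀ la) u)) (sym (hit-suc la n u)))

  parts-partition : ∀ bs → IsPartition (parts bs)
  parts-partition [] = tt
  parts-partition (true ∷ bs) = parts-partition bs
  parts-partition (false ∷ bs) = grow-partition (count bs) (parts bs) (parts-partition bs)

  parts-length : ∀ bs → length (parts bs) ≤ count bs
  parts-length [] = z≤n
  parts-length (true ∷ bs) = ℕP.m≤n⇒m≤1+n (parts-length bs)
  parts-length (false ∷ bs) = ℕP.≤-reflexive (grow-length (count bs) (parts bs))

  parts-head : ∀ bs → head₀ (parts bs) + count bs ≤ length bs
  parts-head [] = z≤n
  parts-head (true ∷ bs) = ℕP.≤-trans (ℕP.≤-reflexive (ℕP.+-suc _ (count bs))) (s≤s (parts-head bs))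
  parts-head (false ∷ bs) = ℕP.≤-trans (ℕP.+-monoˡ-≤ (count bs) (grow-head (count bs) (parts bs))) (s≤s (parts-head bs))

  -- An occupied first site is one more particle in front, as when the window grows to the left; an
  -- empty first site moves all particles one place on, and this is what `grow` records.
  hit-parts : ∀ bs → map (hit (parts bs) (count bs)) (upTo (length bs)) ≡ bs
  hit-parts [] = refl
  hit-parts (true ∷ bs) = trans (upTo-suc (hit (parts bs) (suc (count bs))) (length bs)) (cong₂ _∷_
    (hit-first (parts bs) (count bs) (parts-length bs))
    (trans (ListP.map-cong (λ u → hit-shift (parts bs) (count bs) u (parts-length bs)) (upTo (length bs))) (hit-parts bs)))
  hit-parts (false ∷ bs) = trans (upTo-suc (hit (parts (false ∷ bs)) (count bs)) (length bs)) (cong₂ _∷_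
    (hit-grow-first (count bs) (parts bs))
    (trans (ListP.map-cong (hit-grow (count bs) (parts bs)) (upTo (length bs))) (hit-parts bs)))

  hit-head : ∀ la ℓ → hit la (suc ℓ) (head₀ la + ℓ) ≡ true
  hit-head la ℓ = trans (hit-suc la ℓ _) (cong (_∨ hit (tail₀ la) ℓ (head₀ la + ℓ)) (⌊⌋-yes (head₀ la + ℓ ℕ.≟ head₀ la + ℓ) refl))

  -- The largest occupied site determines the first part. Since it lies beyond the sites of the
  -- other parts, removing it on both sides leaves equal configurations for the tails.
  hit-injective : ∀ ℓ la la′ → IsPartition la → IsPartition la′ → length la ≤ ℓ → length la′ ≤ ℓ →
    (∀ u → hit la ℓ u ≡ hit la′ ℓ u) → la ≡ la′
  hit-injective zero [] [] p p′ q q′ h = refl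
  hit-injective (suc ℓ) la la′ p p′ q q′ h = rebuild la la′ p p′ heads (hit-injective ℓ (tail₀ la) (tail₀ la′)
    (partition-tail la p) (partition-tail la′ p′) (length-tail la ℓ q) (length-tail la′ ℓ q′) tails)
    where
    below-head : ∀ x y → IsPartition y → hit y (suc ℓ) (head₀ x + ℓ) ≡ true → head₀ x ≤ head₀ y
    below-head x y py e = ℕP.+-cancelʳ-≤ ℓ _ _ (ℕP.≤-pred (ℕP.≤-trans (hit-bound y (suc ℓ) _ py e) (ℕP.≤-reflexive (ℕP.+-suc _ ℓ))))
    heads : head₀ la ≡ head₀ la′
    heads = ℕP.≤-antisym (below-head la la′ p′ (trans (sym (h _)) (hit-head la ℓ))) (below-head la′ la p (trans (h _) (hit-head la′ ℓ)))
    tails : ∀ u → hit (tail₀ la) ℓ u ≡ hit (tail₀ la′) ℓ u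
    tails u with u ℕ.≟ head₀ la + ℓ
    ... | yes refl = trans (hit-beyond (tail₀ la) ℓ _ (partition-tail la p) (ℕP.+-monoˡ-≤ ℓ (head-tail la p)))
      (sym (hit-beyond (tail₀ la′) ℓ _ (partition-tail la′ p′) (ℕP.≤-trans (ℕP.+-monoˡ-≤ ℓ (head-tail la′ p′)) (ℕP.≤-reflexive (cong (_+ ℓ) (sym heads))))))
    ... | no ne = trans (sym (trans (hit-suc la ℓ u) (cong (_∨ hit (tail₀ la) ℓ u) (⌊⌋-no (u ℕ.≟ head₀ la + ℓ) ne))))
      (trans (h u) (trans (hit-suc la′ ℓ u) (cong (_∨ hit (tail₀ la′) ℓ u) (⌊⌋-no (u ℕ.≟ head₀ la′ + ℓ) (λ e → ne (trans e (cong (_+ ℓ) (sym heads))))))))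
    rebuild : ∀ la la′ → IsPartition la → IsPartition la′ → head₀ la ≡ head₀ la′ → tail₀ la ≡ tail₀ la′ → la ≡ la′
    rebuild [] [] p p′ e e′ = refl
    rebuild (x ∷ r) (y ∷ r′) p p′ e e′ = cong₂ _∷_ e e′
    rebuild [] (y ∷ r) p p′ e e′ = ⊥-elim (ℕP.<⇒≢ (head-positive y r p′) e)
    rebuild (x ∷ r) [] p p′ e e′ = ⊥-elim (ℕP.<⇒≢ (head-positive x r p) (sym e))

  colour : Fin k → List (Label k) → List Bool
  colour a s = map (λ I → lookup I a) s

  decode : List (Label k) → Tuple k
  decode s = tabulate λ a → parts (colour a s)

  decode-partition : ∀ (s : List (Label k)) → IsPartitionTuple (decode s)
  decode-partition s = VecAllP.tabulate⁺ λ a → parts-partition (colour a s)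

  count-colour : ∀ (s : List (Label k)) {ℓ} → counts s ≡ replicate k ℓ → ∀ a → count (colour a s) ≡ ℓ
  count-colour s {ℓ} filled a = trans (count-map s) (trans (sym (trans (cong (λ v → lookup v a) (counts-tabulate s)) (VecP.lookup∘tabulate _ a)))
    (trans (cong (λ v → lookup v a) filled) (VecP.lookup-replicate a ℓ)))
    where
    count-map : ∀ s → count (colour a s) ≡ Σᴺ s (λ I → b2n (lookup I a))
    count-map [] = refl
    count-map (I ∷ s) = cong (b2n (lookup I a) +_) (count-map s)

  decode-fits : ∀ (s : List (Label k)) {ℓ} → counts s ≡ replicate k ℓ → Fits ℓ (length s) (decode s)
  decode-fits s {ℓ} filled a rewrite VecP.lookup∘tabulate (λ a → parts (colour a s)) a | sym (count-colour s filled a) =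
    parts-length (colour a s) , ℕP.≤-trans (parts-head (colour a s)) (ℕP.≤-reflexive (ListP.length-map _ s))

  transpose : ∀ (s : List (Label k)) (f : Fin k → ℕ → Bool) → (∀ a → map (f a) (upTo (length s)) ≡ colour a s) →
    map (λ u → tabulate (λ a → f a u)) (upTo (length s)) ≡ s
  transpose [] f h = refl
  transpose (I ∷ s) f h = trans (upTo-suc _ (length s)) (cong₂ _∷_
    (trans (VecP.tabulate-cong λ a → ListP.∷-injectiveˡ (trans (sym (upTo-suc (f a) (length s))) (h a))) (VecP.tabulate∘lookup I))
    (transpose s (λ a → f a ∘ suc) λ a → ListP.∷-injectiveʳ (trans (sym (upTo-suc (f a) (length s))) (h a))))

  stateOf-decode : ∀ (s : List (Label k)) {ℓ} → counts s ≡ replicate k ℓ → stateOf (decode s) ℓ (length s) ≡ s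
  stateOf-decode s {ℓ} filled = transpose s (λ a → hit (lookup (decode s) a) ℓ) λ a →
    trans (cong₂ (λ la n → map (hit la n) (upTo (length s))) (VecP.lookup∘tabulate (λ a → parts (colour a s)) a) (sym (count-colour s filled a)))
    (trans (cong (λ n → map (hit (parts (colour a s)) (count (colour a s))) (upTo n)) (sym (ListP.length-map _ s))) (hit-parts (colour a s)))

  stateOf-injective : ∀ (α β : Tuple k) ℓ c → IsPartitionTuple α → IsPartitionTuple β → Fits ℓ c α → Fits ℓ c β →
    stateOf α ℓ c ≡ stateOf β ℓ c → α ≡ β
  stateOf-injective α β ℓ c pα pβ fα fβ eq = trans (sym (VecP.tabulate∘lookup α)) (trans (VecP.tabulate-cong λ a →
    hit-injective ℓ (lookup α a) (lookup β a) (partition-lookup pα a) (partition-lookup pβ a) (proj₁ (fα a)) (proj₁ (fβ a)) (same a)) (VecP.tabulate∘lookup β))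
    where
    upTo-injective : ∀ {A : Set} (f g : ℕ → A) c → map f (upTo c) ≡ map g (upTo c) → ∀ u → u < c → f u ≡ g u
    upTo-injective f g (suc c) e zero lt = ListP.∷-injectiveˡ (trans (sym (upTo-suc f c)) (trans e (upTo-suc g c)))
    upTo-injective f g (suc c) e (suc u) (s≤s lt) =
      upTo-injective (f ∘ suc) (g ∘ suc) c (ListP.∷-injectiveʳ (trans (sym (upTo-suc f c)) (trans e (upTo-suc g c)))) u lt
    same : ∀ a u → hit (lookup α a) ℓ u ≡ hit (lookup β a) ℓ u
    same a u with u ℕP.<? c
    ... | yes lt = trans (sym (VecP.lookup∘tabulate (λ a → hit (lookup α a) ℓ u) a)) (trans (cong (λ v → lookup v a)
      (upTo-injective _ _ c eq u lt)) (VecP.lookup∘tabulate (λ a → hit (lookup β a) ℓ u) a))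
    ... | no ge = trans (hit-beyond _ ℓ u (partition-lookup pα a) (ℕP.≤-trans (proj₂ (fα a)) (ℕP.≮⇒≥ ge)))
      (sym (hit-beyond _ ℓ u (partition-lookup pβ a) (ℕP.≤-trans (proj₂ (fβ a)) (ℕP.≮⇒≥ ge))))

  -- Both tuples have the same state by `stateOf-decode`, and `stateOf` is injective on tuples that
  -- fit.
  decode-stateOf : ∀ (α : Tuple k) ℓ c → IsPartitionTuple α → Fits ℓ c α → decode (stateOf α ℓ c) ≡ α
  decode-stateOf α ℓ c p f = stateOf-injective (decode s) α ℓ c (decode-partition s) p
    (≡.subst (λ n → Fits ℓ n (decode s)) len (decode-fits s filled)) f
    (trans (cong (stateOf (decode s) ℓ) (sym len)) (stateOf-decode s filled))
    where
    s = stateOf α ℓ c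
    filled = StateOf.counts-stateOf α ℓ c p f
    len : length s ≡ c
    len = trans (ListP.length-map _ (upTo c)) (ListP.length-upTo c)

-- Enlarging the window

length-stateOf : ∀ {k} (α : Tuple k) ℓ c → length (stateOf α ℓ c) ≡ c
length-stateOf α ℓ c = ≡.trans (ListP.length-map _ (upTo c)) (ListP.length-upTo c)

Fits-∷ʳ : ∀ {k ℓ c} {α : Tuple k} → Fits ℓ c α → Fits ℓ (suc c) α
Fits-∷ʳ f a = proj₁ (f a) , ℕP.m≤n⇒m≤1+n (proj₂ (f a))

Fits-full : ∀ {k ℓ c} {α : Tuple k} → Fits ℓ c α → Fits (suc ℓ) (suc c) α
Fits-full f a = ℕP.m≤n⇒m≤1+n (proj₁ (f a)) , ℕP.≤-trans (ℕP.≤-reflexive (ℕP.+-suc _ _)) (s≤s (proj₂ (f a)))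

Fits-window : ∀ {k ℓ N} (α : Tuple k) → maxLen α ≤ ℓ → maxPart α ≤ N → Fits ℓ (ℓ ℕ.+ N ℕ.+ 1) α
Fits-window {ℓ = ℓ} {N} α p q a = ℕP.≤-trans (length≤maxLen α a) p ,
  ℕP.≤-trans (ℕP.+-monoˡ-≤ ℓ (ℕP.≤-trans (head≤maxPart α a) q)) (ℕP.≤-trans (ℕP.≤-reflexive (ℕP.+-comm N ℓ)) (ℕP.m≤m+n (ℓ ℕ.+ N) 1))

-- Adding a particle of every colour in front shifts the number of crossings
-- by a constant that does not depend on the tuple.
offset : ℕ → ℕ → ℕ → ℕ
offset k ℓ zero = 0
offset k ℓ (suc d) = φᵛ (replicate k (d ℕ.+ ℓ)) (bv full) ℕ.+ offset k ℓ d

NL-offset : ∀ {k} (α : Tuple k) ℓ d → IsPartitionTuple α → maxLen α ≤ ℓ → NL (d ℕ.+ ℓ) α ≡ offset k ℓ d ℕ.+ NL ℓ α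
NL-offset α ℓ zero part p = ≡.refl
NL-offset {k} α ℓ (suc d) part p = begin
  NL (suc (d ℕ.+ ℓ)) α
    ≡⟨ StateOf.crossings-stateOf α (suc (d ℕ.+ ℓ)) (suc c) part (Fits-full {α = α} fits) ⟨
  crossings (stateOf α (suc (d ℕ.+ ℓ)) (suc c))
    ≡⟨ ≡.cong crossings (stateOf-full α (d ℕ.+ ℓ) c (λ a → proj₁ (fits a))) ⟩
  φᵛ (counts s) (bv full) ℕ.+ crossings s
    ≡⟨ ≡.cong₂ (λ n m → φᵛ n (bv full) ℕ.+ m) (StateOf.counts-stateOf α (d ℕ.+ ℓ) c part fits) (StateOf.crossings-stateOf α (d ℕ.+ ℓ) c part fits) ⟩
  φᵛ (replicate k (d ℕ.+ ℓ)) (bv full) ℕ.+ NL (d ℕ.+ ℓ) α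
    ≡⟨ ≡.trans (≡.cong (φᵛ (replicate k (d ℕ.+ ℓ)) (bv full) ℕ.+_) (NL-offset α ℓ d part p)) (≡.sym (ℕP.+-assoc _ (offset k ℓ d) (NL ℓ α))) ⟩
  offset k ℓ (suc d) ℕ.+ NL ℓ α ∎
  where
  open ≡.≡-Reasoning
  c = d ℕ.+ ℓ ℕ.+ maxPart α ℕ.+ 1
  fits = Fits-window {ℓ = d ℕ.+ ℓ} {maxPart α} α (ℕP.≤-trans p (ℕP.m≤n+m ℓ d)) ℕP.≤-refl
  s = stateOf α (d ℕ.+ ℓ) c

dist-NL : ∀ {k} (α β : Tuple k) ℓ → IsPartitionTuple α → IsPartitionTuple β → maxLen α ≤ ℓ → maxLen β ≤ ℓ →
  dist α β ≡ NL ℓ β ℤ.⊖ NL ℓ α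
dist-NL {k} α β ℓ pα pβ qα qβ = begin
  ι (NL L β) ℤ.- ι (NL L α)                              ≡⟨ ℤP.m-n≡m⊖n (NL L β) (NL L α) ⟩
  NL L β ℤ.⊖ NL L α                                      ≡⟨ ℤP.+-cancelˡ-⊖ o (NL L β) (NL L α) ⟨
  (o ℕ.+ NL L β) ℤ.⊖ (o ℕ.+ NL L α)                      ≡⟨ ≡.cong₂ ℤ._⊖_ (NL-offset β L (ℓ ℕ.∸ L) pβ (ℕP.m≤n⊔m (maxLen α) _)) (NL-offset α L (ℓ ℕ.∸ L) pα (ℕP.m≤m⊔n (maxLen α) _)) ⟨
  NL (ℓ ℕ.∸ L ℕ.+ L) β ℤ.⊖ NL (ℓ ℕ.∸ L ℕ.+ L) α          ≡⟨ ≡.cong (λ l → NL l β ℤ.⊖ NL l α) (ℕP.m∸n+n≡m (ℕP.⊔-lub qα qβ)) ⟩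
  NL ℓ β ℤ.⊖ NL ℓ α                                      ∎
  where
  open ≡.≡-Reasoning
  L = maxLen α ⊔ maxLen β
  o = offset k L (ℓ ℕ.∸ L)

module LargeWindows (R : CommutativeRing 0ℓ 0ℓ) (t t⁻¹ : CommutativeRing.Carrier R)
                 (tt⁻¹ : CommutativeRing._≈_ R (CommutativeRing._*_ R t t⁻¹) (CommutativeRing.1# R))
                 (V k : ℕ) where
  private module R = CommutativeRing R
  open Lattice R t t⁻¹ hiding (vertex)
  open Series R t t⁻¹
  open Variables R t t⁻¹ tt⁻¹
  open LatticeLink R t t⁻¹ tt⁻¹ V k
  open CommutativeRing K
  open Rows K using (_^_)

  private
    eqL-refl-ind : ∀ (L : Label k) → ind L L ≈ 1#
    eqL-refl-ind L = reflexive (≡.cong (λ b → if b then 1# else 0#) (eqL-refl L))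

  module _ (rs : List (Row V)) (α β : Tuple k) (pα : IsPartitionTuple α) (pβ : IsPartitionTuple β) where

    entryOf : ℕ → ℕ → FPS V
    entryOf ℓ c = Window.operators c rs (stateOf α ℓ c) (stateOf β ℓ c)

    entry-∷ʳ : ∀ ℓ c → Fits ℓ c α → Fits ℓ c β → entryOf ℓ (suc c) ≈ entryOf ℓ c
    entry-∷ʳ ℓ c fα fβ = trans (reflexive (≡.cong₂ (Window.operators (suc c) rs)
        (stateOf-∅ α ℓ c pα (λ a → proj₂ (fα a))) (stateOf-∅ β ℓ c pβ (λ a → proj₂ (fβ a)))))
      (trans (operators-∷ʳ c rs (stateOf α ℓ c) (stateOf β ℓ c) ∅ (length-stateOf α ℓ c) (length-stateOf β ℓ c))
        (trans (*-congˡ {entryOf ℓ c} (eqL-refl-ind ∅)) (*-identityʳ (entryOf ℓ c))))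

    entry-full : ∀ ℓ c → Fits ℓ c α → Fits ℓ c β → entryOf (suc ℓ) (suc c) ≈ entryOf ℓ c
    entry-full ℓ c fα fβ = trans (reflexive (≡.cong₂ (Window.operators (suc c) rs)
        (stateOf-full α ℓ c (λ a → proj₁ (fα a))) (stateOf-full β ℓ c (λ a → proj₁ (fβ a)))))
      (trans (operators-full c rs (stateOf α ℓ c) (stateOf β ℓ c) full (length-stateOf α ℓ c) (length-stateOf β ℓ c))
        (trans (*-congˡ {entryOf ℓ c} (eqL-refl-ind full)) (*-identityʳ (entryOf ℓ c))))

    entry-right : ∀ r ℓ c → Fits ℓ c α → Fits ℓ c β → (Fits ℓ (r ℕ.+ c) α × Fits ℓ (r ℕ.+ c) β) × (entryOf ℓ (r ℕ.+ c) ≈ entryOf ℓ c)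
    entry-right zero ℓ c fα fβ = (fα , fβ) , refl
    entry-right (suc r) ℓ c fα fβ with entry-right r ℓ c fα fβ
    ... | (gα , gβ) , eq = (Fits-∷ʳ {α = α} gα , Fits-∷ʳ {α = β} gβ) , trans (entry-∷ʳ ℓ (r ℕ.+ c) gα gβ) eq

    entry-left : ∀ d ℓ c → Fits ℓ c α → Fits ℓ c β → (Fits (d ℕ.+ ℓ) (d ℕ.+ c) α × Fits (d ℕ.+ ℓ) (d ℕ.+ c) β) × (entryOf (d ℕ.+ ℓ) (d ℕ.+ c) ≈ entryOf ℓ c)
    entry-left zero ℓ c fα fβ = (fα , fβ) , refl
    entry-left (suc d) ℓ c fα fβ with entry-left d ℓ c fα fβ
    ... | (gα , gβ) , eq = (Fits-full {α = α} gα , Fits-full {α = β} gβ) , trans (entry-full (d ℕ.+ ℓ) (d ℕ.+ c) gα gβ) eq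

    -- `LS` uses a window fitted to the two tuples, whereas a sum over tuples needs a common one.
    -- Empty columns are added on the right and full columns on the left, and neither changes the
    -- entry.
    LS-entry : ∀ ℓ N → maxLen α ≤ ℓ → maxLen β ≤ ℓ → maxPart α ≤ N → maxPart β ≤ N → LS rs α β ≈ entryOf ℓ (ℓ ℕ.+ N ℕ.+ 1)
    LS-entry ℓ N lα lβ mα mβ = begin
      lattice rs c₀ (boundary ℓ₀ N₀ β) (boundary ℓ₀ N₀ α)
        ≈⟨ reflexive (≡.cong₂ (lattice rs c₀) (boundary-stateOf ℓ₀ N₀ β) (boundary-stateOf ℓ₀ N₀ α)) ⟩
      lattice rs c₀ (stateOf β ℓ₀ c₀) (stateOf α ℓ₀ c₀)
        ≈⟨ Window.lattice-link c₀ rs (stateOf β ℓ₀ c₀) (stateOf α ℓ₀ c₀) ⟩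
      entryOf ℓ₀ c₀
        ≈⟨ proj₂ (entry-right (N ℕ.∸ N₀) ℓ₀ c₀ fα fβ) ⟨
      entryOf ℓ₀ (N ℕ.∸ N₀ ℕ.+ c₀)
        ≈⟨ proj₂ (entry-left (ℓ ℕ.∸ ℓ₀) ℓ₀ (N ℕ.∸ N₀ ℕ.+ c₀) (proj₁ (proj₁ (entry-right (N ℕ.∸ N₀) ℓ₀ c₀ fα fβ))) (proj₂ (proj₁ (entry-right (N ℕ.∸ N₀) ℓ₀ c₀ fα fβ)))) ⟨
      entryOf (ℓ ℕ.∸ ℓ₀ ℕ.+ ℓ₀) (ℓ ℕ.∸ ℓ₀ ℕ.+ (N ℕ.∸ N₀ ℕ.+ c₀))
        ≈⟨ reflexive (≡.cong₂ entryOf (ℕP.m∸n+n≡m (ℕP.⊔-lub lα lβ)) (≡.trans (columns≡ (ℓ ℕ.∸ ℓ₀) (N ℕ.∸ N₀) ℓ₀ N₀)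
             (≡.cong₂ (λ a b → a ℕ.+ b ℕ.+ 1) (ℕP.m∸n+n≡m (ℕP.⊔-lub lα lβ)) (ℕP.m∸n+n≡m (ℕP.⊔-lub mα mβ))))) ⟩
      entryOf ℓ (ℓ ℕ.+ N ℕ.+ 1) ∎
      where
      open import Relation.Binary.Reasoning.Setoid setoid
      ℓ₀ = maxLen α ⊔ maxLen β
      N₀ = maxPart α ⊔ maxPart β
      c₀ = ℓ₀ ℕ.+ N₀ ℕ.+ 1
      fα = Fits-window {ℓ = ℓ₀} {N₀} α (ℕP.m≤m⊔n _ _) (ℕP.m≤m⊔n _ _)
      fβ = Fits-window {ℓ = ℓ₀} {N₀} β (ℕP.m≤n⊔m (maxLen α) _) (ℕP.m≤n⊔m (maxPart α) _)
      columns≡ : ∀ d r l n → d ℕ.+ (r ℕ.+ (l ℕ.+ n ℕ.+ 1)) ≡ (d ℕ.+ l) ℕ.+ (r ℕ.+ n) ℕ.+ 1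
      columns≡ = let open +-*-Solver in solve 4 (λ d r l n → d :+ (r :+ (l :+ n :+ con 1)) := (d :+ l) :+ (r :+ n) :+ con 1) ≡.refl

  tpow-⊖ : ∀ a b → tpow (a ℤ.⊖ b) R.≈ (t ^ᴿ a) R.* (t⁻¹ ^ᴿ b)
  tpow-⊖ zero zero = R.sym (R.*-identityˡ R.1#)
  tpow-⊖ zero (suc b) = R.sym (R.*-identityˡ _)
  tpow-⊖ (suc a) zero = R.sym (R.*-identityʳ _)
  tpow-⊖ (suc a) (suc b) = R.trans (R.reflexive (≡.cong tpow (ℤP.[1+m]⊖[1+n]≡m⊖n a b))) (R.trans (tpow-⊖ a b)
    (R.sym (R.trans (solve 4 (λ t x u y → (t :* x) :* (u :* y) := (t :* u) :* (x :* y)) R.refl t (t ^ᴿ a) t⁻¹ (t⁻¹ ^ᴿ b))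
      (R.trans (R.*-congʳ tt⁻¹) (R.*-identityˡ _)))))
    where open RingSolver R

  tpow-dist : ∀ (α β : Tuple k) ℓ N → IsPartitionTuple α → IsPartitionTuple β →
    maxLen α ≤ ℓ → maxLen β ≤ ℓ → maxPart α ≤ N → maxPart β ≤ N →
    const (tpow (dist α β)) ≈ const t ^ crossings (stateOf β ℓ (ℓ ℕ.+ N ℕ.+ 1)) * const t⁻¹ ^ crossings (stateOf α ℓ (ℓ ℕ.+ N ℕ.+ 1))
  tpow-dist α β ℓ N pα pβ lα lβ mα mβ = begin
    const (tpow (dist α β))
      ≈⟨ const-cong (R.trans (R.reflexive (≡.cong tpow (dist-NL α β ℓ pα pβ lα lβ))) (tpow-⊖ (NL ℓ β) (NL ℓ α))) ⟩
    const ((t ^ᴿ NL ℓ β) R.* (t⁻¹ ^ᴿ NL ℓ α))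
      ≈⟨ const-* (t ^ᴿ NL ℓ β) (t⁻¹ ^ᴿ NL ℓ α) ⟨
    const (t ^ᴿ NL ℓ β) * const (t⁻¹ ^ᴿ NL ℓ α)
      ≈⟨ *-cong (const-^ (NL ℓ β)) (const⁻¹-^ (NL ℓ α)) ⟨
    const t ^ NL ℓ β * const t⁻¹ ^ NL ℓ α
      ≈⟨ reflexive (≡.cong₂ (λ a b → const t ^ a * const t⁻¹ ^ b)
           (StateOf.crossings-stateOf β ℓ (ℓ ℕ.+ N ℕ.+ 1) pβ (Fits-window {ℓ = ℓ} {N} β lβ mβ))
           (StateOf.crossings-stateOf α ℓ (ℓ ℕ.+ N ℕ.+ 1) pα (Fits-window {ℓ = ℓ} {N} α lα mα))) ⟨
    const t ^ crossings (stateOf β ℓ (ℓ ℕ.+ N ℕ.+ 1)) * const t⁻¹ ^ crossings (stateOf α ℓ (ℓ ℕ.+ N ℕ.+ 1)) ∎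
    where
    open import Relation.Binary.Reasoning.Setoid setoid
    const-cong : ∀ {c c′} → c R.≈ c′ → const c ≈ const c′
    const-cong h = monoS-cong zeros h
    const⁻¹-^ : ∀ n → const t⁻¹ ^ n ≈ const (t⁻¹ ^ᴿ n)
    const⁻¹-^ zero = refl
    const⁻¹-^ (suc n) = trans (*-congˡ {const t⁻¹} (const⁻¹-^ n)) (const-* t⁻¹ (t⁻¹ ^ᴿ n))

-- The factor Ω

module Products (K : CommutativeRing 0ℓ 0ℓ) where
  open CommutativeRing K
  open RingSolver K

  ∏ : List A → (A → Carrier) → Carrier
  ∏ xs f = List.foldr _*_ 1# (map f xs)

  ∏-cong : ∀ (xs : List A) {f g : A → Carrier} → (∀ x → f x ≈ g x) → ∏ xs f ≈ ∏ xs g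
  ∏-cong [] h = refl
  ∏-cong (x ∷ xs) h = *-cong (h x) (∏-cong xs h)

  ∏-cong-All : ∀ {xs : List A} {f g : A → Carrier} → All (λ x → f x ≈ g x) xs → ∏ xs f ≈ ∏ xs g
  ∏-cong-All [] = refl
  ∏-cong-All (h ∷ hs) = *-cong h (∏-cong-All hs)

  ∏-1 : ∀ (xs : List A) → ∏ xs (λ _ → 1#) ≈ 1#
  ∏-1 [] = refl
  ∏-1 (x ∷ xs) = trans (*-identityˡ _) (∏-1 xs)

  ∏-* : ∀ (xs : List A) (f g : A → Carrier) → ∏ xs f * ∏ xs g ≈ ∏ xs (λ x → f x * g x)
  ∏-* [] f g = *-identityˡ _
  ∏-* (x ∷ xs) f g = trans (solve 4 (λ a b c d → (a :* b) :* (c :* d) := (a :* c) :* (b :* d)) refl (f x) (∏ xs f) (g x) (∏ xs g))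
    (*-congˡ (∏-* xs f g))

  ∏-++ : ∀ (xs ys : List A) f → ∏ (xs ++ ys) f ≈ ∏ xs f * ∏ ys f
  ∏-++ [] ys f = sym (*-identityˡ _)
  ∏-++ (x ∷ xs) ys f = trans (*-congˡ (∏-++ xs ys f)) (sym (*-assoc _ _ _))

  ∏-map : ∀ (g : A → B) xs f → ∏ (map g xs) f ≡ ∏ xs (λ x → f (g x))
  ∏-map g xs f = ≡.cong (List.foldr _*_ 1#) (≡.sym (ListP.map-∘ xs))

  ∏-concatMap : ∀ (g : A → List B) xs f → ∏ (concatMap g xs) f ≈ ∏ xs (λ x → ∏ (g x) f)
  ∏-concatMap g [] f = refl
  ∏-concatMap g (x ∷ xs) f = trans (∏-++ (g x) (concatMap g xs) f) (*-congˡ (∏-concatMap g xs f))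

  ∏-swap : ∀ (xs : List A) (ys : List B) (f : A → B → Carrier) → ∏ xs (λ x → ∏ ys (f x)) ≈ ∏ ys (λ y → ∏ xs (λ x → f x y))
  ∏-swap [] ys f = sym (∏-1 ys)
  ∏-swap (x ∷ xs) ys f = trans (*-congˡ (∏-swap xs ys f)) (∏-* ys (f x) (λ y → ∏ xs (λ x → f x y)))

  ∏-upTo : ∀ n f → ∏ (upTo (suc n)) f ≈ ∏ (upTo n) f * f n
  ∏-upTo n f = trans (reflexive (≡.cong (λ ns → ∏ ns f) (≡.sym (ListP.upTo-∷ʳ n)))) (trans (∏-++ (upTo n) (n ∷ []) f) (*-congˡ (*-identityʳ (f n))))

module _ (R : CommutativeRing 0ℓ 0ℓ) (t t⁻¹ : CommutativeRing.Carrier R)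
         (tt⁻¹ : CommutativeRing._≈_ R (CommutativeRing._*_ R t t⁻¹) (CommutativeRing.1# R)) where
  private module R = CommutativeRing R
  open Lattice R t t⁻¹
  open Series R t t⁻¹
  open Variables R t t⁻¹ tt⁻¹

  -- As u and v differ, the exponent of u in (u v)^j is j. This is how `geomInv` reads off j from a
  -- monomial; for u = v it would be 2 j.
  module GeometricSeries {V : ℕ} (c : R.Carrier) (u v : Fin V) (u≢v : u ≢ v) where
    private
      m : Mono V
      m = pairMono u v

      lookup-unit : ∀ (w : Fin V) x → lookup (unitV w 1) x ≡ (if ⌊ x Fin.≟ w ⌋ then 1 else 0)
      lookup-unit w x = VecP.lookup∘tabulate _ x

      lookup-m : lookup m u ≡ 1
      lookup-m = ≡.trans (VecP.lookup-zipWith ℕ._+_ u (unitV u 1) (unitV v 1))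
        (≡.cong₂ ℕ._+_ (≡.trans (lookup-unit u u) (own u)) (≡.trans (lookup-unit v u) other))
        where
        own : ∀ (u : Fin V) → (if ⌊ u Fin.≟ u ⌋ then 1 else 0) ≡ 1
        own u with u Fin.≟ u
        ... | yes _ = ≡.refl
        ... | no ne = ⊥-elim (ne ≡.refl)
        other : (if ⌊ u Fin.≟ v ⌋ then 1 else 0) ≡ 0
        other with u Fin.≟ v
        ... | yes p = ⊥-elim (u≢v p)
        ... | no _ = ≡.refl

      multiple : ℕ → Mono V
      multiple j = Vec.map (j ℕ.*_) m

      multiple-suc : ∀ j → multiple (suc j) ≡ m +ᵛ multiple j
      multiple-suc j = by m
        where
        by : ∀ {n} (m : Vec ℕ n) → Vec.map (suc j ℕ.*_) m ≡ m +ᵛ Vec.map (j ℕ.*_) m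
        by [] = ≡.refl
        by (x ∷ m) = ≡.cong (_ ∷_) (by m)

      multiple-0 : multiple 0 ≡ zeros
      multiple-0 = by m
        where
        by : ∀ {n} (m : Vec ℕ n) → Vec.map (0 ℕ.*_) m ≡ replicate n 0
        by [] = ≡.refl
        by (x ∷ m) = ≡.cong (0 ∷_) (by m)

      g : FPS V
      g = geomInv c u v

      geomInv-≡ : ∀ e → e ≡ multiple (lookup e u) → g e R.≈ (R.- c) ^ᴿ lookup e u
      geomInv-≡ e p with VecP.≡-dec ℕ._≟_ e (multiple (lookup e u))
      ... | yes _ = R.refl
      ... | no ne = ⊥-elim (ne p)

      geomInv-≢ : ∀ e → e ≢ multiple (lookup e u) → g e R.≈ R.0#
      geomInv-≢ e ne with VecP.≡-dec ℕ._≟_ e (multiple (lookup e u))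
      ... | yes p = ⊥-elim (ne p)
      ... | no _ = R.refl

      lookup-+ : ∀ e′ → lookup (m +ᵛ e′) u ≡ suc (lookup e′ u)
      lookup-+ e′ = ≡.trans (VecP.lookup-zipWith ℕ._+_ u m e′) (≡.cong (ℕ._+ lookup e′ u) lookup-m)

      nonzero : ∀ e′ → m +ᵛ e′ ≢ zeros
      nonzero e′ p with ≡.trans (≡.sym (lookup-+ e′)) (≡.trans (≡.cong (λ e → lookup e u) p) (VecP.lookup-replicate u 0))
      ... | ()

      at-+ : ∀ e′ → g (m +ᵛ e′) R.+ c R.* g e′ R.≈ R.0#
      at-+ e′ with VecP.≡-dec ℕ._≟_ e′ (multiple (lookup e′ u))
      ... | yes p = R.trans (R.+-congʳ (R.trans
              (geomInv-≡ (m +ᵛ e′) (≡.trans (≡.cong (m +ᵛ_) p) (≡.trans (≡.sym (multiple-suc (lookup e′ u))) (≡.cong multiple (≡.sym (lookup-+ e′))))))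
              (R.reflexive (≡.cong ((R.- c) ^ᴿ_) (lookup-+ e′)))))
            (R.trans (R.sym (R.distribʳ _ (R.- c) c)) (R.trans (R.*-congʳ (R.-‿inverseˡ c)) (R.zeroˡ _)))
      ... | no ne = R.trans (R.+-cong (geomInv-≢ (m +ᵛ e′) (λ p → ne (zipWith-+-injective m
              (≡.trans p (≡.trans (≡.cong multiple (lookup-+ e′)) (multiple-suc (lookup e′ u))))))) (R.zeroʳ c)) (R.+-identityˡ R.0#)

      at-nothing : ∀ e → quotient m e ≡ nothing → g e R.≈ oneS e
      at-nothing e q with VecP.≡-dec ℕ._≟_ e (multiple (lookup e u))
      ... | no ne = R.sym (monoS-≢ R.1# λ p → ne (≡.trans p (≡.trans (≡.sym multiple-0)
              (≡.cong multiple (≡.sym (≡.trans (≡.cong (λ e → lookup e u) p) (VecP.lookup-replicate u 0)))))))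
      ... | yes p = cases (lookup e u) p
        where
        bad : ∀ e′ → e ≢ m +ᵛ e′
        bad e′ ≡.refl with ≡.trans (≡.sym q) (quotient-of-+ m e′)
        ... | ()
        cases : ∀ j → e ≡ multiple j → (R.- c) ^ᴿ j R.≈ oneS e
        cases zero p rewrite ≡.trans p multiple-0 = R.sym (monoS-≡ R.1# zeros)
        cases (suc j) p = ⊥-elim (bad (multiple j) (≡.trans p (multiple-suc j)))

    geomInv-inverse : ((oneS ⊕ monoS c m) ⊛ g) ≋ oneS
    geomInv-inverse e = R.trans (distribʳ g oneS (monoS c m) e) (R.trans (R.+-cong (*-identityˡ g e) (monoS-⊛ c m g e)) (cases (quotient m e) ≡.refl))
      where
      open CommutativeRing (seriesRing V) using (distribʳ; *-identityˡ)
      cases : ∀ q → quotient m e ≡ q → g e R.+ shift q (λ e′ → c R.* g e′) R.≈ oneS e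
      cases nothing q = R.trans (R.+-identityʳ _) (at-nothing e q)
      cases (just e′) q rewrite quotient-+ m e q = R.trans (at-+ e′) (R.sym (monoS-≢ R.1# (nonzero e′)))

  module CauchyFactor (k : ℕ) (n m p q : ℕ) where
    open Vars n m p q
    open LatticeLink R t t⁻¹ tt⁻¹ (n ℕ.+ m ℕ.+ p ℕ.+ q) k using (K; const-^)
    open CommutativeRing K
    open Algebra.Properties.Ring ring using (-‿distribˡ-*; -‿distribʳ-*)
    open RingSolver K
    open Rows K using (_^_)
    open Products K
    open ExchangeRows K (const t) (const t⁻¹) const-inverse using (crossing)
    open RowFactors R t t⁻¹ tt⁻¹ (n ℕ.+ m ℕ.+ p ℕ.+ q) k

    private
      X = n ℕ.+ m ℕ.+ p ℕ.+ q

      factor : ℕ → Row X → Row X → FPS X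
      factor l (white , x) (white , w) = oneMinus (t ^ᴿ l) x w
      factor l (white , x) (purple , z) = geomInv (t ^ᴿ l) x z
      factor l (purple , y) (white , w) = geomInv (t ^ᴿ l) y w
      factor l (purple , y) (purple , z) = oneMinus (t ^ᴿ l) y z

      -- Only pairs of different colour bring in a geometric series, so distinct variables are
      -- demanded only of them.
      data Distinct : Row X → Row X → Set where
        same : ∀ {c x w} → Distinct (c , x) (c , w)
        distinct : ∀ {c d x w} → x ≢ w → Distinct (c , x) (d , w)

      crossing-∏ : ∀ z j → crossing z j ≈ ∏ (upTo j) (λ l → 1# + z * const t ^ l)
      crossing-∏ z zero = refl
      crossing-∏ z (suc j) = trans (*-congˡ {1# + z * const t ^ j} (crossing-∏ z j)) (trans (*-comm (1# + z * const t ^ j) (∏ (upTo j) f)) (sym (∏-upTo j f)))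
        where
        f : ℕ → FPS X
        f l = 1# + z * const t ^ l

      pair-monomial : ∀ u v l → (var u * var v) * const t ^ l ≈ monoS (t ^ᴿ l) (pairMono u v)
      pair-monomial u v l = trans (*-cong (monoS-* R.1# R.1# (unitV u 1) (unitV v 1)) (const-^ l))
        (trans (monoS-* (R.1# R.* R.1#) (t ^ᴿ l) (pairMono u v) zeros)
        (trans (monoS-cong (pairMono u v +ᵛ zeros) (R.trans (R.*-congʳ (R.*-identityˡ R.1#)) (R.*-identityˡ _)))
          (reflexive (≡.cong (monoS (t ^ᴿ l)) (+ᵛ-identityʳ (pairMono u v))))))

      monoS-neg : ∀ c (m : Mono X) → - monoS c m ≈ monoS (R.- c) m
      monoS-neg c m e with VecP.≡-dec ℕ._≟_ e m
      ... | yes _ = R.refl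
      ... | no _ = -0≈0
        where open Algebra.Properties.Ring R.ring using () renaming (-0#≈0# to -0≈0)

      oneMinus-crossing : ∀ u v → crossing (- (var u * var v)) k ≈ ∏ (upTo k) (λ l → oneMinus (t ^ᴿ l) u v)
      oneMinus-crossing u v = trans (crossing-∏ (- (var u * var v)) k) (∏-cong (upTo k) λ l →
        +-congˡ {1#} (trans (sym (-‿distribˡ-* (var u * var v) (const t ^ l))) (trans (-‿cong (pair-monomial u v l)) (monoS-neg (t ^ᴿ l) (pairMono u v)))))

      crossing-cong : ∀ {z z′} j → z ≈ z′ → crossing z j ≈ crossing z′ j
      crossing-cong zero h = refl
      crossing-cong {z} {z′} (suc j) h = *-cong (+-congˡ {1#} (*-congʳ {const t ^ j} h)) (crossing-cong j h)

      geomInv-crossing : ∀ u v → u ≢ v → crossing (var u * var v) k * ∏ (upTo k) (λ l → geomInv (t ^ᴿ l) u v) ≈ 1#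
      geomInv-crossing u v ne = trans (*-congʳ {∏ (upTo k) (λ l → geomInv (t ^ᴿ l) u v)} (crossing-∏ (var u * var v) k))
        (trans (∏-* (upTo k) (λ l → 1# + (var u * var v) * const t ^ l) (λ l → geomInv (t ^ᴿ l) u v)) (trans (∏-cong (upTo k) λ l →
          trans (*-congʳ {geomInv (t ^ᴿ l) u v} (+-congˡ {1#} (pair-monomial u v l))) (GeometricSeries.geomInv-inverse (t ^ᴿ l) u v ne)) (∏-1 (upTo k))))

      single : ∀ r r′ → Distinct r r′ → denominator r r′ * ∏ (upTo k) (λ l → factor l r r′) ≈ numerator r r′
      single (white , x) (white , w) d = trans (*-identityˡ _) (trans (sym (oneMinus-crossing x w))
        (crossing-cong k (trans (-‿cong (*-comm (var x) (var w))) (-‿distribʳ-* (var w) (var x)))))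
      single (purple , y) (purple , z) d = trans (*-identityˡ _) (trans (sym (oneMinus-crossing y z))
        (crossing-cong k (trans (-‿cong (*-comm (var y) (var z))) (-‿distribˡ-* (var z) (var y)))))
      single (purple , y) (white , w) (distinct ne) = trans (*-congʳ {∏ (upTo k) (λ l → geomInv (t ^ᴿ l) y w)} (crossing-cong k (*-comm (var w) (var y))))
        (geomInv-crossing y w ne)
      single (white , x) (purple , z) (distinct ne) = geomInv-crossing x z ne

      inverse : Row X → Row X → FPS X
      inverse (white , x) (white , w) = 1#
      inverse (white , x) (purple , z) = ∏ (upTo k) (λ l → geomInv (t ^ᴿ l) x z)
      inverse (purple , y) (white , w) = ∏ (upTo k) (λ l → geomInv (t ^ᴿ l) y w)
      inverse (purple , y) (purple , z) = 1#

      single-inverse : ∀ r r′ → Distinct r r′ → denominator r r′ * inverse r r′ ≈ 1#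
      single-inverse (white , x) (white , w) d = *-identityˡ 1#
      single-inverse (purple , y) (purple , z) d = *-identityˡ 1#
      single-inverse (purple , y) (white , w) d = single (purple , y) (white , w) d
      single-inverse (white , x) (purple , z) d = single (white , x) (purple , z) d

      rs = rowsOf Xs Ys
      rs′ = rowsOf Ws Zs

      xv≢zv : ∀ i b → xv i ≢ zv b
      xv≢zv i b eq with ≡.trans (≡.sym (FinP.splitAt-↑ˡ (n ℕ.+ m ℕ.+ p) ((i ↑ˡ m) ↑ˡ p) q)) (≡.trans (≡.cong (Fin.splitAt (n ℕ.+ m ℕ.+ p)) eq) (FinP.splitAt-↑ʳ (n ℕ.+ m ℕ.+ p) q b))
      ... | ()

      yv≢wv : ∀ j a → yv j ≢ wv a
      yv≢wv j a eq with ≡.trans (≡.sym (FinP.splitAt-↑ˡ (n ℕ.+ m) (n ↑ʳ j) p)) (≡.trans (≡.cong (Fin.splitAt (n ℕ.+ m)) (FinP.↑ˡ-injective q _ _ eq)) (FinP.splitAt-↑ʳ (n ℕ.+ m) p a))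
      ... | ()

      all-rows : ∀ {P : Row X → Set} {a b} (f : Fin a → Fin X) (g : Fin b → Fin X) → (∀ i → P (white , f i)) → (∀ j → P (purple , g j)) →
        All P (rowsOf (map f (allFin a)) (map g (allFin b)))
      all-rows {P} f g hf hg = AllP.++⁺ (on white f hf) (on purple g hg)
        where
        on : ∀ ty {a} (f : Fin a → Fin X) → (∀ i → P (ty , f i)) → All P (map (ty ,_) (map f (allFin a)))
        on ty f h = AllP.map⁺ {P = P} {f = ty ,_} (AllP.map⁺ {P = λ v → P (ty , v)} {f = f} (All.universal h _))

      all-distinct : All (λ r → All (Distinct r) rs′) rs
      all-distinct = all-rows xv yv (λ i → all-rows wv zv (λ a → same) (λ b → distinct (xv≢zv i b)))
                                    (λ j → all-rows wv zv (λ a → distinct (yv≢wv j a)) (λ b → same))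

      ∏-rows : ∀ (us vs : List (Fin X)) (h : Row X → FPS X) → ∏ (rowsOf us vs) h ≈ ∏ us (λ u → h (white , u)) * ∏ vs (λ v → h (purple , v))
      ∏-rows us vs h = trans (∏-++ (map (white ,_) us) (map (purple ,_) vs) h)
        (reflexive (≡.cong₂ _*_ (∏-map (white ,_) us h) (∏-map (purple ,_) vs h)))

      ∏-pairs : ∀ us vs (F : Fin X × Fin X → FPS X) → ∏ (pairs R t t⁻¹ us vs) F ≈ ∏ us (λ u → ∏ vs (λ v → F (u , v)))
      ∏-pairs us vs F = trans (∏-concatMap (λ u → map (u ,_) vs) us F) (∏-cong us λ u → reflexive (∏-map (u ,_) vs F))

      layer : ∀ l → ∏ rs (λ r → ∏ rs′ (factor l r)) ≈
        ((∏ Xs (λ u → ∏ Ws (oneMinus (t ^ᴿ l) u)) * ∏ Ys (λ u → ∏ Zs (oneMinus (t ^ᴿ l) u)))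
          * ∏ Ys (λ u → ∏ Ws (geomInv (t ^ᴿ l) u))) * ∏ Xs (λ u → ∏ Zs (geomInv (t ^ᴿ l) u))
      layer l = trans (∏-rows Xs Ys (λ r → ∏ rs′ (factor l r))) (trans (*-cong
        (trans (∏-cong Xs λ u → ∏-rows Ws Zs (factor l (white , u))) (sym (∏-* Xs (λ u → ∏ Ws (oneMinus (t ^ᴿ l) u)) (λ u → ∏ Zs (geomInv (t ^ᴿ l) u)))))
        (trans (∏-cong Ys λ u → ∏-rows Ws Zs (factor l (purple , u))) (sym (∏-* Ys (λ u → ∏ Ws (geomInv (t ^ᴿ l) u)) (λ u → ∏ Zs (oneMinus (t ^ᴿ l) u))))))
        (solve 4 (λ a b c d → (a :* b) :* (c :* d) := ((a :* d) :* c) :* b) refl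
          (∏ Xs (λ u → ∏ Ws (oneMinus (t ^ᴿ l) u))) (∏ Xs (λ u → ∏ Zs (geomInv (t ^ᴿ l) u)))
          (∏ Ys (λ u → ∏ Ws (geomInv (t ^ᴿ l) u))) (∏ Ys (λ u → ∏ Zs (oneMinus (t ^ᴿ l) u)))))

      Ω-layers : Ω R t t⁻¹ k ≈ ∏ (upTo k) (λ l → ∏ rs (λ r → ∏ rs′ (factor l r)))
      Ω-layers = ∏-cong (upTo k) λ l → trans
        (*-cong (*-cong (*-cong (∏-pairs Xs Ws _) (∏-pairs Ys Zs _)) (∏-pairs Ys Ws _)) (∏-pairs Xs Zs _))
        (sym (layer l))

    private
      ∏-all : ∀ {f g : Row X → Row X → FPS X} → (∀ r r′ → Distinct r r′ → denominator r r′ * f r r′ ≈ g r r′) →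
        product₂ denominator rs rs′ * product₂ f rs rs′ ≈ product₂ g rs rs′
      ∏-all {f} {g} h = trans (∏-* rs (λ r → ∏ rs′ (denominator r)) (λ r → ∏ rs′ (f r)))
        (∏-cong-All (All.map (λ {r} ds → trans (∏-* rs′ (denominator r) (f r)) (∏-cong-All (All.map (λ {r′} d → h r r′ d) ds))) all-distinct))

    denominator⁻¹ : FPS X
    denominator⁻¹ = product₂ inverse rs rs′

    denominator-inverse : denominator⁻¹ * product₂ denominator rs rs′ ≈ 1#
    denominator-inverse = trans (*-comm denominator⁻¹ (product₂ denominator rs rs′))
      (trans (∏-all {g = λ _ _ → 1#} single-inverse) (trans (∏-cong rs λ r → ∏-1 rs′) (∏-1 rs)))

    Ω-quotient : product₂ denominator rs rs′ * Ω R t t⁻¹ k ≈ product₂ numerator rs rs′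
    Ω-quotient = trans (*-congˡ {product₂ denominator rs rs′} (trans Ω-layers
        (trans (∏-swap (upTo k) rs (λ l r → ∏ rs′ (factor l r))) (∏-cong rs λ r → ∏-swap (upTo k) rs′ (λ l → factor l r)))))
      (∏-all {f = λ r r′ → ∏ (upTo k) (λ l → factor l r r′)} single)

-- Finite supports

-- `back` recovers the element from which a member of the concatenation stems, so the pieces
-- belonging to different elements are disjoint.
unique-concatMap : ∀ (f : A → List B) (back : B → A) → (∀ x → All (λ y → back y ≡ x) (f x)) → (∀ x → Unique (f x)) →
  ∀ {xs} → Unique xs → Unique (concatMap f xs)
unique-concatMap f back sect uf [] = []
unique-concatMap f back sect uf {x ∷ xs} (x∉ ∷ u) = UniqueP.++⁺ (uf x) (unique-concatMap f back sect uf u)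
  λ (y∈ , y∈′) → All.lookup x∉ (≡.subst (_∈ xs) (All.lookup (sect x) y∈) (origin xs y∈′)) ≡.refl
  where
  origin : ∀ xs {y} → y ∈ concatMap f xs → back y ∈ xs
  origin (x ∷ xs) y∈ with MemP.∈-++⁻ (f x) y∈
  ... | inj₁ p = here (All.lookup (sect x) p)
  ... | inj₂ p = there (origin xs p)

unique-map : ∀ (f : A → B) (back : B → A) {xs} → All (λ x → back (f x) ≡ x) xs → Unique xs → Unique (map f xs)
unique-map f back {xs} sect u = AllPairs.map (λ ne eq → ne (≡.cong back eq)) (AllPairsP.map⁻
  (≡.subst Unique (≡.sym (≡.trans (≡.sym (ListP.map-∘ xs)) (ListP.map-id-local sect))) u))

labels-unique : ∀ k → Unique (allLabels k)
labels-unique zero = [] ∷ []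
labels-unique (suc k) = unique-concatMap (λ v → (false ∷ v) ∷ (true ∷ v) ∷ []) Vec.tail (λ v → ≡.refl ∷ ≡.refl ∷ [])
  (λ v → ((λ ()) ∷ []) ∷ [] ∷ []) (labels-unique k)

states-unique : ∀ k c → Unique (allRowStates k c)
states-unique k zero = [] ∷ []
states-unique k (suc c) = unique-concatMap (λ L → map (L ∷_) (allRowStates k c)) first
  (λ L → AllP.map⁺ (All.universal (λ s → ≡.refl) (allRowStates k c)))
  (λ L → UniqueP.map⁺ ListP.∷-injectiveʳ (states-unique k c)) (labels-unique k)
  where
  first : List (Label k) → Label k
  first [] = ∅
  first (I ∷ s) = I

states-complete : ∀ {k} (s : List (Label k)) → s ∈ allRowStates k (length s)
states-complete [] = here ≡.refl
states-complete {k} (I ∷ s) = MemP.∈-concatMap⁺ (λ L → map (L ∷_) (allRowStates k (length s)))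
  (lose (labels-complete I) (MemP.∈-map⁺ (I ∷_) (states-complete s)))
  where
  labels-complete : ∀ {k} (I : Label k) → I ∈ allLabels k
  labels-complete [] = here ≡.refl
  labels-complete (false ∷ I) = MemP.∈-concatMap⁺ _ (lose (labels-complete I) (here ≡.refl))
  labels-complete (true ∷ I) = MemP.∈-concatMap⁺ _ (lose (labels-complete I) (there (here ≡.refl)))

-- In the window with columns -(b+1), …, b the tuples of size at most b are
-- exactly the states of energy less than groundEnergy + b + 1.
module Enumeration (k b : ℕ) where
  ℓ c β : ℕ
  ℓ = suc b
  c = ℓ ℕ.+ b ℕ.+ 1
  β = groundEnergy k ℓ ℕ.+ suc b

  Admissible : List (Label k) → Set
  Admissible s = counts s ≡ replicate k ℓ × energy s < β

  admissible? : Decidable Admissible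
  admissible? s = VecP.≡-dec ℕ._≟_ (counts s) (replicate k ℓ) ×-dec (energy s ℕP.<? β)

  tuples : List (Tuple k)
  tuples = map decode (filter admissible? (allRowStates k c))

  admissibles : All (λ s → length s ≡ c × Admissible s) (filter admissible? (allRowStates k c))
  admissibles = All.zip (AllP.filter⁺ admissible? (states-length k c) , AllP.all-filter admissible? (allRowStates k c))

  stateOf∘decode : ∀ s → length s ≡ c → Admissible s → stateOf (decode s) ℓ c ≡ s
  stateOf∘decode s p (q , _) = ≡.trans (≡.cong (stateOf (decode s) ℓ) (≡.sym p)) (stateOf-decode s q)

  size-decode : ∀ s → length s ≡ c → Admissible s → tupleSize (decode s) ≤ b
  size-decode s p (q , lt) = ℕP.≤-pred (ℕP.+-cancelˡ-< (groundEnergy k ℓ) _ _ (≡.subst (_< β)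
    (≡.trans (≡.cong energy (≡.sym (stateOf∘decode s p (q , lt)))) (StateOf.energy-stateOf (decode s) ℓ c (decode-partition s)
      (≡.subst (λ n → Fits ℓ n (decode s)) p (decode-fits s q)))) lt))

  maxLen≤ℓ : ∀ {α : Tuple k} → IsPartitionTuple α → tupleSize α ≤ b → maxLen α ≤ ℓ
  maxLen≤ℓ {α} p q = ℕP.≤-trans (maxLen≤ α p) (ℕP.m≤n⇒m≤1+n q)

  maxPart≤b : ∀ {α : Tuple k} → tupleSize α ≤ b → maxPart α ≤ b
  maxPart≤b {α} q = ℕP.≤-trans (maxPart≤ α) q

  tuple-fits : ∀ {α : Tuple k} → IsPartitionTuple α → tupleSize α ≤ b → Fits ℓ c α
  tuple-fits {α} p q = Fits-window {ℓ = ℓ} {b} α (maxLen≤ℓ p q) (maxPart≤b {α} q)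

  energy-tuple : ∀ {α : Tuple k} → IsPartitionTuple α → tupleSize α ≤ b → energy (stateOf α ℓ c) ≡ groundEnergy k ℓ ℕ.+ tupleSize α
  energy-tuple {α} p q = StateOf.energy-stateOf α ℓ c p (tuple-fits p q)

  counts-tuple : ∀ {α : Tuple k} → IsPartitionTuple α → tupleSize α ≤ b → counts (stateOf α ℓ c) ≡ replicate k ℓ
  counts-tuple {α} p q = StateOf.counts-stateOf α ℓ c p (tuple-fits p q)

  tuple-energy< : ∀ {α : Tuple k} → IsPartitionTuple α → tupleSize α ≤ b → energy (stateOf α ℓ c) < β
  tuple-energy< p q = ℕP.≤-<-trans (ℕP.≤-reflexive (energy-tuple p q)) (ℕP.+-monoʳ-< (groundEnergy k ℓ) (s≤s q))

  tuples-unique : Unique tuples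
  tuples-unique = unique-map decode (λ α → stateOf α ℓ c) (All.map (λ {s} (p , q) → stateOf∘decode s p q) admissibles)
    (UniqueP.filter⁺ admissible? (states-unique k c))

  tuples-partition : All IsPartitionTuple tuples
  tuples-partition = AllP.map⁺ (All.universal decode-partition _)

  tuples-complete : ∀ {α} → IsPartitionTuple α → tupleSize α ≤ b → α ∈ tuples
  tuples-complete {α} p q = ≡.subst (_∈ tuples) (decode-stateOf α ℓ c p (tuple-fits p q)) (MemP.∈-map⁺ decode
    (MemP.∈-filter⁺ admissible? (≡.subst (λ n → stateOf α ℓ c ∈ allRowStates k n) (length-stateOf α ℓ c) (states-complete (stateOf α ℓ c)))
      (counts-tuple p q , tuple-energy< p q)))

  ∉tuples : ∀ {α} → IsPartitionTuple α → α ∉ tuples → b < tupleSize α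
  ∉tuples p n = ℕP.≰⇒> λ q → n (tuples-complete p q)

  -- A tuple of size at most b has at most b nonzero parts, each at most b. With ℓ = b + 1 one zero
  -- part of every colour remains and fills the first column, and the columns reach one place beyond
  -- the largest possible particle.
  stateOf-inner : ∀ {K t τ tτ} (α : Tuple k) → IsPartitionTuple α → tupleSize α ≤ b → Operators.Inner K t τ tτ k c (stateOf α ℓ c)
  stateOf-inner {K} {t} {τ} {tτ} α p q = ≡.subst Inner (≡.sym shape) (inner (stateOf α b (b ℕ.+ b)))
    where
    open Operators K t τ tτ k c using (Inner; inner)
    shape : stateOf α ℓ c ≡ full ∷ stateOf α b (b ℕ.+ b) ++ ∅ ∷ []
    shape = ≡.trans (stateOf-full α b (b ℕ.+ b ℕ.+ 1) (λ a → ℕP.≤-trans (length≤maxLen α a) (ℕP.≤-trans (maxLen≤ α p) q)))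
      (≡.cong (full ∷_) (≡.trans (≡.cong (stateOf α b) (ℕP.+-comm (b ℕ.+ b) 1))
        (stateOf-∅ α b (b ℕ.+ b) p (λ a → ℕP.+-monoˡ-≤ b (ℕP.≤-trans (head≤maxPart α a) (maxPart≤b {α} q))))))

module FiniteSupport (R : CommutativeRing 0ℓ 0ℓ) where
  open CommutativeRing R
  open Sums R

  ∑-filter : ∀ {P : A → Set} (P? : Decidable P) {xs} f → All (λ x → ¬ P x → f x ≈ 0#) xs → ∑ xs f ≈ ∑ (filter P? xs) f
  ∑-filter P? f [] = refl
  ∑-filter P? {x ∷ xs} f (h ∷ hs) with P? x
  ... | yes p = +-congˡ (∑-filter P? f hs)
  ... | no n = trans (+-cong (h n) (∑-filter P? f hs)) (+-identityˡ _)

  module _ (_≟_ : (x y : A) → Dec (x ≡ y)) where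
    private
      at-equal : A → A → Carrier → Carrier
      at-equal x y a = if ⌊ x ≟ y ⌋ then a else 0#

      at-≢ : ∀ {x y} a → x ≢ y → at-equal x y a ≈ 0#
      at-≢ {x} {y} a ne with x ≟ y
      ... | yes p = ⊥-elim (ne p)
      ... | no _ = refl

      at-≡ : ∀ {x} a → at-equal x x a ≈ a
      at-≡ {x} a with x ≟ x
      ... | yes p = refl
      ... | no n = ⊥-elim (n ≡.refl)

      at-0 : ∀ {x y a} → a ≈ 0# → at-equal x y a ≈ 0#
      at-0 {x} {y} h with x ≟ y
      ... | yes p = h
      ... | no _ = refl

      select : ∀ {x ys a} → Unique ys → x ∈ ys → ∑[ y ∈ ys ] at-equal x y a ≈ a
      select {x} {y ∷ ys} {a} (y∉ ∷ u) (here ≡.refl) = trans (+-cong (at-≡ a) (∑-zero-All (All.map (λ ne → at-≢ a ne) y∉))) (+-identityʳ a)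
      select {x} {y ∷ ys} {a} (y∉ ∷ u) (there p) = trans (+-cong (at-≢ a (λ eq → All.lookup y∉ p (≡.sym eq))) (select u p)) (+-identityˡ a)

      expand : ∀ {xs ys f} → Unique ys → All (λ x → x ∈ ys ⊎ f x ≈ 0#) xs → ∑ xs f ≈ ∑[ x ∈ xs ] ∑[ y ∈ ys ] at-equal x y (f x)
      expand {ys = ys} u h = ∑-cong-All (All.map (λ { (inj₁ p) → sym (select u p) ; (inj₂ z) → trans z (sym (∑-zero ys λ y → at-0 z)) }) h)

    -- Both sums equal the double sum of f over the pairs of equal elements, because a value that is
    -- not zero has exactly one partner in the other duplicate-free list.
    ∑-support : ∀ {xs ys f} → Unique xs → Unique ys → All (λ x → x ∈ ys ⊎ f x ≈ 0#) xs → All (λ y → y ∈ xs ⊎ f y ≈ 0#) ys → ∑ xs f ≈ ∑ ys f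
    ∑-support {xs} {ys} {f} ux uy hx hy = trans (expand uy hx) (trans (∑-swap xs ys _) (trans
      (∑-cong ys λ y → ∑-cong xs λ x → flip x y) (sym (expand ux hy))))
      where
      flip : ∀ x y → at-equal x y (f x) ≈ at-equal y x (f y)
      flip x y with x ≟ y | y ≟ x
      ... | yes ≡.refl | yes _ = refl
      ... | no _ | no _ = refl
      ... | yes p | no n = ⊥-elim (n (≡.sym p))
      ... | no n | yes p = ⊥-elim (n (≡.sym p))

-- The two sums and their truncation to a window

module CauchySums (R : CommutativeRing 0ℓ 0ℓ) (t t⁻¹ : CommutativeRing.Carrier R)
                 (tt⁻¹ : CommutativeRing._≈_ R (CommutativeRing._*_ R t t⁻¹) (CommutativeRing.1# R))
                 {V k : ℕ} (rs rs′ : List (Lattice.Row R t t⁻¹ V))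
                 (mu nu : Tuple k) (pmu : IsPartitionTuple mu) (pnu : IsPartitionTuple nu) where
  private module R = CommutativeRing R
  open Lattice R t t⁻¹ hiding (vertex)
  open Series R t t⁻¹
  open Variables R t t⁻¹ tt⁻¹
  open RowFactors R t t⁻¹ tt⁻¹ V k
  open LargeWindows R t t⁻¹ tt⁻¹ V k
  open CommutativeRing (seriesRing V)
  open RingSolver (seriesRing V)
  open Sums R using (∑; ∑-cong-All)
  open Rows (seriesRing V) using (_^_)
  open import Algebra.Properties.CommutativeSemigroup ℕP.+-commutativeSemigroup using () renaming (x∙yz≈y∙xz to swap)

  LS-Hom : ∀ r (α β : Tuple k) → IsPartitionTuple α → IsPartitionTuple β → Hom (tupleSize β) (tupleSize α) (LS r α β)
  LS-Hom r α β pα pβ e ne = R.trans (LS-entry r α β pα pβ ℓ N lα lβ mα mβ e)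
    (RowOperators.operators-Up R t t⁻¹ tt⁻¹ V k c r .GradedOperators.Up.up-hom (stateOf α ℓ c) (stateOf β ℓ c) e λ p →
      ne (ℕP.+-cancelˡ-≡ (groundEnergy k ℓ) _ _ (≡.trans (swap (groundEnergy k ℓ) (Vec.sum e) (tupleSize β)) (≡.trans
        (≡.cong (Vec.sum e ℕ.+_) (≡.sym (StateOf.energy-stateOf β ℓ c pβ (Fits-window {ℓ = ℓ} {N} β lβ mβ))))
        (≡.trans p (StateOf.energy-stateOf α ℓ c pα (Fits-window {ℓ = ℓ} {N} α lα mα)))))))
    where
    ℓ = maxLen α ⊔ maxLen β
    N = maxPart α ⊔ maxPart β
    c = ℓ ℕ.+ N ℕ.+ 1
    lα = ℕP.m≤m⊔n (maxLen α) (maxLen β)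
    lβ = ℕP.m≤n⊔m (maxLen α) (maxLen β)
    mα = ℕP.m≤m⊔n (maxPart α) (maxPart β)
    mβ = ℕP.m≤n⊔m (maxPart α) (maxPart β)

  F G : Tuple k → FPS V
  F la = scale (tpow (dist mu la)) (LS rs nu la ⊛ LS rs′ mu la)
  G la = scale (tpow (dist la nu)) (LS rs la mu ⊛ LS rs′ la nu)

  F-large : ∀ la → IsPartitionTuple la → tupleSize nu < tupleSize la → ∀ e → F la e R.≈ R.0#
  F-large la pla lt e = R.trans (R.*-congˡ (⊛-zero (LS rs nu la) (LS rs′ mu la) e λ a _ → inj₁ (LS-Hom rs nu la pnu pla a
    λ p → ℕP.<⇒≱ lt (ℕP.≤-trans (ℕP.m≤n+m _ (Vec.sum a)) (ℕP.≤-reflexive p))))) (R.zeroʳ _)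

  -- By homogeneity a tuple on the right side reaches the monomial e only if its size is at most |μ|
  -- + |e|. On the left side the bound |ν| serves all monomials at once.
  G-large : ∀ la → IsPartitionTuple la → ∀ e → tupleSize mu ℕ.+ Vec.sum e < tupleSize la → G la e R.≈ R.0#
  G-large la pla e lt = R.trans (R.*-congˡ (⊛-zero (LS rs la mu) (LS rs′ la nu) e λ a eq → inj₁ (LS-Hom rs la mu pla pmu a
    λ p → ℕP.<⇒≱ lt (ℕP.≤-trans (ℕP.≤-reflexive (≡.sym p)) (ℕP.≤-trans (ℕP.≤-reflexive (ℕP.+-comm (Vec.sum a) (tupleSize mu)))
      (ℕP.+-monoʳ-≤ (tupleSize mu) (ℕP.≤-trans (ℕP.m≤m+n (Vec.sum a) _) (ℕP.≤-reflexive eq)))))))) (R.zeroʳ _)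

  module At (b : ℕ) (mu≤b : tupleSize mu ≤ b) (nu≤b : tupleSize nu ≤ b) where
    open Enumeration k b
    open GradedOperators R t t⁻¹ tt⁻¹ V k c using (State; states; isState; Inner; star; _∘_; Up; ∑-coeff)
    open RowOperators R t t⁻¹ tt⁻¹ V k c
    open RowExchange R t t⁻¹ tt⁻¹ V k c (replicate k ℓ) β using (Valid; valid; exchange-all; within)

    s-mu s-nu : State
    s-mu = stateOf mu ℓ c
    s-nu = stateOf nu ℓ c

    -- With the right particle numbers and energy below β, a state is the state of a tuple of size
    -- at most b, and such tuples keep clear of both ends of the window.
    packed : ∀ {s} → Valid s → energy s < β → Inner s
    packed {s} (valid (isState p) q) lt = ≡.subst Inner (stateOf∘decode s p (q , lt))
      (stateOf-inner (decode s) (decode-partition s) (size-decode s p (q , lt)))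

    tuple-valid : ∀ {α} → IsPartitionTuple α → tupleSize α ≤ b → Valid (stateOf α ℓ c)
    tuple-valid {α} p q = valid (isState (length-stateOf α ℓ c)) (counts-tuple p q)

    LHS RHS : FPS V
    LHS = (operators rs ∘ star (operators rs′)) s-nu s-mu
    RHS = (star (operators rs′) ∘ operators rs) s-nu s-mu

    exchanged : ∀ e → Vec.sum e ℕ.+ tupleSize mu ≤ b → (product₂ denominator rs rs′ * LHS) e R.≈ (product₂ numerator rs rs′ * RHS) e
    exchanged e le = within (exchange-all packed rs rs′) (tuple-valid pnu nu≤b) (tuple-valid pmu mu≤b) e
      (ℕP.≤-<-trans (ℕP.≤-reflexive (≡.trans (≡.cong (Vec.sum e ℕ.+_) (energy-tuple pmu mu≤b)) (swap (Vec.sum e) (groundEnergy k ℓ) (tupleSize mu))))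
        (ℕP.+-monoʳ-< (groundEnergy k ℓ) (s≤s le)))

    module _ (la : Tuple k) (pla : IsPartitionTuple la) (la≤b : tupleSize la ≤ b) where
      private
        s = stateOf la ℓ c
        entry′ : ∀ r (α β : Tuple k) → IsPartitionTuple α → IsPartitionTuple β → tupleSize α ≤ b → tupleSize β ≤ b →
          LS r α β ≈ operators r (stateOf α ℓ c) (stateOf β ℓ c)
        entry′ r α β pα pβ qα qβ = LS-entry r α β pα pβ ℓ b (maxLen≤ℓ pα qα) (maxLen≤ℓ pβ qβ) (maxPart≤b {α} qα) (maxPart≤b {β} qβ)
        weight : ∀ (α β : Tuple k) → IsPartitionTuple α → IsPartitionTuple β → tupleSize α ≤ b → tupleSize β ≤ b →
          const (tpow (dist α β)) ≈ const t ^ crossings (stateOf β ℓ c) * const t⁻¹ ^ crossings (stateOf α ℓ c)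
        weight α β pα pβ qα qβ = tpow-dist α β ℓ b pα pβ (maxLen≤ℓ pα qα) (maxLen≤ℓ pβ qβ) (maxPart≤b {α} qα) (maxPart≤b {β} qβ)

      F-entry : F la ≈ operators rs s-nu s * star (operators rs′) s s-mu
      F-entry = trans (λ e → R.sym (const-⊛ (tpow (dist mu la)) (LS rs nu la ⊛ LS rs′ mu la) e))
        (trans (*-cong (weight mu la pmu pla mu≤b la≤b) (*-cong (entry′ rs nu la pnu pla nu≤b la≤b) (entry′ rs′ mu la pmu pla mu≤b la≤b)))
          (solve 3 (λ w x y → w :* (x :* y) := x :* (w :* y)) refl
            (const t ^ crossings s * const t⁻¹ ^ crossings s-mu) (operators rs s-nu s) (operators rs′ s-mu s)))

      G-entry : G la ≈ star (operators rs′) s-nu s * operators rs s s-mu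
      G-entry = trans (λ e → R.sym (const-⊛ (tpow (dist la nu)) (LS rs la mu ⊛ LS rs′ la nu) e))
        (trans (*-cong (weight la nu pla pnu la≤b nu≤b) (*-cong (entry′ rs la mu pla pmu la≤b mu≤b) (entry′ rs′ la nu pla pnu la≤b nu≤b)))
          (solve 3 (λ w x y → w :* (x :* y) := (w :* y) :* x) refl
            (const t ^ crossings s-nu * const t⁻¹ ^ crossings s) (operators rs s s-mu) (operators rs′ s s-nu)))

    private
      -- `decode` and `stateOf` match the listed tuples with the admissible states; the sum over
      -- intermediate states also runs over the others, whose terms must vanish for conservation or
      -- energy reasons.
      over-tuples : ∀ (H : Tuple k → FPS V) (h : State → FPS V) e →
        (∀ la → IsPartitionTuple la → tupleSize la ≤ b → H la ≈ h (stateOf la ℓ c)) →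
        (∀ s → ¬ Admissible s → h s e R.≈ R.0#) → ∑ tuples (λ la → H la e) R.≈ Sums.∑ (seriesRing V) states h e
      over-tuples H h e same outside = R.trans (R.reflexive (≡.cong (List.foldr R._+_ R.0#) (≡.sym (ListP.map-∘ (filter admissible? states)))))
        (R.trans (∑-cong-All (All.map (λ {s} (p , a) → R.trans (same (decode s) (decode-partition s) (size-decode s p a) e)
            (R.reflexive (≡.cong (λ s → h s e) (stateOf∘decode s p a)))) admissibles))
        (R.trans (R.sym (FiniteSupport.∑-filter R admissible? (λ s → h s e) (All.universal outside states))) (R.sym (∑-coeff states h e))))

    F-sum : ∀ e → ∑ tuples (λ la → F la e) R.≈ LHS e
    F-sum e = over-tuples F (λ s → operators rs s-nu s * star (operators rs′) s s-mu) e F-entry outside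
      where
      outside : ∀ s → ¬ Admissible s → (operators rs s-nu s * star (operators rs′) s s-mu) e R.≈ R.0#
      outside s na with VecP.≡-dec ℕ._≟_ (counts s) (replicate k ℓ)
      ... | no ne = ⊛-zero (operators rs s-nu s) (star (operators rs′) s s-mu) e λ a _ → inj₁
              (Up.up-counts (operators-Up rs) s-nu s (λ p → ne (≡.trans (≡.sym p) (counts-tuple pnu nu≤b))) a)
      ... | yes q = ⊛-zero (operators rs s-nu s) (star (operators rs′) s s-mu) e λ a _ → inj₁
              (Up.up-hom (operators-Up rs) s-nu s a λ p → na (q , ℕP.≤-<-trans (ℕP.≤-trans (ℕP.m≤n+m _ (Vec.sum a)) (ℕP.≤-reflexive p)) (tuple-energy< pnu nu≤b)))

    G-sum : ∀ e → Vec.sum e ℕ.+ tupleSize mu ≤ b → ∑ tuples (λ la → G la e) R.≈ RHS e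
    G-sum e le = over-tuples G (λ s → star (operators rs′) s-nu s * operators rs s s-mu) e G-entry outside
      where
      outside : ∀ s → ¬ Admissible s → (star (operators rs′) s-nu s * operators rs s s-mu) e R.≈ R.0#
      outside s na = by (VecP.≡-dec ℕ._≟_ (counts s) (replicate k ℓ))
        where
        small : ∀ a → a ≤ Vec.sum e → a ℕ.+ energy s-mu < β
        small a le′ = ℕP.≤-<-trans (ℕP.≤-reflexive (≡.trans (≡.cong (a ℕ.+_) (energy-tuple pmu mu≤b)) (swap a (groundEnergy k ℓ) (tupleSize mu))))
          (ℕP.+-monoʳ-< (groundEnergy k ℓ) (s≤s (ℕP.≤-trans (ℕP.+-monoˡ-≤ (tupleSize mu) le′) le)))
        by : Dec (counts s ≡ replicate k ℓ) → (star (operators rs′) s-nu s * operators rs s s-mu) e R.≈ R.0#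
        by (no ne) = ⊛-zero (star (operators rs′) s-nu s) (operators rs s s-mu) e λ a _ → inj₂
              (Up.up-counts (operators-Up rs) s s-mu (λ p → ne (≡.trans p (counts-tuple pmu mu≤b))) _)
        by (yes q) = ⊛-zero (star (operators rs′) s-nu s) (operators rs s s-mu) e λ a eq → inj₂
              (Up.up-hom (operators-Up rs) s s-mu _ λ p → na (q , ≡.subst (_< β) p
                (small _ (ℕP.≤-trans (ℕP.m≤n+m _ (Vec.sum a)) (ℕP.≤-reflexive eq)))))

  -- The window must contain μ and ν themselves, the left sum with |λ| at most |ν|, the right sum
  -- with |λ| at most |μ| + |e|, and it must resolve degree |e| starting from μ.
  bound : Mono V → ℕ
  bound e = tupleSize mu ℕ.+ tupleSize nu ℕ.+ Vec.sum e

  private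
    mu≤ : ∀ e → tupleSize mu ≤ bound e
    mu≤ e = ℕP.≤-trans (ℕP.m≤m+n _ _) (ℕP.m≤m+n _ (Vec.sum e))

    nu≤ : ∀ e → tupleSize nu ≤ bound e
    nu≤ e = ℕP.≤-trans (ℕP.m≤n+m _ (tupleSize mu)) (ℕP.m≤m+n _ (Vec.sum e))

    degree≤ : ∀ (e a : Mono V) → Vec.sum a ≤ Vec.sum e → tupleSize mu ℕ.+ Vec.sum a ≤ bound e
    degree≤ e a le = ℕP.+-mono-≤ (ℕP.m≤m+n _ _) le

    tuples-at : Mono V → List (Tuple k)
    tuples-at e = Enumeration.tuples k (bound e)

  S T : FPS V
  S e = sumR (map (λ la → F la e) (tuples-at e))
  T e = sumR (map (λ la → G la e) (tuples-at e))

  S-sum : HasSum F S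
  S-sum e = tuples-at e , tuples-unique , tuples-partition , (λ la pla la∉ → F-large la pla (ℕP.≤-<-trans (nu≤ e) (∉tuples pla la∉)) e) , R.refl
    where open Enumeration k (bound e)

  T-sum : HasSum G T
  T-sum e = tuples-at e , tuples-unique , tuples-partition , (λ la pla la∉ → G-large la pla e (ℕP.≤-<-trans (degree≤ e e ℕP.≤-refl) (∉tuples pla la∉))) , R.refl
    where open Enumeration k (bound e)

  -- Each coefficient of `T` is defined by a list adapted to its own monomial, but the product with
  -- Ω at e needs all of them in the single window chosen for e. Both lists contain every tuple that
  -- contributes at a.
  T-larger : ∀ e a → Vec.sum a ≤ Vec.sum e → T a R.≈ sumR (map (λ la → G la a) (tuples-at e))
  T-larger e a le = FiniteSupport.∑-support R _≟_ (E.tuples-unique a) (E.tuples-unique e)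
    (All.map (λ {la} p → inside e ℕP.≤-refl le p) (E.tuples-partition a))
    (All.map (λ {la} p → inside a le ℕP.≤-refl p) (E.tuples-partition e))
    where
    module E e = Enumeration k (bound e)
    _≟_ : (α β : Tuple k) → Dec (α ≡ β)
    _≟_ = VecP.≡-dec (ListP.≡-dec ℕ._≟_)
    open DecMembership _≟_ using (_∈?_)
    inside : ∀ f → Vec.sum f ≤ Vec.sum e → Vec.sum a ≤ Vec.sum f → ∀ {la} → IsPartitionTuple la → la ∈ tuples-at f ⊎ G la a R.≈ R.0#
    inside f _ le′ {la} p with la ∈? tuples-at f
    ... | yes q = inj₁ q
    ... | no n = inj₂ (G-large la p a (ℕP.≤-<-trans (degree≤ f a le′) (E.∉tuples f p n)))

  cauchy : ∀ (Ω D : FPS V) → D * product₂ denominator rs rs′ ≈ 1# → product₂ denominator rs rs′ * Ω ≈ product₂ numerator rs rs′ → S ≈ Ω * T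
  cauchy Ω D inv quot e = begin
    S e                                   ≈⟨ F-sum e ⟩
    LHS e                                 ≈⟨ trans (*-congʳ {LHS} inv) (*-identityˡ LHS) e ⟨
    ((D * den) * LHS) e                   ≈⟨ *-assoc D den LHS e ⟩
    (D * (den * LHS)) e                   ≈⟨ ⊛-cong-below {f = D} {D} e (λ a _ → R.refl) (λ a le → exchanged a (within-bound a le)) ⟩
    (D * (num * RHS)) e                   ≈⟨ *-congˡ {D} (*-congʳ {RHS} quot) e ⟨
    (D * ((den * Ω) * RHS)) e             ≈⟨ solve 4 (λ d n o r → d :* ((n :* o) :* r) := (d :* n) :* (o :* r)) refl D den Ω RHS e ⟩
    ((D * den) * (Ω * RHS)) e             ≈⟨ trans (*-congʳ {Ω * RHS} inv) (*-identityˡ (Ω * RHS)) e ⟩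
    (Ω * RHS) e                           ≈⟨ ⊛-cong-below {f = Ω} {Ω} e (λ a _ → R.refl) (λ a le → R.trans (T-larger e a le) (G-sum a (within-bound a le))) ⟨
    (Ω * T) e                             ∎
    where
    open Relation.Binary.Reasoning.Setoid R.setoid
    open At (bound e) (mu≤ e) (nu≤ e)
    den = product₂ denominator rs rs′
    num = product₂ numerator rs rs′
    within-bound : ∀ (a : Mono V) → Vec.sum a ≤ Vec.sum e → Vec.sum a ℕ.+ tupleSize mu ≤ bound e
    within-bound a le = ℕP.≤-trans (ℕP.≤-reflexive (ℕP.+-comm (Vec.sum a) (tupleSize mu))) (degree≤ e a le)

theorem6p13 :
    (R : CommutativeRing 0ℓ 0ℓ) (t t⁻¹ : CommutativeRing.Carrier R) →
    CommutativeRing._≈_ R (CommutativeRing._*_ R t t⁻¹) (CommutativeRing.1# R) →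
    (k : ℕ) → 1 ≤ k →
    (n m p q : ℕ) → 1 ≤ n → 1 ≤ m → 1 ≤ p → 1 ≤ q →
    (mu nu : Tuple k) → IsPartitionTuple mu → IsPartitionTuple nu →
    let open Lattice R t t⁻¹ in
    let open Vars n m p q in
    Σ (FPS _) λ S → Σ (FPS _) λ T →
      HasSum (λ la → scale (tpow (dist mu la))
                       (LS (rowsOf Xs Ys) nu la ⊛ LS (rowsOf Ws Zs) mu la)) S
      × HasSum (λ la → scale (tpow (dist la nu))
                       (LS (rowsOf Xs Ys) la mu ⊛ LS (rowsOf Ws Zs) la nu)) T
      × (S ≋ (Ω R t t⁻¹ k ⊛ T))
theorem6p13 R t t⁻¹ tt⁻¹ k _ n m p q _ _ _ _ mu nu pmu pnu =
  S , T , S-sum , T-sum , cauchy (Ω R t t⁻¹ k) denominator⁻¹ denominator-inverse Ω-quotient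
  where
  open Lattice R t t⁻¹
  open Vars n m p q
  open CauchyFactor R t t⁻¹ tt⁻¹ k n m p q
  open CauchySums R t t⁻¹ tt⁻¹ (rowsOf Xs Ys) (rowsOf Ws Zs) mu nu pmu pnu
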